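{- Let $\gamma=\frac{5+\sqrt5}{10}$ and define $f_1:[0,2]\setminus\{\gamma,2\gamma\}\to[0,1]$ by $f_1(x)=0$ if $0\le x<\gamma$, $f_1(x)=\frac{\sqrt5-1}{2}$ if $\gamma<x<2\gamma$, and $f_1(x)=1$ if $2\gamma<x\le 2$. Fix integers $l_1,l_2\geq 0$ and reals $\epsilon_1,\epsilon_2>0$. There exists $M(\epsilon_1,\epsilon_2)>0$ such that for all $g>M(\epsilon_1,\epsilon_2)$ and all pairs of sets of integers \[ C,C'\subseteq \big[1,(\gamma-\epsilon_1)g\big) \cup \big((\gamma+\epsilon_1)g,(2\gamma-\epsilon_1)g\big) \cup \big((2\gamma+\epsilon_1)g,2g\big] \] with $|C|=l_1$, $|C'|=l_2$ and $C\cap C'=\emptyset$, we have \[ \left|\mathbb{P}_g[C\subseteq S \text{ and } C'\cap S=\emptyset]-\prod_{n\in C}f_{1}\left(\tfrac{n}{g}\right)\prod_{n\in C'}\left(1-f_{1}\left(\tfrac{n}{g}\right)\right)\right|<\epsilon_2. \]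
   Context: A numerical semigroup $S$ is a submonoid of $\mathbb{N}_0$ with finite complement; its genus is $|\mathbb{N}_0\setminus S|$. $\mathbb{P}_g$ is the uniform probability measure on the finite set $\mathcal{S}_g$ of numerical semigroups of genus $g$, and $S$ denotes a random element of $\mathcal{S}_g$. -}

module Defs where

open import Data.Bool using (Bool; true; false; _∧_; _∨_; not; if_then_else_)
open import Data.Nat as ℕ using (ℕ; zero; suc; _≡ᵇ_)
open import Data.Integer using (+_)
open import Data.Rational as Q using (ℚ; 0ℚ; 1ℚ; _≤ᵇ_)
open import Data.List using (List; []; _∷_; length; filter)
open import Data.List.Membership.Propositional using (_∈_; _∉_)
open import Data.List.Relation.Unary.All using (All)
open import Data.List.Relation.Unary.Linked using (Linked)
open import Data.List.Relation.Unary.Unique.Propositional using (Unique)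
open import Data.Product using (_×_)
open import Data.Sum using (_⊎_)
open import Relation.Binary.PropositionalEquality using (_≡_)
open import Data.Unit using (⊤)
open import Data.Empty using (⊥)

-- Numerical semigroups of genus g, represented by their (finite) set of
-- gaps ℕ₀ ∖ S, written as a strictly increasing list.

record IsGapList (g : ℕ) (G : List ℕ) : Set where
  field
    sorted   : Linked ℕ._<_ G
    genus    : length G ≡ g
    zero∈S   : 0 ∉ G
    closed   : ∀ a b → a ∉ G → b ∉ G → (a ℕ.+ b) ∉ G

record Enumerates (g : ℕ) (L : List (List ℕ)) : Set where
  field
    unique   : Unique L
    sound    : All (IsGapList g) L
    complete : ∀ G → IsGapList g G → G ∈ L

memᵇ : ℕ → List ℕ → Bool
memᵇ n []       = false
memᵇ n (x ∷ xs) = (n ≡ᵇ x) ∨ memᵇ n xs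

allᵇ : (ℕ → Bool) → List ℕ → Bool
allᵇ p []       = true
allᵇ p (x ∷ xs) = p x ∧ allᵇ p xs

-- for the semigroup with gap list G:  C ⊆ S and C' ∩ S = ∅
eventᵇ : List ℕ → List ℕ → List ℕ → Bool
eventᵇ C C' G = allᵇ (λ c → not (memᵇ c G)) C ∧ allᵇ (λ c → memᵇ c G) C'

countᵇ : (List ℕ → Bool) → List (List ℕ) → ℕ
countᵇ p []       = 0
countᵇ p (x ∷ xs) = if p x then suc (countᵇ p xs) else countᵇ p xs

ratio : ℕ → ℕ → ℚ
ratio k zero    = 0ℚ
ratio k (suc n) = (+ k) Q./ suc n

-- ℙ_g[C ⊆ S and C' ∩ S = ∅], computed from an enumeration L of 𝒮_g
prob : List (List ℕ) → List ℕ → List ℕ → ℚ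
prob L C C' = ratio (countᵇ (eventᵇ C C') L) (length L)

record Q5 : Set where
  constructor _+√5·_
  field
    re : ℚ
    im : ℚ
open Q5 public

ι : ℚ → Q5
ι p = p +√5· 0ℚ

ℕ→Q5 : ℕ → Q5
ℕ→Q5 n = ι ((+ n) Q./ 1)

_⊕_ : Q5 → Q5 → Q5
(p +√5· q) ⊕ (r +√5· s) = (p Q.+ r) +√5· (q Q.+ s)

⊝_ : Q5 → Q5
⊝ (p +√5· q) = (Q.- p) +√5· (Q.- q)

_⊖_ : Q5 → Q5 → Q5
x ⊖ y = x ⊕ (⊝ y)

five : ℚ
five = (+ 5) Q./ 1

_⊗_ : Q5 → Q5 → Q5
(p +√5· q) ⊗ (r +√5· s) = ((p Q.* r) Q.+ (five Q.* (q Q.* s))) +√5· ((p Q.* s) Q.+ (q Q.* r))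

_<ᵇ_ : ℚ → ℚ → Bool
p <ᵇ q = not (q ≤ᵇ p)

_==ᵇ_ : ℚ → ℚ → Bool
p ==ᵇ q = (p ≤ᵇ q) ∧ (q ≤ᵇ p)

-- p + q√5 > 0 (exact sign test in ℚ(√5) ⊆ ℝ)
posᵇ : Q5 → Bool
posᵇ (p +√5· q) =
     ((0ℚ ≤ᵇ p) ∧ (0ℚ ≤ᵇ q) ∧ not ((p ==ᵇ 0ℚ) ∧ (q ==ᵇ 0ℚ)))
  ∨ ((0ℚ <ᵇ p) ∧ (q <ᵇ 0ℚ) ∧ ((five Q.* (q Q.* q)) <ᵇ (p Q.* p)))
  ∨ ((p <ᵇ 0ℚ) ∧ (0ℚ <ᵇ q) ∧ ((p Q.* p) <ᵇ (five Q.* (q Q.* q))))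

_<₅_ : Q5 → Q5 → Set
x <₅ y with posᵇ (y ⊖ x)
... | true  = ⊤
... | false = ⊥

_<₅ᵇ_ : Q5 → Q5 → Bool
x <₅ᵇ y = posᵇ (y ⊖ x)

half : ℚ
half = (+ 1) Q./ 2

γ : Q5
γ = half +√5· ((+ 1) Q./ 10)

two : Q5
two = ι ((+ 2) Q./ 1)

φ' : Q5
φ' = (Q.- half) +√5· half

-- f₁ on rational arguments (a rational never equals γ or 2γ, which are
-- irrational, so the excluded points never occur).
f₁ : ℚ → Q5
f₁ x = if ι x <₅ᵇ γ then ι 0ℚ
       else if ι x <₅ᵇ (two ⊗ γ) then φ'
       else ι 1ℚ

prodIn : ℕ → List ℕ → Q5
prodIn g []       = ι 1ℚ
prodIn g (n ∷ ns) = f₁ (ratio n g) ⊗ prodIn g ns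

prodOut : ℕ → List ℕ → Q5
prodOut g []       = ι 1ℚ
prodOut g (n ∷ ns) = (ι 1ℚ ⊖ f₁ (ratio n g)) ⊗ prodOut g ns

InRegion : ℚ → ℕ → ℕ → Set
InRegion ε g n =
  1 ℕ.≤ n × n ℕ.≤ 2 ℕ.* g ×
  (  (N <₅ ((γ ⊖ e) ⊗ G))
   ⊎ (((γ ⊕ e) ⊗ G) <₅ N × N <₅ (((two ⊗ γ) ⊖ e) ⊗ G))
   ⊎ (((two ⊗ γ) ⊕ e) ⊗ G) <₅ N)
  where
    N = ℕ→Q5 n
    G = ℕ→Q5 g
    e = ι ε

AbsLt : Q5 → Q5 → Set
AbsLt x ε = ((⊝ ε) <₅ x) × (x <₅ ε)

{-# OPTIONS --safe #-}
-- A semigroup of multiplicity m and genus g is a word w₁ … w_{m−1} with letter sum g, where w_i is the number of gaps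
-- congruent to i modulo m. Every word over {1,2} occurs, so there are at least Fibonacci many semigroups of genus g.
-- Let l be the place of the last occurrence of a letter q ≥ 3. Reflection about l pairs the letters, and each pair has
-- sum at least q; past the first letter 1 the pairs form a chain. A potential function for this chain bounds the words
-- with a letter q ≥ 4 by a polynomial times (50/31)^g, where 50/31 is below the golden ratio, and likewise the heads (the
-- parts up to the last letter 3) of words over {1,2,3}. So almost all words are a short head followed by a word over
-- {1,2}, whose number of twos is concentrated by Chebyshev's inequality. For a fixed head and a fixed number of twos, the
-- tail is uniform, and prescribing boundedly many letters is a hypergeometric event: a letter is 1 with probability close
-- to 1/φ, almost independently. Here n ∈ S is impossible below m ≈ γ g, asks for a letter 1 between m and 2m, and is
-- automatic beyond. The inequalities in ℚ(√5) follow from their values at two rational approximations of √5, one from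
-- each side, given by quotients of Fibonacci numbers.
module Submission where

-- The reflection alone is too weak: for q = 3 and q = 4 the weights (31/50)^(u+v) of the pairs with
-- letters at most q and sum at least q add up to more than 1, so the chain is needed. With the
-- first letter 1 at place s, the first s pairs have no predecessor, and their losses could build up
-- exponentially. But no letter before s is 1, and what this gains to the left of l pays for the
-- losses on both sides, up to the bounded factor (7/6)^4. To the right of l the reflection is i + j
-- = m + l; it costs 1, so the pairs there have sum at least q - 1, with letters at most q - 1. For
-- q ≥ 4 this is the same problem with a smaller q; for q = 3 it is no condition, and the right side
-- is the free tail over {1,2}. No asymptotic number of semigroups is used. Exceptional semigroups
-- are compared with the Fibonacci number of words over {1,2}, where 31 · 21 = 651 > 650 = 50 · 13
-- supplies the exponential gap, and the estimate is proved in every group of words with the same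
-- head and the same number of twos. The limiting product is the same for all groups, so the
-- estimates simply add up.

module Counting where
  open import Defs using (memᵇ; IsGapList; Enumerates; countᵇ; allᵇ; eventᵇ)
  open import Data.Bool using (Bool; true; false; _∧_; _∨_; not; if_then_else_; T)
  open import Data.Empty using (⊥; ⊥-elim)
  open import Data.Integer as ℤ using (ℤ; ∣_∣)
  import Data.Integer.Properties as ℤP
  import Data.Integer.Tactic.RingSolver as ℤS
  open import Data.List using (List; []; _∷_; length; map; concatMap; _++_; filterᵇ; upTo; cartesianProduct; replicate; applyUpTo)
  open import Data.List.Membership.Propositional using (_∈_; _∉_)
  open import Data.List.Membership.Propositional.Properties
  open import Data.List.Properties using (length-++; length-map; length-upTo; ∷-injective; ∷-injectiveʳ)
  open import Data.List.Relation.Unary.All as All using (All; []; _∷_)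
  open import Data.List.Relation.Unary.AllPairs as AllPairs using (AllPairs; []; _∷_)
  import Data.List.Relation.Unary.AllPairs.Properties as AP
  open import Data.List.Relation.Unary.Any using (here; there)
  open import Data.List.Relation.Unary.Linked.Properties using (Linked⇒AllPairs; AllPairs⇒Linked)
  open import Data.List.Relation.Unary.Unique.Propositional using (Unique)
  import Data.List.Relation.Unary.Unique.Propositional.Properties as Uniq
  open import Data.Maybe using (Maybe; just; nothing)
  open import Data.Nat
  open import Data.Nat.Divisibility using (n∣m*n)
  open import Data.Nat.DivMod
  open import Data.Nat.Properties
  open import Data.Nat.Tactic.RingSolver using (solve-∀)
  open import Data.Product using (∃; _×_; _,_; proj₁; proj₂)
  open import Data.Product.Properties using (,-injective)
  open import Data.Sum using (_⊎_; inj₁; inj₂; [_,_]′)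
  open import Data.Unit using (tt)
  open import Function using (_∘_; case_of_)
  open import Relation.Binary using (tri<; tri≈; tri>)
  open import Relation.Binary.PropositionalEquality
  open import Relation.Nullary using (¬_; yes; no)

  -- Finite sums, lists without repetition, bounded search.

  sumL : {A : Set} → (A → ℕ) → List A → ℕ
  sumL f []       = 0
  sumL f (x ∷ xs) = f x + sumL f xs

  sumL-++ : {A : Set} (f : A → ℕ) (xs ys : List A) → sumL f (xs ++ ys) ≡ sumL f xs + sumL f ys
  sumL-++ f []       ys = refl
  sumL-++ f (x ∷ xs) ys = trans (cong (f x +_) (sumL-++ f xs ys)) (sym (+-assoc (f x) _ _))

  sumL-map : {A B : Set} (f : B → ℕ) (g : A → B) (xs : List A) → sumL f (map g xs) ≡ sumL (f ∘ g) xs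
  sumL-map f g []       = refl
  sumL-map f g (x ∷ xs) = cong (f (g x) +_) (sumL-map f g xs)

  sumL-concatMap : {A B : Set} (f : B → ℕ) (g : A → List B) (xs : List A) →
    sumL f (concatMap g xs) ≡ sumL (λ x → sumL f (g x)) xs
  sumL-concatMap f g []       = refl
  sumL-concatMap f g (x ∷ xs) =
    trans (sumL-++ f (g x) _) (cong (sumL f (g x) +_) (sumL-concatMap f g xs))

  sumL-mono : {A : Set} {f g : A → ℕ} (xs : List A) → (∀ x → x ∈ xs → f x ≤ g x) → sumL f xs ≤ sumL g xs
  sumL-mono []       h = z≤n
  sumL-mono (x ∷ xs) h = +-mono-≤ (h x (here refl)) (sumL-mono xs (λ y y∈ → h y (there y∈)))

  sumL-cong : {A : Set} {f g : A → ℕ} (xs : List A) → (∀ x → x ∈ xs → f x ≡ g x) → sumL f xs ≡ sumL g xs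
  sumL-cong []       h = refl
  sumL-cong (x ∷ xs) h = cong₂ _+_ (h x (here refl)) (sumL-cong xs (λ y y∈ → h y (there y∈)))

  sumL-*ˡ : {A : Set} (c : ℕ) (f : A → ℕ) (xs : List A) → sumL (λ x → c * f x) xs ≡ c * sumL f xs
  sumL-*ˡ c f []       = sym (*-zeroʳ c)
  sumL-*ˡ c f (x ∷ xs) = trans (cong (c * f x +_) (sumL-*ˡ c f xs)) (sym (*-distribˡ-+ c (f x) _))

  sumL-*ʳ : {A : Set} (c : ℕ) (f : A → ℕ) (xs : List A) → sumL (λ x → f x * c) xs ≡ sumL f xs * c
  sumL-*ʳ c f []       = refl
  sumL-*ʳ c f (x ∷ xs) = trans (cong (f x * c +_) (sumL-*ʳ c f xs)) (sym (*-distribʳ-+ c (f x) _))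

  length-sumL : {A : Set} (xs : List A) → length xs ≡ sumL (λ _ → 1) xs
  length-sumL []       = refl
  length-sumL (x ∷ xs) = cong suc (length-sumL xs)

  sumL-const : {A : Set} (c : ℕ) (xs : List A) → sumL (λ _ → c) xs ≡ length xs * c
  sumL-const c []       = refl
  sumL-const c (x ∷ xs) = cong (c +_) (sumL-const c xs)

  length-concatMap : {A B : Set} (f : A → List B) (xs : List A) → length (concatMap f xs) ≡ sumL (λ x → length (f x)) xs
  length-concatMap f []       = refl
  length-concatMap f (x ∷ xs) = trans (length-++ (f x)) (cong (length (f x) +_) (length-concatMap f xs))

  ∈-sumL : {A : Set} (f : A → ℕ) {x : A} {xs : List A} → x ∈ xs → f x ≤ sumL f xs
  ∈-sumL f {xs = y ∷ ys} (here refl) = m≤m+n _ _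
  ∈-sumL f {xs = y ∷ ys} (there p)   = ≤-trans (∈-sumL f p) (m≤n+m _ (f y))

  concatMap-∈⁺ : {A B : Set} {f : A → List B} {x : A} {y : B} {xs : List A} → x ∈ xs → y ∈ f x → y ∈ concatMap f xs
  concatMap-∈⁺ {f = f} {xs = x ∷ xs} (here refl) q = ∈-++⁺ˡ q
  concatMap-∈⁺ {f = f} {xs = x ∷ xs} (there p)   q = ∈-++⁺ʳ (f x) (concatMap-∈⁺ p q)

  concatMap-∈⁻ : {A B : Set} (f : A → List B) {y : B} (xs : List A) → y ∈ concatMap f xs → ∃ λ x → x ∈ xs × y ∈ f x
  concatMap-∈⁻ f (x ∷ xs) p with ∈-++⁻ (f x) p
  ... | inj₁ q = x , here refl , q
  ... | inj₂ q with concatMap-∈⁻ f xs q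
  ...   | x' , x'∈ , q' = x' , there x'∈ , q'

  Unique-concatMap : {A B : Set} (f : A → List B) {xs : List A} → Unique xs → (∀ x → x ∈ xs → Unique (f x)) →
    (∀ {x x' y} → y ∈ f x → y ∈ f x' → x ≡ x') → Unique (concatMap f xs)
  Unique-concatMap f []        u k = []
  Unique-concatMap f {x ∷ xs} (x∉ ∷ uxs) u k =
    Uniq.++⁺ (u x (here refl)) (Unique-concatMap f uxs (λ y y∈ → u y (there y∈)) k)
      λ { (p , q) → let (x' , x'∈ , q') = concatMap-∈⁻ f xs q in All.lookup x∉ x'∈ (k p q') }

  filterᵇ-∈⁺ : {A : Set} (p : A → Bool) {x : A} {xs : List A} → x ∈ xs → p x ≡ true → x ∈ filterᵇ p xs
  filterᵇ-∈⁺ p {xs = y ∷ ys} (here refl) e rewrite e = here refl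
  filterᵇ-∈⁺ p {xs = y ∷ ys} (there q)   e with p y
  ... | true  = there (filterᵇ-∈⁺ p q e)
  ... | false = filterᵇ-∈⁺ p q e

  filterᵇ-∈⁻ : {A : Set} (p : A → Bool) {x : A} (xs : List A) → x ∈ filterᵇ p xs → x ∈ xs × p x ≡ true
  filterᵇ-∈⁻ p (y ∷ ys) q with p y in e
  filterᵇ-∈⁻ p (y ∷ ys) (here refl) | true  = here refl , e
  filterᵇ-∈⁻ p (y ∷ ys) (there q)   | true  = let (a , b) = filterᵇ-∈⁻ p ys q in there a , b
  filterᵇ-∈⁻ p (y ∷ ys) q           | false = let (a , b) = filterᵇ-∈⁻ p ys q in there a , b

  filterᵇ-Unique : {A : Set} (p : A → Bool) {xs : List A} → Unique xs → Unique (filterᵇ p xs)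
  filterᵇ-Unique p []        = []
  filterᵇ-Unique p {x ∷ xs} (x∉ ∷ u) with p x
  ... | true  = All.tabulate (λ q → All.lookup x∉ (proj₁ (filterᵇ-∈⁻ p xs q))) ∷ filterᵇ-Unique p u
  ... | false = filterᵇ-Unique p u

  sumL-filterᵇ-mono : {A : Set} (f : A → ℕ) {p p' : A → Bool} (xs : List A) → (∀ x → x ∈ xs → p x ≡ true → p' x ≡ true) →
    sumL f (filterᵇ p xs) ≤ sumL f (filterᵇ p' xs)
  sumL-filterᵇ-mono f []       h = z≤n
  sumL-filterᵇ-mono f {p} {p'} (x ∷ xs) h with p x in e | p' x in e'
  ... | true  | true  = +-monoʳ-≤ (f x) (sumL-filterᵇ-mono f xs (λ y y∈ → h y (there y∈)))
  ... | true  | false = case trans (sym e') (h x (here refl) e) of λ ()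
  ... | false | true  = ≤-trans (sumL-filterᵇ-mono f xs (λ y y∈ → h y (there y∈))) (m≤n+m _ (f x))
  ... | false | false = sumL-filterᵇ-mono f xs (λ y y∈ → h y (there y∈))

  -- The partner of the first element is deleted from `ys`; by injectivity no later element can be
  -- related to it. Working with a relation allows a semigroup to be matched with any code that
  -- represents it, without a coding function on gap lists.
  length-≤-rel : {A B : Set} {xs : List A} {ys : List B} (R : A → B → Set) → Unique xs →
    (∀ x → x ∈ xs → ∃ λ y → y ∈ ys × R x y) → (∀ {x x' y} → x ∈ xs → x' ∈ xs → R x y → R x' y → x ≡ x') → length xs ≤ length ys
  length-≤-rel R []         ex inj = z≤n
  length-≤-rel {xs = x ∷ xs} {ys} R (x∉ ∷ u) ex inj with ex x (here refl)
  ... | y , y∈ , r with ∈-∃++ y∈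
  ...   | as , bs , refl = ≤-trans (s≤s (length-≤-rel {ys = as ++ bs} R u ex' (λ p q → inj (there p) (there q))))
      (≤-reflexive (trans (cong suc (length-++ as)) (trans (sym (+-suc (length as) _)) (sym (length-++ as)))))
    where
    ex' : ∀ x' → x' ∈ xs → ∃ λ y' → y' ∈ as ++ bs × R x' y'
    ex' x' x'∈ with ex x' (there x'∈)
    ... | y' , y'∈ , r' with ∈-++⁻ as y'∈
    ...   | inj₁ q           = y' , ∈-++⁺ˡ q , r'
    ...   | inj₂ (here refl) = ⊥-elim (All.lookup x∉ x'∈ (inj (here refl) (there x'∈) r r'))
    ...   | inj₂ (there q)   = y' , ∈-++⁺ʳ as q , r'

  countᵇ-filter : (p : List ℕ → Bool) (xs : List (List ℕ)) → countᵇ p xs ≡ length (filterᵇ p xs)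
  countᵇ-filter p []       = refl
  countᵇ-filter p (x ∷ xs) with p x
  ... | true  = cong suc (countᵇ-filter p xs)
  ... | false = countᵇ-filter p xs

  bit : Bool → ℕ
  bit true  = 1
  bit false = 0

  length-filterᵇ : {A : Set} (p : A → Bool) (xs : List A) → length (filterᵇ p xs) ≡ sumL (λ x → bit (p x)) xs
  length-filterᵇ p []       = refl
  length-filterᵇ p (x ∷ xs) with p x
  ... | true  = cong suc (length-filterᵇ p xs)
  ... | false = length-filterᵇ p xs

  sumTo : ℕ → (ℕ → ℕ) → ℕ
  sumTo zero    F = 0
  sumTo (suc n) F = sumTo n F + F n

  sumTo-cong : ∀ n {F G : ℕ → ℕ} → (∀ i → i < n → F i ≡ G i) → sumTo n F ≡ sumTo n G
  sumTo-cong zero    h = refl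
  sumTo-cong (suc n) h = cong₂ _+_ (sumTo-cong n (λ i i<n → h i (m<n⇒m<1+n i<n))) (h n ≤-refl)

  sumTo-mono : ∀ n {F G : ℕ → ℕ} → (∀ i → i < n → F i ≤ G i) → sumTo n F ≤ sumTo n G
  sumTo-mono zero    h = z≤n
  sumTo-mono (suc n) h = +-mono-≤ (sumTo-mono n (λ i i<n → h i (m<n⇒m<1+n i<n))) (h n ≤-refl)

  sumTo-add : ∀ a b (F : ℕ → ℕ) → sumTo (a + b) F ≡ sumTo a F + sumTo b (λ i → F (a + i))
  sumTo-add a zero    F rewrite +-identityʳ a = sym (+-identityʳ _)
  sumTo-add a (suc b) F rewrite +-suc a b = trans (cong (_+ F (a + b)) (sumTo-add a b F)) (+-assoc (sumTo a F) _ _)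

  sumTo-+ : ∀ n (F G : ℕ → ℕ) → sumTo n (λ i → F i + G i) ≡ sumTo n F + sumTo n G
  sumTo-+ zero    F G = refl
  sumTo-+ (suc n) F G = trans (cong (_+ (F n + G n)) (sumTo-+ n F G)) (lem (sumTo n F) (sumTo n G) (F n) (G n))
    where
    lem : ∀ a b c d → a + b + (c + d) ≡ a + c + (b + d)
    lem = solve-∀

  sumTo-zero : ∀ n → sumTo n (λ _ → 0) ≡ 0
  sumTo-zero zero    = refl
  sumTo-zero (suc n) = trans (+-identityʳ _) (sumTo-zero n)

  sumTo-swap : ∀ m n (F : ℕ → ℕ → ℕ) → sumTo m (λ i → sumTo n (F i)) ≡ sumTo n (λ j → sumTo m (λ i → F i j))
  sumTo-swap zero    n F = sym (sumTo-zero n)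
  sumTo-swap (suc m) n F = trans (cong (_+ sumTo n (F m)) (sumTo-swap m n F))
    (sym (sumTo-+ n (λ j → sumTo m (λ i → F i j)) (F m)))

  sumTo-blocks : ∀ b m (F : ℕ → ℕ) → sumTo (b * m) F ≡ sumTo b (λ t → sumTo m (λ i → F (t * m + i)))
  sumTo-blocks zero    m F = refl
  sumTo-blocks (suc b) m F = trans (cong (λ z → sumTo z F) (+-comm m (b * m)))
    (trans (sumTo-add (b * m) m F) (cong (_+ sumTo m (λ i → F (b * m + i))) (sumTo-blocks b m F)))

  sumTo-shift : ∀ n (F : ℕ → ℕ) → sumTo (suc n) F ≡ F 0 + sumTo n (λ i → F (suc i))
  sumTo-shift n F = trans (sumTo-add 1 n F) refl

  sumTo-rev : ∀ n (F : ℕ → ℕ) → sumTo n F ≡ sumTo n (λ i → F (n ∸ suc i))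
  sumTo-rev zero    F = refl
  sumTo-rev (suc n) F = trans (cong (_+ F n) (sumTo-rev n F)) (trans (+-comm _ (F n)) (sym (sumTo-shift n (λ i → F (suc n ∸ suc i)))))

  sumL-upTo : ∀ n (F : ℕ → ℕ) → sumL F (upTo n) ≡ sumTo n F
  sumL-upTo n F = go n (λ x → x) F
    where
    go : ∀ n (f : ℕ → ℕ) (F : ℕ → ℕ) → sumL F (applyUpTo f n) ≡ sumTo n (F ∘ f)
    go zero    f F = refl
    go (suc n) f F = trans (cong (F (f 0) +_) (go n (f ∘ suc) F)) (sym (sumTo-shift n (F ∘ f)))

  ≡ᵇ-refl : ∀ n → (n ≡ᵇ n) ≡ true
  ≡ᵇ-refl zero    = refl
  ≡ᵇ-refl (suc n) = ≡ᵇ-refl n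

  ≡ᵇ-sound : ∀ m n → (m ≡ᵇ n) ≡ true → m ≡ n
  ≡ᵇ-sound zero    zero    e = refl
  ≡ᵇ-sound (suc m) (suc n) e = cong suc (≡ᵇ-sound m n e)

  memᵇ-sound : ∀ n G → memᵇ n G ≡ true → n ∈ G
  memᵇ-sound n (x ∷ xs) e with n ≡ᵇ x in q
  ... | true  = here (≡ᵇ-sound n x q)
  ... | false = there (memᵇ-sound n xs e)

  memᵇ-complete : ∀ n G → n ∈ G → memᵇ n G ≡ true
  memᵇ-complete n (x ∷ xs) (here refl) rewrite ≡ᵇ-refl n = refl
  memᵇ-complete n (x ∷ xs) (there p) with n ≡ᵇ x
  ... | true  = refl
  ... | false = memᵇ-complete n xs p

  sumTo-δ : ∀ b x → x < b → sumTo b (λ n → bit (n ≡ᵇ x)) ≡ 1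
  sumTo-δ (suc b) x x<b with b ≡ᵇ x in e
  ... | true  with refl ← ≡ᵇ-sound b x e = cong (_+ 1) (trans (sumTo-cong b (λ i i<b → lem i i<b)) (sumTo-zero b))
    where
    lem : ∀ i → i < b → bit (i ≡ᵇ b) ≡ 0
    lem i i<b with i ≡ᵇ b in q
    ... | true  = ⊥-elim (<-irrefl (≡ᵇ-sound i b q) i<b)
    ... | false = refl
  ... | false with m≤n⇒m<n∨m≡n (≤-pred x<b)
  ...   | inj₁ x<b' = trans (+-identityʳ _) (sumTo-δ b x x<b')
  ...   | inj₂ refl = case trans (sym (≡ᵇ-refl b)) e of λ ()

  sumTo-memᵇ : ∀ b G → Unique G → All (_< b) G → sumTo b (λ n → bit (memᵇ n G)) ≡ length G
  sumTo-memᵇ b []       u         a         = sumTo-zero b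
  sumTo-memᵇ b (x ∷ xs) (x∉ ∷ u) (x<b ∷ a) =
    trans (sumTo-cong b (λ i _ → split i)) (trans (sumTo-+ b (λ n → bit (n ≡ᵇ x)) _) (cong₂ _+_ (sumTo-δ b x x<b) (sumTo-memᵇ b xs u a)))
    where
    split : ∀ n → bit ((n ≡ᵇ x) ∨ memᵇ n xs) ≡ bit (n ≡ᵇ x) + bit (memᵇ n xs)
    split n with n ≡ᵇ x in e | memᵇ n xs in e'
    ... | true  | true  with refl ← ≡ᵇ-sound n x e = ⊥-elim (All.lookup x∉ (memᵇ-sound n xs e') refl)
    ... | true  | false = refl
    ... | false | true  = refl
    ... | false | false = refl

  findFirst : (p : ℕ → Bool) (n : ℕ) → (∀ i → i < n → p i ≡ false) ⊎ (∃ λ s → s < n × p s ≡ true × (∀ i → i < s → p i ≡ false))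
  findFirst p zero    = inj₁ (λ i ())
  findFirst p (suc n) with findFirst p n
  ... | inj₂ (s , s<n , ps , q) = inj₂ (s , m<n⇒m<1+n s<n , ps , q)
  ... | inj₁ h with p n in e
  ...   | true  = inj₂ (n , ≤-refl , e , h)
  ...   | false = inj₁ λ i i<sn → case m≤n⇒m<n∨m≡n (≤-pred i<sn) of λ { (inj₁ i<n) → h i i<n ; (inj₂ refl) → e }

  findLast : (p : ℕ → Bool) (n : ℕ) → (∀ i → i < n → p i ≡ false) ⊎ (∃ λ s → s < n × p s ≡ true × (∀ i → s < i → i < n → p i ≡ false))
  findLast p zero    = inj₁ (λ i ())
  findLast p (suc n) with p n in e
  ... | true  = inj₂ (n , ≤-refl , e , λ i n<i i≤n → ⊥-elim (<-irrefl refl (≤-trans n<i (≤-pred i≤n))))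
  ... | false with findLast p n
  ...   | inj₁ h = inj₁ λ i i<sn → case m≤n⇒m<n∨m≡n (≤-pred i<sn) of λ { (inj₁ i<n) → h i i<n ; (inj₂ refl) → e }
  ...   | inj₂ (s , s<n , ps , q) = inj₂ (s , m<n⇒m<1+n s<n , ps ,
            λ i s<i i<sn → case m≤n⇒m<n∨m≡n (≤-pred i<sn) of λ { (inj₁ i<n) → q i s<i i<n ; (inj₂ refl) → e })

  lastMax : (w : ℕ → ℕ) (n : ℕ) → ∃ λ l → l ≤ n × (∀ i → i ≤ n → w i ≤ w l) × (∀ i → l < i → i ≤ n → w i < w l)
  lastMax w zero    = 0 , z≤n , (λ { zero _ → ≤-refl }) , λ i 0<i i≤0 → ⊥-elim (<-irrefl refl (≤-trans 0<i i≤0))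
  lastMax w (suc n) with lastMax w n
  ... | l , l≤n , mx , last with w l ≤? w (suc n)
  ...   | yes p = suc n , ≤-refl ,
          (λ i i≤sn → case m≤n⇒m<n∨m≡n i≤sn of λ { (inj₁ i<sn) → ≤-trans (mx i (≤-pred i<sn)) p ; (inj₂ refl) → ≤-refl }) ,
          λ i sn<i i≤sn → ⊥-elim (<-irrefl refl (≤-trans sn<i i≤sn))
  ...   | no ¬p = l , m≤n⇒m≤1+n l≤n ,
          (λ i i≤sn → case m≤n⇒m<n∨m≡n i≤sn of λ { (inj₁ i<sn) → mx i (≤-pred i<sn) ; (inj₂ refl) → <⇒≤ (≰⇒> ¬p) }) ,
          λ i l<i i≤sn → case m≤n⇒m<n∨m≡n i≤sn of λ { (inj₁ i<sn) → last i l<i (≤-pred i<sn) ; (inj₂ refl) → ≰⇒> ¬p }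

  -- Kunz coordinates

  <ᵇ-true : ∀ {m n} → m < n → (m <ᵇ n) ≡ true
  <ᵇ-true {m} {n} p with m <ᵇ n | <⇒<ᵇ p
  ... | true | _ = refl

  <ᵇ-sound : ∀ m n → (m <ᵇ n) ≡ true → m < n
  <ᵇ-sound m n e = <ᵇ⇒< m n (subst T (sym e) tt)

  ≤ᵇ-true : ∀ {m n} → m ≤ n → (m ≤ᵇ n) ≡ true
  ≤ᵇ-true {m} {n} p with m ≤ᵇ n | ≤⇒≤ᵇ p
  ... | true | _ = refl

  ≤ᵇ-sound : ∀ m n → (m ≤ᵇ n) ≡ true → m ≤ n
  ≤ᵇ-sound m n e = ≤ᵇ⇒≤ m n (subst T (sym e) tt)

  <ᵇ-false : ∀ {m n} → n ≤ m → (m <ᵇ n) ≡ false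
  <ᵇ-false {m} {n} p with m <ᵇ n in e
  ... | false = refl
  ... | true  = ⊥-elim (<-irrefl refl (≤-trans (<ᵇ-sound m n e) p))

  ≤ᵇ-false : ∀ {m n} → n < m → (m ≤ᵇ n) ≡ false
  ≤ᵇ-false {m} {n} p with m ≤ᵇ n in e
  ... | false = refl
  ... | true  = ⊥-elim (<-irrefl refl (≤-trans p (≤ᵇ-sound m n e)))

  ≢true⇒≡false : ∀ {b} → ¬ (b ≡ true) → b ≡ false
  ≢true⇒≡false {true}  h = ⊥-elim (h refl)
  ≢true⇒≡false {false} h = refl

  sumTo-one : ∀ n → sumTo n (λ _ → 1) ≡ n
  sumTo-one zero    = refl
  sumTo-one (suc n) = trans (+-comm _ 1) (cong suc (sumTo-one n))

  sumTo-monoˡ : ∀ {a b} (F : ℕ → ℕ) → a ≤ b → sumTo a F ≤ sumTo b F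
  sumTo-monoˡ {a} F a≤b with m≤n⇒∃[o]m+o≡n a≤b
  ... | o , refl = ≤-trans (m≤m+n _ _) (≤-reflexive (sym (sumTo-add a o F)))

  bit≤1 : ∀ b → bit b ≤ 1
  bit≤1 true  = ≤-refl
  bit≤1 false = z≤n

  module _ (p : ℕ → Bool) (down : ∀ t → p (suc t) ≡ true → p t ≡ true) where

    private
      down* : ∀ {s t} → s ≤ t → p t ≡ true → p s ≡ true
      down* {s} {zero}  z≤n h = h
      down* {s} {suc t} s≤t h with m≤n⇒m<n∨m≡n s≤t
      ... | inj₁ s<t  = down* (≤-pred s<t) (down t h)
      ... | inj₂ refl = h

    -- By `down` the solutions of `p` form an initial segment, so counting them locates its end. In
    -- a residue class modulo the multiplicity the gaps form such a segment, because a nongap plus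
    -- the multiplicity is a nongap.
    initial-count-> : ∀ {t} b → t < b → p t ≡ true → t < sumTo b (bit ∘ p)
    initial-count-> {t} b t<b h = ≤-trans
      (≤-reflexive (trans (sym (sumTo-one (suc t))) (sumTo-cong (suc t) (λ i i≤t → cong bit (sym (down* (≤-pred i≤t) h))))))
      (sumTo-monoˡ (bit ∘ p) t<b)

    initial-count-true : ∀ {t} b → t < sumTo b (bit ∘ p) → p t ≡ true
    initial-count-true {t} b h with p t in e
    ... | true  = refl
    ... | false = ⊥-elim (<-irrefl refl (≤-trans h (bound b)))
      where
      bound : ∀ b → sumTo b (bit ∘ p) ≤ t
      bound zero    = z≤n
      bound (suc b) with p b in q
      ... | false = ≤-trans (≤-reflexive (+-identityʳ _)) (bound b)
      ... | true  with t ≤? b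
      ...   | yes t≤b = case trans (sym e) (down* t≤b q) of λ ()
      ...   | no  t≰b = ≤-trans (+-monoˡ-≤ 1 (≤-trans (sumTo-mono b (λ i _ → bit≤1 (p i))) (≤-reflexive (sumTo-one b))))
                (≤-trans (≤-reflexive (+-comm b 1)) (≰⇒> t≰b))

  sorted-ext : {xs ys : List ℕ} → AllPairs _<_ xs → AllPairs _<_ ys → (∀ n → n ∈ xs → n ∈ ys) → (∀ n → n ∈ ys → n ∈ xs) → xs ≡ ys
  sorted-ext {[]}     {[]}     _ _ _ _ = refl
  sorted-ext {[]}     {y ∷ ys} _ _ _ g = case g y (here refl) of λ ()
  sorted-ext {x ∷ xs} {[]}     _ _ f _ = case f x (here refl) of λ ()
  sorted-ext {x ∷ xs} {y ∷ ys} (x< ∷ sx) (y< ∷ sy) f g = cong₂ _∷_ x≡y (sorted-ext sx sy f' g')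
    where
    x≡y : x ≡ y
    x≡y with f x (here refl) | g y (here refl)
    ... | here e  | _       = e
    ... | there _ | here e  = sym e
    ... | there p | there q = ⊥-elim (<-asym (All.lookup y< p) (All.lookup x< q))
    f' : ∀ n → n ∈ xs → n ∈ ys
    f' n p with f n (there p)
    ... | here refl = ⊥-elim (<-irrefl x≡y (All.lookup x< p))
    ... | there q   = q
    g' : ∀ n → n ∈ ys → n ∈ xs
    g' n p with g n (there p)
    ... | here refl = ⊥-elim (<-irrefl (sym x≡y) (All.lookup y< p))
    ... | there q   = q

  sorted-unique : {G : List ℕ} → AllPairs _<_ G → Unique G
  sorted-unique = AllPairs.map <⇒≢

  -- Kunz coordinates: w i is the number of gaps congruent to i modulo the multiplicity m.
  record Kunz (g : ℕ) (G : List ℕ) : Set where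
    field
      pm    : ℕ
      w     : ℕ → ℕ
    m = suc pm
    field
      sorted  : AllPairs _<_ G
      gap⇒    : ∀ i t → i < m → t * m + i ∈ G → t < w i
      gap⇐    : ∀ i t → i < m → t < w i → t * m + i ∈ G
      w0      : w 0 ≡ 0
      pos     : ∀ i → 0 < i → i < m → 1 ≤ w i
      sub     : ∀ i j → i + j < m → w (i + j) ≤ w i + w j
      sub-mod : ∀ i j l → i < m → j < m → l < m → i + j ≡ m + l → w l ≤ suc (w i + w j)
      total   : sumTo m w ≡ g

  kunz : ∀ {g G} → IsGapList g G → Kunz g G
  kunz {g} {G} gl = go (findFirst (λ n → not (mem (suc n))) (suc b))
    where
    open IsGapList gl renaming (sorted to lnk)
    -- A bound above all gaps. It also suffices as a number of blocks of length `m`: if `t * m + i`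
    -- is a gap then `t` is below `b`.
    b = suc (sumL (λ x → x) G)
    mem : ℕ → Bool
    mem n = memᵇ n G
    mem-true : ∀ {n} → n ∈ G → mem n ≡ true
    mem-true {n} = memᵇ-complete n G
    mem-false : ∀ {n} → mem n ≡ false → n ∉ G
    mem-false e p = case trans (sym e) (mem-true p) of λ ()
    ∉-mem : ∀ {n} → n ∉ G → mem n ≡ false
    ∉-mem {n} h = ≢true⇒≡false (λ e → h (memᵇ-sound n G e))
    below : ∀ {x} → x ∈ G → x < b
    below p = s≤s (∈-sumL (λ x → x) p)
    srt : AllPairs _<_ G
    srt = Linked⇒AllPairs <-trans lnk
    go : _ → Kunz g G
    go (inj₁ h) = ⊥-elim (<-asym (n<1+n b) (below (memᵇ-sound _ G (not-false (h b ≤-refl)))))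
      where
      not-false : ∀ {x} → not x ≡ false → x ≡ true
      not-false {true} _ = refl
    go (inj₂ (pm , _ , pm∉ , first)) = record
      { pm = pm ; w = w ; sorted = srt ; gap⇒ = gap⇒ ; gap⇐ = gap⇐ ; w0 = w0
      ; pos = pos ; sub = sub ; sub-mod = sub-mod ; total = total }
      where
      m = suc pm
      not-true : ∀ {x} → not x ≡ true → x ≡ false
      not-true {false} _ = refl
      not-false : ∀ {x} → not x ≡ false → x ≡ true
      not-false {true} _ = refl
      m∉ : m ∉ G
      m∉ = mem-false (not-true pm∉)
      w : ℕ → ℕ
      w i = sumTo b (λ t → bit (mem (t * m + i)))
      reassoc : ∀ t i k → suc k + t * suc k + i ≡ (t * suc k + i) + suc k
      reassoc = solve-∀
      down : ∀ i t → mem (suc t * m + i) ≡ true → mem (t * m + i) ≡ true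
      down i t e with mem (t * m + i) in q
      ... | true  = refl
      ... | false = ⊥-elim (closed _ _ (mem-false q) m∉ (subst (_∈ G) (reassoc t i pm) (memᵇ-sound _ G e)))
      gap⇒ : ∀ i t → i < m → t * m + i ∈ G → t < w i
      gap⇒ i t _ p = initial-count-> _ (down i) b
        (≤-trans (s≤s (≤-trans (m≤m*n t m) (m≤m+n _ i))) (below p)) (mem-true p)
      gap⇐ : ∀ i t → i < m → t < w i → t * m + i ∈ G
      gap⇐ i t _ h = memᵇ-sound _ G (initial-count-true _ (down i) b h)
      end∉ : ∀ i → i < m → w i * m + i ∉ G
      end∉ i i<m p = <-irrefl refl (gap⇒ i (w i) i<m p)
      mult∉ : ∀ t → t * m + 0 ∉ G
      mult∉ zero    = zero∈S
      mult∉ (suc t) p = closed _ _ (mult∉ t) m∉ (subst (_∈ G) (reassoc t 0 pm) p)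
      w0 : w 0 ≡ 0
      w0 = trans (sumTo-cong b (λ t _ → cong bit (∉-mem (mult∉ t)))) (sumTo-zero b)
      pos : ∀ i → 0 < i → i < m → 1 ≤ w i
      pos (suc i) _ i<m = gap⇒ (suc i) 0 i<m (memᵇ-sound _ G (not-false (first i (≤-pred i<m))))
      sub : ∀ i j → i + j < m → w (i + j) ≤ w i + w j
      sub i j h = ≮⇒≥ λ q → closed _ _ (end∉ i (≤-trans (s≤s (m≤m+n i j)) h)) (end∉ j (≤-trans (s≤s (m≤n+m j i)) h))
        (subst (_∈ G) (lem (w i) (w j) i j pm) (gap⇐ (i + j) (w i + w j) h q))
        where
        lem : ∀ a b i j k → (a + b) * suc k + (i + j) ≡ a * suc k + i + (b * suc k + j)
        lem = solve-∀
      sub-mod : ∀ i j l → i < m → j < m → l < m → i + j ≡ m + l → w l ≤ suc (w i + w j)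
      sub-mod i j l i<m j<m l<m e = ≮⇒≥ λ q → closed _ _ (end∉ i i<m) (end∉ j j<m)
        (subst (_∈ G) (trans (lem₁ (w i) (w j) l pm) (trans (cong ((w i + w j) * m +_) (sym e)) (lem₂ (w i) (w j) i j pm)))
          (gap⇐ l (suc (w i + w j)) l<m q))
        where
        lem₁ : ∀ a b l k → suc (a + b) * suc k + l ≡ (a + b) * suc k + (suc k + l)
        lem₁ = solve-∀
        lem₂ : ∀ a b i j k → (a + b) * suc k + (i + j) ≡ a * suc k + i + (b * suc k + j)
        lem₂ = solve-∀
      total : sumTo m w ≡ g
      -- The gaps below `b * m` are all the gaps; they are counted by residue class and in their
      -- natural order.
      total = trans (sym (sumTo-swap b m (λ t i → bit (mem (t * m + i)))))
        (trans (sym (sumTo-blocks b m (λ n → bit (mem n))))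
        (trans (sumTo-memᵇ (b * m) G (sorted-unique srt) (All.tabulate (λ p → ≤-trans (below p) (m≤m*n b m)))) genus))

  kunz-ext : ∀ {g g' G G'} (K : Kunz g G) (K' : Kunz g' G') → Kunz.pm K ≡ Kunz.pm K' →
    (∀ i → i < Kunz.m K → Kunz.w K i ≡ Kunz.w K' i) → G ≡ G'
  kunz-ext {G = G} {G'} K K' refl ew = sorted-ext K.sorted K'.sorted
    (λ n p → subst (_∈ G') (sym (dm n)) (K'.gap⇐ _ _ (m%n<n n K.m) (subst (n / K.m <_) (ew _ (m%n<n n K.m)) (K.gap⇒ _ _ (m%n<n n K.m) (subst (_∈ G) (dm n) p)))))
    (λ n p → subst (_∈ G) (sym (dm n)) (K.gap⇐ _ _ (m%n<n n K.m) (subst (n / K.m <_) (sym (ew _ (m%n<n n K.m))) (K'.gap⇒ _ _ (m%n<n n K.m) (subst (_∈ G') (dm n) p)))))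
    where
    module K = Kunz K
    module K' = Kunz K'
    dm : ∀ n → n ≡ n / K.m * K.m + n % K.m
    dm n = trans (m≡m%n+[m/n]*n n K.m) (+-comm (n % K.m) _)

  module _ (pm : ℕ) where
    private m = suc pm
    block-% : ∀ t i → i < m → (t * m + i) % m ≡ i
    block-% t i i<m = trans (cong (_% m) (+-comm (t * m) i)) (trans ([m+kn]%n≡m%n i t m) (m<n⇒m%n≡m i<m))
    block-/ : ∀ t i → i < m → (t * m + i) / m ≡ t
    block-/ t i i<m = trans (+-distrib-/-∣ˡ i (n∣m*n t)) (trans (cong₂ _+_ (m*n/n≡m t m) (m<n⇒m/n≡0 i<m)) (+-identityʳ t))

  -- The inverse of the passage to Kunz coordinates. Since no coordinate exceeds `B`, the first `B`
  -- blocks of length `m` contain every gap.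
  module Decode (pm : ℕ) (V : ℕ → ℕ) (B : ℕ) (V≤B : ∀ i → V i ≤ B) where
    private m = suc pm
    isGapᵇ : ℕ → Bool
    isGapᵇ n = (n / m) <ᵇ V (n % m)

    decode : List ℕ
    decode = filterᵇ isGapᵇ (upTo (B * m))

    decode⇒ : ∀ i t → i < m → t * m + i ∈ decode → t < V i
    decode⇒ i t i<m p = <ᵇ-sound t (V i)
      (subst₂ (λ x y → (x <ᵇ V y) ≡ true) (block-/ pm t i i<m) (block-% pm t i i<m) (proj₂ (filterᵇ-∈⁻ isGapᵇ (upTo (B * m)) p)))

    decode⇐ : ∀ i t → i < m → t < V i → t * m + i ∈ decode
    decode⇐ i t i<m h = filterᵇ-∈⁺ isGapᵇ (∈-upTo⁺ lt)
      (subst₂ (λ x y → (x <ᵇ V y) ≡ true) (sym (block-/ pm t i i<m)) (sym (block-% pm t i i<m)) (<ᵇ-true h))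
      where
      lt : t * m + i < B * m
      lt = ≤-trans (+-monoʳ-< (t * m) i<m) (≤-trans (≤-reflexive (+-comm (t * m) m)) (*-monoˡ-≤ m (≤-trans h (V≤B i))))

    decode-sorted : AllPairs _<_ decode
    decode-sorted = filt (AP.applyUpTo⁺₁ (λ x → x) (B * m) (λ i<j _ → i<j))
      where
      filt : ∀ {xs} → AllPairs _<_ xs → AllPairs _<_ (filterᵇ isGapᵇ xs)
      filt []       = []
      filt {x ∷ xs} (a ∷ s) with isGapᵇ x
      ... | true  = All.tabulate (λ q → All.lookup a (proj₁ (filterᵇ-∈⁻ isGapᵇ xs q))) ∷ filt s
      ... | false = filt s

    decode-length : length decode ≡ sumTo m V
    decode-length = trans (length-filterᵇ isGapᵇ (upTo (B * m))) (trans (sumL-upTo (B * m) _) (trans (sumTo-blocks B m _)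
      (trans (sumTo-swap B m _) (sumTo-cong m λ i i<m → trans (sumTo-cong B λ t _ →
        cong bit (cong₂ (λ x y → x <ᵇ V y) (block-/ pm t i i<m) (block-% pm t i i<m))) (thr (V i) B (V≤B i))))))
      where
      thr : ∀ v B → v ≤ B → sumTo B (λ t → bit (t <ᵇ v)) ≡ v
      thr v zero    z≤n = refl
      thr v (suc B) v≤ with m≤n⇒m<n∨m≡n v≤
      ... | inj₁ v<  rewrite <ᵇ-false (≤-pred v<) = trans (+-identityʳ _) (thr v B (≤-pred v<))
      ... | inj₂ refl = trans (sumTo-cong (suc B) λ i i≤B → cong bit (<ᵇ-true i≤B)) (sumTo-one (suc B))

    module _ (V0 : V 0 ≡ 0) (sub : ∀ i j → i + j < m → V (i + j) ≤ V i + V j)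
             (sub-mod : ∀ i j l → i < m → j < m → l < m → i + j ≡ m + l → V l ≤ suc (V i + V j)) where
      decode-gaps : IsGapList (sumTo m V) decode
      decode-gaps = record
        { sorted = AllPairs⇒Linked decode-sorted
        ; genus  = decode-length
        ; zero∈S = λ p → case subst (0 <_) V0 (decode⇒ 0 0 (s≤s z≤n) p) of λ ()
        ; closed = closed }
        where
        dm : ∀ n → n ≡ n / m * m + n % m
        dm n = trans (m≡m%n+[m/n]*n n m) (+-comm (n % m) _)
        ∉⇒ : ∀ n → n ∉ decode → V (n % m) ≤ n / m
        ∉⇒ n h = ≮⇒≥ λ q → h (subst (_∈ decode) (sym (dm n)) (decode⇐ (n % m) (n / m) (m%n<n n m) q))
        closed : ∀ a b → a ∉ decode → b ∉ decode → (a + b) ∉ decode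
        closed a b ha hb p with (a % m + b % m) <? m
        ... | yes lt = <-irrefl refl (≤-trans
                (decode⇒ _ (a / m + b / m) lt (subst (_∈ decode) (trans (cong₂ _+_ (dm a) (dm b)) (lem (a / m) (b / m) _ _ pm)) p))
                (≤-trans (sub _ _ lt) (+-mono-≤ (∉⇒ a ha) (∉⇒ b hb))))
          where
          lem : ∀ a b i j k → a * suc k + i + (b * suc k + j) ≡ (a + b) * suc k + (i + j)
          lem = solve-∀
        ... | no ge with m≤n⇒∃[o]m+o≡n (≮⇒≥ ge)
        ...   | l , e = <-irrefl refl (≤-trans
                (decode⇒ l (suc (a / m + b / m)) l<m (subst (_∈ decode) (trans (cong₂ _+_ (dm a) (dm b)) (trans (lem (a / m) (b / m) _ _ pm)
                  (trans (cong ((a / m + b / m) * m +_) (sym e)) (lem' (a / m) (b / m) l pm)))) p))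
                (≤-trans (sub-mod _ _ l (m%n<n a m) (m%n<n b m) l<m (sym e)) (s≤s (+-mono-≤ (∉⇒ a ha) (∉⇒ b hb)))))
          where
          lem : ∀ a b i j k → a * suc k + i + (b * suc k + j) ≡ (a + b) * suc k + (i + j)
          lem = solve-∀
          lem' : ∀ a b l k → (a + b) * suc k + (suc k + l) ≡ suc (a + b) * suc k + l
          lem' = solve-∀
          l<m : l < m
          l<m = +-cancelˡ-< m l m (subst (_< m + m) (sym e) (+-mono-< (m%n<n a m) (m%n<n b m)))

  -- Weighted words and potentials

  prodTo : ℕ → (ℕ → ℕ) → ℕ
  prodTo zero    F = 1
  prodTo (suc n) F = F n * prodTo n F

  prev : {A : Set} → ℕ → List A → Maybe A
  prev k       []      = nothing
  prev zero    (a ∷ P) = just a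
  prev (suc k) (a ∷ P) = prev k P

  -- Words grow at the head; the letter added at step n may depend on the whole word built so far.
  module Process {A : Set} (wt : A → ℕ) (cands : ℕ → List A → List A) where

    words : ℕ → List (List A)
    words zero    = [] ∷ []
    words (suc n) = concatMap (λ P → map (_∷ P) (cands n P)) (words n)

    weight : List A → ℕ
    weight []      = 1
    weight (a ∷ P) = wt a * weight P

    words-suc⁺ : ∀ n {P a} → P ∈ words n → a ∈ cands n P → (a ∷ P) ∈ words (suc n)
    words-suc⁺ n p q = concatMap-∈⁺ p (∈-map⁺ _ q)

    words-suc⁻ : ∀ n {P'} → P' ∈ words (suc n) → ∃ λ P → ∃ λ a → P' ≡ a ∷ P × P ∈ words n × a ∈ cands n P
    words-suc⁻ n p with concatMap-∈⁻ _ (words n) p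
    ... | P , P∈ , q with ∈-map⁻ _ q
    ...   | a , a∈ , refl = P , a , refl , P∈ , a∈

    words-length : ∀ n {P} → P ∈ words n → length P ≡ n
    words-length zero    (here refl) = refl
    words-length (suc n) p with words-suc⁻ n p
    ... | P , a , refl , P∈ , _ = cong suc (words-length n P∈)

    -- A letter without a letter s steps before it is treated as having a virtual predecessor of potential H.
    module Bound (U H' s' N : ℕ) (h : ℕ → A → ℕ) (num den : ℕ → ℕ) where
      private
        H = suc H'
        s = suc s'

      -- A letter is constrained by the letter `s` steps back, so the potential must remember a
      -- whole window: it is the product over the `k` most recent letters, with `H` standing for
      -- missing ones.
      pot : ℕ → List A → ℕ
      pot zero    P       = 1
      pot (suc k) []      = H * pot k []
      pot (suc k) (a ∷ P) = h (length P) a * pot k P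

      potAt : ℕ → List A → ℕ
      potAt k       []      = H
      potAt zero    (a ∷ P) = h (length P) a
      potAt (suc k) (a ∷ P) = potAt k P

      pot-split : ∀ k P → pot (suc k) P ≡ pot k P * potAt k P
      pot-split zero    []      = *-comm H 1
      pot-split zero    (a ∷ P) = *-comm (h (length P) a) 1
      pot-split (suc k) []      = trans (cong (H *_) (pot-split k [])) (sym (*-assoc H (pot k []) _))
      pot-split (suc k) (a ∷ P) = trans (cong (h (length P) a *_) (pot-split k P)) (sym (*-assoc (h (length P) a) _ _))

      pot-[] : ∀ k → pot k [] ≡ H ^ k
      pot-[] zero    = refl
      pot-[] (suc k) = cong (H *_) (pot-[] k)

      pot-lower : ∀ k P → (∀ i → i < length P → length P ≤ i + k → ∀ a → H ≤ h i a) → H ^ k ≤ pot k P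
      pot-lower zero    P       q = ≤-refl
      pot-lower (suc k) []      q = *-monoʳ-≤ H (pot-lower k [] (λ i ()))
      pot-lower (suc k) (a ∷ P) q = *-mono-≤ (q (length P) ≤-refl (≤-trans (m≤m+n _ k) (≤-reflexive (sym (+-suc (length P) k)))) a)
        (pot-lower k P (λ i i< le → q i (m<n⇒m<1+n i<) (≤-trans (s≤s le) (≤-reflexive (sym (+-suc i k))))))

      Z : ℕ → ℕ
      Z n = sumL (λ P → weight P * pot s P) (words n)

      module _ (cond : ∀ n → n < N → ∀ P → P ∈ words n → den n * sumL (λ a → wt a * h n a) (cands n P) ≤ num n * (U * potAt s' P)) where

        -- When a letter is appended, its potential enters the window of length `s` and the
        -- potential of the letter `s` steps back leaves it. The hypothesis `cond` compares exactly
        -- these two.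
        Z-step : ∀ n → n < N → den n * Z (suc n) ≤ num n * U * Z n
        Z-step n n<N = begin
          den n * Z (suc n)
            ≡⟨ cong (den n *_) (sumL-concatMap _ _ (words n)) ⟩
          den n * sumL (λ P → sumL (λ P' → weight P' * pot s P') (map (_∷ P) (cands n P))) (words n)
            ≡⟨ sumL-*ˡ (den n) _ (words n) ⟨
          sumL (λ P → den n * sumL (λ P' → weight P' * pot s P') (map (_∷ P) (cands n P))) (words n)
            ≤⟨ sumL-mono (words n) one ⟩
          sumL (λ P → num n * U * (weight P * pot s P)) (words n)
            ≡⟨ sumL-*ˡ (num n * U) _ (words n) ⟩
          num n * U * Z n ∎
          where
          open ≤-Reasoning
          one : ∀ P → P ∈ words n → den n * sumL (λ P' → weight P' * pot s P') (map (_∷ P) (cands n P)) ≤ num n * U * (weight P * pot s P)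
          one P P∈ = begin
            den n * sumL (λ P' → weight P' * pot s P') (map (_∷ P) (cands n P))
              ≡⟨ cong (den n *_) (sumL-map _ (_∷ P) (cands n P)) ⟩
            den n * sumL (λ a → (wt a * weight P) * (h (length P) a * pot s' P)) (cands n P)
              ≡⟨ cong (den n *_) (sumL-cong (cands n P) (λ a _ → trans (cong (λ z → (wt a * weight P) * (h z a * pot s' P)) (words-length n P∈))
                   (lem₁ (wt a) (weight P) (h n a) (pot s' P)))) ⟩
            den n * sumL (λ a → (weight P * pot s' P) * (wt a * h n a)) (cands n P)
              ≡⟨ cong (den n *_) (sumL-*ˡ (weight P * pot s' P) _ (cands n P)) ⟩
            den n * ((weight P * pot s' P) * sumL (λ a → wt a * h n a) (cands n P))
              ≡⟨ lem₂ (den n) (weight P * pot s' P) _ ⟩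
            (weight P * pot s' P) * (den n * sumL (λ a → wt a * h n a) (cands n P))
              ≤⟨ *-monoʳ-≤ (weight P * pot s' P) (cond n n<N P P∈) ⟩
            (weight P * pot s' P) * (num n * (U * potAt s' P))
              ≡⟨ lem₃ (weight P) (pot s' P) (num n) U (potAt s' P) ⟩
            num n * U * (weight P * (pot s' P * potAt s' P))
              ≡⟨ cong (λ z → num n * U * (weight P * z)) (pot-split s' P) ⟨
            num n * U * (weight P * pot s P) ∎
            where
            lem₁ : ∀ a b c d → (a * b) * (c * d) ≡ (b * d) * (a * c)
            lem₁ = solve-∀
            lem₂ : ∀ a b c → a * (b * c) ≡ b * (a * c)
            lem₂ = solve-∀
            lem₃ : ∀ a b c d e → (a * b) * (c * (d * e)) ≡ c * d * (a * (b * e))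
            lem₃ = solve-∀

        Z-bound : ∀ n → n ≤ N → prodTo n den * Z n ≤ prodTo n num * (U ^ n * H ^ s)
        Z-bound zero    _   = ≤-reflexive (cong (1 *_) (trans (+-identityʳ _) (cong (λ z → 1 * z) (pot-[] s))))
        Z-bound (suc n) n<N = begin
          den n * prodTo n den * Z (suc n)        ≡⟨ lem₁ (den n) (prodTo n den) (Z (suc n)) ⟩
          prodTo n den * (den n * Z (suc n))      ≤⟨ *-monoʳ-≤ (prodTo n den) (Z-step n n<N) ⟩
          prodTo n den * (num n * U * Z n)        ≡⟨ lem₂ (prodTo n den) (num n * U) (Z n) ⟩
          num n * U * (prodTo n den * Z n)        ≤⟨ *-monoʳ-≤ (num n * U) (Z-bound n (<⇒≤ n<N)) ⟩
          num n * U * (prodTo n num * (U ^ n * H ^ s)) ≡⟨ lem₃ (num n) U (prodTo n num) (U ^ n) (H ^ s) ⟩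
          num n * prodTo n num * (U * U ^ n * H ^ s) ∎
          where
          open ≤-Reasoning
          lem₁ : ∀ a b c → a * b * c ≡ b * (a * c)
          lem₁ = solve-∀
          lem₂ : ∀ a b c → a * (b * c) ≡ b * (a * c)
          lem₂ = solve-∀
          lem₃ : ∀ a b c d e → a * b * (c * (d * e)) ≡ a * c * (b * d * e)
          lem₃ = solve-∀

        -- The final window is worth at least `H ^ s`, which is exactly what the empty word was
        -- charged at the start, so this factor cancels.
        words-bound : (∀ i → N ≤ i + s → ∀ a → H ≤ h i a) → prodTo N den * sumL weight (words N) ≤ prodTo N num * U ^ N
        words-bound big = *-cancelʳ-≤ _ _ (H ^ s) ⦃ m^n≢0 H s ⦄ (begin
          prodTo N den * sumL weight (words N) * H ^ s   ≡⟨ trans (*-assoc (prodTo N den) _ _) (cong (prodTo N den *_) (sym (sumL-*ʳ (H ^ s) weight (words N)))) ⟩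
          prodTo N den * sumL (λ P → weight P * H ^ s) (words N)
            ≤⟨ *-monoʳ-≤ (prodTo N den) (sumL-mono (words N) (λ P P∈ → *-monoʳ-≤ (weight P)
                 (pot-lower s P (λ i _ le → big i (subst (_≤ i + s) (words-length N P∈) le))))) ⟩
          prodTo N den * Z N                             ≤⟨ Z-bound N ≤-refl ⟩
          prodTo N num * (U ^ N * H ^ s)                 ≡⟨ *-assoc (prodTo N num) _ _ ⟨
          prodTo N num * U ^ N * H ^ s ∎)
          where open ≤-Reasoning

  Pair : Set
  Pair = ℕ × ℕ

  letters : ℕ → List ℕ
  letters Q = map suc (upTo Q)

  alph : ℕ → List Pair
  alph Q = cartesianProduct (letters Q) (letters Q)

  pairTotal : Pair → ℕ
  pairTotal (u , v) = u + v

  -- (31/50)^(u + v), cleared of denominators.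
  wtQ : ℕ → Pair → ℕ
  wtQ Q a = 31 ^ pairTotal a * 50 ^ (2 * Q ∸ pairTotal a)

  imp : Bool → Bool → Bool
  imp true  b = b
  imp false b = true

  -- If the letter at place `s` is 1, subadditivity gives `w (i + s) ≤ suc (w i)`. Applied on the
  -- left it bounds the new `u` by the old `u'`; applied to the mirrored places, where the order is
  -- reversed, it bounds the old `v'` by the new `v`.
  chain : Maybe Pair → Pair → Bool
  chain nothing          _       = true
  chain (just (u' , v')) (u , v) = (u ≤ᵇ suc u') ∧ (v' ≤ᵇ suc v)

  -- `r₁` and `r₂` record that the left or the right place of the pair comes before the first letter
  -- 1, which excludes the letter 1 there.
  okPair : ℕ → Bool → Bool → Maybe Pair → Pair → Bool
  okPair Q r₁ r₂ mp (u , v) = (Q ≤ᵇ u + v) ∧ (imp r₁ (2 ≤ᵇ u) ∧ (imp r₂ (2 ≤ᵇ v) ∧ chain mp (u , v)))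

  pairSum : ℕ → Bool → Bool → Maybe Pair → (Pair → ℕ) → ℕ
  pairSum Q r₁ r₂ mp h = sumL (λ a → wtQ Q a * h a) (filterᵇ (okPair Q r₁ r₂ mp) (alph Q))

  -- pot true is a supersolution of the transfer inequality for pairs that have a successor in the chain;
  -- a pair without successor carries the constant potential H.
  record Potential (Q : ℕ) : Set where
    field
      tab : Pair → ℕ
      H'  : ℕ
    H = suc H'
    pot : Bool → Pair → ℕ
    pot b a = if b then tab a else H
    U = 50 ^ (2 * Q)
    field
      chained : ∀ b a' → a' ∈ alph Q → pairSum Q false false (just a') (pot b) ≤ U * tab a'
      -- Pairs without predecessor: an unrestricted pair may lose a factor 7/6, a pair with one
      -- restricted letter gains 6/7, and a pair with two gains (6/7)². The common ratio allows
      -- losses to be offset against gains by counting exponents.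
      free    : ∀ b → 6 * pairSum Q false false nothing (pot b) ≤ 7 * (U * H)
      restr₁  : ∀ b → 7 * pairSum Q true false nothing (pot b) ≤ 6 * (U * H)
      restr₂  : ∀ b → 49 * pairSum Q true true nothing (pot b) ≤ 36 * (U * H)

  -- The suprema of Mᵗ 1 over t ≥ 1, scaled by 10⁴ and slightly enlarged, where M is the weighted transfer matrix of
  -- the chain condition.
  tab₃ : Pair → ℕ
  tab₃ (1 , 2) = 8643
  tab₃ (1 , 3) = 6259
  tab₃ (2 , 3) = 7744
  tab₃ (3 , 3) = 7744
  tab₃ _       = 11607

  tab₄ : Pair → ℕ
  tab₄ (1 , 3) = 5360
  tab₄ (1 , 4) = 3881
  tab₄ (2 , 2) = 8677
  tab₄ (2 , 3) = 7198
  tab₄ (2 , 4) = 4802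
  tab₄ (3 , 3) = 8338
  tab₄ (3 , 4) = 5374
  tab₄ (4 , 3) = 8338
  tab₄ (4 , 4) = 5374
  tab₄ _       = 10733

  module Check (Q : ℕ) (tab : Pair → ℕ) (H' : ℕ) where
    U = 50 ^ (2 * Q)
    pt : Bool → Pair → ℕ
    pt b a = if b then tab a else suc H'
    chainedᵇ : Bool → List Pair → Bool
    chainedᵇ b []       = true
    chainedᵇ b (a ∷ as) = (pairSum Q false false (just a) (pt b) ≤ᵇ U * tab a) ∧ chainedᵇ b as
    ∧-left : ∀ {a b} → a ∧ b ≡ true → a ≡ true
    ∧-left {true} _ = refl
    ∧-right : ∀ {a b} → a ∧ b ≡ true → b ≡ true
    ∧-right {true} e = e
    chained-sound : ∀ b as → chainedᵇ b as ≡ true → ∀ a → a ∈ as → pairSum Q false false (just a) (pt b) ≤ U * tab a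
    chained-sound b (a ∷ as) e .a (here refl) = ≤ᵇ-sound _ _ (∧-left e)
    chained-sound b (a ∷ as) e a' (there p)   = chained-sound b as (∧-right {a = pairSum Q false false (just a) (pt b) ≤ᵇ U * tab a} e) a' p

    make : (∀ b → chainedᵇ b (alph Q) ≡ true) → (∀ b → (6 * pairSum Q false false nothing (pt b) ≤ᵇ 7 * (U * suc H')) ≡ true) →
      (∀ b → (7 * pairSum Q true false nothing (pt b) ≤ᵇ 6 * (U * suc H')) ≡ true) →
      (∀ b → (49 * pairSum Q true true nothing (pt b) ≤ᵇ 36 * (U * suc H')) ≡ true) → Potential Q
    make c f r₁ r₂ = record { tab = tab ; H' = H' ; chained = λ b → chained-sound b (alph Q) (c b)
      ; free = λ b → ≤ᵇ-sound _ _ (f b) ; restr₁ = λ b → ≤ᵇ-sound _ _ (r₁ b) ; restr₂ = λ b → ≤ᵇ-sound _ _ (r₂ b) }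

  onBool : {P : Bool → Set} → P true → P false → ∀ b → P b
  onBool t f true  = t
  onBool t f false = f

  -- For `Q` = 3 and `Q` = 4 the pairs of sum at least `Q` weigh about 1.16 and 1.07 relative to
  -- `U`, so a constant potential would violate `chained`. The tables make it finitely many
  -- numerical inequalities, which hold by evaluation.
  potential₃ : Potential 3
  potential₃ = Check.make 3 tab₃ 9999 (onBool refl refl) (onBool refl refl) (onBool refl refl) (onBool refl refl)

  potential₄ : Potential 4
  potential₄ = Check.make 4 tab₄ 9999 (onBool refl refl) (onBool refl refl) (onBool refl refl) (onBool refl refl)

  -- From here on the pairs weigh less than 1 even without the chain, so a constant potential
  -- suffices.
  potential₅ : Potential 5
  potential₅ = Check.make 5 (λ _ → 1) 0 (onBool refl refl) (onBool refl refl) (onBool refl refl) (onBool refl refl)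

  potential₆ : Potential 6
  potential₆ = Check.make 6 (λ _ → 1) 0 (onBool refl refl) (onBool refl refl) (onBool refl refl) (onBool refl refl)

  sumL-filterᵇ : {A : Set} (f : A → ℕ) (p : A → Bool) (xs : List A) → sumL f (filterᵇ p xs) ≡ sumL (λ x → if p x then f x else 0) xs
  sumL-filterᵇ f p []       = refl
  sumL-filterᵇ f p (x ∷ xs) with p x
  ... | true  = cong (f x +_) (sumL-filterᵇ f p xs)
  ... | false = sumL-filterᵇ f p xs

  sumL-cartesianProduct : {A B : Set} (f : A × B → ℕ) (xs : List A) (ys : List B) →
    sumL f (cartesianProduct xs ys) ≡ sumL (λ x → sumL (λ y → f (x , y)) ys) xs
  sumL-cartesianProduct f []       ys = refl
  sumL-cartesianProduct f (x ∷ xs) ys =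
    trans (sumL-++ f (map (x ,_) ys) _) (cong₂ _+_ (sumL-map f (x ,_) ys) (sumL-cartesianProduct f xs ys))

  sumL-letters : ∀ Q (F : ℕ → ℕ) → sumL F (letters Q) ≡ sumTo Q (λ i → F (suc i))
  sumL-letters Q F = trans (sumL-map F suc (upTo Q)) (sumL-upTo Q (F ∘ suc))

  -- The geometric series of ratio 31/50 with denominators cleared; 19 is 50 - 31.
  geometric : ∀ c k n → 19 * sumTo n (λ j → 31 ^ (c + j) * 50 ^ (k + n ∸ j)) + 50 * (31 ^ (c + n) * 50 ^ k) ≡ 50 * (31 ^ c * 50 ^ (k + n))
  geometric c k zero rewrite +-identityʳ c | +-identityʳ k = refl
  geometric c k (suc n) = begin
    19 * (sumTo n (λ j → 31 ^ (c + j) * 50 ^ (k + suc n ∸ j)) + 31 ^ (c + n) * 50 ^ (k + suc n ∸ n)) + 50 * (31 ^ (c + suc n) * 50 ^ k)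
      ≡⟨ cong₂ (λ x y → 19 * x + 50 * (y * 50 ^ k))
           (cong₂ _+_ (sumTo-cong n (λ j _ → cong (λ z → 31 ^ (c + j) * 50 ^ (z ∸ j)) (+-suc k n)))
              (cong (λ z → 31 ^ (c + n) * 50 ^ z) (trans (cong (_∸ n) (+-suc k n)) (m+n∸n≡m (suc k) n))))
           (cong (31 ^_) (+-suc c n)) ⟩
    19 * (S + x * (50 * y)) + 50 * (31 * x * y)  ≡⟨ lem S x y ⟩
    19 * S + 50 * (x * (50 * y))                 ≡⟨ geometric c (suc k) n ⟩
    50 * (31 ^ c * 50 ^ (suc k + n))             ≡⟨ cong (λ z → 50 * (31 ^ c * 50 ^ z)) {x = k + suc n} {y = suc k + n} (+-suc k n) ⟨
    50 * (31 ^ c * 50 ^ (k + suc n)) ∎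
    where
    open ≡-Reasoning
    S = sumTo n (λ j → 31 ^ (c + j) * 50 ^ (suc k + n ∸ j))
    x = 31 ^ (c + n)
    y = 50 ^ k
    lem : ∀ S x y → 19 * (S + x * (50 * y)) + 50 * (31 * x * y) ≡ 19 * S + 50 * (x * (50 * y))
    lem = solve-∀

  sumTo-const : ∀ n c → sumTo n (λ _ → c) ≡ n * c
  sumTo-const zero    c = refl
  sumTo-const (suc n) c = trans (cong (_+ c) (sumTo-const n c)) (+-comm _ c)

  sumTo-*ˡ : ∀ n c (F : ℕ → ℕ) → sumTo n (λ i → c * F i) ≡ c * sumTo n F
  sumTo-*ˡ zero    c F = sym (*-zeroʳ c)
  sumTo-*ˡ (suc n) c F = trans (cong (_+ c * F n) (sumTo-*ˡ n c F)) (sym (*-distribˡ-+ c _ (F n)))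

  -- Total weight of the pairs for a large alphabet.

  module LargeAlphabet (q : ℕ) where
    Q = suc q

    entry : ℕ → ℕ → ℕ
    entry i j = if Q ≤ᵇ suc i + suc j then wtQ Q (suc i , suc j) else 0

    -- In the row of the left letter `suc i` the admissible sums are the consecutive numbers from
    -- `Q` on, a piece of a geometric series starting at (31/50)^Q. Only the row of the letter `Q`
    -- starts at the sum `suc Q`, whence the separate `lastRow`.
    row : ∀ i → i < q → 19 * sumTo Q (entry i) ≤ 50 * (31 ^ Q * 50 ^ Q)
    row i i<q with m≤n⇒∃[o]m+o≡n i<q
    ... | a , refl = begin
      19 * sumTo Q (entry i)  ≡⟨ cong (19 *_) (trans (cong (λ z → sumTo z (entry i)) Q≡) (sumTo-add a (suc (suc i)) (entry i))) ⟩
      19 * (sumTo a (entry i) + sumTo (suc (suc i)) (λ j → entry i (a + j)))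
        ≡⟨ cong (19 *_) (cong₂ _+_ (trans (sumTo-cong a small) (sumTo-zero a)) (sumTo-cong (suc (suc i)) large)) ⟩
      19 * sumTo (suc (suc i)) (λ j → 31 ^ (Q + j) * 50 ^ (a + suc (suc i) ∸ j))
        ≤⟨ m≤m+n _ _ ⟩
      _ ≡⟨ geometric Q a (suc (suc i)) ⟩
      50 * (31 ^ Q * 50 ^ (a + suc (suc i)))  ≡⟨ cong (λ z → 50 * (31 ^ Q * 50 ^ z)) {x = Q} {y = a + suc (suc i)} Q≡ ⟨
      50 * (31 ^ Q * 50 ^ Q) ∎
      where
      open ≤-Reasoning
      Q≡ : suc (suc i + a) ≡ a + suc (suc i)
      Q≡ = +-comm (suc (suc i)) a
      small : ∀ j → j < a → entry i j ≡ 0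
      small j j<a rewrite ≤ᵇ-false {suc (suc i + a)} {suc i + suc j} (s≤s (+-monoʳ-≤ (suc i) j<a)) = refl
      tot : ∀ j → suc i + suc (a + j) ≡ suc (suc i + a) + j
      tot j = lem i a j
        where
        lem : ∀ i a j → suc i + suc (a + j) ≡ suc (suc i + a) + j
        lem = solve-∀
      large : ∀ j → j < suc (suc i) → entry i (a + j) ≡ 31 ^ (Q + j) * 50 ^ (a + suc (suc i) ∸ j)
      large j j< rewrite ≤ᵇ-true {suc (suc i + a)} {suc i + suc (a + j)} (≤-trans (m≤m+n _ j) (≤-reflexive (sym (tot j)))) =
        cong₂ (λ x y → 31 ^ x * 50 ^ y) (tot j)
          (trans (cong (2 * Q ∸_) (tot j)) (trans (sym (∸-+-assoc (2 * Q) Q j)) (cong (_∸ j) (trans (m+n∸m≡n Q (Q + 0)) (trans (+-identityʳ Q) Q≡)))))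

    lastRow : 19 * sumTo Q (entry q) ≤ 50 * (31 ^ suc Q * 50 ^ q)
    lastRow = begin
      19 * (sumTo q (entry q) + entry q q)  ≡⟨ cong (19 *_) (cong₂ _+_ (sumTo-cong q val) last) ⟩
      19 * (sumTo q (λ j → 31 ^ (suc Q + j) * 50 ^ (0 + q ∸ j)) + 31 ^ (suc Q + q) * 1) ≡⟨ *-distribˡ-+ 19 (sumTo q (λ j → 31 ^ (suc Q + j) * 50 ^ (0 + q ∸ j))) _ ⟩
      19 * sumTo q (λ j → 31 ^ (suc Q + j) * 50 ^ (0 + q ∸ j)) + 19 * (31 ^ (suc Q + q) * 1)
        ≤⟨ +-monoʳ-≤ (19 * sumTo q (λ j → 31 ^ (suc Q + j) * 50 ^ (0 + q ∸ j))) (*-monoˡ-≤ (31 ^ (suc Q + q) * 1) (m≤m+n 19 31)) ⟩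
      19 * sumTo q (λ j → 31 ^ (suc Q + j) * 50 ^ (0 + q ∸ j)) + 50 * (31 ^ (suc Q + q) * 1)
        ≡⟨ geometric (suc Q) 0 q ⟩
      50 * (31 ^ suc Q * 50 ^ q) ∎
      where
      open ≤-Reasoning
      tot : ∀ j → suc q + suc j ≡ suc Q + j
      tot j = +-suc (suc q) j
      twice : 2 * Q ≡ suc Q + q
      twice = lem q
        where
        lem : ∀ q → 2 * suc q ≡ suc (suc q) + q
        lem = solve-∀
      val : ∀ j → j < q → entry q j ≡ 31 ^ (suc Q + j) * 50 ^ (q ∸ j)
      val j _ rewrite ≤ᵇ-true {Q} {suc q + suc j} (m≤m+n (suc q) (suc j)) =
        cong₂ (λ x y → 31 ^ x * 50 ^ y) (tot j)
          (trans (cong₂ _∸_ twice (tot j)) ([m+n]∸[m+o]≡n∸o (suc Q) q j))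
      last : entry q q ≡ 31 ^ (suc Q + q) * 1
      last rewrite ≤ᵇ-true {Q} {suc q + suc q} (m≤m+n (suc q) (suc q)) =
        cong₂ (λ x y → 31 ^ x * y) (tot q) (cong (50 ^_) (trans (cong₂ _∸_ twice (tot q)) (n∸n≡0 (suc Q + q))))

    all-pairs : 19 * sumL (wtQ Q) (filterᵇ (λ a → Q ≤ᵇ pairTotal a) (alph Q)) ≤ (50 * q) * (31 ^ Q * 50 ^ Q) + 50 * (31 ^ suc Q * 50 ^ q)
    all-pairs = begin
      19 * sumL (wtQ Q) (filterᵇ (λ a → Q ≤ᵇ pairTotal a) (alph Q))
        ≡⟨ cong (19 *_) (trans (sumL-filterᵇ (wtQ Q) _ (alph Q)) (trans (sumL-cartesianProduct (λ a → if Q ≤ᵇ pairTotal a then wtQ Q a else 0) (letters Q) (letters Q))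
            (trans (sumL-letters Q _) (sumTo-cong Q (λ i _ → sumL-letters Q _))))) ⟩
      19 * sumTo Q (λ i → sumTo Q (entry i))
        ≡⟨ sumTo-*ˡ Q 19 (λ i → sumTo Q (entry i)) ⟨
      sumTo q (λ i → 19 * sumTo Q (entry i)) + 19 * sumTo Q (entry q)
        ≤⟨ +-mono-≤ (sumTo-mono q row) lastRow ⟩
      sumTo q (λ _ → 50 * (31 ^ Q * 50 ^ Q)) + 50 * (31 ^ suc Q * 50 ^ q)
        ≡⟨ cong (_+ 50 * (31 ^ suc Q * 50 ^ q)) (trans (sumTo-const q _) (lem q (31 ^ Q * 50 ^ Q))) ⟩
      (50 * q) * (31 ^ Q * 50 ^ Q) + 50 * (31 ^ suc Q * 50 ^ q) ∎
      where
      open ≤-Reasoning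
      lem : ∀ q x → q * (50 * x) ≡ 50 * q * x
      lem = solve-∀

  -- 684 is 19 · 36, where 19 comes from the geometric series and 36/49 is the value (6/7)² demanded
  -- by `restr₂`. The analogous inequality with exponent 6 is false (49 · 281 · (31/50)^6 is about
  -- 782), so the induction starts at 7 and smaller alphabets are evaluated directly.
  polynomial-vs-geometric : ∀ k → (49 * (50 * (6 + k) + 31)) * 31 ^ (7 + k) ≤ 684 * 50 ^ (7 + k)
  polynomial-vs-geometric zero    = ≤ᵇ-sound (49 * (50 * 6 + 31) * 31 ^ 7) (684 * 50 ^ 7) refl
  polynomial-vs-geometric (suc k) = begin
    (49 * (50 * (7 + k) + 31)) * (31 * 31 ^ (7 + k))  ≡⟨ lem₁ k (31 ^ (7 + k)) ⟩
    (49 * (31 * (50 * (7 + k) + 31))) * 31 ^ (7 + k)  ≤⟨ *-monoˡ-≤ (31 ^ (7 + k)) (*-monoʳ-≤ 49 step) ⟩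
    (49 * (50 * (50 * (6 + k) + 31))) * 31 ^ (7 + k)  ≡⟨ lem₂ (50 * (6 + k) + 31) (31 ^ (7 + k)) ⟩
    50 * ((49 * (50 * (6 + k) + 31)) * 31 ^ (7 + k))  ≤⟨ *-monoʳ-≤ 50 (polynomial-vs-geometric k) ⟩
    50 * (684 * 50 ^ (7 + k))                         ≡⟨ lem₃ (50 ^ (7 + k)) ⟩
    684 * (50 * 50 ^ (7 + k)) ∎
    where
    open ≤-Reasoning
    lem₁ : ∀ k x → (49 * (50 * (7 + k) + 31)) * (31 * x) ≡ (49 * (31 * (50 * (7 + k) + 31))) * x
    lem₁ = solve-∀
    lem₂ : ∀ y x → (49 * (50 * y)) * x ≡ 50 * ((49 * y) * x)
    lem₂ = solve-∀
    lem₃ : ∀ x → 50 * (684 * x) ≡ 684 * (50 * x)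
    lem₃ = solve-∀
    step : 31 * (50 * (7 + k) + 31) ≤ 50 * (50 * (6 + k) + 31)
    step = ≤-trans (m≤m+n _ (950 * k + 4739)) (≤-reflexive (lem k))
      where
      lem : ∀ k → 31 * (50 * (7 + k) + 31) + (950 * k + 4739) ≡ 50 * (50 * (6 + k) + 31)
      lem = solve-∀

  -- The total weight (6/7)² meets the strongest of the four conditions, `restr₂`, and the others
  -- are weaker; restricting the pairs only lowers the sum.
  constantPotential : ∀ Q → 49 * sumL (wtQ Q) (filterᵇ (λ a → Q ≤ᵇ pairTotal a) (alph Q)) ≤ 36 * 50 ^ (2 * Q) → Potential Q
  constantPotential Q all = record { tab = λ _ → 1 ; H' = 0
    ; chained = λ b a' _ → small b false false (just a')
    ; free    = λ b → ≤-trans (*-monoʳ-≤ 6 (small b false false nothing)) (*-monoˡ-≤ (U * 1) (n≤1+n 6))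
    ; restr₁  = λ b → *-cancelˡ-≤ 6 (seven b true false nothing)
    ; restr₂  = λ b → ≤-trans (pairs b true true nothing) (*-monoʳ-≤ 36 (≤-reflexive (sym (*-identityʳ U)))) }
    where
    open ≤-Reasoning
    U = 50 ^ (2 * Q)
    pt : Bool → Pair → ℕ
    pt b a = if b then 1 else 1
    pt1 : ∀ b a → pt b a ≡ 1
    pt1 true  a = refl
    pt1 false a = refl
    pairs : ∀ b r₁ r₂ mp → 49 * pairSum Q r₁ r₂ mp (pt b) ≤ 36 * U
    pairs b r₁ r₂ mp = ≤-trans (*-monoʳ-≤ 49 (≤-trans
        (≤-reflexive (sumL-cong (filterᵇ (okPair Q r₁ r₂ mp) (alph Q)) (λ a _ → trans (cong (wtQ Q a *_) (pt1 b a)) (*-identityʳ _))))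
        (sumL-filterᵇ-mono (wtQ Q) {okPair Q r₁ r₂ mp} {λ a → Q ≤ᵇ pairTotal a} (alph Q) (λ { (u , v) _ e → Check.∧-left Q (λ _ → 1) 0 e })))) all
    small : ∀ b r₁ r₂ mp → pairSum Q r₁ r₂ mp (pt b) ≤ U * 1
    small b r₁ r₂ mp = ≤-trans (*-cancelˡ-≤ 49 (≤-trans (pairs b r₁ r₂ mp) (*-monoˡ-≤ U (≤ᵇ-sound 36 49 refl)))) (≤-reflexive (sym (*-identityʳ U)))
    seven : ∀ b r₁ r₂ mp → 6 * (7 * pairSum Q r₁ r₂ mp (pt b)) ≤ 6 * (6 * (U * 1))
    seven b r₁ r₂ mp = begin
      6 * (7 * p)      ≡⟨ *-assoc 6 7 p ⟨
      42 * p           ≤⟨ *-monoˡ-≤ p (≤ᵇ-sound 42 49 refl) ⟩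
      49 * p           ≤⟨ pairs b r₁ r₂ mp ⟩
      36 * U           ≡⟨ *-assoc 6 6 U ⟩
      6 * (6 * U)      ≡⟨ cong (λ z → 6 * (6 * z)) (*-identityʳ U) ⟨
      6 * (6 * (U * 1)) ∎
      where p = pairSum Q r₁ r₂ mp (pt b)

  potential₇ : ∀ k → Potential (7 + k)
  potential₇ k = constantPotential (7 + k) (bound (6 + k) (polynomial-vs-geometric k))
    where
    open ≤-Reasoning
    bound : ∀ q → (49 * (50 * q + 31)) * 31 ^ suc q ≤ 684 * 50 ^ suc q →
      49 * sumL (wtQ (suc q)) (filterᵇ (λ a → suc q ≤ᵇ pairTotal a) (alph (suc q))) ≤ 36 * 50 ^ (2 * suc q)
    bound q h = *-cancelˡ-≤ 19 (begin
      19 * (49 * S)                      ≡⟨ lem₁ S ⟩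
      49 * (19 * S)                      ≤⟨ *-monoʳ-≤ 49 (LargeAlphabet.all-pairs q) ⟩
      49 * ((50 * q) * (31 ^ Q * 50 ^ Q) + 50 * (31 * 31 ^ Q * 50 ^ q))  ≡⟨ lem₂ q (31 ^ Q) (50 ^ q) ⟩
      ((49 * (50 * q + 31)) * 31 ^ Q) * 50 ^ Q ≤⟨ *-monoˡ-≤ (50 ^ Q) h ⟩
      (684 * 50 ^ Q) * 50 ^ Q            ≡⟨ lem₃ (50 ^ Q) ⟩
      19 * (36 * (50 ^ Q * 50 ^ Q))      ≡⟨ cong (λ z → 19 * (36 * z)) (trans (sym (^-distribˡ-+-* 50 Q Q)) (cong (λ z → 50 ^ (Q + z)) (sym (+-identityʳ Q)))) ⟩
      19 * (36 * 50 ^ (2 * Q)) ∎)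
      where
      Q = suc q
      S = sumL (wtQ Q) (filterᵇ (λ a → Q ≤ᵇ pairTotal a) (alph Q))
      lem₁ : ∀ S → 19 * (49 * S) ≡ 49 * (19 * S)
      lem₁ = solve-∀
      lem₂ : ∀ n x y → 49 * ((50 * n) * (x * (50 * y)) + 50 * (31 * x * y)) ≡ ((49 * (50 * n + 31)) * x) * (50 * y)
      lem₂ = solve-∀
      lem₃ : ∀ x → (684 * x) * x ≡ 19 * (36 * (x * x))
      lem₃ = solve-∀

  potential : ∀ k → Potential (3 + k)
  potential 0 = potential₃
  potential 1 = potential₄
  potential 2 = potential₅
  potential 3 = potential₆
  potential (suc (suc (suc (suc k)))) = potential₇ k

  -- Reflected pairs of letters

  half-cases : ∀ n → (n ≡ ⌊ n /2⌋ + ⌊ n /2⌋) ⊎ (n ≡ suc (⌊ n /2⌋ + ⌊ n /2⌋))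
  half-cases 0 = inj₁ refl
  half-cases 1 = inj₂ refl
  half-cases (suc (suc n)) with half-cases n
  ... | inj₁ e = inj₁ (cong suc (trans (cong suc e) (sym (+-suc _ _))))
  ... | inj₂ e = inj₂ (cong suc (cong suc (trans e (sym (+-suc _ _)))))

  -- The letter fixed by the reflection i ↦ suc l₀ ∸ i, if there is one.
  midAt : (F : ℕ → ℕ) (l₀ N : ℕ) → (l₀ ≡ N + N) ⊎ (l₀ ≡ suc (N + N)) → ℕ
  midAt F l₀ N (inj₁ _) = 0
  midAt F l₀ N (inj₂ _) = F (suc N)

  mid : (ℕ → ℕ) → ℕ → ℕ
  mid F l₀ = midAt F l₀ ⌊ l₀ /2⌋ (half-cases l₀)

  mirror-even : ∀ N n → n < N → suc (N + N) ∸ suc n ≡ suc (N + (N ∸ suc n))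
  mirror-even N n n<N = trans (+-∸-assoc N (<⇒≤ n<N)) (trans (cong (N +_) (+-∸-assoc 1 {N} n<N)) (+-suc N _))

  mirror-odd : ∀ N n → n < N → suc (suc (N + N)) ∸ suc n ≡ suc (N + suc (N ∸ suc n))
  mirror-odd N n n<N = trans (+-∸-assoc 1 {N + N} (≤-trans (<⇒≤ n<N) (m≤m+n N N)))
    (cong suc (trans (+-∸-assoc N (<⇒≤ n<N)) (cong (N +_) (+-∸-assoc 1 {N} n<N))))

  fold-sum : ∀ l₀ (F : ℕ → ℕ) →
    sumTo l₀ (λ i → F (suc i)) ≡ sumTo ⌊ l₀ /2⌋ (λ n → F (suc n) + F (suc l₀ ∸ suc n)) + mid F l₀
  fold-sum l₀ F = go l₀ ⌊ l₀ /2⌋ (half-cases l₀)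
    where
    open ≡-Reasoning
    lem : ∀ a b c → a + (b + c) ≡ a + c + b
    lem = solve-∀
    go : ∀ l₀ N c → sumTo l₀ (λ i → F (suc i)) ≡ sumTo N (λ n → F (suc n) + F (suc l₀ ∸ suc n)) + midAt F l₀ N c
    go .(N + N) N (inj₁ refl) = begin
      sumTo (N + N) (F ∘ suc)                     ≡⟨ sumTo-add N N (F ∘ suc) ⟩
      sumTo N (F ∘ suc) + sumTo N (λ i → F (suc (N + i)))
        ≡⟨ cong (sumTo N (F ∘ suc) +_) (trans (sumTo-rev N _) (sumTo-cong N (λ n n<N → cong F (sym (mirror-even N n n<N))))) ⟩
      sumTo N (F ∘ suc) + sumTo N (λ n → F (suc (N + N) ∸ suc n)) ≡⟨ sumTo-+ N (F ∘ suc) _ ⟨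
      sumTo N (λ n → F (suc n) + F (suc (N + N) ∸ suc n)) ≡⟨ +-identityʳ _ ⟨
      _ ∎
    go .(suc (N + N)) N (inj₂ refl) = begin
      sumTo (suc (N + N)) (F ∘ suc)               ≡⟨ cong (λ z → sumTo z (F ∘ suc)) (+-suc N N) ⟨
      sumTo (N + suc N) (F ∘ suc)                 ≡⟨ sumTo-add N (suc N) (F ∘ suc) ⟩
      sumTo N (F ∘ suc) + sumTo (suc N) (λ i → F (suc (N + i)))
        ≡⟨ cong (sumTo N (F ∘ suc) +_) (sumTo-shift N _) ⟩
      sumTo N (F ∘ suc) + (F (suc (N + 0)) + sumTo N (λ i → F (suc (N + suc i))))
        ≡⟨ cong₂ (λ x y → sumTo N (F ∘ suc) + (F (suc x) + y)) (+-identityʳ N)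
             (trans (sumTo-rev N _) (sumTo-cong N (λ n n<N → cong F (sym (mirror-odd N n n<N))))) ⟩
      sumTo N (F ∘ suc) + (F (suc N) + sumTo N (λ n → F (suc (suc (N + N)) ∸ suc n)))
        ≡⟨ lem (sumTo N (F ∘ suc)) (F (suc N)) _ ⟩
      sumTo N (F ∘ suc) + sumTo N (λ n → F (suc (suc (N + N)) ∸ suc n)) + F (suc N)
        ≡⟨ cong (_+ F (suc N)) (sumTo-+ N (F ∘ suc) _) ⟨
      _ ∎

  half<mirror : ∀ l₀ n → n < ⌊ l₀ /2⌋ → suc n < suc l₀ ∸ suc n × suc l₀ ∸ suc n < suc l₀
  half<mirror l₀ n n< = go l₀ ⌊ l₀ /2⌋ (half-cases l₀) n<
    where
    go : ∀ l₀ N → (l₀ ≡ N + N) ⊎ (l₀ ≡ suc (N + N)) → n < N → suc n < suc l₀ ∸ suc n × suc l₀ ∸ suc n < suc l₀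
    go .(N + N) N (inj₁ refl) n< = subst (λ z → suc n < z × z < suc (N + N)) (sym (mirror-even N n n<))
          (s≤s (≤-trans n< (m≤m+n N _)) , s≤s (+-monoʳ-< N (∸-monoʳ-< {N} {suc n} {0} (s≤s z≤n) n<)))
    go .(suc (N + N)) N (inj₂ refl) n< = subst (λ z → suc n < z × z < suc (suc (N + N))) (sym (mirror-odd N n n<))
          (s≤s (≤-trans n< (m≤m+n N _)) , s≤s (≤-trans (≤-reflexive (cong suc (+-suc N (N ∸ suc n)))) (s≤s (+-monoʳ-< N (∸-monoʳ-< {N} {suc n} {0} (s≤s z≤n) n<)))))

  -- Injectivity of the coding by reflected pairs: places beyond the middle are read from the second
  -- components, and the middle place, if there is one, from `mid`.
  fold-ext : ∀ l₀ (F G : ℕ → ℕ) → (∀ n → n < ⌊ l₀ /2⌋ → F (suc n) ≡ G (suc n) × F (suc l₀ ∸ suc n) ≡ G (suc l₀ ∸ suc n)) →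
    mid F l₀ ≡ mid G l₀ → ∀ i → i < l₀ → F (suc i) ≡ G (suc i)
  fold-ext l₀ F G = go l₀ ⌊ l₀ /2⌋ (half-cases l₀)
    where
    back : ∀ {N o} → o < N → N ∸ suc (N ∸ suc o) ≡ o
    back {N} {o} o<N = trans (cong (N ∸_) (sym (+-∸-assoc 1 o<N))) (m∸[m∸n]≡n (<⇒≤ o<N))
    lt : ∀ {N o} → o < N → N ∸ suc o < N
    lt {N} {o} o<N = ∸-monoʳ-< {N} {suc o} {0} (s≤s z≤n) o<N
    go : ∀ l₀ N c → (∀ n → n < N → F (suc n) ≡ G (suc n) × F (suc l₀ ∸ suc n) ≡ G (suc l₀ ∸ suc n)) →
      midAt F l₀ N c ≡ midAt G l₀ N c → ∀ i → i < l₀ → F (suc i) ≡ G (suc i)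
    go .(N + N) N (inj₁ refl) h e i i<l₀ with i <? N
    ... | yes i<N = proj₁ (h i i<N)
    ... | no  i≮N with m≤n⇒∃[o]m+o≡n (≮⇒≥ i≮N)
    ...   | o , refl = subst (λ z → F z ≡ G z) (trans (mirror-even N (N ∸ suc o) (lt o<N)) (cong (λ z → suc (N + z)) (back o<N))) (proj₂ (h (N ∸ suc o) (lt o<N)))
      where
      o<N : o < N
      o<N = +-cancelˡ-< N o N i<l₀
    go .(suc (N + N)) N (inj₂ refl) h e i i<l₀ with <-cmp i N
    ... | tri< i<N _ _ = proj₁ (h i i<N)
    ... | tri≈ _ refl _ = e
    ... | tri> _ _ N<i with m≤n⇒∃[o]m+o≡n N<i
    ...   | o , refl = subst (λ z → F z ≡ G z) (trans (mirror-odd N (N ∸ suc o) (lt o<N)) (cong suc (trans (cong (λ z → N + suc z) (back o<N)) (+-suc N o)))) (proj₂ (h (N ∸ suc o) (lt o<N)))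
      where
      o<N : o < N
      o<N = +-cancelˡ-< (suc N) o N i<l₀

  bld : {A : Set} → (ℕ → A) → ℕ → List A
  bld f zero    = []
  bld f (suc n) = f n ∷ bld f n

  bld-ext : {A : Set} (f g : ℕ → A) (N : ℕ) → bld f N ≡ bld g N → ∀ n → n < N → f n ≡ g n
  bld-ext f g (suc N) e n n< with ∷-injective e | m≤n⇒m<n∨m≡n (≤-pred n<)
  ... | a , b | inj₁ n<N  = bld-ext f g N b n n<N
  ... | a , b | inj₂ refl = a

  prev-bld : {A : Set} (f : ℕ → A) → ∀ k n → (n ≤ k × prev k (bld f n) ≡ nothing) ⊎ (∃ λ j → n ≡ j + suc k × prev k (bld f n) ≡ just (f j))
  prev-bld f k       zero    = inj₁ (z≤n , refl)
  prev-bld f zero    (suc n) = inj₂ (n , sym (+-comm n 1) , refl)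
  prev-bld f (suc k) (suc n) with prev-bld f k n
  ... | inj₁ (p , e)     = inj₁ (s≤s p , e)
  ... | inj₂ (j , p , e) = inj₂ (j , trans (cong suc p) (sym (+-suc j (suc k))) , e)

  tw : List Pair → ℕ
  tw = sumL pairTotal

  tw-bld : ∀ f N → tw (bld f N) ≡ sumTo N (pairTotal ∘ f)
  tw-bld f zero    = refl
  tw-bld f (suc N) = trans (cong (pairTotal (f N) +_) (tw-bld f N)) (+-comm (pairTotal (f N)) _)

  ∧-true : ∀ {a b} → a ≡ true → b ≡ true → a ∧ b ≡ true
  ∧-true refl refl = refl

  ∧-true⁻ : ∀ {a b} → a ∧ b ≡ true → a ≡ true × b ≡ true
  ∧-true⁻ {true} e = refl , e

  letters-∈ : ∀ {Q u} → 1 ≤ u → u ≤ Q → u ∈ letters Q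
  letters-∈ {Q} {suc u} _ h = ∈-map⁺ suc (∈-upTo⁺ h)

  letters-≤ : ∀ {Q u} → u ∈ letters Q → u ≤ Q
  letters-≤ p with ∈-map⁻ suc p
  ... | _ , q , refl = ∈-upTo⁻ q

  prodTo-* : ∀ n (F G : ℕ → ℕ) → prodTo n (λ i → F i * G i) ≡ prodTo n F * prodTo n G
  prodTo-* zero    F G = refl
  prodTo-* (suc n) F G = trans (cong (F n * G n *_) (prodTo-* n F G)) (lem (F n) (G n) _ _)
    where
    lem : ∀ a b c d → a * b * (c * d) ≡ a * c * (b * d)
    lem = solve-∀

  prodTo-^ : ∀ n b (F : ℕ → ℕ) → prodTo n (λ i → b ^ F i) ≡ b ^ sumTo n F
  prodTo-^ zero    b F = refl
  prodTo-^ (suc n) b F = trans (cong (b ^ F n *_) (prodTo-^ n b F)) (trans (sym (^-distribˡ-+-* b (F n) (sumTo n F))) (cong (b ^_) (+-comm (F n) (sumTo n F))))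

  -- Words of reflected pairs (w (off + i) , w (off + suc l₀ ∸ i)); s = suc s' is a place with letter 1, before which no letter is 1.
  module Region (Q : ℕ) (potential : Potential Q) (s' l₀ off : ℕ) where
    s = suc s'
    l = suc l₀
    N = ⌊ l₀ /2⌋
    private module pt = Potential potential
    U = 50 ^ (2 * Q)

    early : ℕ → Bool
    early i = (off + i) <ᵇ s

    r₁ r₂ : ℕ → Bool
    r₁ n = early (suc n)
    r₂ n = early (l ∸ suc n)

    cands : ℕ → List Pair → List Pair
    cands n P = filterᵇ (okPair Q (r₁ n) (r₂ n) (prev s' P)) (alph Q)

    -- Exponents of the losses 7/6 and of the gains 6/7 in the transfer inequality at the first s pairs.
    up dn : ℕ → ℕ
    up n = if n <ᵇ s then (if r₁ n then 0 else 1) else 0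
    dn n = if n <ᵇ s then (if r₁ n then (if r₂ n then 2 else 1) else 0) else 0

    Up = sumTo N up
    Dn = sumTo N dn

    open Process (wtQ Q) cands public

    private
      num den : ℕ → ℕ
      num n = 7 ^ up n * 6 ^ dn n
      den n = 6 ^ up n * 7 ^ dn n
      -- The pair `n` has a successor in the chain exactly when `n + s < N`. All other pairs carry
      -- `H`, which gives the lower bound for the final window.
      h : ℕ → Pair → ℕ
      h n = pt.pot (n + s <ᵇ N)
      module B = Bound U pt.H' s' N h num den

    words-alph : ∀ n {P} → P ∈ words n → All (_∈ alph Q) P
    words-alph zero    (here refl) = []
    words-alph (suc n) p with words-suc⁻ n p
    ... | P , a , refl , P∈ , a∈ = proj₁ (filterᵇ-∈⁻ _ (alph Q) a∈) ∷ words-alph n P∈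

    private
      at : ∀ k P → (length P ≤ k × prev k P ≡ nothing × B.potAt k P ≡ pt.H) ⊎
        (∃ λ a → ∃ λ j → length P ≡ j + suc k × prev k P ≡ just a × B.potAt k P ≡ h j a × a ∈ P)
      at k       []      = inj₁ (z≤n , refl , refl)
      at zero    (a ∷ P) = inj₂ (a , length P , sym (+-comm (length P) 1) , refl , refl , here refl)
      at (suc k) (a ∷ P) with at k P
      ... | inj₁ (p , e , f)               = inj₁ (s≤s p , e , f)
      ... | inj₂ (b , j , p , e , f , b∈) = inj₂ (b , j , trans (cong suc p) (sym (+-suc j (suc k))) , e , f , there b∈)

      weaken : ∀ ρ₁ ρ₂ mp hh → pairSum Q ρ₁ ρ₂ mp hh ≤ pairSum Q false false mp hh
      weaken ρ₁ ρ₂ mp hh = sumL-filterᵇ-mono (λ a → wtQ Q a * hh a) {okPair Q ρ₁ ρ₂ mp} {okPair Q false false mp} (alph Q)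
        λ { (u , v) _ e → let (a , e') = ∧-true⁻ {Q ≤ᵇ u + v} e ; (_ , e'') = ∧-true⁻ {imp ρ₁ (2 ≤ᵇ u)} e'
                              (_ , c) = ∧-true⁻ {imp ρ₂ (2 ≤ᵇ v)} e'' in ∧-true a c }
      initial : ∀ (ρ₁ ρ₂ b : Bool) →
        (6 ^ (if ρ₁ then 0 else 1) * 7 ^ (if ρ₁ then (if ρ₂ then 2 else 1) else 0)) * pairSum Q ρ₁ ρ₂ nothing (pt.pot b) ≤
        (7 ^ (if ρ₁ then 0 else 1) * 6 ^ (if ρ₁ then (if ρ₂ then 2 else 1) else 0)) * (U * pt.H)
      initial false ρ₂    b = ≤-trans (*-monoʳ-≤ 6 (weaken false ρ₂ nothing (pt.pot b))) (pt.free b)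
      initial true  false b = pt.restr₁ b
      initial true  true  b = pt.restr₂ b

      -- If there is no pair `s` steps earlier, the step is one of the first `s`, and its loss or
      -- gain is booked in `num` and `den`. Otherwise both exponents are 0 and `chained` applies
      -- without loss.
      cond : ∀ n → n < N → ∀ P → P ∈ words n → den n * sumL (λ a → wtQ Q a * h n a) (cands n P) ≤ num n * (U * B.potAt s' P)
      cond n n<N P P∈ with at s' P
      ... | inj₁ (p , e , f) rewrite e | f | <ᵇ-true {n} {s} (s≤s (subst (_≤ s') (words-length n P∈) p)) = initial (r₁ n) (r₂ n) (n + s <ᵇ N)
      ... | inj₂ (a , j , p , e , f , a∈) rewrite e | f
          | <ᵇ-false {n} {s} (subst (s ≤_) (trans (sym p) (words-length n P∈)) (m≤n+m s j))
          | <ᵇ-true {j + s} {N} (subst (_< N) (trans (sym (words-length n P∈)) p) n<N) =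
        ≤-trans (≤-reflexive (+-identityʳ _)) (≤-trans (≤-trans (weaken (r₁ n) (r₂ n) (just a) (pt.pot (n + s <ᵇ N))) (pt.chained (n + s <ᵇ N) a (All.lookup (words-alph n P∈) a∈))) (≤-reflexive (sym (+-identityʳ _))))

    weight-sum : (6 ^ Up * 7 ^ Dn) * sumL weight (words N) ≤ (7 ^ Up * 6 ^ Dn) * U ^ N
    weight-sum = subst₂ (λ x y → x * sumL weight (words N) ≤ y * U ^ N)
      (trans (prodTo-* N _ _) (cong₂ _*_ (prodTo-^ N 6 up) (prodTo-^ N 7 dn)))
      (trans (prodTo-* N _ _) (cong₂ _*_ (prodTo-^ N 7 up) (prodTo-^ N 6 dn)))
      (B.words-bound cond big)
      where
      big : ∀ i → N ≤ i + s → ∀ a → pt.H ≤ h i a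
      big i le a rewrite <ᵇ-false {i + s} {N} le = ≤-refl

    weight-value : ∀ n {P} → P ∈ words n → weight P * 50 ^ tw P ≡ 31 ^ tw P * U ^ n
    weight-value zero    (here refl) = refl
    weight-value (suc n) p with words-suc⁻ n p
    ... | P , a@(u , v) , refl , P∈ , a∈ with ∈-cartesianProduct⁻ (letters Q) (letters Q) (proj₁ (filterᵇ-∈⁻ (okPair Q (r₁ n) (r₂ n) (prev s' P)) (alph Q) a∈))
    ...   | u∈ , v∈ = begin
      wtQ Q a * weight P * 50 ^ (pairTotal a + tw P)     ≡⟨ cong (wtQ Q a * weight P *_) (^-distribˡ-+-* 50 (pairTotal a) (tw P)) ⟩
      31 ^ pairTotal a * 50 ^ (2 * Q ∸ pairTotal a) * weight P * (50 ^ pairTotal a * 50 ^ tw P)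
        ≡⟨ lem₁ (31 ^ pairTotal a) (50 ^ (2 * Q ∸ pairTotal a)) (weight P) (50 ^ pairTotal a) (50 ^ tw P) ⟩
      31 ^ pairTotal a * (50 ^ (2 * Q ∸ pairTotal a) * 50 ^ pairTotal a) * (weight P * 50 ^ tw P)
        ≡⟨ cong₂ (λ x y → 31 ^ pairTotal a * x * y) (trans (sym (^-distribˡ-+-* 50 (2 * Q ∸ pairTotal a) (pairTotal a))) (cong (50 ^_) (m∸n+n≡m tot≤))) (weight-value n P∈) ⟩
      31 ^ pairTotal a * U * (31 ^ tw P * U ^ n)         ≡⟨ lem₂ (31 ^ pairTotal a) U (31 ^ tw P) (U ^ n) ⟩
      31 ^ pairTotal a * 31 ^ tw P * (U * U ^ n)         ≡⟨ cong (_* (U * U ^ n)) (^-distribˡ-+-* 31 (pairTotal a) (tw P)) ⟨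
      31 ^ (pairTotal a + tw P) * (U * U ^ n) ∎
      where
      open ≡-Reasoning
      tot≤ : pairTotal a ≤ 2 * Q
      tot≤ = ≤-trans (+-mono-≤ (letters-≤ u∈) (letters-≤ v∈)) (≤-reflexive (cong (Q +_) (sym (+-identityʳ Q))))
      lem₁ : ∀ a b c d e → a * b * c * (d * e) ≡ a * (b * d) * (c * e)
      lem₁ = solve-∀
      lem₂ : ∀ a b c d → a * b * (c * d) ≡ a * c * (b * d)
      lem₂ = solve-∀

    module Encode (w : ℕ → ℕ) (range : ∀ i → 0 < i → i < l → 1 ≤ w i × w i ≤ Q)
      (reflect : ∀ i j → 0 < i → 0 < j → i + j ≡ l → Q ≤ w i + w j)
      (step : ∀ i → 0 < i → i + s < l → w (i + s) ≤ suc (w i))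
      (early-2 : ∀ i → 0 < i → i < l → off + i < s → 2 ≤ w i) where

      pair : ℕ → Pair
      pair n = w (suc n) , w (l ∸ suc n)

      code : List Pair
      code = bld pair N

      private
        ok : ∀ n → n < N → pair n ∈ cands n (bld pair n)
        ok n n<N = filterᵇ-∈⁺ _ {xs = alph Q} (∈-cartesianProduct⁺ (letters-∈ (proj₁ ru) (proj₂ ru)) (letters-∈ (proj₁ rv) (proj₂ rv)))
          (∧-true (≤ᵇ-true (reflect (suc n) (l ∸ suc n) (s≤s z≤n) 0<j sum))
            (∧-true (impl (suc n) (s≤s z≤n) sn<l) (∧-true (impl (l ∸ suc n) 0<j j<l) ch)))
          where
          sn<j = proj₁ (half<mirror l₀ n n<N)
          j<l  = proj₂ (half<mirror l₀ n n<N)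
          sn<l = <-trans sn<j j<l
          0<j : 0 < l ∸ suc n
          0<j = <-trans (s≤s z≤n) sn<j
          sum : suc n + (l ∸ suc n) ≡ l
          sum = m+[n∸m]≡n (<⇒≤ sn<l)
          ru = range (suc n) (s≤s z≤n) sn<l
          rv = range (l ∸ suc n) 0<j j<l
          impl : ∀ i → 0 < i → i < l → imp (early i) (2 ≤ᵇ w i) ≡ true
          impl i 0<i i<l with early i in e
          ... | false = refl
          ... | true  = ≤ᵇ-true (early-2 i 0<i i<l (<ᵇ-sound (off + i) s e))
          ch : chain (prev s' (bld pair n)) (pair n) ≡ true
          ch with prev-bld pair s' n
          ... | inj₁ (_ , e) rewrite e = refl
          ... | inj₂ (j , refl , e) rewrite e = ∧-true (≤ᵇ-true (step (suc j) (s≤s z≤n) sn<l))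
              (≤ᵇ-true (subst (λ z → w z ≤ suc (w (l ∸ suc n))) shift (step (l ∸ suc n) 0<j (subst (_< l) (sym shift) (s≤s (m∸n≤m l₀ j))))))
            where
            shift : l ∸ suc (j + s) + s ≡ l ∸ suc j
            shift = trans (cong (_+ s) (sym (∸-+-assoc l (suc j) s))) (m∸n+n≡m (m+n≤o⇒m≤o∸n s (≤-trans (≤-reflexive (+-comm s (suc j))) (<⇒≤ sn<l))))

      code-∈ : code ∈ words N
      code-∈ = go N ≤-refl
        where
        go : ∀ n → n ≤ N → bld pair n ∈ words n
        go zero    _   = here refl
        go (suc n) n<N = words-suc⁺ n (go n (<⇒≤ n<N)) (ok n n<N)

      code-tw : tw code + mid w l₀ ≡ sumTo l₀ (λ i → w (suc i))
      code-tw = trans (cong (_+ mid w l₀) (tw-bld pair N)) (sym (fold-sum l₀ w))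

  -- Balance of losses and gains among the pairs without predecessor.

  sumTo-<ᵇ : ∀ n s → sumTo n (λ i → bit (i <ᵇ s)) ≡ n ⊓ s
  sumTo-<ᵇ zero    s = refl
  sumTo-<ᵇ (suc n) s with n <? s
  ... | yes n<s rewrite <ᵇ-true n<s = trans (cong (_+ 1) (trans (sumTo-<ᵇ n s) (m≤n⇒m⊓n≡m (<⇒≤ n<s)))) (trans (+-comm n 1) (sym (m≤n⇒m⊓n≡m n<s)))
  ... | no  n≮s rewrite <ᵇ-false (≮⇒≥ n≮s) = trans (+-identityʳ _) (trans (sumTo-<ᵇ n s) (trans (m≥n⇒m⊓n≡n (≮⇒≥ n≮s)) (sym (m≥n⇒m⊓n≡n (m≤n⇒m≤1+n (≮⇒≥ n≮s))))))

  sumTo-δ≤1 : ∀ n x → sumTo n (λ i → bit (i ≡ᵇ x)) ≤ 1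
  sumTo-δ≤1 n x with x <? n
  ... | yes x<n = ≤-reflexive (sumTo-δ n x x<n)
  ... | no  x≮n = ≤-trans (≤-reflexive (trans (sumTo-cong n zeros) (sumTo-zero n))) z≤n
    where
    zeros : ∀ i → i < n → bit (i ≡ᵇ x) ≡ 0
    zeros i i<n with i ≡ᵇ x in e
    ... | false = refl
    ... | true  = ⊥-elim (x≮n (subst (_< n) (≡ᵇ-sound i x e) i<n))

  module Costs (Q : ℕ) (p : Potential Q) (s' l₀ off : ℕ) where
    open Region Q p s' l₀ off

    Up≤s : Up ≤ s
    Up≤s = ≤-trans (sumTo-mono N one) (≤-trans (≤-reflexive (sumTo-<ᵇ N s)) (m⊓n≤n N s))
      where
      one : ∀ n → n < N → up n ≤ bit (n <ᵇ s)
      one n _ with n <ᵇ s | r₁ n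
      ... | true  | true  = z≤n
      ... | true  | false = ≤-refl
      ... | false | _     = z≤n

    -- A loss at the pair `n` requires `n < s` and `s ≤ off + suc n`; among the first `s` pairs,
    -- those with `n < s ∸ suc off` incur none.
    Up≤off : Up ≤ suc off
    Up≤off = +-cancelʳ-≤ (N ⊓ (s ∸ suc off)) Up (suc off) (begin
      Up + N ⊓ (s ∸ suc off)                               ≡⟨ cong (Up +_) (sumTo-<ᵇ N (s ∸ suc off)) ⟨
      Up + sumTo N (λ n → bit (n <ᵇ (s ∸ suc off)))         ≡⟨ sumTo-+ N up _ ⟨
      sumTo N (λ n → up n + bit (n <ᵇ (s ∸ suc off)))       ≤⟨ sumTo-mono N one ⟩
      sumTo N (λ n → bit (n <ᵇ s))                          ≡⟨ sumTo-<ᵇ N s ⟩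
      N ⊓ s                                                ≤⟨ ⊓-mono-≤ (m≤n+m N (suc off)) (m≤n+m∸n s (suc off)) ⟩
      (suc off + N) ⊓ (suc off + (s ∸ suc off))            ≡⟨ +-distribˡ-⊓ (suc off) N (s ∸ suc off) ⟨
      suc off + N ⊓ (s ∸ suc off) ∎)
      where
      open ≤-Reasoning
      one : ∀ n → n < N → up n + bit (n <ᵇ (s ∸ suc off)) ≤ bit (n <ᵇ s)
      one n _ with suc off + n <? s
      ... | yes lt rewrite <ᵇ-true {n} {s} (≤-trans (s≤s (m≤n+m n (suc off))) lt) | <ᵇ-true {off + suc n} {s} (subst (_< s) (sym (+-suc off n)) lt) = bit≤1 _
      ... | no  ge rewrite <ᵇ-false {n} {s ∸ suc off} (m≤n+o⇒m∸n≤o s (suc off) (≮⇒≥ ge)) with n <ᵇ s | r₁ n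
      ...   | true  | true  = z≤n
      ...   | true  | false = ≤-refl
      ...   | false | _     = z≤n

  module Costs₀ (Q : ℕ) (p : Potential Q) (s' l₀ : ℕ) where
    open Region Q p s' l₀ 0

    -- With offset 0 the only pair that has neither a predecessor nor a restricted left letter is
    -- the pair `s'`, whose left place is `s` itself.
    Up≤1 : Up ≤ 1
    Up≤1 = ≤-trans (sumTo-mono N one) (sumTo-δ≤1 N s')
      where
      one : ∀ n → n < N → up n ≤ bit (n ≡ᵇ s')
      one n _ with n <ᵇ s in e | suc n <ᵇ s in e'
      ... | false | _     = z≤n
      ... | true  | true  = z≤n
      ... | true  | false with n ≡ᵇ s' in e''
      ...   | true  = ≤-refl
      ...   | false with m≤n⇒m<n∨m≡n (≤-pred (<ᵇ-sound n s e))
      ...     | inj₁ n<s' = case trans (sym (<ᵇ-true {suc n} {s} (s≤s n<s'))) e' of λ ()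
      ...     | inj₂ refl = case trans (sym (≡ᵇ-refl n)) e'' of λ ()

    -- The gains count the places before `s` on the left side, one or two per pair. The 2 makes up
    -- for a possible middle place, which belongs to no pair, and for passing from `s' ⊓ l₀` to
    -- `s ⊓ l`.
    Dn-lower : s ⊓ l ≤ Dn + 2
    Dn-lower = begin
      suc (s' ⊓ l₀)                               ≡⟨ cong suc (⊓-comm s' l₀) ⟩
      suc (l₀ ⊓ s')                               ≡⟨ cong suc (sumTo-<ᵇ l₀ s') ⟨
      suc (sumTo l₀ (λ i → bit (suc i <ᵇ s)))     ≡⟨ cong suc (fold-sum l₀ F) ⟩
      suc (sumTo N (λ n → F (suc n) + F (l ∸ suc n)) + mid F l₀)
        ≤⟨ s≤s (+-mono-≤ (sumTo-mono N one) (mid≤ (half-cases l₀))) ⟩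
      suc (Dn + 1)                                ≡⟨ +-suc Dn 1 ⟨
      Dn + 2 ∎
      where
      open ≤-Reasoning
      F : ℕ → ℕ
      F i = bit (i <ᵇ s)
      mid≤ : ∀ c → midAt F l₀ N c ≤ 1
      mid≤ (inj₁ _) = z≤n
      mid≤ (inj₂ _) = bit≤1 (suc N <ᵇ s)
      one : ∀ n → n < N → F (suc n) + F (l ∸ suc n) ≤ dn n
      one n n<N with suc n <? s
      ... | no ge rewrite <ᵇ-false {suc n} {s} (≮⇒≥ ge) | <ᵇ-false {l ∸ suc n} {s} (≤-trans (≮⇒≥ ge) (<⇒≤ (proj₁ (half<mirror l₀ n n<N)))) = z≤n
      ... | yes lt rewrite <ᵇ-true {n} {s} (<-trans (n<1+n n) lt) | <ᵇ-true {suc n} {s} lt with (l ∸ suc n) <ᵇ s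
      ...   | true  = ≤-refl
      ...   | false = ≤-refl

  -- The argument of Kraft's inequality: an element of size `t x` has weight proportional to
  -- (31/50)^(t x), so each of the counted elements weighs at least (31/50)^g relative to `C`, while
  -- the total weight is at most 2.
  kraft : {A : Set} (xs : List A) (W t : A → ℕ) (C c g : ℕ) → 0 < C → (∀ x → x ∈ xs → W x * 50 ^ t x ≡ 31 ^ t x * C) →
    sumL W xs ≤ 2 * C → length (filterᵇ (λ x → t x + c ≡ᵇ g) xs) * 31 ^ g ≤ 2 * 50 ^ g
  kraft xs W t C c g 0<C val bound = *-cancelʳ-≤ _ _ C ⦃ >-nonZero 0<C ⦄ (begin
    length F * 31 ^ g * C            ≡⟨ trans (*-assoc (length F) _ _) (sym (sumL-const (31 ^ g * C) F)) ⟩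
    sumL (λ _ → 31 ^ g * C) F        ≤⟨ sumL-mono F one ⟩
    sumL (λ x → W x * 50 ^ g) F      ≡⟨ sumL-*ʳ (50 ^ g) W F ⟩
    sumL W F * 50 ^ g                ≤⟨ *-monoˡ-≤ (50 ^ g) (sub xs) ⟩
    sumL W xs * 50 ^ g               ≤⟨ *-monoˡ-≤ (50 ^ g) bound ⟩
    2 * C * 50 ^ g                   ≡⟨ lem C (50 ^ g) ⟩
    2 * 50 ^ g * C ∎)
    where
    open ≤-Reasoning
    F = filterᵇ (λ x → t x + c ≡ᵇ g) xs
    lem : ∀ a b → 2 * a * b ≡ 2 * b * a
    lem = solve-∀
    lem₂ : ∀ a b c → a * b * c ≡ a * c * b
    lem₂ = solve-∀
    sub : ∀ xs → sumL W (filterᵇ (λ x → t x + c ≡ᵇ g) xs) ≤ sumL W xs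
    sub []       = z≤n
    sub (x ∷ xs) with t x + c ≡ᵇ g
    ... | true  = +-monoʳ-≤ (W x) (sub xs)
    ... | false = ≤-trans (sub xs) (m≤n+m _ (W x))
    one : ∀ x → x ∈ F → 31 ^ g * C ≤ W x * 50 ^ g
    one x p with filterᵇ-∈⁻ (λ x → t x + c ≡ᵇ g) xs p
    ... | x∈ , e with ≡ᵇ-sound (t x + c) g e
    ...   | refl = begin
      31 ^ (t x + c) * C               ≡⟨ cong (_* C) (^-distribˡ-+-* 31 (t x) c) ⟩
      31 ^ t x * 31 ^ c * C            ≡⟨ lem₂ (31 ^ t x) (31 ^ c) C ⟩
      31 ^ t x * C * 31 ^ c            ≡⟨ cong (_* 31 ^ c) (val x x∈) ⟨
      W x * 50 ^ t x * 31 ^ c          ≤⟨ *-monoʳ-≤ (W x * 50 ^ t x) (^-monoˡ-≤ c (≤ᵇ-sound 31 50 refl)) ⟩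
      W x * 50 ^ t x * 50 ^ c          ≡⟨ *-assoc (W x) _ _ ⟩
      W x * (50 ^ t x * 50 ^ c)        ≡⟨ cong (W x *_) (^-distribˡ-+-* 50 (t x) c) ⟨
      W x * 50 ^ (t x + c) ∎

  6^≤7^ : ∀ n → 6 ^ n ≤ 7 ^ n
  6^≤7^ n = ^-monoˡ-≤ n (n≤1+n 6)

  -- (7/6)⁴ ≤ 2
  four-steps : ∀ V D S C → V ≤ D + 4 → S * (6 ^ V * 7 ^ D) ≤ (7 ^ V * 6 ^ D) * C → S ≤ 2 * C
  four-steps V D S C V≤ h with m≤n⇒∃[o]m+o≡n V≤
  ... | o , e = *-cancelʳ-≤ S (2 * C) (6 ^ o * (6 ^ V * 7 ^ D)) ⦃ m*n≢0 (6 ^ o) (6 ^ V * 7 ^ D) ⦃ m^n≢0 6 o ⦄ ⦃ m*n≢0 _ _ ⦃ m^n≢0 6 V ⦄ ⦃ m^n≢0 7 D ⦄ ⦄ ⦄ (begin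
    S * (6 ^ o * (6 ^ V * 7 ^ D))   ≡⟨ lem₁ S (6 ^ o) (6 ^ V * 7 ^ D) ⟩
    6 ^ o * (S * (6 ^ V * 7 ^ D))   ≤⟨ *-mono-≤ (6^≤7^ o) h ⟩
    7 ^ o * ((7 ^ V * 6 ^ D) * C)   ≡⟨ lem₂ (7 ^ o) (7 ^ V) (6 ^ D) C ⟩
    (7 ^ V * 7 ^ o) * (6 ^ D * C)   ≡⟨ cong (_* (6 ^ D * C)) (trans (sym (^-distribˡ-+-* 7 V o)) (trans (cong (7 ^_) e) (^-distribˡ-+-* 7 D 4))) ⟩
    (7 ^ D * 2401) * (6 ^ D * C)    ≤⟨ *-monoˡ-≤ (6 ^ D * C) (*-monoʳ-≤ (7 ^ D) (≤ᵇ-sound 2401 2592 refl)) ⟩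
    (7 ^ D * 2592) * (6 ^ D * C)    ≡⟨ lem₃ (7 ^ D) (6 ^ D) C ⟩
    2 * C * ((6 ^ D * 1296) * 7 ^ D) ≡⟨ cong (λ z → 2 * C * (z * 7 ^ D)) (trans (sym (^-distribˡ-+-* 6 D 4)) (trans (cong (6 ^_) (sym e)) (^-distribˡ-+-* 6 V o))) ⟩
    2 * C * ((6 ^ V * 6 ^ o) * 7 ^ D) ≡⟨ lem₄ C (6 ^ V) (6 ^ o) (7 ^ D) ⟩
    2 * C * (6 ^ o * (6 ^ V * 7 ^ D)) ∎)
    where
    open ≤-Reasoning
    lem₁ : ∀ a b c → a * (b * c) ≡ b * (a * c)
    lem₁ = solve-∀
    lem₂ : ∀ a b c d → a * ((b * c) * d) ≡ (b * a) * (c * d)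
    lem₂ = solve-∀
    lem₃ : ∀ a b c → (a * 2592) * (b * c) ≡ 2 * c * ((b * 1296) * a)
    lem₃ = solve-∀
    lem₄ : ∀ c a b d → 2 * c * ((a * b) * d) ≡ 2 * c * (b * (a * d))
    lem₄ = solve-∀

  module OneRegion (Q : ℕ) (p : Potential Q) (s' l₀ : ℕ) where
    private module R = Region Q p s' l₀ 0

    count : ∀ c n → length (filterᵇ (λ P → tw P + c ≡ᵇ n) (R.words R.N)) * 31 ^ n ≤ 2 * 50 ^ n
    count c n = kraft (R.words R.N) R.weight tw (R.U ^ R.N) c n (m^n>0 R.U ⦃ m^n≢0 50 (2 * Q) ⦄ R.N)
      (λ P P∈ → R.weight-value R.N P∈)
      (four-steps R.Up R.Dn (sumL R.weight (R.words R.N)) (R.U ^ R.N) (≤-trans (Costs₀.Up≤1 Q p s' l₀) (≤-trans (s≤s z≤n) (m≤n+m 4 R.Dn)))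
        (≤-trans (≤-reflexive (*-comm (sumL R.weight (R.words R.N)) (6 ^ R.Up * 7 ^ R.Dn))) R.weight-sum))

  module TwoRegions (Q : ℕ) (p : Potential (suc Q)) (p' : Potential Q) (s' l₀ l₀' : ℕ) where
    private
      module R  = Region (suc Q) p s' l₀ 0
      module R' = Region Q p' s' l₀' (suc l₀)

    pairs : List (List Pair × List Pair)
    pairs = cartesianProduct (R.words R.N) (R'.words R'.N)

    tw₂ : List Pair × List Pair → ℕ
    tw₂ (P , P') = tw P + tw P'

    private
      W : List Pair × List Pair → ℕ
      W (P , P') = R.weight P * R'.weight P'
      C = R.U ^ R.N * R'.U ^ R'.N
      S  = sumL R.weight (R.words R.N)
      S' = sumL R'.weight (R'.words R'.N)

      W-sum : sumL W pairs ≡ S * S'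
      W-sum = trans (sumL-cartesianProduct W (R.words R.N) (R'.words R'.N))
        (trans (sumL-cong (R.words R.N) (λ P _ → sumL-*ˡ (R.weight P) R'.weight (R'.words R'.N))) (sumL-*ʳ S' R.weight (R.words R.N)))

      bound : (S * S') * (6 ^ (R.Up + R'.Up) * 7 ^ R.Dn) ≤ (7 ^ (R.Up + R'.Up) * 6 ^ R.Dn) * C
      bound = *-cancelʳ-≤ _ _ (7 ^ R'.Dn) ⦃ m^n≢0 7 R'.Dn ⦄ (begin
        (S * S') * (6 ^ (R.Up + R'.Up) * 7 ^ R.Dn) * 7 ^ R'.Dn
          ≡⟨ trans (cong (λ z → (S * S') * (z * 7 ^ R.Dn) * 7 ^ R'.Dn) (^-distribˡ-+-* 6 R.Up R'.Up)) (lem₁ S S' (6 ^ R.Up) (6 ^ R'.Up) (7 ^ R.Dn) (7 ^ R'.Dn)) ⟩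
        ((6 ^ R.Up * 7 ^ R.Dn) * S) * ((6 ^ R'.Up * 7 ^ R'.Dn) * S')
          ≤⟨ *-mono-≤ R.weight-sum R'.weight-sum ⟩
        ((7 ^ R.Up * 6 ^ R.Dn) * R.U ^ R.N) * ((7 ^ R'.Up * 6 ^ R'.Dn) * R'.U ^ R'.N)
          ≤⟨ *-monoʳ-≤ ((7 ^ R.Up * 6 ^ R.Dn) * R.U ^ R.N) (*-monoˡ-≤ (R'.U ^ R'.N) (*-monoʳ-≤ (7 ^ R'.Up) (6^≤7^ R'.Dn))) ⟩
        ((7 ^ R.Up * 6 ^ R.Dn) * R.U ^ R.N) * ((7 ^ R'.Up * 7 ^ R'.Dn) * R'.U ^ R'.N)
          ≡⟨ trans (lem₂ (7 ^ R.Up) (6 ^ R.Dn) (R.U ^ R.N) (7 ^ R'.Up) (7 ^ R'.Dn) (R'.U ^ R'.N))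
               (cong (λ z → (z * 6 ^ R.Dn) * C * 7 ^ R'.Dn) (sym (^-distribˡ-+-* 7 R.Up R'.Up))) ⟩
        (7 ^ (R.Up + R'.Up) * 6 ^ R.Dn) * C * 7 ^ R'.Dn ∎)
        where
        open ≤-Reasoning
        lem₁ : ∀ s t a b c d → (s * t) * ((a * b) * c) * d ≡ ((a * c) * s) * ((b * d) * t)
        lem₁ = solve-∀
        lem₂ : ∀ a b c d e f → ((a * b) * c) * ((d * e) * f) ≡ ((a * d) * b) * (c * f) * e
        lem₂ = solve-∀

      -- The decisive balance. The right side may lose once for each of `min (s, l) + 1` pairs, but
      -- then the left side has about `min (s, l)` places before the first letter 1, and each of
      -- them gains the same factor.
      exponents : R.Up + R'.Up ≤ R.Dn + 4
      exponents = begin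
        R.Up + R'.Up           ≤⟨ +-mono-≤ (Costs₀.Up≤1 (suc Q) p s' l₀) (⊓-glb (≤-trans (Costs.Up≤s Q p' s' l₀' (suc l₀)) (n≤1+n _)) (Costs.Up≤off Q p' s' l₀' (suc l₀))) ⟩
        2 + (R.s ⊓ R.l)        ≤⟨ s≤s (s≤s (Costs₀.Dn-lower (suc Q) p s' l₀)) ⟩
        2 + (R.Dn + 2)         ≡⟨ lem R.Dn ⟩
        R.Dn + 4 ∎
        where
        open ≤-Reasoning
        lem : ∀ d → 2 + (d + 2) ≡ d + 4
        lem = solve-∀

    count : ∀ c n → length (filterᵇ (λ x → tw₂ x + c ≡ᵇ n) pairs) * 31 ^ n ≤ 2 * 50 ^ n
    count c n = kraft pairs W tw₂ C c n
      (*-mono-≤ (m^n>0 R.U ⦃ m^n≢0 50 (2 * suc Q) ⦄ R.N) (m^n>0 R'.U ⦃ m^n≢0 50 (2 * Q) ⦄ R'.N))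
      val (subst (_≤ 2 * C) (sym W-sum) (four-steps (R.Up + R'.Up) R.Dn (S * S') C exponents bound))
      where
      val : ∀ x → x ∈ pairs → W x * 50 ^ tw₂ x ≡ 31 ^ tw₂ x * C
      val (P , P') x∈ with ∈-cartesianProduct⁻ (R.words R.N) (R'.words R'.N) x∈
      ... | P∈ , P'∈ = trans (cong (W (P , P') *_) (^-distribˡ-+-* 50 (tw P) (tw P'))) (trans (lem₁ (R.weight P) (R'.weight P') (50 ^ tw P) (50 ^ tw P'))
            (trans (cong₂ _*_ (R.weight-value R.N P∈) (R'.weight-value R'.N P'∈))
            (trans (lem₁ (31 ^ tw P) (R.U ^ R.N) (31 ^ tw P') (R'.U ^ R'.N)) (cong (_* C) (sym (^-distribˡ-+-* 31 (tw P) (tw P')))))))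
        where
        lem₁ : ∀ a b c d → a * b * (c * d) ≡ (a * c) * (b * d)
        lem₁ = solve-∀

  -- Semigroups with a Kunz coordinate at least 4

  length-cartesianProduct : {A B : Set} (xs : List A) (ys : List B) → length (cartesianProduct xs ys) ≡ length xs * length ys
  length-cartesianProduct xs ys = trans (length-sumL (cartesianProduct xs ys)) (trans (sumL-cartesianProduct (λ _ → 1) xs ys)
    (trans (sumL-cong xs (λ _ _ → sym (length-sumL ys))) (sumL-const (length ys) xs)))

  length-concatMap-bound : {A B : Set} (f : A → List B) (xs : List A) (a b : ℕ) → (∀ x → x ∈ xs → length (f x) * a ≤ b) →
    length (concatMap f xs) * a ≤ length xs * b
  length-concatMap-bound f xs a b h = begin
    length (concatMap f xs) * a        ≡⟨ cong (_* a) (length-concatMap f xs) ⟩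
    sumL (λ x → length (f x)) xs * a   ≡⟨ sumL-*ʳ a _ xs ⟨
    sumL (λ x → length (f x) * a) xs   ≤⟨ sumL-mono xs h ⟩
    sumL (λ _ → b) xs                  ≡⟨ sumL-const b xs ⟩
    length xs * b ∎
    where open ≤-Reasoning

  mid-≤ : ∀ (w : ℕ → ℕ) l₀ → mid w l₀ ≤ sumTo l₀ (λ i → w (suc i))
  mid-≤ w l₀ = ≤-trans (m≤n+m _ _) (≤-reflexive (sym (fold-sum l₀ w)))

  module KunzFacts {g G} (K : Kunz g G) where
    open Kunz K

    -- If no letter 1 occurs up to `n`, the witness `s = suc n` makes the step condition vacuous and
    -- the bound 2 valid everywhere, so that this case needs no separate treatment.
    firstOne : ∀ n → n ≤ pm → ∃ λ s' → s' ≤ n × (∀ i → 0 < i → i ≤ n → i < suc s' → 2 ≤ w i) ×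
      (∀ i → i + suc s' ≤ n → w (i + suc s') ≤ suc (w i))
    firstOne n n≤ with findFirst (λ i → w (suc i) ≡ᵇ 1) n
    ... | inj₁ none = n , ≤-refl , two , λ i le → ⊥-elim (<-irrefl refl (≤-trans (m≤n+m (suc n) i) le))
      where
      two : ∀ i → 0 < i → i ≤ n → i < suc n → 2 ≤ w i
      two (suc i) _ i<n _ with m≤n⇒m<n∨m≡n (pos (suc i) (s≤s z≤n) (s≤s (≤-trans i<n n≤)))
      ... | inj₁ lt = lt
      ... | inj₂ eq = case trans (sym (none i i<n)) (subst (λ z → (z ≡ᵇ 1) ≡ true) eq refl) of λ ()
    ... | inj₂ (s' , s'<n , one , before) = s' , <⇒≤ s'<n , two , step
      where
      two : ∀ i → 0 < i → i ≤ n → i < suc s' → 2 ≤ w i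
      two (suc i) _ i<n i<s with m≤n⇒m<n∨m≡n (pos (suc i) (s≤s z≤n) (s≤s (≤-trans i<n n≤)))
      ... | inj₁ lt = lt
      ... | inj₂ eq = case trans (sym (before i (≤-pred i<s))) (subst (λ z → (z ≡ᵇ 1) ≡ true) eq refl) of λ ()
      step : ∀ i → i + suc s' ≤ n → w (i + suc s') ≤ suc (w i)
      step i le = ≤-trans (sub i (suc s') (s≤s (≤-trans le n≤)))
        (≤-reflexive (trans (cong (w i +_) (≡ᵇ-sound _ 1 one)) (+-comm (w i) 1)))

    total-pos : sumTo pm (λ i → w (suc i)) ≡ g
    total-pos = trans (cong (_+ sumTo pm (λ i → w (suc i))) (sym w0)) (trans (sym (sumTo-shift pm w)) total)

    pm≤g : pm ≤ g
    pm≤g = ≤-trans (≤-reflexive (sym (sumTo-one pm))) (≤-trans (sumTo-mono pm (λ i i< → pos (suc i) (s≤s z≤n) (s≤s i<))) (≤-reflexive total-pos))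

    w≤g : ∀ i → i ≤ pm → w i ≤ g
    w≤g zero    _ = ≤-trans (≤-reflexive w0) z≤n
    w≤g (suc i) h = ≤-trans (≤-trans (m≤n+m (w (suc i)) _) (sumTo-monoˡ (λ i → w (suc i)) h)) (≤-reflexive total-pos)

    total-split : ∀ l₀ r → pm ≡ suc l₀ + r → sumTo l₀ (λ i → w (suc i)) + w (suc l₀) + sumTo r (λ i → w (suc l₀ + suc i)) ≡ g
    total-split l₀ r e = trans (cong (sumTo l₀ (λ i → w (suc i)) + w (suc l₀) +_) (sumTo-cong r (λ i _ → cong w (+-suc (suc l₀) i))))
      (trans (sym (sumTo-add (suc l₀) r (λ i → w (suc i)))) (trans (cong (λ z → sumTo z (λ i → w (suc i))) (sym e)) total-pos))

  -- (κ , s' , l₀ , l₀' , c , c'): the largest letter 4 + κ has its last occurrence at suc l₀, the first letter 1 is at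
  -- suc s', and c , c' are the letters fixed by the reflections of the two sides of length l₀ and l₀'.
  Tuple : Set
  Tuple = ℕ × ℕ × ℕ × ℕ × ℕ × ℕ

  range : ℕ → List ℕ
  range g = upTo (suc g)

  box : {B : Set} → ℕ → List B → List (ℕ × B)
  box g ys = cartesianProduct (range g) ys

  length-box : {B : Set} (g : ℕ) (ys : List B) {m : ℕ} → length ys ≡ m → length (box g ys) ≡ suc g * m
  length-box g ys e = trans (length-cartesianProduct (range g) ys) (cong₂ _*_ (length-upTo (suc g)) e)

  tuples : ℕ → List Tuple
  tuples g = box g (box g (box g (box g (box g (range g)))))

  length-tuples : ∀ g → length (tuples g) ≡ suc g ^ 6
  length-tuples g = trans (length-box g (box g (box g (box g (box g (range g)))))
      (length-box g (box g (box g (box g (range g)))) (length-box g (box g (box g (range g)))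
        (length-box g (box g (range g)) (length-box g (range g) (length-upTo (suc g))))))) (lem (suc g))
    where
    lem : ∀ n → n * (n * (n * (n * (n * n)))) ≡ n * (n * (n * (n * (n * (n * 1)))))
    lem = solve-∀

  Code₁ : Set
  Code₁ = Tuple × (List Pair × List Pair)

  admissible₁ : ℕ → Tuple → List (List Pair × List Pair)
  admissible₁ g (κ , s' , l₀ , l₀' , c , c') = filterᵇ (λ x → T.tw₂ x + (c + c' + (4 + κ)) ≡ᵇ g) T.pairs
    where module T = TwoRegions (3 + κ) (potential (suc κ)) (potential κ) s' l₀ l₀'

  codes₁ : ℕ → List Code₁
  codes₁ g = concatMap (λ t → map (t ,_) (admissible₁ g t)) (tuples g)

  codes₁-count : ∀ g → length (codes₁ g) * 31 ^ g ≤ suc g ^ 6 * (2 * 50 ^ g)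
  codes₁-count g = ≤-trans (length-concatMap-bound (λ t → map (t ,_) (admissible₁ g t)) (tuples g) (31 ^ g) (2 * 50 ^ g)
      (λ { t@(κ , s' , l₀ , l₀' , c , c') _ → ≤-trans (≤-reflexive (cong (_* 31 ^ g) (length-map (t ,_) (admissible₁ g t))))
        (TwoRegions.count (3 + κ) (potential (suc κ)) (potential κ) s' l₀ l₀' (c + c' + (4 + κ)) g) }))
    (≤-reflexive (cong (_* (2 * 50 ^ g)) (length-tuples g)))

  pairAt : (ℕ → ℕ) → ℕ → ℕ → Pair
  pairAt w l n = w (suc n) , w (l ∸ suc n)

  record Rep₁ (g : ℕ) (G : List ℕ) (x : Code₁) : Set where
    field
      K : Kunz g G
    open Kunz K
    κ = proj₁ (proj₁ x)
    l₀  = proj₁ (proj₂ (proj₂ (proj₁ x)))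
    l₀' = proj₁ (proj₂ (proj₂ (proj₂ (proj₁ x))))
    c   = proj₁ (proj₂ (proj₂ (proj₂ (proj₂ (proj₁ x)))))
    c'  = proj₂ (proj₂ (proj₂ (proj₂ (proj₂ (proj₁ x)))))
    field
      size : pm ≡ suc l₀ + l₀'
      top  : w (suc l₀) ≡ 4 + κ
      mid₁ : mid w l₀ ≡ c
      mid₂ : mid (λ i → w (suc l₀ + i)) l₀' ≡ c'
      list₁ : bld (pairAt w (suc l₀)) ⌊ l₀ /2⌋ ≡ proj₁ (proj₂ x)
      list₂ : bld (pairAt (λ i → w (suc l₀ + i)) (suc l₀')) ⌊ l₀' /2⌋ ≡ proj₂ (proj₂ x)

  region-ext : ∀ (w w' : ℕ → ℕ) l₀ → bld (pairAt w (suc l₀)) ⌊ l₀ /2⌋ ≡ bld (pairAt w' (suc l₀)) ⌊ l₀ /2⌋ → mid w l₀ ≡ mid w' l₀ →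
    ∀ i → i < l₀ → w (suc i) ≡ w' (suc i)
  region-ext w w' l₀ e em = fold-ext l₀ w w' (λ n n< → ,-injective (bld-ext (pairAt w (suc l₀)) (pairAt w' (suc l₀)) ⌊ l₀ /2⌋ e n n<)) em

  Rep₁-injective : ∀ {g G G' x} → Rep₁ g G x → Rep₁ g G' x → G ≡ G'
  Rep₁-injective {x = (κ , s' , l₀ , l₀' , c , c') , P , P'} ρ σ =
    kunz-ext ρ.K σ.K (trans ρ.size (sym σ.size)) eq
    where
    module ρ = Rep₁ ρ
    module σ = Rep₁ σ
    w = Kunz.w ρ.K
    v = Kunz.w σ.K
    eq : ∀ i → i < suc (Kunz.pm ρ.K) → w i ≡ v i
    eq zero    _ = trans (Kunz.w0 ρ.K) (sym (Kunz.w0 σ.K))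
    eq (suc i) i< with <-cmp i l₀
    ... | tri< lt _ _   = region-ext w v l₀ (trans ρ.list₁ (sym σ.list₁)) (trans ρ.mid₁ (sym σ.mid₁)) i lt
    ... | tri≈ _ refl _ = trans ρ.top (sym σ.top)
    ... | tri> _ _ gt with m≤n⇒∃[o]m+o≡n gt
    ...   | o , refl = subst (λ z → w z ≡ v z) (+-suc (suc l₀) o)
              (region-ext (λ i → w (suc l₀ + i)) (λ i → v (suc l₀ + i)) l₀' (trans ρ.list₂ (sym σ.list₂)) (trans ρ.mid₂ (sym σ.mid₂)) o
                (+-cancelˡ-< (suc l₀) o l₀' (subst (suc l₀ + o <_) ρ.size (≤-pred i<))))

  -- With `l` the last place of the largest letter `4 + κ`, the left side is reflected by
  -- `i + j ≡ l`. On the right side the sum wraps around the multiplicity, and `sub-mod` lowers the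
  -- required sum to `3 + κ`; letters after the last maximum are also at most `3 + κ`. Both sides
  -- thus fall under a `Potential`, because `3 + κ` is at least 3: this is where a letter at least 4
  -- enters.
  encode₁ : ∀ {g G} (K : Kunz g G) i → i ≤ Kunz.pm K → 4 ≤ Kunz.w K i → ∃ λ x → x ∈ codes₁ g × Rep₁ g G x
  encode₁ {g} {G} K i i≤ 4≤ with lastMax (Kunz.w K) (Kunz.pm K)
  ... | zero , _ , mx , _ = ⊥-elim (case ≤-trans 4≤ (≤-trans (mx i i≤) (≤-reflexive (Kunz.w0 K))) of λ ())
  ... | suc l₀ , l≤ , mx , lst with m≤n⇒∃[o]m+o≡n l≤ | m≤n⇒∃[o]m+o≡n (≤-trans 4≤ (mx i i≤)) | KunzFacts.firstOne K (Kunz.pm K) ≤-refl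
  ...   | l₀' , size | κ , top | s' , s'≤ , two , step = (t , R.Encode.code w rng refl₁ stp e2 , R'.Encode.code w' rng' refl' stp' e2') ,
      concatMap-∈⁺ (∈-cartesianProduct⁺ (bd κ≤) (∈-cartesianProduct⁺ (bd s'≤g) (∈-cartesianProduct⁺ (bd l₀≤) (∈-cartesianProduct⁺ (bd l₀'≤) (∈-cartesianProduct⁺ (bd c≤) (bd c'≤))))))
        (∈-map⁺ (t ,_) (filterᵇ-∈⁺ _ (∈-cartesianProduct⁺ (R.Encode.code-∈ w rng refl₁ stp e2) (R'.Encode.code-∈ w' rng' refl' stp' e2')) good)) ,
      record { K = K ; size = sym size ; top = sym top ; mid₁ = refl ; mid₂ = refl ; list₁ = refl ; list₂ = refl }
    where
    open Kunz K hiding (m)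
    open KunzFacts K
    l = suc l₀
    w' : ℕ → ℕ
    w' i = w (l + i)
    t : Tuple
    t = κ , s' , l₀ , l₀' , mid w l₀ , mid w' l₀'
    module R  = Region (4 + κ) (potential (suc κ)) s' l₀ 0
    module R' = Region (3 + κ) (potential κ) s' l₀' l
    below : ∀ {i} → i < l → i ≤ pm
    below h = ≤-trans (<⇒≤ h) l≤
    inside : ∀ {i} → i < suc l₀' → l + i ≤ pm
    inside h = ≤-trans (+-monoʳ-≤ l (≤-pred h)) (≤-reflexive size)
    rng : ∀ i → 0 < i → i < l → 1 ≤ w i × w i ≤ 4 + κ
    rng i 0<i i<l = pos i 0<i (s≤s (below i<l)) , ≤-trans (mx i (below i<l)) (≤-reflexive (sym top))
    refl₁ : ∀ i j → 0 < i → 0 < j → i + j ≡ l → 4 + κ ≤ w i + w j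
    refl₁ i j _ _ e = ≤-trans (≤-reflexive (trans top (cong w (sym e)))) (sub i j (s≤s (≤-trans (≤-reflexive e) l≤)))
    stp : ∀ i → 0 < i → i + suc s' < l → w (i + suc s') ≤ suc (w i)
    stp i _ h = step i (below h)
    e2 : ∀ i → 0 < i → i < l → 0 + i < suc s' → 2 ≤ w i
    e2 i 0<i i<l h = two i 0<i (below i<l) h
    rng' : ∀ i → 0 < i → i < suc l₀' → 1 ≤ w' i × w' i ≤ 3 + κ
    rng' i 0<i i< = pos (l + i) (s≤s z≤n) (s≤s (inside i<)) , ≤-pred (≤-trans (lst (l + i) (m<m+n l 0<i) (inside i<)) (≤-reflexive (sym top)))
    refl' : ∀ i j → 0 < i → 0 < j → i + j ≡ suc l₀' → 3 + κ ≤ w' i + w' j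
    refl' i j 0<i 0<j e = ≤-pred (≤-trans (≤-reflexive top) (sub-mod (l + i) (l + j) l (s≤s (inside i<)) (s≤s (inside j<)) (s≤s l≤)
        (trans (lem l₀ i j) (cong (λ z → suc (z + l)) size'))))
      where
      i< : i < suc l₀'
      i< = ≤-trans (m<m+n i 0<j) (≤-reflexive e)
      j< : j < suc l₀'
      j< = ≤-trans (m<n+m j 0<i) (≤-reflexive e)
      lem : ∀ l i j → suc l + i + (suc l + j) ≡ suc (l + (i + j) + suc l)
      lem = solve-∀
      size' : l₀ + (i + j) ≡ pm
      size' = trans (cong (l₀ +_) e) (trans (+-suc l₀ l₀') size)
    stp' : ∀ i → 0 < i → i + suc s' < suc l₀' → w' (i + suc s') ≤ suc (w' i)
    stp' i _ h = subst (λ z → w z ≤ suc (w' i)) (+-assoc l i (suc s')) (step (l + i) (≤-trans (≤-reflexive (+-assoc l i (suc s'))) (inside h)))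
    e2' : ∀ i → 0 < i → i < suc l₀' → l + i < suc s' → 2 ≤ w' i
    e2' i _ i< h = two (l + i) (s≤s z≤n) (inside i<) h
    bd : ∀ {n} → n ≤ g → n ∈ upTo (suc g)
    bd h = ∈-upTo⁺ (s≤s h)
    κ≤ : κ ≤ g
    κ≤ = ≤-trans (m≤n+m κ 4) (≤-trans (≤-reflexive top) (w≤g l l≤))
    s'≤g : s' ≤ g
    s'≤g = ≤-trans s'≤ pm≤g
    l₀≤ : l₀ ≤ g
    l₀≤ = ≤-trans (n≤1+n l₀) (≤-trans l≤ pm≤g)
    l₀'≤ : l₀' ≤ g
    l₀'≤ = ≤-trans (m≤n+m l₀' l) (≤-trans (≤-reflexive size) pm≤g)
    A = sumTo l₀ (λ i → w (suc i))
    B = sumTo l₀' (λ i → w' (suc i))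
    AB : A + w l + B ≡ g
    AB = total-split l₀ l₀' (sym size)
    c≤ : mid w l₀ ≤ g
    c≤ = ≤-trans (mid-≤ w l₀) (≤-trans (m≤m+n A _) (≤-trans (m≤m+n (A + w l) B) (≤-reflexive AB)))
    c'≤ : mid w' l₀' ≤ g
    c'≤ = ≤-trans (mid-≤ w' l₀') (≤-trans (m≤n+m B (A + w l)) (≤-reflexive AB))
    P = R.Encode.code w rng refl₁ stp e2
    P' = R'.Encode.code w' rng' refl' stp' e2'
    good : (tw P + tw P' + (mid w l₀ + mid w' l₀' + (4 + κ)) ≡ᵇ g) ≡ true
    good = trans (cong (_≡ᵇ g) (trans (lem (tw P) (tw P') (mid w l₀) (mid w' l₀') (4 + κ))
        (trans (cong₂ (λ a b → a + (4 + κ) + b) (R.Encode.code-tw w rng refl₁ stp e2) (R'.Encode.code-tw w' rng' refl' stp' e2'))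
          (trans (cong (λ z → A + z + B) top) AB)))) (≡ᵇ-refl g)
      where
      lem : ∀ p p' c c' q → p + p' + (c + c' + q) ≡ p + c + q + (p' + c')
      lem = solve-∀

  -- Binomial and Fibonacci numbers

  binom : ℕ → ℕ → ℕ
  binom r       zero    = 1
  binom zero    (suc e) = 0
  binom (suc r) (suc e) = binom r (suc e) + binom r e

  arr : ℕ → ℕ → List (List ℕ)
  arr r       zero    = replicate r 1 ∷ []
  arr zero    (suc e) = []
  arr (suc r) (suc e) = map (1 ∷_) (arr r (suc e)) ++ map (2 ∷_) (arr r e)

  length-arr : ∀ r e → length (arr r e) ≡ binom r e
  length-arr r       zero    = refl
  length-arr zero    (suc e) = refl
  length-arr (suc r) (suc e) = trans (length-++ (map (1 ∷_) (arr r (suc e))))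
    (cong₂ _+_ (trans (length-map (1 ∷_) (arr r (suc e))) (length-arr r (suc e))) (trans (length-map (2 ∷_) (arr r e)) (length-arr r e)))

  -- Words over {1,2} with sum `N`, sorted by length `r`: the number of twos is then `N ∸ r`.
  fibo : ℕ → ℕ
  fibo N = sumTo (suc N) (λ r → binom r (N ∸ r))

  tails : ℕ → List (List ℕ)
  tails N = concatMap (λ r → arr r (N ∸ r)) (range N)

  length-tails : ∀ N → length (tails N) ≡ fibo N
  length-tails N = trans (length-concatMap (λ r → arr r (N ∸ r)) (range N)) (trans (sumL-upTo (suc N) _) (sumTo-cong (suc N) (λ r _ → length-arr r (N ∸ r))))

  fibo-rec : ∀ N → fibo (2 + N) ≡ fibo (1 + N) + fibo N
  fibo-rec N = begin
    sumTo (3 + N) (λ r → binom r (2 + N ∸ r))            ≡⟨ sumTo-shift (2 + N) _ ⟩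
    sumTo (suc N) F + F (suc N)                           ≡⟨ cong₂ _+_ (trans (sumTo-cong (suc N) pascal) (sumTo-+ (suc N) G H)) (cong (binom (2 + N)) (n∸n≡0 N)) ⟩
    sumTo (suc N) G + sumTo (suc N) H + 1                 ≡⟨ lem (sumTo (suc N) G) (sumTo (suc N) H) ⟩
    sumTo (suc N) G + 1 + sumTo (suc N) H                 ≡⟨ cong (λ z → sumTo (suc N) G + z + sumTo (suc N) H) (cong (binom (suc N)) (n∸n≡0 N)) ⟨
    fibo (1 + N) + fibo N ∎
    where
    open ≡-Reasoning
    F = λ r → binom (suc r) (1 + N ∸ r)
    G = λ r → binom r (1 + N ∸ r)
    H = λ r → binom r (N ∸ r)
    lem : ∀ a b → a + b + 1 ≡ a + 1 + b
    lem = solve-∀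
    pascal : ∀ r → r < suc N → F r ≡ G r + H r
    pascal r r≤N rewrite +-∸-assoc 1 (≤-pred r≤N) = refl

  fibo-mono₁ : ∀ N → fibo N ≤ fibo (suc N)
  fibo-mono₁ zero    = ≤-refl
  fibo-mono₁ (suc N) = ≤-trans (m≤m+n _ _) (≤-reflexive (sym (fibo-rec N)))

  fibo-mono : ∀ {M N} → M ≤ N → fibo M ≤ fibo N
  fibo-mono {M} {N} M≤N with m≤n⇒∃[o]m+o≡n M≤N
  ... | o , refl = go o
    where
    go : ∀ o → fibo M ≤ fibo (M + o)
    go zero    = ≤-reflexive (cong fibo (sym (+-identityʳ M)))
    go (suc o) = ≤-trans (go o) (≤-trans (fibo-mono₁ (M + o)) (≤-reflexive (cong fibo (sym (+-suc M o)))))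

  fibo-double : ∀ N → fibo (suc N) ≤ 2 * fibo N
  fibo-double zero    = s≤s z≤n
  fibo-double (suc N) = ≤-trans (≤-reflexive (fibo-rec N)) (+-monoʳ-≤ (fibo (suc N)) (≤-trans (fibo-mono₁ N) (m≤m+n _ 0)))

  fibo-pos : ∀ N → 1 ≤ fibo N
  fibo-pos N = fibo-mono {0} {N} z≤n

  -- 21 f(N+1) + 13 f(N) grows by a factor of at least 21/13 in every step.
  fibo-growth : ∀ n N → 21 ^ n * fibo N ≤ 2 * (13 ^ n * fibo (N + n))
  fibo-growth n N = *-cancelˡ-≤ 34 (begin
    34 * (21 ^ n * fibo N)             ≡⟨ lem₁ (21 ^ n) (fibo N) ⟩
    21 ^ n * (34 * fibo N)             ≤⟨ *-monoʳ-≤ (21 ^ n) (lower N) ⟩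
    21 ^ n * v N                       ≤⟨ steps n ⟩
    13 ^ n * v (N + n)                 ≤⟨ *-monoʳ-≤ (13 ^ n) (upper (N + n)) ⟩
    13 ^ n * (68 * fibo (N + n))       ≡⟨ lem₂ (13 ^ n) (fibo (N + n)) ⟩
    34 * (2 * (13 ^ n * fibo (N + n))) ∎)
    where
    open ≤-Reasoning
    v : ℕ → ℕ
    v N = 21 * fibo (suc N) + 13 * fibo N
    lem₁ : ∀ a b → 34 * (a * b) ≡ a * (34 * b)
    lem₁ = solve-∀
    lem₂ : ∀ a b → a * (68 * b) ≡ 34 * (2 * (a * b))
    lem₂ = solve-∀
    lower : ∀ N → 34 * fibo N ≤ v N
    lower N = ≤-trans (≤-reflexive (*-distribʳ-+ (fibo N) 21 13)) (+-monoˡ-≤ (13 * fibo N) (*-monoʳ-≤ 21 (fibo-mono₁ N)))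
    upper : ∀ N → v N ≤ 68 * fibo N
    upper N = ≤-trans (+-monoˡ-≤ (13 * fibo N) (*-monoʳ-≤ 21 (fibo-double N))) (≤-trans (≤-reflexive (lem (fibo N))) (*-monoˡ-≤ (fibo N) (≤ᵇ-sound 55 68 refl)))
      where
      lem : ∀ a → 21 * (2 * a) + 13 * a ≡ 55 * a
      lem = solve-∀
    -- The difference of the two sides is exactly `fibo (suc N)`, because 13 · 34 - 21² = 1.
    one : ∀ N → 21 * v N ≤ 13 * v (suc N)
    one N = begin
      21 * (21 * fibo (suc N) + 13 * fibo N)                      ≤⟨ m≤m+n _ (fibo (suc N)) ⟩
      21 * (21 * fibo (suc N) + 13 * fibo N) + fibo (suc N)       ≡⟨ lem (fibo (suc N)) (fibo N) ⟩
      13 * (21 * (fibo (suc N) + fibo N) + 13 * fibo (suc N))     ≡⟨ cong (λ z → 13 * (21 * z + 13 * fibo (suc N))) (fibo-rec N) ⟨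
      13 * v (suc N) ∎
      where
      lem : ∀ a b → 21 * (21 * a + 13 * b) + a ≡ 13 * (21 * (a + b) + 13 * a)
      lem = solve-∀
    steps : ∀ n → 21 ^ n * v N ≤ 13 ^ n * v (N + n)
    steps zero    = ≤-reflexive (cong (λ z → 1 * v z) (sym (+-identityʳ N)))
    steps (suc n) = begin
      21 * 21 ^ n * v N          ≡⟨ *-assoc 21 (21 ^ n) (v N) ⟩
      21 * (21 ^ n * v N)        ≤⟨ *-monoʳ-≤ 21 (steps n) ⟩
      21 * (13 ^ n * v (N + n))  ≡⟨ lem (13 ^ n) (v (N + n)) ⟩
      13 ^ n * (21 * v (N + n))  ≤⟨ *-monoʳ-≤ (13 ^ n) (one (N + n)) ⟩
      13 ^ n * (13 * v (suc (N + n))) ≡⟨ trans (lem' (13 ^ n) _) (cong (λ z → 13 * 13 ^ n * v z) (sym (+-suc N n))) ⟩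
      13 * 13 ^ n * v (N + suc n) ∎
      where
      lem : ∀ a b → 21 * (a * b) ≡ a * (21 * b)
      lem = solve-∀
      lem' : ∀ a b → a * (13 * b) ≡ 13 * a * b
      lem' = solve-∀

  -- The left side, divided by `a ^ d`, is a single term in the expansion of (a + 1)^n.
  binom-^ : ∀ a n d → binom n d * a ^ n ≤ suc a ^ n * a ^ d
  binom-^ a n       zero    = ≤-trans (≤-reflexive (*-identityˡ (a ^ n))) (≤-trans (^-monoˡ-≤ n (n≤1+n a)) (≤-reflexive (sym (*-identityʳ (suc a ^ n)))))
  binom-^ a zero    (suc d) = z≤n
  binom-^ a (suc n) (suc d) = begin
    (binom n (suc d) + binom n d) * (a * a ^ n)                             ≡⟨ lem₁ a (binom n (suc d)) (binom n d) (a ^ n) ⟩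
    a * (binom n (suc d) * a ^ n) + a * (binom n d * a ^ n)                 ≤⟨ +-mono-≤ (*-monoʳ-≤ a (binom-^ a n (suc d))) (*-monoʳ-≤ a (binom-^ a n d)) ⟩
    a * (suc a ^ n * (a * a ^ d)) + a * (suc a ^ n * a ^ d)                 ≡⟨ lem₂ a (suc a ^ n) (a ^ d) ⟩
    suc a * suc a ^ n * (a * a ^ d) ∎
    where
    open ≤-Reasoning
    lem₁ : ∀ c a b x → (a + b) * (c * x) ≡ c * (a * x) + c * (b * x)
    lem₁ = solve-∀
    lem₂ : ∀ a x y → a * (x * (a * y)) + a * (x * y) ≡ suc a * x * (a * y)
    lem₂ = solve-∀

  binom-absorb : ∀ r e → suc e * binom (suc r) (suc e) ≡ suc r * binom r e
  binom-absorb zero    zero    = refl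
  binom-absorb zero    (suc e) = *-zeroʳ (2 + e)
  binom-absorb (suc r) zero    = trans (cong (λ z → 1 * (z + 1)) (trans (sym (*-identityˡ _)) (binom-absorb r zero))) (lem r)
    where
    lem : ∀ r → 1 * (suc r * 1 + 1) ≡ suc (suc r) * 1
    lem = solve-∀
  binom-absorb (suc r) (suc e) = begin
    suc (suc e) * (binom (suc r) (suc (suc e)) + (binom r (suc e) + binom r e))
      ≡⟨ *-distribˡ-+ (suc (suc e)) (binom (suc r) (suc (suc e))) _ ⟩
    suc (suc e) * binom (suc r) (suc (suc e)) + (binom (suc r) (suc e) + suc e * binom (suc r) (suc e))
      ≡⟨ cong₂ (λ x y → x + (binom (suc r) (suc e) + y)) (binom-absorb r (suc e)) (binom-absorb r e) ⟩
    suc r * binom r (suc e) + (binom (suc r) (suc e) + suc r * binom r e)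
      ≡⟨ lem r (binom r (suc e)) (binom r e) ⟩
    suc (suc r) * (binom r (suc e) + binom r e) ∎
    where
    open ≡-Reasoning
    lem : ∀ r a b → suc r * a + ((a + b) + suc r * b) ≡ suc (suc r) * (a + b)
    lem = solve-∀

  power-≤-binom : ∀ n d → suc n ^ d ≤ d ! * binom (n + d) d
  power-≤-binom n zero    = ≤-refl
  power-≤-binom n (suc d) = begin
    suc n * suc n ^ d                               ≤⟨ *-mono-≤ (s≤s (m≤m+n n d)) (power-≤-binom n d) ⟩
    suc (n + d) * (d ! * binom (n + d) d)           ≡⟨ lem (suc (n + d)) (d !) (binom (n + d) d) ⟩
    d ! * (suc (n + d) * binom (n + d) d)           ≡⟨ cong (d ! *_) (binom-absorb (n + d) d) ⟨
    d ! * (suc d * binom (suc (n + d)) (suc d))     ≡⟨ lem' (d !) (suc d) _ ⟩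
    suc d * d ! * binom (suc (n + d)) (suc d)       ≡⟨ cong (λ z → suc d * d ! * binom z (suc d)) (+-suc n d) ⟨
    suc d * d ! * binom (n + suc d) (suc d) ∎
    where
    open ≤-Reasoning
    lem : ∀ a b c → a * (b * c) ≡ b * (a * c)
    lem = solve-∀
    lem' : ∀ a b c → a * (b * c) ≡ b * a * c
    lem' = solve-∀

  -- A power of `suc n` is at most a constant times one binomial coefficient, and this coefficient
  -- is part of one term in the expansion of (a + 1)^(n + d).
  power-vs-exponential : ∀ a .⦃ _ : NonZero a ⦄ d → ∃ λ C → ∀ n → suc n ^ d * a ^ n ≤ C * suc a ^ n
  power-vs-exponential a d = d ! * suc a ^ d , λ n → *-cancelʳ-≤ (suc n ^ d * a ^ n) (d ! * suc a ^ d * suc a ^ n) (a ^ d) ⦃ m^n≢0 a d ⦄ (begin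
    suc n ^ d * a ^ n * a ^ d                       ≡⟨ trans (*-assoc (suc n ^ d) (a ^ n) (a ^ d)) (cong (suc n ^ d *_) (sym (^-distribˡ-+-* a n d))) ⟩
    suc n ^ d * a ^ (n + d)                         ≤⟨ *-monoˡ-≤ (a ^ (n + d)) (power-≤-binom n d) ⟩
    d ! * binom (n + d) d * a ^ (n + d)             ≡⟨ *-assoc (d !) (binom (n + d) d) (a ^ (n + d)) ⟩
    d ! * (binom (n + d) d * a ^ (n + d))           ≤⟨ *-monoʳ-≤ (d !) (binom-^ a (n + d) d) ⟩
    d ! * (suc a ^ (n + d) * a ^ d)                 ≡⟨ cong (λ z → d ! * (z * a ^ d)) (^-distribˡ-+-* (suc a) n d) ⟩
    d ! * (suc a ^ n * suc a ^ d * a ^ d)           ≡⟨ lem (d !) (suc a ^ n) (suc a ^ d) (a ^ d) ⟩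
    d ! * suc a ^ d * suc a ^ n * a ^ d ∎)
    where
    open ≤-Reasoning
    lem : ∀ a b c e → a * (b * c * e) ≡ a * c * b * e
    lem = solve-∀

  ^-*-distrib : ∀ a b n → (a * b) ^ n ≡ a ^ n * b ^ n
  ^-*-distrib a b zero    = refl
  ^-*-distrib a b (suc n) = trans (cong (a * b *_) (^-*-distrib a b n)) (lem a b (a ^ n) (b ^ n))
    where
    lem : ∀ a b x y → a * b * (x * y) ≡ a * x * (b * y)
    lem = solve-∀

  module _ (p q u v a : ℕ) .⦃ _ : NonZero a ⦄ (pu : p * u ≡ suc a) (qv : q * v ≡ a)
           (growth : ∀ n N → u ^ n * fibo N ≤ 2 * (v ^ n * fibo (N + n))) where

    subexponential : ∀ d k → ∃ λ C → ∀ x n N → x * p ^ n ≤ suc n ^ d * (2 * q ^ n) → x * fibo N * suc n ^ k ≤ C * fibo (N + n)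
    subexponential d k with power-vs-exponential a (d + k)
    ... | C , h = 4 * C , λ x n N b → *-cancelʳ-≤ (x * fibo N * suc n ^ k) (4 * C * fibo (N + n)) (suc a ^ n) ⦃ m^n≢0 (suc a) n ⦄ (begin
      x * fibo N * suc n ^ k * suc a ^ n              ≡⟨ trans (cong (x * fibo N * suc n ^ k *_) (trans (cong (_^ n) (sym pu)) (^-*-distrib p u n))) (lem₁ x (fibo N) (suc n ^ k) (p ^ n) (u ^ n)) ⟩
      (x * p ^ n) * (u ^ n * fibo N) * suc n ^ k      ≤⟨ *-monoˡ-≤ (suc n ^ k) (*-mono-≤ b (growth n N)) ⟩
      (suc n ^ d * (2 * q ^ n)) * (2 * (v ^ n * fibo (N + n))) * suc n ^ k
        ≡⟨ lem₂ (suc n ^ d) (q ^ n) (v ^ n) (fibo (N + n)) (suc n ^ k) ⟩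
      4 * ((suc n ^ d * suc n ^ k) * (q ^ n * v ^ n)) * fibo (N + n)
        ≡⟨ cong₂ (λ y z → 4 * (y * z) * fibo (N + n)) (sym (^-distribˡ-+-* (suc n) d k)) (trans (sym (^-*-distrib q v n)) (cong (_^ n) qv)) ⟩
      4 * (suc n ^ (d + k) * a ^ n) * fibo (N + n)    ≤⟨ *-monoˡ-≤ (fibo (N + n)) (*-monoʳ-≤ 4 (h n)) ⟩
      4 * (C * suc a ^ n) * fibo (N + n)              ≡⟨ lem₃ C (suc a ^ n) (fibo (N + n)) ⟩
      4 * C * fibo (N + n) * suc a ^ n ∎)
      where
      open ≤-Reasoning
      lem₁ : ∀ x f k a b → x * f * k * (a * b) ≡ (x * a) * (b * f) * k
      lem₁ = solve-∀
      lem₂ : ∀ d a b f k → (d * (2 * a)) * (2 * (b * f)) * k ≡ 4 * ((d * k) * (a * b)) * f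
      lem₂ = solve-∀
      lem₃ : ∀ c x f → 4 * (c * x) * f ≡ 4 * c * f * x
      lem₃ = solve-∀

  -- 50/31 < 21/13: a quantity bounded by a polynomial times (50/31)ⁿ is small against the growth of fibo over n steps.
  abstract
    negligible : ∀ d k → ∃ λ C → ∀ x n N → x * 31 ^ n ≤ suc n ^ d * (2 * 50 ^ n) → x * fibo N * suc n ^ k ≤ C * fibo (N + n)
    -- 31 · 21 = 651 and 50 · 13 = 650: the remaining factor (650/651)^n absorbs every power of
    -- `suc n`.
    negligible = subexponential 31 50 21 13 650 refl refl fibo-growth

  -- Σ_{n > K} 1/(n (n+1)) = 1/(K+1)
  inverse-square-tail : ∀ (a : ℕ → ℕ) A K j → (∀ i → i < j → a i * suc (suc K + i) ^ 2 ≤ A) → suc K * sumTo j a ≤ A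
  inverse-square-tail a A K j h = *-cancelˡ-≤ (suc (K + j)) (≤-trans (≤-reflexive (lem (suc (K + j)) (suc K) (sumTo j a)))
      (≤-trans (go j h) (≤-trans (*-monoʳ-≤ A (≤-trans (m≤n+m j K) (n≤1+n _))) (≤-reflexive (*-comm A _)))))
    where
    open ≤-Reasoning
    lem : ∀ x k s → x * (k * s) ≡ k * x * s
    lem = solve-∀
    go : ∀ j → (∀ i → i < j → a i * suc (suc K + i) ^ 2 ≤ A) → suc K * suc (K + j) * sumTo j a ≤ A * j
    go zero    h = ≤-trans (≤-reflexive (*-zeroʳ (suc K * suc (K + 0)))) z≤n
    go (suc j) h = *-cancelˡ-≤ (suc (K + j)) (begin
      suc (K + j) * (suc K * suc (K + suc j) * (sumTo j a + a j))
        ≡⟨ cong (λ z → suc (K + j) * (suc K * suc z * (sumTo j a + a j))) (+-suc K j) ⟩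
      suc (K + j) * (suc K * suc (suc (K + j)) * (sumTo j a + a j))
        ≡⟨ lem₁ (K + j) K (sumTo j a) (a j) ⟩
      suc (suc (K + j)) * (suc K * suc (K + j) * sumTo j a) + suc K * (a j * (suc (K + j) * suc (suc (K + j))))
        ≤⟨ +-mono-≤ (*-monoʳ-≤ (suc (suc (K + j))) (go j (λ i i<j → h i (m<n⇒m<1+n i<j)))) (*-monoʳ-≤ (suc K) last) ⟩
      suc (suc (K + j)) * (A * j) + suc K * A
        ≡⟨ lem₂ K j A ⟩
      suc (K + j) * (A * suc j) ∎)
      where
      lem₁ : ∀ n K s a → suc n * (suc K * suc (suc n) * (s + a)) ≡ suc (suc n) * (suc K * suc n * s) + suc K * (a * (suc n * suc (suc n)))
      lem₁ = solve-∀
      lem₂ : ∀ K j A → suc (suc (K + j)) * (A * j) + suc K * A ≡ suc (K + j) * (A * suc j)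
      lem₂ = solve-∀
      last : a j * (suc (K + j) * suc (suc (K + j))) ≤ A
      last = ≤-trans (*-monoʳ-≤ (a j) (*-mono-≤ (n≤1+n (suc (K + j))) (≤-reflexive (sym (*-identityʳ _))))) (h j ≤-refl)

  -- Words with a long head

  slice : (ℕ → ℕ) → ℕ → List ℕ
  slice f zero    = []
  slice f (suc r) = f 0 ∷ slice (f ∘ suc) r

  length-slice : ∀ f r → length (slice f r) ≡ r
  length-slice f zero    = refl
  length-slice f (suc r) = cong suc (length-slice (f ∘ suc) r)

  slice-ext : ∀ f f' r → slice f r ≡ slice f' r → ∀ i → i < r → f i ≡ f' i
  slice-ext f f' (suc r) e zero    _        = proj₁ (∷-injective e)
  slice-ext f f' (suc r) e (suc i) (s≤s i<) = slice-ext (f ∘ suc) (f' ∘ suc) r (proj₂ (∷-injective e)) i i<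

  slice-arr : ∀ f r → (∀ i → i < r → 1 ≤ f i × f i ≤ 2) → ∃ λ e → sumTo r f ≡ r + e × slice f r ∈ arr r e
  slice-arr f zero    h = 0 , refl , here refl
  slice-arr f (suc r) h with f 0 in e₀ | h 0 (s≤s z≤n) | slice-arr (f ∘ suc) r (λ i i< → h (suc i) (s≤s i<))
  ... | 1 | _ | zero  , s , p = 0 , trans (sumTo-shift r f) (cong₂ _+_ e₀ s) , ones p
    where
    ones : slice (f ∘ suc) r ∈ arr r 0 → (1 ∷ slice (f ∘ suc) r) ∈ arr (suc r) 0
    ones (here e) = here (cong (1 ∷_) e)
  ... | 1 | _ | suc e , s , p = suc e , trans (sumTo-shift r f) (cong₂ _+_ e₀ s) , ∈-++⁺ˡ (∈-map⁺ (1 ∷_) p)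
  ... | 2 | _ | e     , s , p = suc e , trans (sumTo-shift r f) (trans (cong₂ _+_ e₀ s) (cong suc (sym (+-suc r e)))) ,
          ∈-++⁺ʳ (map (1 ∷_) (arr r (suc e))) (∈-map⁺ (2 ∷_) p)
  ... | suc (suc (suc _)) | (_ , s≤s (s≤s ())) | _

  arr-tails : ∀ {N t} r e → N ≡ r + e → t ∈ arr r e → t ∈ tails N
  arr-tails r e refl p = concatMap-∈⁺ (∈-upTo⁺ (s≤s (m≤m+n r e))) (subst (λ z → _ ∈ arr r z) (sym (m+n∸m≡n r e)) p)

  -- (s' , l₀ , c): the last letter 3 is at suc l₀, the first letter 1 at suc s', and c is fixed by the reflection.
  HeadTuple : Set
  HeadTuple = ℕ × ℕ × ℕ

  headTuples : ℕ → List HeadTuple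
  headTuples n = box n (box n (range n))

  HeadCode : Set
  HeadCode = HeadTuple × List Pair

  admissible₂ : ℕ → HeadTuple → List (List Pair)
  admissible₂ n (s' , l₀ , c) = filterᵇ (λ P → tw P + (c + 3) ≡ᵇ n) (R.words R.N)
    where module R = Region 3 potential₃ s' l₀ 0

  headCodes : ℕ → List HeadCode
  headCodes n = concatMap (λ t → map (t ,_) (admissible₂ n t)) (headTuples n)

  headCodes-count : ∀ n → length (headCodes n) * 31 ^ n ≤ suc n ^ 3 * (2 * 50 ^ n)
  headCodes-count n = ≤-trans (length-concatMap-bound (λ t → map (t ,_) (admissible₂ n t)) (headTuples n) (31 ^ n) (2 * 50 ^ n)
      (λ { t@(s' , l₀ , c) _ → ≤-trans (≤-reflexive (cong (_* 31 ^ n) (length-map (t ,_) (admissible₂ n t)))) (OneRegion.count 3 potential₃ s' l₀ (c + 3) n) }))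
    (≤-reflexive (cong (_* (2 * 50 ^ n)) (trans (length-box n (box n (range n)) (length-box n (range n) (length-upTo (suc n)))) (lem (suc n)))))
    where
    lem : ∀ n → n * (n * n) ≡ n * (n * (n * 1))
    lem = solve-∀

  Code₂ : Set
  Code₂ = HeadCode × List ℕ

  codes₂ : ℕ → ℕ → List Code₂
  codes₂ K g = concatMap (λ j → cartesianProduct (headCodes (suc K + j)) (tails (g ∸ (suc K + j)))) (upTo (g ∸ K))

  codes₁-small : ∀ Y → ∃ λ M → ∀ g → M ≤ g → Y * length (codes₁ g) ≤ fibo g
  codes₁-small Y = go (proj₁ (negligible 6 1)) (proj₂ (negligible 6 1))
    where
    open ≤-Reasoning
    lem : ∀ y x g → y * x * g ≡ y * (x * 1 * (g * 1))
    lem = solve-∀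
    lem' : ∀ y c f → y * (c * f) ≡ f * (c * y)
    lem' = solve-∀
    go : ∀ C → (∀ x n N → x * 31 ^ n ≤ suc n ^ 6 * (2 * 50 ^ n) → x * fibo N * suc n ^ 1 ≤ C * fibo (N + n)) →
      ∃ λ M → ∀ g → M ≤ g → Y * length (codes₁ g) ≤ fibo g
    go C h = C * Y , λ g M≤ → *-cancelʳ-≤ (Y * length (codes₁ g)) (fibo g) (suc g) (begin
      Y * length (codes₁ g) * suc g              ≡⟨ lem Y (length (codes₁ g)) (suc g) ⟩
      Y * (length (codes₁ g) * 1 * (suc g * 1))  ≤⟨ *-monoʳ-≤ Y (h (length (codes₁ g)) g 0 (codes₁-count g)) ⟩
      Y * (C * fibo g)                           ≡⟨ lem' Y C (fibo g) ⟩
      fibo g * (C * Y)                           ≤⟨ *-monoʳ-≤ (fibo g) (≤-trans M≤ (n≤1+n g)) ⟩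
      fibo g * suc g ∎)

  length-codes₂ : ∀ K g → length (codes₂ K g) ≡ sumTo (g ∸ K) (λ j → length (headCodes (suc K + j)) * length (tails (g ∸ (suc K + j))))
  length-codes₂ K g = trans (length-concatMap (λ j → cartesianProduct (headCodes (suc K + j)) (tails (g ∸ (suc K + j)))) (upTo (g ∸ K)))
    (trans (sumL-upTo (g ∸ K) (λ j → length (cartesianProduct (headCodes (suc K + j)) (tails (g ∸ (suc K + j))))))
      (sumTo-cong (g ∸ K) (λ j _ → length-cartesianProduct (headCodes (suc K + j)) (tails (g ∸ (suc K + j))))))

  -- A head of sum `n` is exponentially rarer than the Fibonacci growth over the same `n` steps. Two
  -- spare powers of `suc n` make the sum over all `n > K` of order 1/K, uniformly in `g`.
  codes₂-small : ∀ Y → ∃ λ K → ∀ g → Y * length (codes₂ K g) ≤ fibo g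
  codes₂-small Y = go (proj₁ (negligible 3 2)) (proj₂ (negligible 3 2))
    where
    open ≤-Reasoning
    go : ∀ C → (∀ x n N → x * 31 ^ n ≤ suc n ^ 3 * (2 * 50 ^ n) → x * fibo N * suc n ^ 2 ≤ C * fibo (N + n)) →
      ∃ λ K → ∀ g → Y * length (codes₂ K g) ≤ fibo g
    go C h = K , λ g → *-cancelˡ-≤ (suc C) (begin
      suc C * (Y * length (codes₂ K g))   ≡⟨ *-assoc (suc C) Y _ ⟨
      K * length (codes₂ K g)             ≤⟨ *-monoˡ-≤ (length (codes₂ K g)) (n≤1+n K) ⟩
      suc K * length (codes₂ K g)         ≡⟨ cong (suc K *_) (length-codes₂ K g) ⟩
      suc K * sumTo (g ∸ K) (a g)         ≤⟨ inverse-square-tail (a g) (suc C * fibo g) K (g ∸ K) (each g) ⟩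
      suc C * fibo g ∎)
      where
      K = suc C * Y
      a : ℕ → ℕ → ℕ
      a g j = length (headCodes (suc K + j)) * length (tails (g ∸ (suc K + j)))
      each : ∀ g i → i < g ∸ K → a g i * suc (suc K + i) ^ 2 ≤ suc C * fibo g
      each g i i< = begin
        a g i * suc (suc K + i) ^ 2
          ≡⟨ cong (λ z → length (headCodes (suc K + i)) * z * suc (suc K + i) ^ 2) (length-tails (g ∸ (suc K + i))) ⟩
        length (headCodes (suc K + i)) * fibo (g ∸ (suc K + i)) * suc (suc K + i) ^ 2
          ≤⟨ h (length (headCodes (suc K + i))) (suc K + i) (g ∸ (suc K + i)) (headCodes-count (suc K + i)) ⟩
        C * fibo (g ∸ (suc K + i) + (suc K + i))
          ≡⟨ cong (λ z → C * fibo z) (m∸n+n≡m le) ⟩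
        C * fibo g
          ≤⟨ m≤n+m (C * fibo g) (fibo g) ⟩
        suc C * fibo g ∎
        where
        le : suc K + i ≤ g
        le = ≤-trans (≤-reflexive (sym (+-suc K i))) (≤-trans (+-monoʳ-≤ K i<) (≤-reflexive (m+[n∸m]≡n {K} {g} (<⇒≤ (m∸n≢0⇒n<m {g} {K} (λ z → case subst (i <_) z i< of λ ()))))))

  record Rep₂ (g : ℕ) (G : List ℕ) (x : Code₂) : Set where
    l₀ = proj₁ (proj₂ (proj₁ (proj₁ x)))
    c  = proj₂ (proj₂ (proj₁ (proj₁ x)))
    field
      K : Kunz g G
      r : ℕ
    open Kunz K
    field
      size : pm ≡ suc l₀ + r
      top  : w (suc l₀) ≡ 3
      mid₁ : mid w l₀ ≡ c
      list₁ : bld (pairAt w (suc l₀)) ⌊ l₀ /2⌋ ≡ proj₂ (proj₁ x)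
      list₂ : slice (λ i → w (suc l₀ + suc i)) r ≡ proj₂ x

  Rep₂-injective : ∀ {g G G' x} → Rep₂ g G x → Rep₂ g G' x → G ≡ G'
  Rep₂-injective {x = ((s' , l₀ , c) , P) , t} ρ σ = kunz-ext ρ.K σ.K (trans ρ.size (trans (cong (suc l₀ +_) r≡) (sym σ.size))) eq
    where
    module ρ = Rep₂ ρ
    module σ = Rep₂ σ
    w = Kunz.w ρ.K
    v = Kunz.w σ.K
    r≡ : ρ.r ≡ σ.r
    r≡ = trans (sym (length-slice _ ρ.r)) (trans (cong length (trans ρ.list₂ (sym σ.list₂))) (length-slice _ σ.r))
    eq : ∀ i → i < suc (Kunz.pm ρ.K) → w i ≡ v i
    eq zero    _ = trans (Kunz.w0 ρ.K) (sym (Kunz.w0 σ.K))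
    eq (suc i) i< with <-cmp i l₀
    ... | tri< lt _ _   = region-ext w v l₀ (trans ρ.list₁ (sym σ.list₁)) (trans ρ.mid₁ (sym σ.mid₁)) i lt
    ... | tri≈ _ refl _ = trans ρ.top (sym σ.top)
    ... | tri> _ _ gt with m≤n⇒∃[o]m+o≡n gt
    ...   | o , refl = subst (λ z → w z ≡ v z) (+-suc (suc l₀) o)
              (slice-ext (λ i → w (suc l₀ + suc i)) (λ i → v (suc l₀ + suc i)) ρ.r
                (trans ρ.list₂ (trans (sym σ.list₂) (cong (slice (λ i → v (suc l₀ + suc i))) (sym r≡)))) o
                (+-cancelˡ-< (suc l₀) o ρ.r (subst (suc l₀ + o <_) ρ.size (≤-pred i<))))

  -- Up to the last letter 3 the reflection applies as for larger letters. After it the letters are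
  -- 1 or 2 and are kept literally; the head sum includes the final 3.
  encode₂ : ∀ {g G} (K : Kunz g G) l₀ r Kmax → Kunz.pm K ≡ suc l₀ + r → (∀ i → i ≤ suc l₀ → Kunz.w K i ≤ 3) → Kunz.w K (suc l₀) ≡ 3 →
    (∀ i → suc l₀ < i → i ≤ Kunz.pm K → Kunz.w K i ≤ 2) → Kmax < sumTo l₀ (λ i → Kunz.w K (suc i)) + 3 →
    ∃ λ x → x ∈ codes₂ Kmax g × Rep₂ g G x
  encode₂ {g} {G} K l₀ r Kmax size ≤3 top ≤2 big with m≤n⇒∃[o]m+o≡n big | KunzFacts.firstOne K l₀ (≤-trans (n≤1+n l₀) (≤-trans (m≤m+n (suc l₀) r) (≤-reflexive (sym size))))
  ... | j , nj | s' , s'≤ , two , step with slice-arr (λ i → Kunz.w K (suc l₀ + suc i)) r (λ i i< →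
          Kunz.pos K (suc l₀ + suc i) (s≤s z≤n) (s≤s (≤-trans (+-monoʳ-≤ (suc l₀) i<) (≤-reflexive (sym size)))) ,
          ≤2 (suc l₀ + suc i) (m<m+n (suc l₀) (s≤s z≤n)) (≤-trans (+-monoʳ-≤ (suc l₀) i<) (≤-reflexive (sym size))))
  ...   | e , sum-e , sl∈ = ((t , P) , slice (λ i → w (l + suc i)) r) ,
      concatMap-∈⁺ {f = λ j → cartesianProduct (headCodes (suc Kmax + j)) (tails (g ∸ (suc Kmax + j)))} {xs = upTo (g ∸ Kmax)}
        (∈-upTo⁺ j<) (∈-cartesianProduct⁺ head∈ (arr-tails r e rest sl∈)) ,
      record { K = K ; r = r ; size = size ; top = top ; mid₁ = refl ; list₁ = refl ; list₂ = refl }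
    where
    open Kunz K hiding (m)
    open KunzFacts K
    l = suc l₀
    n = suc Kmax + j
    l≤ : l ≤ pm
    l≤ = ≤-trans (m≤m+n (suc l₀) r) (≤-reflexive (sym size))
    t : HeadTuple
    t = s' , l₀ , mid w l₀
    module R  = Region 3 potential₃ s' l₀ 0
    A = sumTo l₀ (λ i → w (suc i))
    AB : A + w l + sumTo r (λ i → w (l + suc i)) ≡ g
    AB = total-split l₀ r size
    n+rest : n + sumTo r (λ i → w (l + suc i)) ≡ g
    n+rest = trans (cong (_+ sumTo r (λ i → w (l + suc i))) (trans nj (cong (A +_) (sym top)))) AB
    n≤g : n ≤ g
    n≤g = ≤-trans (m≤m+n n _) (≤-reflexive n+rest)
    j< : j < g ∸ Kmax
    j< = m+n≤o⇒m≤o∸n (suc j) (≤-trans (≤-reflexive (cong suc (+-comm j Kmax))) n≤g)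
    rest : g ∸ n ≡ r + e
    rest = trans (cong (_∸ n) (sym n+rest)) (trans (m+n∸m≡n n _) sum-e)
    bd : ∀ {i} → i ≤ n → i ∈ range n
    bd h = ∈-upTo⁺ (s≤s h)
    A≤n : A ≤ n
    A≤n = ≤-trans (m≤m+n A 3) (≤-reflexive (sym nj))
    c≤n : mid w l₀ ≤ n
    c≤n = ≤-trans (mid-≤ w l₀) A≤n
    inside : ∀ {i} → i < l → i < suc pm
    inside h = s≤s (≤-trans (<⇒≤ h) l≤)
    l₀≤n : l₀ ≤ n
    l₀≤n = ≤-trans (≤-reflexive (sym (sumTo-one l₀))) (≤-trans (sumTo-mono l₀ (λ i i< → pos (suc i) (s≤s z≤n) (inside (s≤s i<)))) A≤n)
    rng : ∀ i → 0 < i → i < l → 1 ≤ w i × w i ≤ 3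
    rng i 0<i i<l = pos i 0<i (inside i<l) , ≤3 i (<⇒≤ i<l)
    rfl : ∀ i j → 0 < i → 0 < j → i + j ≡ l → 3 ≤ w i + w j
    rfl i j _ _ e = ≤-trans (≤-reflexive (trans (sym top) (cong w (sym e)))) (sub i j (s≤s (≤-trans (≤-reflexive e) l≤)))
    stp : ∀ i → 0 < i → i + suc s' < l → w (i + suc s') ≤ suc (w i)
    stp i _ h = step i (≤-pred h)
    e2 : ∀ i → 0 < i → i < l → 0 + i < suc s' → 2 ≤ w i
    e2 i 0<i i<l h = two i 0<i (≤-pred i<l) h
    P = R.Encode.code w rng rfl stp e2
    good : (tw P + (mid w l₀ + 3) ≡ᵇ n) ≡ true
    good = trans (cong (_≡ᵇ n) (trans (sym (+-assoc (tw P) _ 3)) (trans (cong (_+ 3) (R.Encode.code-tw w rng rfl stp e2)) (sym nj)))) (≡ᵇ-refl n)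
    P∈ : P ∈ admissible₂ n t
    P∈ = filterᵇ-∈⁺ (λ P → tw P + (mid w l₀ + 3) ≡ᵇ n) (R.Encode.code-∈ w rng rfl stp e2) good
    t∈ : t ∈ headTuples n
    t∈ = ∈-cartesianProduct⁺ (bd (≤-trans s'≤ l₀≤n)) (∈-cartesianProduct⁺ (bd l₀≤n) (bd c≤n))
    head∈ : (t , P) ∈ headCodes n
    head∈ = concatMap-∈⁺ {f = λ t → map (t ,_) (admissible₂ n t)} {xs = headTuples n} t∈ (∈-map⁺ (t ,_) P∈)

  module Deviation where
    open import Data.Integer using (+_)

    -- Deviation from the typical number of twos

    sumZ : ℕ → (ℕ → ℤ) → ℤ
    sumZ zero    F = + 0
    sumZ (suc n) F = sumZ n F ℤ.+ F n

    sumZ-cong : ∀ n {F G : ℕ → ℤ} → (∀ i → i < n → F i ≡ G i) → sumZ n F ≡ sumZ n G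
    sumZ-cong zero    h = refl
    sumZ-cong (suc n) h = cong₂ ℤ._+_ (sumZ-cong n (λ i i< → h i (m<n⇒m<1+n i<))) (h n ≤-refl)

    sumZ-mono : ∀ n {F G : ℕ → ℤ} → (∀ i → i < n → F i ℤ.≤ G i) → sumZ n F ℤ.≤ sumZ n G
    sumZ-mono zero    h = ℤP.≤-refl
    sumZ-mono (suc n) h = ℤP.+-mono-≤ (sumZ-mono n (λ i i< → h i (m<n⇒m<1+n i<))) (h n ≤-refl)

    sumZ-+ : ∀ n (F G : ℕ → ℤ) → sumZ n (λ i → F i ℤ.+ G i) ≡ sumZ n F ℤ.+ sumZ n G
    sumZ-+ zero    F G = refl
    sumZ-+ (suc n) F G = trans (cong (ℤ._+ (F n ℤ.+ G n)) (sumZ-+ n F G)) (lem (sumZ n F) (sumZ n G) (F n) (G n))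
      where
      lem : ∀ a b c d → a ℤ.+ b ℤ.+ (c ℤ.+ d) ≡ a ℤ.+ c ℤ.+ (b ℤ.+ d)
      lem = ℤS.solve-∀

    sumZ-shift : ∀ n (F : ℕ → ℤ) → sumZ (suc n) F ≡ F 0 ℤ.+ sumZ n (λ i → F (suc i))
    sumZ-shift zero    F = ℤP.+-comm (+ 0) (F 0)
    sumZ-shift (suc n) F = trans (cong (ℤ._+ F (suc n)) (sumZ-shift n F)) (ℤP.+-assoc (F 0) _ (F (suc n)))

    sumZ-pos : ∀ n (F : ℕ → ℕ) → sumZ n (λ i → + F i) ≡ + sumTo n F
    sumZ-pos zero    F = refl
    sumZ-pos (suc n) F = cong (ℤ._+ + F n) (sumZ-pos n F)

    cancelˡ : ∀ x y z → x ℤ.+ y ≡ x ℤ.+ z → y ≡ z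
    cancelˡ x y z e = trans (lem x y) (trans (cong (ℤ._- x) e) (sym (lem x z)))
      where
      lem : ∀ x y → y ≡ x ℤ.+ y ℤ.- x
      lem = ℤS.solve-∀

    binomℤ : ℕ → ℕ → ℤ
    binomℤ r e = + binom r e

    absorb : ∀ r e → (+ suc e) ℤ.* binomℤ (suc r) (suc e) ≡ (+ suc r) ℤ.* binomℤ r e
    absorb r e = trans (sym (ℤP.pos-* (suc e) (binom (suc r) (suc e)))) (trans (cong +_ (binom-absorb r e)) (ℤP.pos-* (suc r) (binom r e)))

    absorb-upper : ∀ r e → (+ 1 ℤ.+ + r) ℤ.* binomℤ r e ≡ (+ 1 ℤ.+ + r ℤ.- + e) ℤ.* binomℤ (suc r) e
    absorb-upper r zero    = cong (ℤ._* + 1) (sym (ℤP.+-identityʳ (+ suc r)))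
    absorb-upper r (suc e) = trans (lem₁ (+ r) (binomℤ r (suc e)) (binomℤ r e)) (trans (cong (λ z → (+ 1 ℤ.+ + r) ℤ.* (binomℤ r (suc e) ℤ.+ binomℤ r e) ℤ.- z) (sym (absorb r e))) (lem₂ (+ r) (+ e) (binomℤ r (suc e) ℤ.+ binomℤ r e)))
      where
      lem₁ : ∀ r x y → (+ 1 ℤ.+ r) ℤ.* x ≡ (+ 1 ℤ.+ r) ℤ.* (x ℤ.+ y) ℤ.- (+ 1 ℤ.+ r) ℤ.* y
      lem₁ = ℤS.solve-∀
      lem₂ : ∀ r e z → (+ 1 ℤ.+ r) ℤ.* z ℤ.- (+ 1 ℤ.+ e) ℤ.* z ≡ (+ 1 ℤ.+ r ℤ.- (+ 1 ℤ.+ e)) ℤ.* z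
      lem₂ = ℤS.solve-∀

    -- The ratio of consecutive terms along the antidiagonal, that is, of the numbers of words over
    -- {1,2} of equal sum with lengths `r` and `suc r`.
    neighbours : ∀ r e → (+ 1 ℤ.+ + r) ℤ.* (+ 1 ℤ.+ + e) ℤ.* binomℤ r (suc e) ≡ (+ 1 ℤ.+ + r ℤ.- + e) ℤ.* (+ r ℤ.- + e) ℤ.* binomℤ (suc r) e
    neighbours r e = begin
      R ℤ.* E ℤ.* binomℤ r (suc e)                                   ≡⟨ lem₁ R E (binomℤ r (suc e)) ⟩
      E ℤ.* (R ℤ.* binomℤ r (suc e))                                 ≡⟨ cong (E ℤ.*_) (absorb-upper r (suc e)) ⟩
      E ℤ.* ((R ℤ.- E) ℤ.* binomℤ (suc r) (suc e))                   ≡⟨ lem₂ E (+ r) (+ e) (binomℤ (suc r) (suc e)) ⟩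
      (+ r ℤ.- + e) ℤ.* (E ℤ.* binomℤ (suc r) (suc e))               ≡⟨ cong ((+ r ℤ.- + e) ℤ.*_) (trans (absorb r e) (absorb-upper r e)) ⟩
      (+ r ℤ.- + e) ℤ.* ((R ℤ.- + e) ℤ.* binomℤ (suc r) e)           ≡⟨ lem₃ (+ r ℤ.- + e) (R ℤ.- + e) (binomℤ (suc r) e) ⟩
      (R ℤ.- + e) ℤ.* (+ r ℤ.- + e) ℤ.* binomℤ (suc r) e ∎
      where
      open ≡-Reasoning
      R = + 1 ℤ.+ + r
      E = + 1 ℤ.+ + e
      lem₁ : ∀ a b c → a ℤ.* b ℤ.* c ≡ b ℤ.* (a ℤ.* c)
      lem₁ = ℤS.solve-∀
      lem₂ : ∀ a r e c → a ℤ.* ((+ 1 ℤ.+ r ℤ.- (+ 1 ℤ.+ e)) ℤ.* c) ≡ (r ℤ.- e) ℤ.* (a ℤ.* c)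
      lem₂ = ℤS.solve-∀
      lem₃ : ∀ a b c → a ℤ.* (b ℤ.* c) ≡ b ℤ.* a ℤ.* c
      lem₃ = ℤS.solve-∀

    -- d² − r e with d = r − e; it vanishes at the typical proportion of twos.
    form : ℤ → ℤ → ℤ
    form r e = (r ℤ.- e) ℤ.* (r ℤ.- e) ℤ.- r ℤ.* e

    dev : ℕ → ℕ → ℤ
    dev r e = form (+ r) (+ e)

    module SecondMoment (N : ℕ) where
      c : ℕ → ℤ
      c r = binomℤ r (N ∸ r)
      e : ℕ → ℤ
      e r = + (N ∸ r)
      d : ℕ → ℤ
      d r = + r ℤ.- e r
      D : ℕ → ℤ
      D r = dev r (N ∸ r)
      -- `f r` comes from the left side of `neighbours` multiplied by `D`, and `g` is the same
      -- quantity expressed at the next index. There `d` has grown by 2, and `D − 5 d + 5` is the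
      -- former value of `D`.
      f g : ℕ → ℤ
      f r = c r ℤ.* ((+ 1 ℤ.+ + r) ℤ.* e r ℤ.* D r)
      g r = c r ℤ.* (d r ℤ.* (d r ℤ.- + 1) ℤ.* (D r ℤ.- + 5 ℤ.* d r ℤ.+ + 5))

      shifted : ∀ r → r < N → f r ≡ g (suc r)
      shifted r r<N with m≤n⇒∃[o]m+o≡n r<N
      ... | o , refl rewrite m+n∸m≡n r o | trans (cong (_∸ r) (sym (+-suc r o))) (m+n∸m≡n r (suc o)) = begin
        x ℤ.* ((+ 1 ℤ.+ + r) ℤ.* (+ 1 ℤ.+ + o) ℤ.* form (+ r) (+ 1 ℤ.+ + o))
          ≡⟨ lem₁ x (+ 1 ℤ.+ + r) (+ 1 ℤ.+ + o) (form (+ r) (+ 1 ℤ.+ + o)) ⟩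
        (+ 1 ℤ.+ + r) ℤ.* (+ 1 ℤ.+ + o) ℤ.* x ℤ.* form (+ r) (+ 1 ℤ.+ + o)
          ≡⟨ cong (ℤ._* form (+ r) (+ 1 ℤ.+ + o)) (neighbours r o) ⟩
        (+ 1 ℤ.+ + r ℤ.- + o) ℤ.* (+ r ℤ.- + o) ℤ.* y ℤ.* form (+ r) (+ 1 ℤ.+ + o)
          ≡⟨ lem₂ (+ r) (+ o) y ⟩
        _ ∎
        where
        open ≡-Reasoning
        x = binomℤ r (suc o)
        y = binomℤ (suc r) o
        lem₁ : ∀ x r e f → x ℤ.* (r ℤ.* e ℤ.* f) ≡ r ℤ.* e ℤ.* x ℤ.* f
        lem₁ = ℤS.solve-∀
        lem₂ : ∀ r o y → (+ 1 ℤ.+ r ℤ.- o) ℤ.* (r ℤ.- o) ℤ.* y ℤ.* ((r ℤ.- (+ 1 ℤ.+ o)) ℤ.* (r ℤ.- (+ 1 ℤ.+ o)) ℤ.- r ℤ.* (+ 1 ℤ.+ o)) ≡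
          y ℤ.* ((+ 1 ℤ.+ r ℤ.- o) ℤ.* (+ 1 ℤ.+ r ℤ.- o ℤ.- + 1) ℤ.* ((+ 1 ℤ.+ r ℤ.- o) ℤ.* (+ 1 ℤ.+ r ℤ.- o) ℤ.- (+ 1 ℤ.+ r) ℤ.* o ℤ.- + 5 ℤ.* (+ 1 ℤ.+ r ℤ.- o) ℤ.+ + 5))
        lem₂ = ℤS.solve-∀

      f-last : f N ≡ + 0
      f-last rewrite n∸n≡0 N = lem (+ N) (binomℤ N 0) (form (+ N) (+ 0))
        where
        lem : ∀ n x y → x ℤ.* ((+ 1 ℤ.+ n) ℤ.* + 0 ℤ.* y) ≡ + 0
        lem = ℤS.solve-∀

      g-first : ∀ M → M ≡ N → g 0 ≡ + 0
      g-first zero    refl = refl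
      g-first (suc M) refl = refl

      telescope : sumZ (suc N) f ≡ sumZ (suc N) g
      telescope = begin
        sumZ N f ℤ.+ f N                  ≡⟨ cong₂ ℤ._+_ (sumZ-cong N shifted) (trans f-last (sym (g-first N refl))) ⟩
        sumZ N (λ r → g (suc r)) ℤ.+ g 0  ≡⟨ ℤP.+-comm _ (g 0) ⟩
        g 0 ℤ.+ sumZ N (λ r → g (suc r))  ≡⟨ sumZ-shift N g ⟨
        sumZ (suc N) g ∎
        where open ≡-Reasoning

      square upper : ℕ → ℤ
      square r = c r ℤ.* (D r ℤ.* D r)
      upper r  = c r ℤ.* (+ r ℤ.* D r ℤ.+ + 5 ℤ.* d r ℤ.* ((d r ℤ.- + 1) ℤ.* (d r ℤ.- + 1)))

      -- The sums of `f` and `g` agree by telescoping, and `f + square − g` has lower degree: since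
      -- (1 + r) e + D - d (d - 1) = r, the terms of degree four cancel. A sum of squares of size N⁴
      -- becomes a sum of terms of size N³.
      moment : sumZ (suc N) square ≡ sumZ (suc N) upper
      moment = cancelˡ (sumZ (suc N) f) (sumZ (suc N) square) (sumZ (suc N) upper) (begin
        sumZ (suc N) f ℤ.+ sumZ (suc N) square    ≡⟨ sumZ-+ (suc N) f square ⟨
        sumZ (suc N) (λ r → f r ℤ.+ square r)     ≡⟨ sumZ-cong (suc N) (λ r _ → lem (c r) (+ r) (e r)) ⟩
        sumZ (suc N) (λ r → g r ℤ.+ upper r)      ≡⟨ sumZ-+ (suc N) g upper ⟩
        sumZ (suc N) g ℤ.+ sumZ (suc N) upper     ≡⟨ cong (ℤ._+ sumZ (suc N) upper) telescope ⟨
        sumZ (suc N) f ℤ.+ sumZ (suc N) upper ∎)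
        where
        open ≡-Reasoning
        lem : ∀ c r e → c ℤ.* ((+ 1 ℤ.+ r) ℤ.* e ℤ.* ((r ℤ.- e) ℤ.* (r ℤ.- e) ℤ.- r ℤ.* e)) ℤ.+ c ℤ.* (((r ℤ.- e) ℤ.* (r ℤ.- e) ℤ.- r ℤ.* e) ℤ.* ((r ℤ.- e) ℤ.* (r ℤ.- e) ℤ.- r ℤ.* e)) ≡
          c ℤ.* ((r ℤ.- e) ℤ.* ((r ℤ.- e) ℤ.- + 1) ℤ.* (((r ℤ.- e) ℤ.* (r ℤ.- e) ℤ.- r ℤ.* e) ℤ.- + 5 ℤ.* (r ℤ.- e) ℤ.+ + 5)) ℤ.+
          c ℤ.* (r ℤ.* ((r ℤ.- e) ℤ.* (r ℤ.- e) ℤ.- r ℤ.* e) ℤ.+ + 5 ℤ.* (r ℤ.- e) ℤ.* (((r ℤ.- e) ℤ.- + 1) ℤ.* ((r ℤ.- e) ℤ.- + 1)))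
        lem = ℤS.solve-∀

    binom-zero : ∀ r e → r < e → binom r e ≡ 0
    binom-zero zero    (suc e) _        = refl
    binom-zero (suc r) (suc e) (s≤s lt) = cong₂ _+_ (binom-zero r (suc e) (m<n⇒m<1+n lt)) (binom-zero r e lt)

    ∣∣-square : ∀ z → + (∣ z ∣ * ∣ z ∣) ≡ z ℤ.* z
    ∣∣-square (+ n)       = ℤP.pos-* n n
    ∣∣-square ℤ.-[1+ n ] = refl

    second-moment : ∀ N → sumTo (suc N) (λ r → binom r (N ∸ r) * (∣ dev r (N ∸ r) ∣ * ∣ dev r (N ∸ r) ∣)) ≤ fibo N * (6 * N ^ 3)
    second-moment N = ℤP.drop‿+≤+ (begin
      + sumTo (suc N) (λ r → binom r (N ∸ r) * (∣ dev r (N ∸ r) ∣ * ∣ dev r (N ∸ r) ∣))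
        ≡⟨ sumZ-pos (suc N) _ ⟨
      sumZ (suc N) (λ r → + (binom r (N ∸ r) * (∣ dev r (N ∸ r) ∣ * ∣ dev r (N ∸ r) ∣)))
        ≡⟨ sumZ-cong (suc N) (λ r _ → trans (ℤP.pos-* (binom r (N ∸ r)) _) (cong (binomℤ r (N ∸ r) ℤ.*_) (∣∣-square (dev r (N ∸ r))))) ⟩
      sumZ (suc N) square
        ≡⟨ moment ⟩
      sumZ (suc N) upper
        ≤⟨ sumZ-mono (suc N) (λ r r≤ → bound r (≤-pred r≤)) ⟩
      sumZ (suc N) (λ r → + (binom r (N ∸ r) * (6 * N ^ 3)))
        ≡⟨ sumZ-pos (suc N) _ ⟩
      + sumTo (suc N) (λ r → binom r (N ∸ r) * (6 * N ^ 3))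
        ≡⟨ cong +_ (trans (sumTo-cong (suc N) (λ r _ → *-comm (binom r (N ∸ r)) (6 * N ^ 3))) (trans (sumTo-*ˡ (suc N) (6 * N ^ 3) _) (*-comm (6 * N ^ 3) _))) ⟩
      + (fibo N * (6 * N ^ 3)) ∎)
      where
      open SecondMoment N
      open ℤP.≤-Reasoning
      bound : ∀ r → r ≤ N → upper r ℤ.≤ + (binom r (N ∸ r) * (6 * N ^ 3))
      bound r r≤N with (N ∸ r) ≤? r
      ... | no gt rewrite binom-zero r (N ∸ r) (≰⇒> gt) = ℤP.≤-reflexive (ℤP.*-zeroˡ (+ r ℤ.* D r ℤ.+ + 5 ℤ.* d r ℤ.* ((d r ℤ.- + 1) ℤ.* (d r ℤ.- + 1))))
      ... | yes le with m≤n⇒∃[o]m+o≡n le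
      ...   | δ , eq = ℤP.≤-trans (ℤP.*-monoˡ-≤-nonNeg (binomℤ r (N ∸ r)) (inner (N ∸ r) δ r N eq (trans (+-comm (N ∸ r) r) (m+[n∸m]≡n r≤N))))
                (ℤP.≤-reflexive (sym (ℤP.pos-* (binom r (N ∸ r)) (6 * N ^ 3))))
        where
        -- With `r = e + δ` and `N = e + r`, the difference between 6 N³ and the summand is a sum of
        -- nonnegative terms; δ (δ - 1) is one of them because δ is a natural number.
        poly : ∀ e δ → + 6 ℤ.* ((e ℤ.+ (e ℤ.+ δ)) ℤ.* ((e ℤ.+ (e ℤ.+ δ)) ℤ.* ((e ℤ.+ (e ℤ.+ δ)) ℤ.* + 1))) ≡
          ((e ℤ.+ δ) ℤ.* ((e ℤ.+ δ ℤ.- e) ℤ.* (e ℤ.+ δ ℤ.- e) ℤ.- (e ℤ.+ δ) ℤ.* e) ℤ.+ + 5 ℤ.* (e ℤ.+ δ ℤ.- e) ℤ.* ((e ℤ.+ δ ℤ.- e ℤ.- + 1) ℤ.* (e ℤ.+ δ ℤ.- e ℤ.- + 1)))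
          ℤ.+ (+ 48 ℤ.* (e ℤ.* e ℤ.* e) ℤ.+ + 72 ℤ.* (e ℤ.* e ℤ.* δ) ℤ.+ + 35 ℤ.* (e ℤ.* δ ℤ.* δ) ℤ.+ (e ℤ.+ δ) ℤ.* (e ℤ.+ δ) ℤ.* e ℤ.+ + 5 ℤ.* (δ ℤ.* δ) ℤ.+ + 5 ℤ.* (δ ℤ.* (δ ℤ.- + 1)))
        poly = ℤS.solve-∀
        inner : ∀ e δ r N → e + δ ≡ r → e + r ≡ N →
          + r ℤ.* form (+ r) (+ e) ℤ.+ + 5 ℤ.* (+ r ℤ.- + e) ℤ.* ((+ r ℤ.- + e ℤ.- + 1) ℤ.* (+ r ℤ.- + e ℤ.- + 1)) ℤ.≤ + (6 * N ^ 3)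
        inner e δ r N refl refl = ℤP.≤-trans (ℤP.i≤i+j _ (+ rest) ) (ℤP.≤-reflexive (trans (cong (λ z → + r ℤ.* form (+ r) (+ e) ℤ.+ + 5 ℤ.* (+ r ℤ.- + e) ℤ.* ((+ r ℤ.- + e ℤ.- + 1) ℤ.* (+ r ℤ.- + e ℤ.- + 1)) ℤ.+ z) rest≡)
            (trans (sym (poly (+ e) (+ δ))) (sym cube))))
          where
          δ' : ℕ → ℕ
          δ' δ = δ * (δ ∸ 1)
          rest = 48 * (e * e * e) + 72 * (e * e * δ) + 35 * (e * δ * δ) + (e + δ) * (e + δ) * e + 5 * (δ * δ) + 5 * δ' δ
          p3 : ∀ a b c → + (a * b * c) ≡ + a ℤ.* + b ℤ.* + c
          p3 a b c = trans (ℤP.pos-* (a * b) c) (cong (ℤ._* + c) (ℤP.pos-* a b))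
          kp3 : ∀ k a b c → + (k * (a * b * c)) ≡ + k ℤ.* (+ a ℤ.* + b ℤ.* + c)
          kp3 k a b c = trans (ℤP.pos-* k (a * b * c)) (cong (+ k ℤ.*_) (p3 a b c))
          pδ : ∀ δ → + δ' δ ≡ + δ ℤ.* (+ δ ℤ.- + 1)
          pδ zero    = refl
          pδ (suc δ) = ℤP.pos-* (suc δ) δ
          rest≡ : + rest ≡ + 48 ℤ.* (+ e ℤ.* + e ℤ.* + e) ℤ.+ + 72 ℤ.* (+ e ℤ.* + e ℤ.* + δ) ℤ.+ + 35 ℤ.* (+ e ℤ.* + δ ℤ.* + δ) ℤ.+ (+ e ℤ.+ + δ) ℤ.* (+ e ℤ.+ + δ) ℤ.* + e ℤ.+ + 5 ℤ.* (+ δ ℤ.* + δ) ℤ.+ + 5 ℤ.* (+ δ ℤ.* (+ δ ℤ.- + 1))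
          rest≡ = cong₂ ℤ._+_ (cong₂ ℤ._+_ (cong₂ ℤ._+_ (cong₂ ℤ._+_ (cong₂ ℤ._+_ (kp3 48 e e e) (kp3 72 e e δ)) (kp3 35 e δ δ)) (p3 (e + δ) (e + δ) e))
            (trans (ℤP.pos-* 5 (δ * δ)) (cong (+ 5 ℤ.*_) (ℤP.pos-* δ δ)))) (trans (ℤP.pos-* 5 (δ' δ)) (cong (+ 5 ℤ.*_) (pδ δ)))
          cube : + (6 * (e + (e + δ)) ^ 3) ≡ + 6 ℤ.* ((+ e ℤ.+ (+ e ℤ.+ + δ)) ℤ.* ((+ e ℤ.+ (+ e ℤ.+ + δ)) ℤ.* ((+ e ℤ.+ (+ e ℤ.+ + δ)) ℤ.* + 1)))
          cube = trans (ℤP.pos-* 6 (n * (n * (n * 1)))) (cong (+ 6 ℤ.*_) (trans (ℤP.pos-* n (n * (n * 1))) (cong (+ n ℤ.*_) (trans (ℤP.pos-* n (n * 1)) (cong (+ n ℤ.*_) (ℤP.pos-* n 1))))))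
            where n = e + (e + δ)

    atypical : ℕ → ℕ → ℕ → Bool
    atypical X N r = N ^ 4 ≤ᵇ X * (∣ dev r (N ∸ r) ∣ * ∣ dev r (N ∸ r) ∣)

    atypicalTails : ℕ → ℕ → List (List ℕ)
    atypicalTails X N = concatMap (λ r → arr r (N ∸ r)) (filterᵇ (atypical X N) (range N))

    -- Chebyshev's inequality: an atypical length contributes at least N⁴/X per word to a second
    -- moment of order N³, which saves a factor `N`.
    atypical-count : ∀ X N → 0 < N → N * length (atypicalTails X N) ≤ 6 * X * fibo N
    atypical-count X N 0<N = *-cancelʳ-≤ _ _ (N ^ 3) ⦃ m^n≢0 N 3 ⦃ >-nonZero 0<N ⦄ ⦄ (begin
      N * length (atypicalTails X N) * N ^ 3              ≡⟨ lem₁ N (length (atypicalTails X N)) (N ^ 3) ⟩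
      N ^ 4 * length (atypicalTails X N)                  ≡⟨ cong (N ^ 4 *_) (trans (length-concatMap _ F) (sumL-cong F (λ r _ → length-arr r (N ∸ r)))) ⟩
      N ^ 4 * sumL (λ r → binom r (N ∸ r)) F              ≡⟨ sumL-*ˡ (N ^ 4) _ F ⟨
      sumL (λ r → N ^ 4 * binom r (N ∸ r)) F              ≤⟨ sumL-mono F (λ r r∈ → ≤-trans (*-monoˡ-≤ (binom r (N ∸ r)) (≤ᵇ-sound (N ^ 4) (X * sq r) (proj₂ (filterᵇ-∈⁻ (atypical X N) (range N) r∈))))
                                                              (≤-reflexive (lem₂ X (sq r) (binom r (N ∸ r))))) ⟩
      sumL (λ r → X * (binom r (N ∸ r) * sq r)) F         ≤⟨ sub (range N) ⟩
      sumL (λ r → X * (binom r (N ∸ r) * sq r)) (range N) ≡⟨ trans (sumL-*ˡ X _ (range N)) (cong (X *_) (sumL-upTo (suc N) _)) ⟩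
      X * sumTo (suc N) (λ r → binom r (N ∸ r) * sq r)    ≤⟨ *-monoʳ-≤ X (second-moment N) ⟩
      X * (fibo N * (6 * N ^ 3))                          ≡⟨ lem₃ X (fibo N) (N ^ 3) ⟩
      6 * X * fibo N * N ^ 3 ∎)
      where
      open ≤-Reasoning
      F = filterᵇ (atypical X N) (range N)
      sq : ℕ → ℕ
      sq r = ∣ dev r (N ∸ r) ∣ * ∣ dev r (N ∸ r) ∣
      lem₁ : ∀ n l m → n * l * m ≡ n * m * l
      lem₁ = solve-∀
      lem₂ : ∀ x s b → x * s * b ≡ x * (b * s)
      lem₂ = solve-∀
      lem₃ : ∀ x f n → x * (f * (6 * n)) ≡ 6 * x * f * n
      lem₃ = solve-∀
      sub : ∀ xs → sumL (λ r → X * (binom r (N ∸ r) * sq r)) (filterᵇ (atypical X N) xs) ≤ sumL (λ r → X * (binom r (N ∸ r) * sq r)) xs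
      sub []       = z≤n
      sub (x ∷ xs) with atypical X N x
      ... | true  = +-monoʳ-≤ _ (sub xs)
      ... | false = ≤-trans (sub xs) (m≤n+m _ (X * (binom x (N ∸ x) * sq x)))

  open Deviation

  -- Words with prescribed letters

  infix 4 _≈[_]_
  _≈[_]_ : ℕ → ℕ → ℕ → Set
  x ≈[ e ] y = x ≤ y + e × y ≤ x + e

  ≈-sym : ∀ {x e y} → x ≈[ e ] y → y ≈[ e ] x
  ≈-sym (p , q) = q , p

  ≈-trans : ∀ {x e y e' z} → x ≈[ e ] y → y ≈[ e' ] z → x ≈[ e + e' ] z
  ≈-trans {x} {e} {y} {e'} {z} (p , q) (p' , q') =
    ≤-trans p (≤-trans (+-monoˡ-≤ e p') (≤-reflexive (lem z e' e))) ,
    ≤-trans q' (≤-trans (+-monoˡ-≤ e' q) (≤-reflexive (+-assoc x e e')))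
    where
    lem : ∀ z e' e → z + e' + e ≡ z + (e + e')
    lem = solve-∀

  ≈-weaken : ∀ {x e e' y} → e ≤ e' → x ≈[ e ] y → x ≈[ e' ] y
  ≈-weaken {x} {y = y} h (p , q) = ≤-trans p (+-monoʳ-≤ y h) , ≤-trans q (+-monoʳ-≤ x h)

  ≈-* : ∀ k {x e y} → x ≈[ e ] y → k * x ≈[ k * e ] k * y
  ≈-* k {x} {e} {y} (p , q) = ≤-trans (*-monoʳ-≤ k p) (≤-reflexive (*-distribˡ-+ k y e)) , ≤-trans (*-monoʳ-≤ k q) (≤-reflexive (*-distribˡ-+ k x e))

  ≈-cancel : ∀ k .⦃ _ : NonZero k ⦄ {x e y} → k * x ≈[ k * e ] k * y → x ≈[ e ] y
  ≈-cancel k {x} {e} {y} (p , q) = *-cancelˡ-≤ k (≤-trans p (≤-reflexive (sym (*-distribˡ-+ k y e)))) , *-cancelˡ-≤ k (≤-trans q (≤-reflexive (sym (*-distribˡ-+ k x e))))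

  ≈-+ : ∀ {x e y x' e' y'} → x ≈[ e ] y → x' ≈[ e' ] y' → x + x' ≈[ e + e' ] y + y'
  ≈-+ {x} {e} {y} {x'} {e'} {y'} (p , q) (p' , q') =
    ≤-trans (+-mono-≤ p p') (≤-reflexive (lem y e y' e')) , ≤-trans (+-mono-≤ q q') (≤-reflexive (lem x e x' e'))
    where
    lem : ∀ a b c d → a + b + (c + d) ≡ a + c + (b + d)
    lem = solve-∀

  ≈-subst : ∀ {x x' e e' y y'} → x ≡ x' → e ≡ e' → y ≡ y' → x ≈[ e ] y → x' ≈[ e' ] y'
  ≈-subst refl refl refl h = h

  data Constraint : Set where
    free one two : Constraint

  okLetter : Constraint → ℕ → Bool
  okLetter free _ = true
  okLetter one  x = x ≡ᵇ 1
  okLetter two  x = x ≡ᵇ 2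

  matches : List Constraint → List ℕ → Bool
  matches []      []      = true
  matches []      (_ ∷ _) = true
  matches (_ ∷ _) []      = false
  matches (k ∷ κ) (x ∷ t) = okLetter k x ∧ matches κ t

  frees ones twos : List Constraint → ℕ
  frees []         = 0
  frees (free ∷ κ) = suc (frees κ)
  frees (one  ∷ κ) = frees κ
  frees (two  ∷ κ) = frees κ
  ones []         = 0
  ones (free ∷ κ) = ones κ
  ones (one  ∷ κ) = suc (ones κ)
  ones (two  ∷ κ) = ones κ
  twos []         = 0
  twos (free ∷ κ) = twos κ
  twos (one  ∷ κ) = twos κ
  twos (two  ∷ κ) = suc (twos κ)

  count : List Constraint → ℕ → ℕ
  count []         zero    = 1
  count []         (suc e) = 0
  count (free ∷ κ) zero    = count κ zero
  count (free ∷ κ) (suc e) = count κ (suc e) + count κ e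
  count (one  ∷ κ) e       = count κ e
  count (two  ∷ κ) zero    = 0
  count (two  ∷ κ) (suc e) = count κ e

  private
    occurrences : (List ℕ → Bool) → List (List ℕ) → ℕ
    occurrences p xs = sumL (λ t → bit (p t)) xs

  count-arr : ∀ κ e → occurrences (matches κ) (arr (length κ) e) ≡ count κ e
  count-arr [] zero    = refl
  count-arr [] (suc e) = refl
  count-arr (k ∷ κ) zero = zero-twos k
    where
    rest : bit (matches κ (replicate (length κ) 1)) ≡ count κ 0
    rest = trans (sym (+-identityʳ _)) (count-arr κ zero)
    zero-twos : ∀ k → occurrences (matches (k ∷ κ)) (arr (suc (length κ)) zero) ≡ count (k ∷ κ) zero
    zero-twos free = trans (+-identityʳ _) rest
    zero-twos one  = trans (+-identityʳ _) rest
    zero-twos two  = refl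
  count-arr (k ∷ κ) (suc e) = trans (sumL-++ _ (map (1 ∷_) A) _) (trans (cong₂ _+_ (sumL-map _ (1 ∷_) A) (sumL-map _ (2 ∷_) B)) (split k))
    where
    A = arr (length κ) (suc e)
    B = arr (length κ) e
    split : ∀ k → sumL (λ t → bit (okLetter k 1 ∧ matches κ t)) A + sumL (λ t → bit (okLetter k 2 ∧ matches κ t)) B ≡ count (k ∷ κ) (suc e)
    split free = cong₂ _+_ (count-arr κ (suc e)) (count-arr κ e)
    split one  = trans (cong₂ _+_ (count-arr κ (suc e)) (trans (sumL-const 0 B) (*-zeroʳ (length B)))) (+-identityʳ _)
    split two  = cong₂ _+_ (trans (sumL-const 0 A) (*-zeroʳ (length A))) (count-arr κ e)

  count-few : ∀ κ e → e < twos κ → count κ e ≡ 0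
  count-few (free ∷ κ) zero    h       = count-few κ zero h
  count-few (free ∷ κ) (suc e) h       = cong₂ _+_ (count-few κ (suc e) h) (count-few κ e (<-trans (n<1+n e) h))
  count-few (one ∷ κ)  e       h       = count-few κ e h
  count-few (two ∷ κ)  zero    h       = refl
  count-few (two ∷ κ)  (suc e) (s≤s h) = count-few κ e h

  -- Deleting the prescribed letters leaves arbitrary words on the free places; the prescribed twos
  -- are taken off the number of twos.
  count-binom : ∀ κ e → count κ (twos κ + e) ≡ binom (frees κ) e
  count-binom []         zero    = refl
  count-binom []         (suc e) = refl
  count-binom (one ∷ κ)  e       = count-binom κ e
  count-binom (two ∷ κ)  e       = count-binom κ e
  count-binom (free ∷ κ) (suc e) = trans (cong (count (free ∷ κ)) (+-suc (twos κ) e))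
    (cong₂ _+_ (trans (cong (count κ) (sym (+-suc (twos κ) e))) (count-binom κ (suc e))) (count-binom κ e))
  count-binom (free ∷ κ) zero with twos κ in eq | count-binom κ zero
  ... | zero  | h = h
  ... | suc b | h = cong₂ _+_ h (count-few κ (b + 0) (subst (b + 0 <_) (sym eq) (s≤s (≤-reflexive (+-identityʳ b)))))

  frees+ones+twos : ∀ κ → length κ ≡ frees κ + (ones κ + twos κ)
  frees+ones+twos []         = refl
  frees+ones+twos (free ∷ κ) = cong suc (frees+ones+twos κ)
  frees+ones+twos (one ∷ κ)  = trans (cong suc (frees+ones+twos κ)) (sym (+-suc (frees κ) _))
  frees+ones+twos (two ∷ κ)  = trans (cong suc (frees+ones+twos κ)) (trans (sym (+-suc (frees κ) _)) (cong (frees κ +_) (sym (+-suc (ones κ) (twos κ)))))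

  ways : ℕ → ℕ → ℕ
  ways d e = binom (d + e) e

  ways-one : ∀ d e → (suc d + e) * ways d e ≡ suc d * ways (suc d) e
  ways-one d zero    = cong (λ z → suc z * 1) (+-identityʳ d)
  ways-one d (suc e) = +-cancelʳ-≡ ((suc d + suc e) * y) _ _ (begin
    (suc d + suc e) * x + (suc d + suc e) * y     ≡⟨ *-distribˡ-+ (suc d + suc e) x y ⟨
    (suc d + suc e) * (x + y)                     ≡⟨ *-distribʳ-+ (x + y) (suc d) (suc e) ⟩
    suc d * (x + y) + suc e * (x + y)             ≡⟨ cong (suc d * (x + y) +_) (binom-absorb (d + suc e) e) ⟩
    suc d * (x + y) + (suc d + suc e) * y ∎)
    where
    open ≡-Reasoning
    x = binom (d + suc e) (suc e)
    y = binom (d + suc e) e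

  ways-two : ∀ d e → (d + suc e) * ways d e ≡ suc e * ways d (suc e)
  ways-two d e rewrite +-suc d e = sym (binom-absorb (d + e) e)

  ways-mono₁ : ∀ d e → ways d e ≤ ways (suc d) e
  ways-mono₁ d zero    = ≤-refl
  ways-mono₁ d (suc e) = m≤m+n _ _

  ways-mono₂ : ∀ d e → ways d e ≤ ways d (suc e)
  ways-mono₂ d e rewrite +-suc d e = m≤n+m _ _

  -- p/q approximates the density of ones, with error 1/Y.
  module Estimate (p p' Y : ℕ) where
    q = p + p'

    Near : ℕ → ℕ → Set
    Near d e = Y * (q * d) ≈[ q * (d + e) ] Y * (p * (d + e))

    -- Among the words with `suc d` ones and `e` twos, those with a 1 at a given place form the
    -- proportion (d + 1)/(d + 1 + e), which `Near` compares with p/q.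
    remove-one : ∀ d e → Near (suc d) e → Y * (q * ways d e) ≈[ q * ways (suc d) e ] Y * (p * ways (suc d) e)
    remove-one d e h = ≈-cancel (suc d + e) (≈-subst
        (trans (lem₁ C Y q (suc d)) (trans (cong (λ z → Y * (q * z)) (sym (ways-one d e))) (lem₂ Y q (suc d + e) (ways d e))))
        (lem₃ C q (suc d + e)) (lem₄ C Y p (suc d + e)) (≈-* C h))
      where
      C = ways (suc d) e
      lem₁ : ∀ c y q d → c * (y * (q * d)) ≡ y * (q * (d * c))
      lem₁ = solve-∀
      lem₂ : ∀ y q r c → y * (q * (r * c)) ≡ r * (y * (q * c))
      lem₂ = solve-∀
      lem₃ : ∀ c q r → c * (q * r) ≡ r * (q * c)
      lem₃ = solve-∀
      lem₄ : ∀ c y p r → c * (y * (p * r)) ≡ r * (y * (p * c))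
      lem₄ = solve-∀

    Near-two : ∀ d e → Near d e → Y * (q * e) ≈[ q * (d + e) ] Y * (p' * (d + e))
    Near-two d e (h₁ , h₂) =
      +-cancelʳ-≤ (Y * (p * (d + e))) _ _ (begin
        Y * (q * e) + Y * (p * (d + e))               ≤⟨ +-monoʳ-≤ (Y * (q * e)) h₂ ⟩
        Y * (q * e) + (Y * (q * d) + q * (d + e))      ≡⟨ lem₁ Y p p' d e ⟩
        Y * (p' * (d + e)) + q * (d + e) + Y * (p * (d + e)) ∎) ,
      +-cancelʳ-≤ (Y * (q * d)) _ _ (begin
        Y * (p' * (d + e)) + Y * (q * d)              ≤⟨ +-monoʳ-≤ (Y * (p' * (d + e))) h₁ ⟩
        Y * (p' * (d + e)) + (Y * (p * (d + e)) + q * (d + e)) ≡⟨ lem₂ Y p p' d e ⟩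
        Y * (q * e) + q * (d + e) + Y * (q * d) ∎)
      where
      open ≤-Reasoning
      lem₁ : ∀ Y p p' d e → Y * ((p + p') * e) + (Y * ((p + p') * d) + (p + p') * (d + e)) ≡ Y * (p' * (d + e)) + (p + p') * (d + e) + Y * (p * (d + e))
      lem₁ = solve-∀
      lem₂ : ∀ Y p p' d e → Y * (p' * (d + e)) + (Y * (p * (d + e)) + (p + p') * (d + e)) ≡ Y * ((p + p') * e) + (p + p') * (d + e) + Y * ((p + p') * d)
      lem₂ = solve-∀

    remove-two : ∀ d e → Near d (suc e) → Y * (q * ways d e) ≈[ q * ways d (suc e) ] Y * (p' * ways d (suc e))
    remove-two d e h = ≈-cancel (d + suc e) ⦃ subst NonZero (sym (+-suc d e)) _ ⦄ (≈-subst
        (trans (lem₁ C Y q (suc e)) (trans (cong (λ z → Y * (q * z)) (sym (ways-two d e))) (lem₂ Y q (d + suc e) (ways d e))))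
        (lem₃ C q (d + suc e)) (lem₄ C Y p' (d + suc e)) (≈-* C (Near-two d (suc e) h)))
      where
      C = ways d (suc e)
      lem₁ : ∀ c y q d → c * (y * (q * d)) ≡ y * (q * (d * c))
      lem₁ = solve-∀
      lem₂ : ∀ y q r c → y * (q * (r * c)) ≡ r * (y * (q * c))
      lem₂ = solve-∀
      lem₃ : ∀ c q r → c * (q * r) ≡ r * (q * c)
      lem₃ = solve-∀
      lem₄ : ∀ c y p r → c * (y * (p * r)) ≡ r * (y * (p * c))
      lem₄ = solve-∀

    theta : ℕ → ℕ → ℕ
    theta a b = p ^ a * p' ^ b

    theta≤ : ∀ a b → theta a b ≤ q ^ (a + b)
    theta≤ a b = ≤-trans (*-mono-≤ (^-monoˡ-≤ a (m≤m+n p p')) (^-monoˡ-≤ b (m≤n+m p' p))) (≤-reflexive (sym (^-distribˡ-+-* q a b)))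

    private
      -- All the proportions are at most 1, so errors do not multiply: the error n/Y of the first
      -- `n` prescriptions grows by 1/Y.
      chain-step : ∀ n θ s W c₁ c₂ → θ ≤ q ^ n → c₁ ≤ c₂ → Y * (q ^ n * W) ≈[ n * (q ^ n * c₁) ] Y * (θ * c₁) →
        Y * (q * c₁) ≈[ q * c₂ ] Y * (s * c₂) → Y * (q ^ suc n * W) ≈[ suc n * (q ^ suc n * c₂) ] Y * (s * θ * c₂)
      chain-step n θ s W c₁ c₂ θ≤ c≤ ih st = ≈-weaken err (≈-trans
          (≈-subst (lem₁ q Y (q ^ n) W) refl (lem₂ q Y θ c₁) (≈-* q ih))
          (≈-subst refl refl (lem₃ θ Y s c₂) (≈-* θ st)))
        where
        lem₁ : ∀ q Y x W → q * (Y * (x * W)) ≡ Y * (q * x * W)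
        lem₁ = solve-∀
        lem₂ : ∀ q Y θ c → q * (Y * (θ * c)) ≡ θ * (Y * (q * c))
        lem₂ = solve-∀
        lem₃ : ∀ θ Y s c → θ * (Y * (s * c)) ≡ Y * (s * θ * c)
        lem₃ = solve-∀
        open ≤-Reasoning
        err : q * (n * (q ^ n * c₁)) + θ * (q * c₂) ≤ suc n * (q ^ suc n * c₂)
        err = begin
          q * (n * (q ^ n * c₁)) + θ * (q * c₂)       ≤⟨ +-mono-≤ (*-monoʳ-≤ q (*-monoʳ-≤ n (*-monoʳ-≤ (q ^ n) c≤))) (*-monoˡ-≤ (q * c₂) θ≤) ⟩
          q * (n * (q ^ n * c₂)) + q ^ n * (q * c₂)   ≡⟨ lem q n (q ^ n) c₂ ⟩
          suc n * (q * q ^ n * c₂) ∎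
          where
          lem : ∀ q n x c → q * (n * (x * c)) + x * (q * c) ≡ suc n * (q * x * c)
          lem = solve-∀

    estimate : ∀ a b d e → (∀ i j → i ≤ a → j ≤ b → Near (i + d) (j + e)) →
      Y * (q ^ (a + b) * ways d e) ≈[ (a + b) * (q ^ (a + b) * ways (a + d) (b + e)) ] Y * (theta a b * ways (a + d) (b + e))
    estimate zero    zero    d e h = ≤-reflexive (sym (+-identityʳ _)) , ≤-reflexive (sym (+-identityʳ _))
    estimate zero    (suc b) d e h = ≈-subst refl refl (cong (λ z → Y * (z * ways d (suc b + e))) (lem p' (p' ^ b)))
      (chain-step b (1 * p' ^ b) p' (ways d e) (ways d (b + e)) (ways d (suc b + e)) (theta≤ 0 b) (ways-mono₂ d (b + e))
        (estimate zero b d e (λ i j i≤ j≤ → h i j i≤ (m≤n⇒m≤1+n j≤))) (remove-two d (b + e) (h 0 (suc b) z≤n ≤-refl)))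
      where
      lem : ∀ p x → p * (1 * x) ≡ 1 * (p * x)
      lem = solve-∀
    estimate (suc a) b d e h = ≈-subst refl refl (cong (λ z → Y * (z * ways (suc a + d) (b + e))) (sym (*-assoc p (p ^ a) (p' ^ b))))
      (chain-step (a + b) (theta a b) p (ways d e) (ways (a + d) (b + e)) (ways (suc a + d) (b + e)) (theta≤ a b) (ways-mono₁ (a + d) (b + e))
        (estimate a b d e (λ i j i≤ j≤ → h i j (m≤n⇒m≤1+n i≤) j≤)) (remove-one (a + d) (b + e) (h (suc a) b ≤-refl ≤-refl)))

  -- (x − y)(x + y + k) = (x² + k x) − (y² + k y)
  root-≈ : ∀ k x y E → x * x + k * x ≈[ E ] y * y + k * y → k * x ≈[ E ] k * y
  root-≈ k x y E (h₁ , h₂) = half x y E h₁ , half y x E h₂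
    where
    half : ∀ x y E → x * x + k * x ≤ y * y + k * y + E → k * x ≤ k * y + E
    half x y E h with ≤-total x y
    ... | inj₁ x≤y = ≤-trans (*-monoʳ-≤ k x≤y) (m≤m+n _ E)
    ... | inj₂ y≤x = +-cancelˡ-≤ (y * y) _ _ (≤-trans (+-monoˡ-≤ (k * x) (*-mono-≤ y≤x y≤x)) (≤-trans h (≤-reflexive (+-assoc (y * y) (k * y) E))))

  module Ratio (p p' : ℕ) (unit : p * p + p * (p + p') ≈[ 1 ] (p + p') * (p + p')) where
    q = p + p'

    -- With `r = d + e`, both d/r and p/q nearly solve x² + x = 1, because d² ≈ r e is the same as
    -- d² + d r ≈ r². After clearing denominators, `root-≈` with `k = q * r` compares the two roots;
    -- the errors in the two equations are δ/r² and 1/q², and they contribute 4 and 1 to the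
    -- constant 5.
    ratio-≈ : ∀ d e δ Z .⦃ _ : NonZero q ⦄ .⦃ _ : NonZero (d + e) ⦄ → d * d ≈[ δ ] (d + e) * e →
      Z * δ ≤ 4 * ((d + e) * (d + e)) → Z ≤ q * q → Z * (q * d) ≈[ 5 * (q * (d + e)) ] Z * (p * (d + e))
    ratio-≈ d e δ Z dd zδ zq = ≈-cancel (q * r) ⦃ m*n≢0 q r ⦄ (≈-subst (lem₁ Z (q * r) (q * d)) (lem₂ q r) (lem₁ Z (q * r) (p * r))
        (≈-weaken err (≈-* Z (root-≈ (q * r) (q * d) (p * r) (q * q * δ + r * r) both))))
      where
      r = d + e
      lem₁ : ∀ z k x → z * (k * x) ≡ k * (z * x)
      lem₁ = solve-∀
      lem₂ : ∀ q r → 5 * (q * q * (r * r)) ≡ q * r * (5 * (q * r))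
      lem₂ = solve-∀
      shape : q * q * (d * d + d * r) ≈[ q * q * δ ] q * q * (r * r)
      shape = ≈-* (q * q) (≈-subst refl (+-identityʳ δ) (lem d e) (≈-+ {x' = d * r} dd (≤-reflexive (sym (+-identityʳ _)) , ≤-reflexive (sym (+-identityʳ _)))))
        where
        lem : ∀ d e → (d + e) * e + d * (d + e) ≡ (d + e) * (d + e)
        lem = solve-∀
      both : (q * d) * (q * d) + (q * r) * (q * d) ≈[ q * q * δ + r * r ] (p * r) * (p * r) + (q * r) * (p * r)
      both = ≈-trans (≈-subst (lem₃ q d r) refl refl shape)
        (≈-sym (≈-subst (lem₄ p q r) (*-identityʳ (r * r)) (*-comm (r * r) (q * q)) (≈-* (r * r) unit)))
        where
        lem₃ : ∀ q d r → q * q * (d * d + d * r) ≡ (q * d) * (q * d) + (q * r) * (q * d)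
        lem₃ = solve-∀
        lem₄ : ∀ p q r → r * r * (p * p + p * q) ≡ (p * r) * (p * r) + (q * r) * (p * r)
        lem₄ = solve-∀
      err : Z * (q * q * δ + r * r) ≤ 5 * (q * q * (r * r))
      err = ≤-trans (≤-reflexive (lem₅ Z (q * q) δ (r * r))) (≤-trans (+-mono-≤ (*-monoʳ-≤ (q * q) zδ) (*-monoˡ-≤ (r * r) zq)) (≤-reflexive (lem₆ (q * q) (r * r))))
        where
        lem₅ : ∀ z q δ r → z * (q * δ + r) ≡ q * (z * δ) + z * r
        lem₅ = solve-∀
        lem₆ : ∀ q r → q * (4 * r) + q * r ≡ 5 * (q * r)
        lem₆ = solve-∀

    -- The initial accuracy is 1/(2 Y), after cancelling 5 from 10 Y. Removing at most `l` of at
    -- least `2 * (Y + 1) * l` letters uses up no more than the other half.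
    near-after-removal : ∀ Y l u v d e .⦃ _ : NonZero q ⦄ → u + v ≤ l → 2 * (Y + 1) * l ≤ (u + d) + (v + e) →
      (10 * Y) * (q * (u + d)) ≈[ 5 * (q * ((u + d) + (v + e))) ] (10 * Y) * (p * ((u + d) + (v + e))) → Estimate.Near p p' Y d e
    near-after-removal Y l u v d e uv≤ big h = ≈-cancel 2 (≈-weaken err (up , down))
      where
      open ≤-Reasoning
      r₁ = (u + d) + (v + e)
      r₂ = d + e
      base : 2 * (Y * (q * (u + d))) ≈[ q * r₁ ] 2 * (Y * (p * r₁))
      base = ≈-cancel 5 (≈-subst (lem Y (q * (u + d))) refl (lem Y (p * r₁)) h)
        where
        lem : ∀ y x → (10 * y) * x ≡ 5 * (2 * (y * x))
        lem = solve-∀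
      loss = 2 * (Y * (q * l))
      up : 2 * (Y * (q * d)) ≤ 2 * (Y * (p * r₂)) + (q * r₁ + loss)
      up = begin
        2 * (Y * (q * d))                           ≤⟨ *-monoʳ-≤ 2 (*-monoʳ-≤ Y (*-monoʳ-≤ q (m≤n+m d u))) ⟩
        2 * (Y * (q * (u + d)))                     ≤⟨ proj₁ base ⟩
        2 * (Y * (p * r₁)) + q * r₁                 ≡⟨ lem Y p u v d e (q * r₁) ⟩
        2 * (Y * (p * r₂)) + (q * r₁ + 2 * (Y * (p * (u + v)))) ≤⟨ +-monoʳ-≤ (2 * (Y * (p * r₂))) (+-monoʳ-≤ (q * r₁) (*-monoʳ-≤ 2 (*-monoʳ-≤ Y (*-mono-≤ (m≤m+n p p') uv≤)))) ⟩
        2 * (Y * (p * r₂)) + (q * r₁ + loss) ∎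
        where
        lem : ∀ Y p u v d e x → 2 * (Y * (p * ((u + d) + (v + e)))) + x ≡ 2 * (Y * (p * (d + e))) + (x + 2 * (Y * (p * (u + v))))
        lem = solve-∀
      down : 2 * (Y * (p * r₂)) ≤ 2 * (Y * (q * d)) + (q * r₁ + loss)
      down = begin
        2 * (Y * (p * r₂))                          ≤⟨ *-monoʳ-≤ 2 (*-monoʳ-≤ Y (*-monoʳ-≤ p (+-mono-≤ (m≤n+m d u) (m≤n+m e v)))) ⟩
        2 * (Y * (p * r₁))                          ≤⟨ proj₂ base ⟩
        2 * (Y * (q * (u + d))) + q * r₁            ≡⟨ lem Y q u d (q * r₁) ⟩
        2 * (Y * (q * d)) + (q * r₁ + 2 * (Y * (q * u))) ≤⟨ +-monoʳ-≤ (2 * (Y * (q * d))) (+-monoʳ-≤ (q * r₁) (*-monoʳ-≤ 2 (*-monoʳ-≤ Y (*-monoʳ-≤ q (≤-trans (m≤m+n u v) uv≤))))) ⟩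
        2 * (Y * (q * d)) + (q * r₁ + loss) ∎
        where
        lem : ∀ Y q u d x → 2 * (Y * (q * (u + d))) + x ≡ 2 * (Y * (q * d)) + (x + 2 * (Y * (q * u)))
        lem = solve-∀
      err : q * r₁ + loss ≤ 2 * (q * r₂)
      err = +-cancelʳ-≤ (2 * (q * (u + v))) _ _ (begin
        q * r₁ + loss + 2 * (q * (u + v))           ≤⟨ +-monoʳ-≤ (q * r₁ + loss) (*-monoʳ-≤ 2 (*-monoʳ-≤ q uv≤)) ⟩
        q * r₁ + loss + 2 * (q * l)                 ≡⟨ lem₁ q r₁ Y l ⟩
        q * r₁ + q * (2 * (Y + 1) * l)              ≤⟨ +-monoʳ-≤ (q * r₁) (*-monoʳ-≤ q big) ⟩
        q * r₁ + q * r₁                             ≡⟨ lem₂ q u v d e ⟩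
        2 * (q * r₂) + 2 * (q * (u + v)) ∎)
        where
        lem₁ : ∀ q r Y l → q * r + 2 * (Y * (q * l)) + 2 * (q * l) ≡ q * r + q * (2 * (Y + 1) * l)
        lem₁ = solve-∀
        lem₂ : ∀ q u v d e → q * ((u + d) + (v + e)) + q * ((u + d) + (v + e)) ≡ 2 * (q * (d + e)) + 2 * (q * (u + v))
        lem₂ = solve-∀

  -- The hypotheses force 9 r ≤ 20 d, so `d` is at least 0.45 r, which is more than r/4.
  many-ones : ∀ d e δ l → d * d ≈[ δ ] (d + e) * e → 10 * δ ≤ (d + e) * (d + e) → 4 * l ≤ d + e → l ≤ d
  many-ones d e δ l (_ , h) small big with l ≤? d
  ... | yes p = p
  ... | no ¬p = ⊥-elim (<-irrefl refl (≤-trans gap (≤-trans chain-≤ (≤-reflexive refl))))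
    where
    open ≤-Reasoning
    d<l = ≰⇒> ¬p
    r = d + e
    0<r : 0 < r
    0<r = ≤-trans (≤-trans (≤-trans (s≤s z≤n) d<l) (m≤m+n l _)) big
    chain-≤ : 10 * (r * r) ≤ 20 * (r * d) + r * r
    chain-≤ = begin
      10 * (r * r)                       ≡⟨ lem d e ⟩
      10 * (r * e) + 10 * (r * d)        ≤⟨ +-monoˡ-≤ (10 * (r * d)) (*-monoʳ-≤ 10 h) ⟩
      10 * (d * d + δ) + 10 * (r * d)    ≤⟨ +-monoˡ-≤ (10 * (r * d)) (*-monoʳ-≤ 10 (+-monoˡ-≤ δ (*-monoˡ-≤ d (m≤m+n d e)))) ⟩
      10 * (r * d + δ) + 10 * (r * d)    ≡⟨ lem' (r * d) δ ⟩
      20 * (r * d) + 10 * δ              ≤⟨ +-monoʳ-≤ (20 * (r * d)) small ⟩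
      20 * (r * d) + r * r ∎
      where
      lem : ∀ d e → 10 * ((d + e) * (d + e)) ≡ 10 * ((d + e) * e) + 10 * ((d + e) * d)
      lem = solve-∀
      lem' : ∀ x δ → 10 * (x + δ) + 10 * x ≡ 20 * x + 10 * δ
      lem' = solve-∀
    gap : 20 * (r * d) + r * r < 10 * (r * r)
    gap = begin-strict
      20 * (r * d) + r * r               <⟨ +-monoˡ-< (r * r) (*-monoʳ-< 20 (*-monoʳ-< r ⦃ >-nonZero 0<r ⦄ d<l)) ⟩
      20 * (r * l) + r * r               ≡⟨ lem r l ⟩
      5 * (r * (4 * l)) + r * r          ≤⟨ +-monoˡ-≤ (r * r) (*-monoʳ-≤ 5 (*-monoʳ-≤ r big)) ⟩
      5 * (r * r) + r * r                ≤⟨ ≤-trans (≤-reflexive (lem' (r * r))) (*-monoˡ-≤ (r * r) (≤ᵇ-sound 6 10 refl)) ⟩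
      10 * (r * r) ∎
      where
      lem : ∀ r l → 20 * (r * l) + r * r ≡ 5 * (r * (4 * l)) + r * r
      lem = solve-∀
      lem' : ∀ x → 5 * x + x ≡ 6 * x
      lem' = solve-∀

  -- Here 9 r ≤ 30 e, so `e` is at least 0.3 r, still more than r/4.
  many-twos : ∀ d e δ l → d * d ≈[ δ ] (d + e) * e → 10 * δ ≤ (d + e) * (d + e) → 4 * l ≤ d + e → l ≤ e
  many-twos d e δ l (h , _) small big with l ≤? e
  ... | yes p = p
  ... | no ¬p = ⊥-elim (<-irrefl refl (≤-trans gap chain-≤))
    where
    open ≤-Reasoning
    e<l = ≰⇒> ¬p
    r = d + e
    0<r : 0 < r
    0<r = ≤-trans (≤-trans (≤-trans (s≤s z≤n) e<l) (m≤m+n l _)) big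
    chain-≤ : 10 * (r * r) ≤ 30 * (r * e) + r * r
    chain-≤ = begin
      10 * (r * r)                       ≡⟨ lem d e ⟩
      10 * (d * d) + 10 * (d * e) + 10 * (r * e)          ≤⟨ +-monoˡ-≤ (10 * (r * e)) (+-mono-≤ (*-monoʳ-≤ 10 h) (*-monoʳ-≤ 10 (*-monoˡ-≤ e (m≤m+n d e)))) ⟩
      10 * (r * e + δ) + 10 * (r * e) + 10 * (r * e)      ≡⟨ lem' (r * e) δ ⟩
      30 * (r * e) + 10 * δ              ≤⟨ +-monoʳ-≤ (30 * (r * e)) small ⟩
      30 * (r * e) + r * r ∎
      where
      lem : ∀ d e → 10 * ((d + e) * (d + e)) ≡ 10 * (d * d) + 10 * (d * e) + 10 * ((d + e) * e)
      lem = solve-∀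
      lem' : ∀ x δ → 10 * (x + δ) + 10 * x + 10 * x ≡ 30 * x + 10 * δ
      lem' = solve-∀
    gap : 30 * (r * e) + r * r < 10 * (r * r)
    gap = begin-strict
      30 * (r * e) + r * r               <⟨ +-monoˡ-< (r * r) (*-monoʳ-< 30 (*-monoʳ-< r ⦃ >-nonZero 0<r ⦄ e<l)) ⟩
      30 * (r * l) + r * r               ≤⟨ +-monoˡ-≤ (r * r) (*-monoˡ-≤ (r * l) (≤ᵇ-sound 30 32 refl)) ⟩
      32 * (r * l) + r * r               ≡⟨ lem r l ⟩
      8 * (r * (4 * l)) + r * r          ≤⟨ +-monoˡ-≤ (r * r) (*-monoʳ-≤ 8 (*-monoʳ-≤ r big)) ⟩
      8 * (r * r) + r * r                ≤⟨ ≤-trans (≤-reflexive (lem' (r * r))) (*-monoˡ-≤ (r * r) (≤ᵇ-sound 9 10 refl)) ⟩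
      10 * (r * r) ∎
      where
      lem : ∀ r l → 32 * (r * l) + r * r ≡ 8 * (r * (4 * l)) + r * r
      lem = solve-∀
      lem' : ∀ x → 8 * x + x ≡ 9 * x
      lem' = solve-∀

  -- Words with letters at most 3

  nth : List ℕ → ℕ → ℕ
  nth []       _       = 0
  nth (x ∷ xs) zero    = x
  nth (x ∷ xs) (suc i) = nth xs i

  total : List ℕ → ℕ
  total = sumL (λ x → x)

  sumTo-nth : ∀ xs → sumTo (length xs) (nth xs) ≡ total xs
  sumTo-nth []       = refl
  sumTo-nth (x ∷ xs) = trans (sumTo-shift (length xs) _) (cong (x +_) (sumTo-nth xs))

  nth-∈ : ∀ xs i → i < length xs → nth xs i ∈ xs
  nth-∈ (x ∷ xs) zero    _       = here refl
  nth-∈ (x ∷ xs) (suc i) (s≤s h) = there (nth-∈ xs i h)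

  nth-++ˡ : ∀ xs ys i → i < length xs → nth (xs ++ ys) i ≡ nth xs i
  nth-++ˡ (x ∷ xs) ys zero    _       = refl
  nth-++ˡ (x ∷ xs) ys (suc i) (s≤s h) = nth-++ˡ xs ys i h

  nth-++ʳ : ∀ xs ys i → nth (xs ++ ys) (length xs + i) ≡ nth ys i
  nth-++ʳ []       ys i = refl
  nth-++ʳ (x ∷ xs) ys i = nth-++ʳ xs ys i

  nth-beyond : ∀ xs i → length xs ≤ i → nth xs i ≡ 0
  nth-beyond []       i       _       = refl
  nth-beyond (x ∷ xs) (suc i) (s≤s h) = nth-beyond xs i h

  nth-ext : ∀ xs ys → length xs ≡ length ys → (∀ i → i < length xs → nth xs i ≡ nth ys i) → xs ≡ ys
  nth-ext []       []       _ _ = refl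
  nth-ext (x ∷ xs) (y ∷ ys) e h = cong₂ _∷_ (h 0 (s≤s z≤n)) (nth-ext xs ys (suc-injective e) (λ i i< → h (suc i) (s≤s i<)))

  nth-slice : ∀ f r i → i < r → nth (slice f r) i ≡ f i
  nth-slice f (suc r) zero    _       = refl
  nth-slice f (suc r) (suc i) (s≤s h) = nth-slice (f ∘ suc) r i h

  total-slice : ∀ f r → total (slice f r) ≡ sumTo r f
  total-slice f zero    = refl
  total-slice f (suc r) = trans (cong (f 0 +_) (total-slice (f ∘ suc) r)) (sym (sumTo-shift r f))

  ∈-slice : ∀ f r {x} → x ∈ slice f r → ∃ λ i → i < r × x ≡ f i
  ∈-slice f (suc r) (here e)  = 0 , s≤s z≤n , e
  ∈-slice f (suc r) (there p) with ∈-slice (f ∘ suc) r p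
  ... | i , i< , e = suc i , s≤s i< , e

  arr-sound : ∀ r e {t} → t ∈ arr r e → length t ≡ r × total t ≡ r + e × (∀ x → x ∈ t → 1 ≤ x × x ≤ 2)
  arr-sound zero    zero    (here refl) = refl , refl , λ _ ()
  arr-sound (suc r) zero    (here refl) with arr-sound r zero (here refl)
  ... | l , s , h = cong suc l , cong suc s , λ { x (here refl) → s≤s z≤n , s≤s z≤n ; x (there p) → h x p }
  arr-sound (suc r) (suc e) p with ∈-++⁻ (map (1 ∷_) (arr r (suc e))) p
  ... | inj₁ q with ∈-map⁻ (1 ∷_) q
  ...   | t , t∈ , refl with arr-sound r (suc e) t∈
  ...     | l , s , h = cong suc l , cong suc s , λ { x (here refl) → s≤s z≤n , s≤s z≤n ; x (there p) → h x p }
  arr-sound (suc r) (suc e) p | inj₂ q with ∈-map⁻ (2 ∷_) q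
  ...   | t , t∈ , refl with arr-sound r e t∈
  ...     | l , s , h = cong suc l , trans (cong (2 +_) s) (cong suc (sym (+-suc r e))) , λ { x (here refl) → s≤s z≤n , ≤-refl ; x (there p) → h x p }

  head-disjoint : ∀ {a b : ℕ} {xs ys : List (List ℕ)} {t} → ¬ (a ≡ b) → t ∈ map (a ∷_) xs × t ∈ map (b ∷_) ys → ⊥
  head-disjoint a≢b (p , q) with ∈-map⁻ _ p | ∈-map⁻ _ q
  ... | _ , _ , refl | _ , _ , e = a≢b (proj₁ (∷-injective e))

  arr-unique : ∀ r e → Unique (arr r e)
  arr-unique zero    zero    = [] ∷ []
  arr-unique (suc r) zero    = [] ∷ []
  arr-unique zero    (suc e) = []
  arr-unique (suc r) (suc e) = Uniq.++⁺ (Uniq.map⁺ ∷-injectiveʳ (arr-unique r (suc e))) (Uniq.map⁺ ∷-injectiveʳ (arr-unique r e)) (head-disjoint λ ())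

  comps₃ : ℕ → List (List ℕ)
  comps₃ 0 = [] ∷ []
  comps₃ 1 = map (1 ∷_) (comps₃ 0)
  comps₃ 2 = map (1 ∷_) (comps₃ 1) ++ map (2 ∷_) (comps₃ 0)
  comps₃ (suc (suc (suc n))) = map (1 ∷_) (comps₃ (suc (suc n))) ++ (map (2 ∷_) (comps₃ (suc n)) ++ map (3 ∷_) (comps₃ n))

  comps₃-unique : ∀ n → Unique (comps₃ n)
  comps₃-unique 0 = [] ∷ []
  comps₃-unique 1 = [] ∷ []
  comps₃-unique 2 = ((λ ()) ∷ []) ∷ [] ∷ []
  comps₃-unique (suc (suc (suc n))) = Uniq.++⁺ (Uniq.map⁺ ∷-injectiveʳ (comps₃-unique (suc (suc n))))
    (Uniq.++⁺ (Uniq.map⁺ ∷-injectiveʳ (comps₃-unique (suc n))) (Uniq.map⁺ ∷-injectiveʳ (comps₃-unique n)) (head-disjoint λ ()))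
    λ { (p , q) → case ∈-++⁻ (map (2 ∷_) (comps₃ (suc n))) q of λ { (inj₁ q') → head-disjoint (λ ()) (p , q') ; (inj₂ q') → head-disjoint (λ ()) (p , q') } }

  comps₃-complete : ∀ h → (∀ x → x ∈ h → 1 ≤ x × x ≤ 3) → h ∈ comps₃ (total h)
  comps₃-complete []      _ = here refl
  comps₃-complete (x ∷ h) l with x | l x (here refl) | comps₃-complete h (λ y p → l y (there p))
  ... | 1 | _ | ih = prepend-one (total h) ih
    where
    prepend-one : ∀ n → h ∈ comps₃ n → (1 ∷ h) ∈ comps₃ (suc n)
    prepend-one 0             p = ∈-map⁺ (1 ∷_) p
    prepend-one 1             p = ∈-++⁺ˡ (∈-map⁺ (1 ∷_) p)
    prepend-one (suc (suc n)) p = ∈-++⁺ˡ (∈-map⁺ (1 ∷_) p)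
  ... | 2 | _ | ih = prepend-two (total h) ih
    where
    prepend-two : ∀ n → h ∈ comps₃ n → (2 ∷ h) ∈ comps₃ (suc (suc n))
    prepend-two 0       p = ∈-++⁺ʳ (map (1 ∷_) (comps₃ 1)) (∈-map⁺ (2 ∷_) p)
    prepend-two (suc n) p = ∈-++⁺ʳ (map (1 ∷_) (comps₃ (suc (suc n)))) (∈-++⁺ˡ (∈-map⁺ (2 ∷_) p))
  ... | 3 | _ | ih = ∈-++⁺ʳ (map (1 ∷_) (comps₃ (suc (suc (total h))))) (∈-++⁺ʳ (map (2 ∷_) (comps₃ (suc (total h)))) (∈-map⁺ (3 ∷_) ih))
  ... | suc (suc (suc (suc _))) | (_ , s≤s (s≤s (s≤s ()))) | _

  comps₃-sound : ∀ n {h} → h ∈ comps₃ n → total h ≡ n × (∀ x → x ∈ h → 1 ≤ x × x ≤ 3)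
  comps₃-sound n p = go n p
    where
    ext : ∀ a {n h xs} → 1 ≤ a × a ≤ 3 → (∀ {h} → h ∈ xs → total h ≡ n × (∀ x → x ∈ h → 1 ≤ x × x ≤ 3)) → h ∈ map (a ∷_) xs →
      total h ≡ a + n × (∀ x → x ∈ h → 1 ≤ x × x ≤ 3)
    ext a ab f q with ∈-map⁻ (a ∷_) q
    ... | h , h∈ , refl with f h∈
    ...   | s , l = cong (a +_) s , λ { x (here refl) → ab ; x (there r) → l x r }
    ab₁ : 1 ≤ 1 × 1 ≤ 3
    ab₁ = s≤s z≤n , s≤s z≤n
    ab₂ : 1 ≤ 2 × 2 ≤ 3
    ab₂ = s≤s z≤n , s≤s (s≤s z≤n)
    ab₃ : 1 ≤ 3 × 3 ≤ 3
    ab₃ = s≤s z≤n , ≤-refl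
    go : ∀ n {h} → h ∈ comps₃ n → total h ≡ n × (∀ x → x ∈ h → 1 ≤ x × x ≤ 3)
    go 0 (here refl) = refl , λ _ ()
    go 1 p = ext 1 ab₁ (go 0) p
    go 2 p = [ ext 1 ab₁ (go 1) , ext 2 ab₂ (go 0) ]′ (∈-++⁻ (map (1 ∷_) (comps₃ 1)) p)
    go (suc (suc (suc n))) p = [ ext 1 ab₁ (go (suc (suc n))) , (λ q → [ ext 2 ab₂ (go (suc n)) , ext 3 ab₃ (go n) ]′
      (∈-++⁻ (map (2 ∷_) (comps₃ (suc n))) q)) ]′ (∈-++⁻ (map (1 ∷_) (comps₃ (suc (suc n)))) p)

  -- A head, empty or ending in its last letter 3, and a tail over {1,2}.
  Word : Set
  Word = List ℕ × List ℕ

  letter : Word → ℕ → ℕ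
  letter (h , t) = nth (0 ∷ (h ++ t))

  size : Word → ℕ
  size (h , t) = length (h ++ t)

  record Good (g : ℕ) (x : Word) : Set where
    h = proj₁ x
    t = proj₂ x
    field
      h-letters : ∀ a → a ∈ h → 1 ≤ a × a ≤ 3
      t-letters : ∀ a → a ∈ t → 1 ≤ a × a ≤ 2
      sub : ∀ i j → i + j ≤ length h → nth (0 ∷ h) (i + j) ≤ nth (0 ∷ h) i + nth (0 ∷ h) j
      last : length h ≡ 0 ⊎ nth (0 ∷ h) (length h) ≡ 3
      genus : total h + total t ≡ g

    in-head : ∀ i → i ≤ length h → letter x i ≡ nth (0 ∷ h) i
    in-head i i≤ = nth-++ˡ (0 ∷ h) t i (s≤s i≤)
    in-tail : ∀ i → letter x (suc (length h) + i) ≡ nth t i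
    in-tail i = nth-++ʳ (0 ∷ h) t i

    all-letters : ∀ a → a ∈ (h ++ t) → 1 ≤ a × a ≤ 3
    all-letters a p with ∈-++⁻ h p
    ... | inj₁ q = h-letters a q
    ... | inj₂ q = proj₁ (t-letters a q) , m≤n⇒m≤1+n (proj₂ (t-letters a q))

    letter-pos : ∀ i → 0 < i → i ≤ size x → 1 ≤ letter x i
    letter-pos (suc i) _ i< = proj₁ (all-letters _ (nth-∈ (h ++ t) i i<))

    letter≤3 : ∀ i → letter x i ≤ 3
    letter≤3 zero = z≤n
    letter≤3 (suc i) with i <? length (h ++ t)
    ... | yes i< = proj₂ (all-letters _ (nth-∈ (h ++ t) i i<))
    ... | no i≮ = ≤-trans (≤-reflexive (nth-beyond (h ++ t) i (≮⇒≥ i≮))) z≤n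

    tail≤2 : ∀ i → length h < i → letter x i ≤ 2
    tail≤2 i h< with m≤n⇒∃[o]m+o≡n h<
    ... | o , refl with o <? length t
    ...   | yes o< = ≤-trans (≤-reflexive (in-tail o)) (proj₂ (t-letters _ (nth-∈ t o o<)))
    ...   | no  o≮ = ≤-trans (≤-reflexive (trans (in-tail o) (nth-beyond t o (≮⇒≥ o≮)))) z≤n

    open Decode (size x) (letter x) 3 letter≤3 public

    gaps : IsGapList g decode
    total≡ : sumTo (suc (size x)) (letter x) ≡ g
    -- Only sums that stay inside the head need a hypothesis: a tail letter is at most 2 ≤ 1 + 1,
    -- and with wrap-around every letter is at most 3 ≤ 1 + 1 + 1.
    closed-facts : (∀ i j → i + j < suc (size x) → letter x (i + j) ≤ letter x i + letter x j) ×
      (∀ i j l → i < suc (size x) → j < suc (size x) → l < suc (size x) → i + j ≡ suc (size x) + l → letter x l ≤ suc (letter x i + letter x j))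
    gaps = subst (λ z → IsGapList z decode) total≡ (decode-gaps refl (proj₁ closed-facts) (proj₂ closed-facts))
    total≡ = trans (sumTo-nth (0 ∷ (h ++ t))) (trans (sumL-++ (λ a → a) h t) genus)
    closed-facts = sub-add , sub-mod
      where
      sub-add : ∀ i j → i + j < suc (size x) → letter x (i + j) ≤ letter x i + letter x j
      sub-add zero    j       _ = ≤-refl
      sub-add (suc i) zero    _ = ≤-trans (≤-reflexive (cong (letter x) (+-identityʳ (suc i)))) (m≤m+n _ 0)
      sub-add (suc i) (suc j) lt with (suc i + suc j) ≤? length h
      ... | yes le = subst₂ _≤_ (sym (in-head (suc i + suc j) le)) (cong₂ _+_ (sym (in-head (suc i) (≤-trans (m≤m+n _ _) le))) (sym (in-head (suc j) (≤-trans (m≤n+m _ (suc i)) le)))) (sub (suc i) (suc j) le)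
      ... | no gt = ≤-trans (tail≤2 (suc i + suc j) (≰⇒> gt))
            (+-mono-≤ (letter-pos (suc i) (s≤s z≤n) (≤-trans (m≤m+n _ (suc j)) (≤-pred lt))) (letter-pos (suc j) (s≤s z≤n) (≤-trans (m≤n+m _ (suc i)) (≤-pred lt))))
      sub-mod : ∀ i j l → i < suc (size x) → j < suc (size x) → l < suc (size x) → i + j ≡ suc (size x) + l → letter x l ≤ suc (letter x i + letter x j)
      sub-mod zero    j       l _  j< _ e = ⊥-elim (<-irrefl refl (≤-trans j< (≤-trans (m≤m+n _ l) (≤-reflexive (sym e)))))
      sub-mod (suc i) zero    l i< _ _  e = ⊥-elim (<-irrefl refl (≤-trans i< (≤-trans (m≤m+n _ l) (≤-reflexive (trans (sym e) (+-identityʳ (suc i)))))))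
      sub-mod (suc i) (suc j) l i< j< _ e = ≤-trans (letter≤3 l) (s≤s (+-mono-≤ (letter-pos (suc i) (s≤s z≤n) (≤-pred i<)) (letter-pos (suc j) (s≤s z≤n) (≤-pred j<))))

  -- Every letter is at most 3, so three blocks of length suc (size x) contain all gaps.
  gapSet : Word → List ℕ
  gapSet x = filterᵇ (λ n → (n / suc (size x)) <ᵇ letter x (n % suc (size x))) (upTo (3 * suc (size x)))
    where open import Data.Nat.DivMod using (_/_; _%_)

  -- The size is one less than the multiplicity, and the letters are numbers of gaps in residue
  -- classes. The cut between head and tail is visible because a nonempty head ends in 3 while tail
  -- letters are at most 2.
  gapSet-injective : ∀ {g x y} → Good g x → Good g y → gapSet x ≡ gapSet y → x ≡ y
  gapSet-injective {x = x@(h , t)} {y@(h' , t')} G G' e = words (heads h≡)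
    where
    module G = Good G
    module G' = Good G'
    no-less : ∀ {x y} (G : Good _ x) (G' : Good _ y) → gapSet x ≡ gapSet y → ¬ (size x < size y)
    no-less {x} {y} G G' e lt = case Good.decode⇒ G 0 1 (s≤s z≤n)
        (subst (_∈ gapSet x) (sym (trans (+-identityʳ _) (+-identityʳ (suc (size x)))))
          (subst (suc (size x) ∈_) (sym e) (Good.decode⇐ G' (suc (size x)) 0 (s≤s lt) (Good.letter-pos G' (suc (size x)) (s≤s z≤n) lt)))) of λ ()
    size≡ : size x ≡ size y
    size≡ = ≤-antisym (≮⇒≥ (no-less G' G (sym e))) (≮⇒≥ (no-less G G' e))
    le : ∀ {x y} (G : Good _ x) (G' : Good _ y) → gapSet x ≡ gapSet y → size x ≡ size y → ∀ i → i < suc (size x) → letter x i ≤ letter y i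
    le {x} {y} G G' e s i i< = ≮⇒≥ λ lt → <-irrefl refl (Good.decode⇒ G' i (letter y i) (subst (λ z → i < suc z) s i<)
        (subst (λ z → letter y i * suc z + i ∈ gapSet y) s (subst (letter y i * suc (size x) + i ∈_) e (Good.decode⇐ G i (letter y i) i< lt))))
    letters≡ : ∀ i → i < suc (size x) → letter x i ≡ letter y i
    letters≡ i i< = ≤-antisym (le G G' e size≡ i i<) (le G' G (sym e) (sym size≡) i (subst (λ z → i < suc z) size≡ i<))
    same : h ++ t ≡ h' ++ t'
    same = nth-ext (h ++ t) (h' ++ t') size≡ (λ i i< → letters≡ (suc i) (s≤s i<))
    not-shorter : ∀ {x y} (G : Good _ x) (G' : Good _ y) → (∀ i → i < suc (size x) → letter x i ≡ letter y i) → size x ≡ size y →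
      ¬ (length (proj₁ x) < length (proj₁ y))
    not-shorter {x} {y} G G' le s lt with Good.last G'
    ... | inj₁ z = case subst (length (proj₁ x) <_) z lt of λ ()
    ... | inj₂ three = <-irrefl refl (≤-trans (≤-reflexive (trans (sym three) (trans (sym (Good.in-head G' k ≤-refl)) (sym (le k k<))))) (Good.tail≤2 G k lt))
      where
      k = length (proj₁ y)
      k< : k < suc (size x)
      k< = s≤s (≤-trans (≤-trans (m≤m+n k _) (≤-reflexive (sym (length-++ (proj₁ y))))) (≤-reflexive (sym s)))
    h≡ : length h ≡ length h'
    h≡ = ≤-antisym (≮⇒≥ (not-shorter G' G (λ i i< → sym (letters≡ i (subst (λ z → i < suc z) (sym size≡) i<))) (sym size≡))) (≮⇒≥ (not-shorter G G' letters≡ size≡))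
    heads : length h ≡ length h' → h ≡ h'
    heads l = nth-ext h h' l (λ i i< → trans (sym (nth-++ˡ h t i i<)) (trans (cong (λ z → nth z i) same) (nth-++ˡ h' t' i (subst (i <_) l i<))))
    words : h ≡ h' → x ≡ y
    words refl = cong (h ,_) (nth-ext t t' (+-cancelˡ-≡ (length h) _ _ (trans (sym (length-++ h)) (trans size≡ (length-++ h))))
      (λ i _ → trans (sym (nth-++ʳ h t i)) (trans (cong (λ z → nth z (length h + i)) same) (nth-++ʳ h t' i))))

  -- Distinct good words give distinct semigroups, so they can be counted inside any enumeration.
  good-count : ∀ {g L} → Enumerates g L → (p : List ℕ → Bool) (xs : List Word) → Unique xs → (∀ x → x ∈ xs → Good g x) →
    sumL (λ x → bit (p (gapSet x))) xs ≤ countᵇ p L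
  good-count {g} {L} en p xs u good = ≤-trans (≤-reflexive (sym (length-filterᵇ (p ∘ gapSet) xs))) (≤-trans
    (length-≤-rel (λ x G → G ≡ gapSet x) (filterᵇ-Unique (p ∘ gapSet) u)
      (λ x x∈ → let (x∈xs , px) = filterᵇ-∈⁻ (p ∘ gapSet) xs x∈ in
        gapSet x , filterᵇ-∈⁺ p (Enumerates.complete en (gapSet x) (Good.gaps (good x x∈xs))) px , refl)
      (λ {x} {x'} x∈ x'∈ e e' → gapSet-injective (good x (proj₁ (filterᵇ-∈⁻ (p ∘ gapSet) xs x∈))) (good x' (proj₁ (filterᵇ-∈⁻ (p ∘ gapSet) xs x'∈))) (trans (sym e) e')))
    (≤-reflexive (sym (countᵇ-filter p L))))

  -- Pairs `i`, `j` whose sum exceeds the length of the head pass the test, since `nth` is 0 there.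
  validᵇ : List ℕ → Bool
  validᵇ h = ((length h ≡ᵇ 0) ∨ (nth (0 ∷ h) (length h) ≡ᵇ 3)) ∧
    allᵇ (λ i → allᵇ (λ j → nth (0 ∷ h) (i + j) ≤ᵇ nth (0 ∷ h) i + nth (0 ∷ h) j) (range (length h))) (range (length h))

  allᵇ-sound : ∀ p xs → allᵇ p xs ≡ true → ∀ x → x ∈ xs → p x ≡ true
  allᵇ-sound p (x ∷ xs) e y (here refl) = proj₁ (∧-true⁻ e)
  allᵇ-sound p (x ∷ xs) e y (there q)   = allᵇ-sound p xs (proj₂ (∧-true⁻ {p x} e)) y q

  allᵇ-complete : ∀ p xs → (∀ x → x ∈ xs → p x ≡ true) → allᵇ p xs ≡ true
  allᵇ-complete p []       h = refl
  allᵇ-complete p (x ∷ xs) h = ∧-true (h x (here refl)) (allᵇ-complete p xs (λ y q → h y (there q)))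

  ∨-true⁻ : ∀ {a b} → a ∨ b ≡ true → a ≡ true ⊎ b ≡ true
  ∨-true⁻ {true}  _ = inj₁ refl
  ∨-true⁻ {false} e = inj₂ e

  ∨-trueʳ : ∀ a {b} → b ≡ true → a ∨ b ≡ true
  ∨-trueʳ true  _ = refl
  ∨-trueʳ false e = e

  not-true⁻ : ∀ {b} → not b ≡ true → b ≡ false
  not-true⁻ {false} _ = refl

  not-true : ∀ {b} → b ≡ false → not b ≡ true
  not-true refl = refl

  heads : ℕ → List (List ℕ)
  heads n = filterᵇ validᵇ (comps₃ n)

  typical : ℕ → ℕ → ℕ → Bool
  typical X N r = not (atypical X N r)

  goodGroup : ℕ → ℕ → List ℕ → List Word
  goodGroup N r h = map (h ,_) (arr r (N ∸ r))

  goodAt : ℕ → ℕ → List ℕ → List Word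
  goodAt X N h = concatMap (λ r → goodGroup N r h) (filterᵇ (typical X N) (range N))

  goodFrom : ℕ → ℕ → ℕ → List Word
  goodFrom X g n = concatMap (goodAt X (g ∸ n)) (heads n)

  goodWords : ℕ → ℕ → ℕ → List Word
  goodWords X Kmax g = concatMap (goodFrom X g) (range Kmax)

  goodGroup-sound : ∀ N r h {x} → x ∈ goodGroup N r h → proj₁ x ≡ h × proj₂ x ∈ arr r (N ∸ r)
  goodGroup-sound N r h p with ∈-map⁻ (h ,_) p
  ... | t , t∈ , refl = refl , t∈

  goodAt-sound : ∀ X N h {x} → x ∈ goodAt X N h → proj₁ x ≡ h × ∃ λ r → r ≤ N × proj₂ x ∈ arr r (N ∸ r)
  goodAt-sound X N h p with concatMap-∈⁻ (λ r → goodGroup N r h) (filterᵇ (typical X N) (range N)) p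
  ... | r , r∈ , q with goodGroup-sound N r h q
  ...   | e , t∈ = e , r , ≤-pred (∈-upTo⁻ (proj₁ (filterᵇ-∈⁻ (typical X N) (range N) r∈))) , t∈

  goodFrom-sound : ∀ X g n {x} → x ∈ goodFrom X g n → proj₁ x ∈ heads n × ∃ λ r → r ≤ g ∸ n × proj₂ x ∈ arr r (g ∸ n ∸ r)
  goodFrom-sound X g n p with concatMap-∈⁻ (goodAt X (g ∸ n)) (heads n) p
  ... | h , h∈ , q with goodAt-sound X (g ∸ n) h q
  ...   | refl , rest = h∈ , rest

  valid-good : ∀ {g} n h t r → n ≤ g → h ∈ heads n → r ≤ g ∸ n → t ∈ arr r (g ∸ n ∸ r) → Good g (h , t)
  valid-good {g} n h t r n≤g h∈ r≤ t∈ with filterᵇ-∈⁻ validᵇ (comps₃ n) h∈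
  ... | h∈c , v with comps₃-sound n h∈c | arr-sound r (g ∸ n ∸ r) t∈ | ∧-true⁻ {(length h ≡ᵇ 0) ∨ (nth (0 ∷ h) (length h) ≡ᵇ 3)} v
  ...   | sh , lh | _ , st , lt | l , s = record
    { h-letters = lh ; t-letters = lt
    ; sub = λ i j le → ≤ᵇ-sound _ _ (allᵇ-sound _ (range (length h)) (allᵇ-sound _ (range (length h)) s i (∈-upTo⁺ (s≤s (≤-trans (m≤m+n i j) le)))) j (∈-upTo⁺ (s≤s (≤-trans (m≤n+m j i) le))))
    ; last = [ (λ e → inj₁ (≡ᵇ-sound _ 0 e)) , (λ e → inj₂ (≡ᵇ-sound _ 3 e)) ]′ (∨-true⁻ l)
    ; genus = trans (cong₂ _+_ sh st) (trans (cong (n +_) (m+[n∸m]≡n r≤)) (m+[n∸m]≡n n≤g)) }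

  goodWords-good : ∀ X Kmax g → Kmax ≤ g → ∀ x → x ∈ goodWords X Kmax g → Good g x
  goodWords-good X Kmax g K≤ (h , t) p with concatMap-∈⁻ (goodFrom X g) (range Kmax) p
  ... | n , n∈ , q with goodFrom-sound X g n q
  ...   | h∈ , r , r≤ , t∈ = valid-good n h t r (≤-trans (≤-pred (∈-upTo⁻ n∈)) K≤) h∈ r≤ t∈

  goodWords-unique : ∀ X Kmax g → Unique (goodWords X Kmax g)
  goodWords-unique X Kmax g = Unique-concatMap (goodFrom X g) (Uniq.upTo⁺ (suc Kmax))
    (λ n _ → Unique-concatMap (goodAt X (g ∸ n)) (filterᵇ-Unique validᵇ (comps₃-unique n))
      (λ h _ → Unique-concatMap (λ r → goodGroup (g ∸ n) r h) (filterᵇ-Unique (typical X (g ∸ n)) (Uniq.upTo⁺ (suc (g ∸ n))))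
        (λ r _ → Uniq.map⁺ (λ e → proj₂ (,-injective e)) (arr-unique r (g ∸ n ∸ r)))
        (λ {r} {r'} p q → trans (sym (proj₁ (arr-sound r (g ∸ n ∸ r) (proj₂ (goodGroup-sound (g ∸ n) r h p))))) (proj₁ (arr-sound r' (g ∸ n ∸ r') (proj₂ (goodGroup-sound (g ∸ n) r' h q))))))
      (λ {h} {h'} p q → trans (sym (proj₁ (goodAt-sound X (g ∸ n) h p))) (proj₁ (goodAt-sound X (g ∸ n) h' q))))
    (λ {n} {n'} p q → trans (sym (head-total n p)) (head-total n' q))
    where
    head-total : ∀ n {x} → x ∈ goodFrom X g n → total (proj₁ x) ≡ n
    head-total n p = proj₁ (comps₃-sound n (proj₁ (filterᵇ-∈⁻ validᵇ (comps₃ n) (proj₁ (goodFrom-sound X g n p)))))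

  tails-unique : ∀ N → Unique (tails N)
  tails-unique N = Unique-concatMap (λ r → arr r (N ∸ r)) (Uniq.upTo⁺ (suc N)) (λ r _ → arr-unique r (N ∸ r))
    (λ {r} {r'} p q → trans (sym (proj₁ (arr-sound r (N ∸ r) p))) (proj₁ (arr-sound r' (N ∸ r') q)))

  countᵇ-all : ∀ L → countᵇ (λ _ → true) L ≡ length L
  countᵇ-all []      = refl
  countᵇ-all (x ∷ L) = cong suc (countᵇ-all L)

  -- With an empty head every word over {1,2} is good. This lower bound is the yardstick for all
  -- exceptional counts.
  fibo≤count : ∀ {g L} → Enumerates g L → fibo g ≤ length L
  fibo≤count {g} {L} en = begin
    fibo g                                       ≡⟨ trans (sym (length-tails g)) (trans (sym (length-map ([] ,_) (tails g))) (length-sumL (map ([] ,_) (tails g)))) ⟩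
    sumL (λ _ → 1) (map ([] ,_) (tails g))       ≤⟨ good-count en (λ _ → true) (map ([] ,_) (tails g)) (Uniq.map⁺ (λ e → proj₂ (,-injective e)) (tails-unique g)) good ⟩
    countᵇ (λ _ → true) L                        ≡⟨ countᵇ-all L ⟩
    length L ∎
    where
    open ≤-Reasoning
    good : ∀ x → x ∈ map ([] ,_) (tails g) → Good g x
    good x p with ∈-map⁻ ([] ,_) p
    ... | t , t∈ , refl with concatMap-∈⁻ (λ r → arr r (g ∸ r)) (range g) t∈
    ...   | r , r∈ , q = valid-good 0 [] t r z≤n (here refl) (≤-pred (∈-upTo⁻ r∈)) q

  codes₃ : ℕ → ℕ → ℕ → List Word
  codes₃ X Kmax g = concatMap (λ n → cartesianProduct (comps₃ n) (atypicalTails X (g ∸ n))) (range Kmax)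

  -- There are finitely many heads of sum at most `Kmax`, and for each of them atypicality of the
  -- tail saves a factor `g ∸ n`, at least `g ∸ Kmax`.
  codes₃-small : ∀ Y X Kmax → ∃ λ M → ∀ g → M ≤ g → Y * length (codes₃ X Kmax g) ≤ fibo g
  codes₃-small Y X Kmax = Kmax + suc (Y * A) , λ g M≤ → *-cancelˡ-≤ A (begin
    A * (Y * length (codes₃ X Kmax g))         ≡⟨ lem A Y (length (codes₃ X Kmax g)) ⟩
    Y * A * length (codes₃ X Kmax g)           ≤⟨ *-monoˡ-≤ (length (codes₃ X Kmax g)) (≤-trans (n≤1+n (Y * A)) (m+n≤o⇒n≤o∸m Kmax M≤)) ⟩
    (g ∸ Kmax) * length (codes₃ X Kmax g)      ≤⟨ bound g (≤-trans (s≤s z≤n) (m+n≤o⇒n≤o∸m Kmax M≤)) ⟩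
    B * (6 * X * fibo g)                       ≡⟨ *-assoc B (6 * X) (fibo g) ⟨
    B * (6 * X) * fibo g                       ≤⟨ *-monoˡ-≤ (fibo g) (n≤1+n (B * (6 * X))) ⟩
    A * fibo g ∎)
    where
    open ≤-Reasoning
    B = sumL (λ n → length (comps₃ n)) (range Kmax)
    A = suc (B * (6 * X))
    lem : ∀ a y l → a * (y * l) ≡ y * a * l
    lem = solve-∀
    m+n≤o⇒n≤o∸m : ∀ m {n o} → m + n ≤ o → n ≤ o ∸ m
    m+n≤o⇒n≤o∸m m {n} h = m+n≤o⇒m≤o∸n n (≤-trans (≤-reflexive (+-comm n m)) h)
    bound : ∀ g → 0 < g ∸ Kmax → (g ∸ Kmax) * length (codes₃ X Kmax g) ≤ B * (6 * X * fibo g)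
    bound g pos = begin
      (g ∸ Kmax) * length (codes₃ X Kmax g)
        ≡⟨ cong ((g ∸ Kmax) *_) (trans (length-concatMap (λ n → cartesianProduct (comps₃ n) (atypicalTails X (g ∸ n))) (range Kmax))
             (sumL-cong (range Kmax) (λ n _ → length-cartesianProduct (comps₃ n) (atypicalTails X (g ∸ n))))) ⟩
      (g ∸ Kmax) * sumL (λ n → length (comps₃ n) * length (atypicalTails X (g ∸ n))) (range Kmax)
        ≡⟨ sumL-*ˡ (g ∸ Kmax) _ (range Kmax) ⟨
      sumL (λ n → (g ∸ Kmax) * (length (comps₃ n) * length (atypicalTails X (g ∸ n)))) (range Kmax)
        ≤⟨ sumL-mono (range Kmax) (λ n n∈ → each n (≤-pred (∈-upTo⁻ n∈))) ⟩
      sumL (λ n → length (comps₃ n) * (6 * X * fibo g)) (range Kmax)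
        ≡⟨ sumL-*ʳ (6 * X * fibo g) (λ n → length (comps₃ n)) (range Kmax) ⟩
      B * (6 * X * fibo g) ∎
      where
      each : ∀ n → n ≤ Kmax → (g ∸ Kmax) * (length (comps₃ n) * length (atypicalTails X (g ∸ n))) ≤ length (comps₃ n) * (6 * X * fibo g)
      each n n≤ = begin
        (g ∸ Kmax) * (length (comps₃ n) * length (atypicalTails X (g ∸ n))) ≡⟨ lem' (g ∸ Kmax) (length (comps₃ n)) _ ⟩
        length (comps₃ n) * ((g ∸ Kmax) * length (atypicalTails X (g ∸ n))) ≤⟨ *-monoʳ-≤ (length (comps₃ n)) (≤-trans (*-monoˡ-≤ (length (atypicalTails X (g ∸ n))) (∸-monoʳ-≤ g n≤))
            (≤-trans (atypical-count X (g ∸ n) (≤-trans pos (∸-monoʳ-≤ g n≤))) (*-monoʳ-≤ (6 * X) (fibo-mono (m∸n≤m g n))))) ⟩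
        length (comps₃ n) * (6 * X * fibo g) ∎
        where
        lem' : ∀ a b c → a * (b * c) ≡ b * (a * c)
        lem' = solve-∀

  record Rep₃ (g : ℕ) (G : List ℕ) (x : Word) : Set where
    field
      K : Kunz g G
      size≡ : Kunz.pm K ≡ size x
      letters≡ : ∀ i → i < Kunz.m K → Kunz.w K i ≡ letter x i

  Rep₃-injective : ∀ {g G G' x} → Rep₃ g G x → Rep₃ g G' x → G ≡ G'
  Rep₃-injective ρ σ = kunz-ext ρ.K σ.K s (λ i i< → trans (ρ.letters≡ i i<) (sym (σ.letters≡ i (subst (λ z → i < suc z) s i<))))
    where
    module ρ = Rep₃ ρ
    module σ = Rep₃ σ
    s = trans ρ.size≡ (sym σ.size≡)

  Rep₃-gapSet : ∀ {g G x} → Good g x → Rep₃ g G x → G ≡ gapSet x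
  Rep₃-gapSet {g} {G} {x} good ρ = kunz-ext ρ.K K' (trans ρ.size≡ refl) (λ i i< → ρ.letters≡ i i<)
    where
    module ρ = Rep₃ ρ
    module D = Good good
    K' : Kunz g (gapSet x)
    K' = record { pm = size x ; w = letter x ; sorted = D.decode-sorted ; gap⇒ = D.decode⇒ ; gap⇐ = D.decode⇐ ; w0 = refl
      ; pos = λ i 0<i i< → D.letter-pos i 0<i (≤-pred i<) ; sub = proj₁ (D.closed-facts) ; sub-mod = proj₂ D.closed-facts ; total = D.total≡ }

  -- In this order: a letter at least 4, a head of sum above `Kmax`, a short head with an atypical
  -- tail, and the good words, which alone carry the estimate.
  Classified : ℕ → ℕ → ℕ → List ℕ → Set
  Classified X Kmax g G = (∃ λ x → x ∈ codes₁ g × Rep₁ g G x) ⊎ (∃ λ x → x ∈ codes₂ Kmax g × Rep₂ g G x) ⊎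
    (∃ λ x → x ∈ codes₃ X Kmax g × Rep₃ g G x) ⊎ (∃ λ x → x ∈ goodWords X Kmax g × Rep₃ g G x)

  classify : ∀ X Kmax {g G} → Kunz g G → Classified X Kmax g G
  classify X Kmax {g} {G} K with findFirst (λ i → 4 ≤ᵇ Kunz.w K i) (suc (Kunz.pm K))
  ... | inj₂ (i , i< , e , _) = inj₁ (encode₁ K i (≤-pred i<) (≤ᵇ-sound 4 _ e))
  ... | inj₁ none = go (findLast (λ i → 3 ≤ᵇ w i) (suc pm))
    where
    open Kunz K hiding (total; m)
    open KunzFacts K
    ≤3 : ∀ i → i ≤ pm → w i ≤ 3
    ≤3 i i≤ = ≤-pred (≰⇒> (λ le → case trans (sym (none i (s≤s i≤))) (≤ᵇ-true le) of λ ()))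
    below3 : ∀ i → (3 ≤ᵇ w i) ≡ false → w i ≤ 2
    below3 i e = ≤-pred (≰⇒> (λ le → case trans (sym e) (≤ᵇ-true le) of λ ()))

    finish : ∀ k r → k + r ≡ pm → (k ≡ 0 ⊎ w k ≡ 3) → (∀ i → k < i → i ≤ pm → w i ≤ 2) → total (slice (w ∘ suc) k) ≤ Kmax → Classified X Kmax g G
    finish k r kr last ≤2 n≤ with slice-arr (λ i → w (suc k + i)) r (λ i i< →
        pos (suc k + i) (s≤s z≤n) (s≤s (inside i i<)) , ≤2 (suc k + i) (s≤s (m≤m+n k i)) (inside i i<))
      where
      inside : ∀ i → i < r → suc k + i ≤ pm
      inside i i< = ≤-trans (≤-reflexive (sym (+-suc k i))) (≤-trans (+-monoʳ-≤ k i<) (≤-reflexive kr))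
    ... | e , sum-e , t∈ = split
      where
      h = slice (w ∘ suc) k
      t = slice (λ i → w (suc k + i)) r
      n = total h
      N = g ∸ n
      lh : length h ≡ k
      lh = length-slice (w ∘ suc) k
      lt : length t ≡ r
      lt = length-slice (λ i → w (suc k + i)) r
      n+ : n + (r + e) ≡ g
      n+ = trans (cong₂ _+_ (total-slice (w ∘ suc) k) (sym sum-e)) (trans (sym (sumTo-add k r (w ∘ suc))) (trans (cong (λ z → sumTo z (w ∘ suc)) kr) total-pos))
      N≡ : N ≡ r + e
      N≡ = trans (cong (_∸ n) (sym n+)) (m+n∸m≡n n (r + e))
      e≡ : N ∸ r ≡ e
      e≡ = trans (cong (_∸ r) N≡) (m+n∸m≡n r e)
      r∈ : r ∈ range N
      r∈ = ∈-upTo⁺ (s≤s (≤-trans (m≤m+n r e) (≤-reflexive (sym N≡))))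
      t∈' : t ∈ arr r (N ∸ r)
      t∈' = subst (λ z → t ∈ arr r z) (sym e≡) t∈
      h-let : ∀ a → a ∈ h → 1 ≤ a × a ≤ 3
      h-let a p with ∈-slice (w ∘ suc) k p
      ... | i , i< , refl = pos (suc i) (s≤s z≤n) (s≤s i≤) , ≤3 (suc i) i≤
        where
        i≤ : suc i ≤ pm
        i≤ = ≤-trans i< (≤-trans (m≤m+n k r) (≤-reflexive kr))
      h∈ : h ∈ comps₃ n
      h∈ = comps₃-complete h h-let
      head-nth : ∀ i → i ≤ k → nth (0 ∷ h) i ≡ w i
      head-nth zero    _  = sym w0
      head-nth (suc i) i< = nth-slice (w ∘ suc) k i i<
      rep : Rep₃ g G (h , t)
      rep = record { K = K ; size≡ = sym (trans (length-++ h) (trans (cong₂ _+_ lh lt) kr)) ; letters≡ = eq }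
        where
        eq : ∀ i → i < suc pm → w i ≡ letter (h , t) i
        eq i i< with i ≤? k
        ... | yes i≤ = sym (trans (nth-++ˡ (0 ∷ h) t i (s≤s (≤-trans i≤ (≤-reflexive (sym lh))))) (head-nth i i≤))
        ... | no gt with m≤n⇒∃[o]m+o≡n (≰⇒> gt)
        ...   | o , refl = sym (trans (cong (λ z → letter (h , t) (suc z + o)) (sym lh)) (trans (nth-++ʳ (0 ∷ h) t o)
                  (nth-slice (λ i → w (suc k + i)) r o (+-cancelˡ-< k o r (subst (k + o <_) (sym kr) (≤-pred i<))))))
      valid : validᵇ h ≡ true
      valid = ∧-true lst (allᵇ-complete _ (range (length h)) (λ i i∈ → allᵇ-complete _ (range (length h)) (λ j j∈ → ≤ᵇ-true (vsub i j (bd i∈) (bd j∈)))))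
        where
        bd : ∀ {i} → i ∈ range (length h) → i ≤ k
        bd i∈ = ≤-trans (≤-pred (∈-upTo⁻ i∈)) (≤-reflexive lh)
        lst : ((length h ≡ᵇ 0) ∨ (nth (0 ∷ h) (length h) ≡ᵇ 3)) ≡ true
        lst rewrite lh = [ (λ e → cong (λ z → (z ≡ᵇ 0) ∨ (nth (0 ∷ h) k ≡ᵇ 3)) e) , (λ w3 → ∨-trueʳ (k ≡ᵇ 0) (cong (_≡ᵇ 3) (trans (head-nth k ≤-refl) w3))) ]′ last
        vsub : ∀ i j → i ≤ k → j ≤ k → nth (0 ∷ h) (i + j) ≤ nth (0 ∷ h) i + nth (0 ∷ h) j
        vsub i j i≤ j≤ with (i + j) ≤? k
        ... | yes le = subst₂ _≤_ (sym (head-nth (i + j) le)) (cong₂ _+_ (sym (head-nth i i≤)) (sym (head-nth j j≤)))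
                         (sub i j (s≤s (≤-trans le (≤-trans (m≤m+n k r) (≤-reflexive kr)))))
        ... | no gt = ≤-trans (≤-reflexive (nth-beyond (0 ∷ h) (i + j) (≤-trans (s≤s (≤-reflexive lh)) (≰⇒> gt)))) z≤n
      split : Classified X Kmax g G
      split with atypical X N r in at
      ... | true  = inj₂ (inj₂ (inj₁ ((h , t) , concatMap-∈⁺ {f = λ n → cartesianProduct (comps₃ n) (atypicalTails X (g ∸ n))} {xs = range Kmax} (∈-upTo⁺ (s≤s n≤))
                      (∈-cartesianProduct⁺ h∈ (concatMap-∈⁺ {f = λ r → arr r (N ∸ r)} {xs = filterᵇ (atypical X N) (range N)} (filterᵇ-∈⁺ (atypical X N) r∈ at) t∈')) , rep)))
      ... | false = inj₂ (inj₂ (inj₂ ((h , t) , concatMap-∈⁺ {f = goodFrom X g} {xs = range Kmax} (∈-upTo⁺ (s≤s n≤))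
                      (concatMap-∈⁺ {f = goodAt X N} {xs = heads n} (filterᵇ-∈⁺ validᵇ h∈ valid)
                        (concatMap-∈⁺ {f = λ r → goodGroup N r h} {xs = filterᵇ (typical X N) (range N)} (filterᵇ-∈⁺ (typical X N) r∈ (not-true at)) (∈-map⁺ (h ,_) t∈'))) , rep)))

    go : _ → Classified X Kmax g G
    go (inj₁ all<3) = finish 0 pm refl (inj₁ refl) (λ i _ i≤ → below3 i (all<3 i (s≤s i≤))) z≤n
    go (inj₂ (zero , _ , e , _)) = case ≤-trans (≤ᵇ-sound 3 (w 0) e) (≤-reflexive w0) of λ ()
    go (inj₂ (suc l₀ , k< , e , after)) with m≤n⇒∃[o]m+o≡n (≤-pred k<)
    ... | r , kr with total (slice (w ∘ suc) (suc l₀)) ≤? Kmax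
    ...   | yes n≤ = finish (suc l₀) r kr (inj₂ w3) (λ i lt i≤ → below3 i (after i lt (s≤s i≤))) n≤
      where
      w3 : w (suc l₀) ≡ 3
      w3 = ≤-antisym (≤3 (suc l₀) (≤-pred k<)) (≤ᵇ-sound 3 _ e)
    ...   | no n≰ = inj₂ (inj₁ (encode₂ K l₀ r Kmax (sym kr) (λ i i≤ → ≤3 i (≤-trans i≤ (≤-pred k<))) w3
            (λ i lt i≤ → below3 i (after i lt (s≤s i≤)))
            (≤-trans (≰⇒> n≰) (≤-reflexive (trans (total-slice (w ∘ suc) (suc l₀)) (cong (sumTo l₀ (w ∘ suc) +_) w3))))))
      where
      w3 : w (suc l₀) ≡ 3
      w3 = ≤-antisym (≤3 (suc l₀) (≤-pred k<)) (≤ᵇ-sound 3 _ e)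

  badCount : ℕ → ℕ → ℕ → ℕ
  badCount X Kmax g = length (codes₁ g) + (length (codes₂ Kmax g) + length (codes₃ X Kmax g))

  -- The three exceptional classes are counted without regard to `p`. In the last class the
  -- semigroup equals `gapSet x`, so `p` can be evaluated on the word.
  count-≤ : ∀ X Kmax {g L} → Kmax ≤ g → Enumerates g L → (p : List ℕ → Bool) →
    countᵇ p L ≤ sumL (λ x → bit (p (gapSet x))) (goodWords X Kmax g) + badCount X Kmax g
  count-≤ X Kmax {g} {L} K≤ en p = begin
    countᵇ p L              ≡⟨ countᵇ-filter p L ⟩
    length (filterᵇ p L)    ≤⟨ length-≤-rel R (filterᵇ-Unique p (Enumerates.unique en)) find (λ _ _ → inj) ⟩
    length ys               ≡⟨ len ⟩
    sumL (λ x → bit (p (gapSet x))) (goodWords X Kmax g) + badCount X Kmax g ∎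
    where
    open ≤-Reasoning
    F = filterᵇ (p ∘ gapSet) (goodWords X Kmax g)
    Code = Code₁ ⊎ Code₂ ⊎ Word ⊎ Word
    y₁ y₂ y₃ y₄ : List Code
    y₁ = map inj₁ (codes₁ g)
    y₂ = map (inj₂ ∘ inj₁) (codes₂ Kmax g)
    y₃ = map (inj₂ ∘ inj₂ ∘ inj₁) (codes₃ X Kmax g)
    y₄ = map (inj₂ ∘ inj₂ ∘ inj₂) F
    ys = y₁ ++ (y₂ ++ (y₃ ++ y₄))
    R : List ℕ → Code → Set
    R G (inj₁ x)               = Rep₁ g G x
    R G (inj₂ (inj₁ x))        = Rep₂ g G x
    R G (inj₂ (inj₂ (inj₁ x))) = Rep₃ g G x
    R G (inj₂ (inj₂ (inj₂ x))) = Rep₃ g G x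
    inj : ∀ {G G' y} → R G y → R G' y → G ≡ G'
    inj {y = inj₁ x}               = Rep₁-injective
    inj {y = inj₂ (inj₁ x)}        = Rep₂-injective
    inj {y = inj₂ (inj₂ (inj₁ x))} = Rep₃-injective
    inj {y = inj₂ (inj₂ (inj₂ x))} = Rep₃-injective
    find : ∀ G → G ∈ filterᵇ p L → ∃ λ y → y ∈ ys × R G y
    find G G∈ with filterᵇ-∈⁻ p L G∈
    ... | G∈L , pG with classify X Kmax (kunz (All.lookup (Enumerates.sound en) G∈L))
    ...   | inj₁ (x , x∈ , r)               = inj₁ x , ∈-++⁺ˡ (∈-map⁺ inj₁ x∈) , r
    ...   | inj₂ (inj₁ (x , x∈ , r))        = inj₂ (inj₁ x) , ∈-++⁺ʳ y₁ (∈-++⁺ˡ (∈-map⁺ (inj₂ ∘ inj₁) x∈)) , r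
    ...   | inj₂ (inj₂ (inj₁ (x , x∈ , r))) = inj₂ (inj₂ (inj₁ x)) , ∈-++⁺ʳ y₁ (∈-++⁺ʳ y₂ (∈-++⁺ˡ (∈-map⁺ (inj₂ ∘ inj₂ ∘ inj₁) x∈))) , r
    ...   | inj₂ (inj₂ (inj₂ (x , x∈ , r))) = inj₂ (inj₂ (inj₂ x)) , ∈-++⁺ʳ y₁ (∈-++⁺ʳ y₂ (∈-++⁺ʳ y₃ (∈-map⁺ (inj₂ ∘ inj₂ ∘ inj₂)
              (filterᵇ-∈⁺ (p ∘ gapSet) x∈ (trans (cong p (sym (Rep₃-gapSet (goodWords-good X Kmax g K≤ x x∈) r))) pG))))) , r
    len : length ys ≡ sumL (λ x → bit (p (gapSet x))) (goodWords X Kmax g) + badCount X Kmax g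
    len = trans (length-++ y₁) (trans (cong₂ _+_ (length-map inj₁ (codes₁ g)) (trans (length-++ y₂) (cong₂ _+_ (length-map _ (codes₂ Kmax g))
      (trans (length-++ y₃) (cong₂ _+_ (length-map _ (codes₃ X Kmax g)) (trans (length-map _ F) (length-filterᵇ (p ∘ gapSet) (goodWords X Kmax g))))))))
      (lem (length (codes₁ g)) (length (codes₂ Kmax g)) (length (codes₃ X Kmax g)) _))
      where
      lem : ∀ a b c d → a + (b + (c + d)) ≡ d + (a + (b + c))
      lem = solve-∀

  -- The event for a fixed head and a fixed number of twos

  data Kind : Set where
    lo mi hi : Kind

  -- Where c lies relative to the multiplicity m = suc (k + r), for a word with head length k and tail length r.
  data Place (k r c : ℕ) : Kind → Set where
    low  : 1 ≤ c → c < suc (k + r) → Place k r c lo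
    middle : ∀ j → j < r → c ≡ suc (k + r) + (suc k + j) → Place k r c mi
    high : suc (k + r) + suc (k + r) + k < c → Place k r c hi

  module Gaps {g h t} (G : Good g (h , t)) where
    private
      module G = Good G
      k = length h
      r = length t
      x = h , t
      size≡ : size x ≡ k + r
      size≡ = length-++ h

    low-gap : ∀ {c} → 1 ≤ c → c < suc (k + r) → memᵇ c (gapSet x) ≡ true
    low-gap {c} 1≤ c< = memᵇ-complete c (gapSet x) (G.decode⇐ c 0 c<' (G.letter-pos c 1≤ (≤-pred c<')))
      where
      c<' : c < suc (size x)
      c<' = subst (λ z → c < suc z) (sym size≡) c<

    -- In the second block the number m + i is a gap exactly when its letter is at least 2, and tail
    -- letters are 1 or 2.
    mid-gap : ∀ j → j < r → memᵇ (suc (k + r) + (suc k + j)) (gapSet x) ≡ (nth t j ≡ᵇ 2)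
    mid-gap j j< with nth t j in e | G.t-letters (nth t j) (nth-∈ t j j<)
    ... | 0 | ()  , _
    ... | 1 | _ = ≢true⇒≡false λ m → case ≤-trans (G.decode⇒ i 1 i< (memᵇ-sound _ (gapSet x) (subst (λ z → memᵇ z (gapSet x) ≡ true) c≡ m))) (≤-reflexive (trans (G.in-tail j) e)) of λ { (s≤s ()) }
      where
      i = suc k + j
      i< : i < suc (size x)
      i< = s≤s (≤-trans (≤-reflexive (sym (+-suc k j))) (≤-trans (+-monoʳ-≤ k j<) (≤-reflexive (sym size≡))))
      c≡ : suc (k + r) + (suc k + j) ≡ 1 * suc (size x) + i
      c≡ = cong (_+ i) (trans (cong suc (sym size≡)) (sym (+-identityʳ (suc (size x)))))
    ... | 2 | _ = memᵇ-complete _ (gapSet x) (subst (_∈ gapSet x) (sym c≡) (G.decode⇐ i 1 i< (≤-reflexive (sym (trans (G.in-tail j) e)))))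
      where
      i = suc k + j
      i< : i < suc (size x)
      i< = s≤s (≤-trans (≤-reflexive (sym (+-suc k j))) (≤-trans (+-monoʳ-≤ k j<) (≤-reflexive (sym size≡))))
      c≡ : suc (k + r) + (suc k + j) ≡ 1 * suc (size x) + i
      c≡ = cong (_+ i) (trans (cong suc (sym size≡)) (sym (+-identityʳ (suc (size x)))))
    ... | suc (suc (suc _)) | _ , s≤s (s≤s ())

    -- A gap beyond the second block requires a letter 3; it then lies in the third block at a place
    -- of the head, hence at most `k` above twice the multiplicity.
    high-gap : ∀ {c} → suc (k + r) + suc (k + r) + k < c → memᵇ c (gapSet x) ≡ false
    high-gap {c} c> = ≢true⇒≡false λ m → bad (c / M) (c % M) (m%n<n c M) dm (G.decode⇒ (c % M) (c / M) (m%n<n c M) (subst (_∈ gapSet x) dm (memᵇ-sound c (gapSet x) m)))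
      where
      M = suc (size x)
      dm : c ≡ c / M * M + c % M
      dm = trans (m≡m%n+[m/n]*n c M) (+-comm (c % M) _)
      c>' : M + M + k < c
      c>' = subst (λ z → suc z + suc z + k < c) (sym size≡) c>
      bad : ∀ s i → i < M → c ≡ s * M + i → s < letter x i → ⊥
      bad s i i<M e s<V with s ≤? 1
      ... | yes s≤1 = <-irrefl refl (≤-trans c>' (≤-trans (≤-reflexive e) (≤-trans (+-mono-≤ (*-monoˡ-≤ M s≤1) (<⇒≤ i<M))
              (≤-trans (≤-reflexive (cong (_+ M) (+-identityʳ M))) (m≤m+n _ k)))))
      ... | no s≰1 with i ≤? k
      ...   | no  i≰k = <-irrefl refl (≤-trans (s≤s (≰⇒> s≰1)) (≤-trans s<V (G.tail≤2 i (≰⇒> i≰k))))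
      ...   | yes i≤k = <-irrefl refl (≤-trans c>' (≤-trans (≤-reflexive e) (≤-trans (+-mono-≤ (*-monoˡ-≤ M (≤-pred (≤-trans s<V (G.letter≤3 i)))) i≤k)
              (≤-reflexive (cong (λ z → M + z + k) (+-identityʳ M))))))

  tab : {A : Set} → (ℕ → A) → ℕ → List A
  tab f zero    = []
  tab f (suc r) = f 0 ∷ tab (f ∘ suc) r

  length-tab : {A : Set} (f : ℕ → A) (r : ℕ) → length (tab f r) ≡ r
  length-tab f zero    = refl
  length-tab f (suc r) = cong suc (length-tab (f ∘ suc) r)

  matches-tab⁻ : ∀ f t → matches (tab f (length t)) t ≡ true → ∀ j → j < length t → okLetter (f j) (nth t j) ≡ true
  matches-tab⁻ f (x ∷ t) e zero    _       = proj₁ (∧-true⁻ e)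
  matches-tab⁻ f (x ∷ t) e (suc j) (s≤s h) = matches-tab⁻ (f ∘ suc) t (proj₂ (∧-true⁻ {okLetter (f 0) x} e)) j h

  matches-tab⁺ : ∀ f t → (∀ j → j < length t → okLetter (f j) (nth t j) ≡ true) → matches (tab f (length t)) t ≡ true
  matches-tab⁺ f []      h = refl
  matches-tab⁺ f (x ∷ t) h = ∧-true (h 0 (s≤s z≤n)) (matches-tab⁺ (f ∘ suc) t (λ j j< → h (suc j) (s≤s j<)))

  bool-ext : ∀ {a b : Bool} → (a ≡ true → b ≡ true) → (b ≡ true → a ≡ true) → a ≡ b
  bool-ext {true}  {b}     f g = sym (f refl)
  bool-ext {false} {true}  f g = g refl
  bool-ext {false} {false} f g = refl

  isMi : Kind → Bool
  isMi mi = true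
  isMi _  = false

  isLo : Kind → Bool
  isLo lo = true
  isLo _  = false

  isHi : Kind → Bool
  isHi hi = true
  isHi _  = false

  oneBit twoBit : Constraint → ℕ
  oneBit one = 1
  oneBit _   = 0
  twoBit two = 1
  twoBit _   = 0

  ones-∷ : ∀ c κ → ones (c ∷ κ) ≡ oneBit c + ones κ
  ones-∷ free κ = refl
  ones-∷ one  κ = refl
  ones-∷ two  κ = refl

  twos-∷ : ∀ c κ → twos (c ∷ κ) ≡ twoBit c + twos κ
  twos-∷ free κ = refl
  twos-∷ one  κ = refl
  twos-∷ two  κ = refl

  ones-tab : ∀ f s → ones (tab f s) ≡ sumTo s (λ j → oneBit (f j))
  ones-tab f zero    = refl
  ones-tab f (suc s) = trans (ones-∷ (f 0) _) (trans (cong (oneBit (f 0) +_) (ones-tab (f ∘ suc) s)) (sym (sumTo-shift s _)))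

  twos-tab : ∀ f s → twos (tab f s) ≡ sumTo s (λ j → twoBit (f j))
  twos-tab f zero    = refl
  twos-tab f (suc s) = trans (twos-∷ (f 0) _) (trans (cong (twoBit (f 0) +_) (twos-tab (f ∘ suc) s)) (sym (sumTo-shift s _)))

  module Positions (C C' : List ℕ) (disjoint : ∀ n → n ∈ C → n ∉ C') (kind : ℕ → Kind) where

    constraint : ℕ → ℕ → Constraint
    constraint o j = if memᵇ (o + j) C then one else (if memᵇ (o + j) C' then two else free)

    offset : ℕ → ℕ → ℕ
    offset k r = suc (k + r) + suc k

    pattern-of : ℕ → ℕ → List Constraint
    pattern-of k r = tab (constraint (offset k r)) r

    module _ (k r : ℕ) (place : ∀ c → c ∈ C → Place k r c (kind c)) (place' : ∀ c → c ∈ C' → Place k r c (kind c)) where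
      private o = offset k r

      o+ : ∀ j → o + j ≡ suc (k + r) + (suc k + j)
      o+ j = +-assoc (suc (k + r)) (suc k) j

      -- High elements of `C` and low elements of `C'` satisfy their condition automatically, and
      -- each middle element prescribes one letter of the tail.
      event-matches : ∀ {g h t} → Good g (h , t) → length h ≡ k → length t ≡ r →
        (∀ c → c ∈ C → isLo (kind c) ≡ false) → (∀ c → c ∈ C' → isHi (kind c) ≡ false) →
        eventᵇ C C' (gapSet (h , t)) ≡ matches (pattern-of k r) t
      event-matches {g} {h} {t} G refl refl noLo noHi = bool-ext to from
        where
        open Gaps G
        S = gapSet (h , t)
        to : eventᵇ C C' S ≡ true → matches (pattern-of k r) t ≡ true
        to e = matches-tab⁺ (constraint o) t ok
          where
          inC = allᵇ-sound _ C (proj₁ (∧-true⁻ e))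
          inC' = allᵇ-sound _ C' (proj₂ (∧-true⁻ {allᵇ (λ c → not (memᵇ c S)) C} e))
          ok : ∀ j → j < r → okLetter (constraint o j) (nth t j) ≡ true
          ok j j< with memᵇ (o + j) C in q
          ... | true with nth t j | Good.t-letters G (nth t j) (nth-∈ t j j<) | trans (sym (mid-gap j j<)) (trans (cong (λ z → memᵇ z S) (sym (o+ j))) (not-true⁻ (inC (o + j) (memᵇ-sound _ C q))))
          ...   | 1 | _ | _ = refl
          ...   | 2 | _ | ()
          ...   | suc (suc (suc _)) | (_ , s≤s (s≤s ())) | _
          ok j j< | false with memᵇ (o + j) C' in q'
          ... | false = refl
          ... | true  = trans (sym (mid-gap j j<)) (trans (cong (λ z → memᵇ z S) (sym (o+ j))) (inC' (o + j) (memᵇ-sound _ C' q')))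
        from : matches (pattern-of k r) t ≡ true → eventᵇ C C' S ≡ true
        from e = ∧-true (allᵇ-complete _ C (λ c c∈ → not-true (outside c c∈ (kind c) (place c c∈) (noLo c c∈)))) (allᵇ-complete _ C' (λ c c∈ → inside c c∈ (kind c) (place' c c∈) (noHi c c∈)))
          where
          ok = matches-tab⁻ (constraint o) t e
          outside : ∀ c → c ∈ C → ∀ κ → Place k r c κ → isLo κ ≡ false → memᵇ c S ≡ false
          outside c c∈ hi (high p) _ = high-gap p
          outside c c∈ mi (middle j j< refl) _ with ok j j<
          ... | okj rewrite memᵇ-complete (o + j) C (subst (_∈ C) (sym (o+ j)) c∈) = trans (mid-gap j j<) (cong (_≡ᵇ 2) (≡ᵇ-sound (nth t j) 1 okj))
          inside : ∀ c → c ∈ C' → ∀ κ → Place k r c κ → isHi κ ≡ false → memᵇ c S ≡ true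
          inside c c∈ lo (low p q) _ = low-gap p q
          inside c c∈ mi (middle j j< refl) _ with ok j j<
          ... | okj rewrite ≢true⇒≡false {memᵇ (o + j) C} (λ m → disjoint (o + j) (memᵇ-sound _ C m) (subst (_∈ C') (sym (o+ j)) c∈))
                          | memᵇ-complete (o + j) C' (subst (_∈ C') (sym (o+ j)) c∈) = trans (mid-gap j j<) okj

      event-low : ∀ {g h t} → Good g (h , t) → length h ≡ k → length t ≡ r → ∀ c → c ∈ C → isLo (kind c) ≡ true → eventᵇ C C' (gapSet (h , t)) ≡ false
      event-low {g} {h} {t} G refl refl c c∈ lw = ≢true⇒≡false λ e → case trans (sym (allᵇ-sound _ C (proj₁ (∧-true⁻ e)) c c∈)) (cong not (gap (kind c) (place c c∈) lw)) of λ ()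
        where
        gap : ∀ κ → Place k r c κ → isLo κ ≡ true → memᵇ c (gapSet (h , t)) ≡ true
        gap lo (low p q) _ = Gaps.low-gap G p q

      event-high : ∀ {g h t} → Good g (h , t) → length h ≡ k → length t ≡ r → ∀ c → c ∈ C' → isHi (kind c) ≡ true → eventᵇ C C' (gapSet (h , t)) ≡ false
      event-high {g} {h} {t} G refl refl c c∈ hg = ≢true⇒≡false λ e →
        case trans (sym (allᵇ-sound _ C' (proj₂ (∧-true⁻ {allᵇ (λ c → not (memᵇ c (gapSet (h , t)))) C} e)) c c∈)) (gap (kind c) (place' c c∈) hg) of λ ()
        where
        gap : ∀ κ → Place k r c κ → isHi κ ≡ true → memᵇ c (gapSet (h , t)) ≡ false
        gap hi (high p) _ = Gaps.high-gap G p

      window-one : ∀ c → Place k r c (kind c) → sumTo r (λ j → bit (o + j ≡ᵇ c)) ≡ bit (isMi (kind c))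
      window-one c pl = go (kind c) pl
        where
        none : (∀ j → j < r → ¬ (o + j ≡ c)) → sumTo r (λ j → bit (o + j ≡ᵇ c)) ≡ 0
        none h = trans (sumTo-cong r (λ j j< → cong bit (≢true⇒≡false (λ e → h j j< (≡ᵇ-sound _ c e))))) (sumTo-zero r)
        go : ∀ κ → Place k r c κ → sumTo r (λ j → bit (o + j ≡ᵇ c)) ≡ bit (isMi κ)
        go lo (low _ c<) = none (λ j _ e → <-irrefl refl (≤-trans c< (≤-trans (m≤m+n (suc (k + r)) (suc k)) (≤-trans (m≤m+n o j) (≤-reflexive e)))))
        go hi (high c>) = none (λ j j< e → <-irrefl refl (≤-trans c> (≤-trans (≤-reflexive (sym (trans (sym (o+ j)) e)))
          (≤-trans (+-monoʳ-≤ (suc (k + r)) (s≤s (+-monoʳ-≤ k (<⇒≤ j<)))) (m≤m+n _ k)))))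
        go mi (middle i i< refl) = trans (sumTo-cong r (λ j _ → cong bit (bool-ext {o + j ≡ᵇ suc (k + r) + (suc k + i)} {j ≡ᵇ i}
            (λ e → trans (cong (_≡ᵇ i) (+-cancelˡ-≡ o j i (trans (≡ᵇ-sound (o + j) (suc (k + r) + (suc k + i)) e) (sym (o+ i))))) (≡ᵇ-refl i))
            (λ e → trans (cong (_≡ᵇ (suc (k + r) + (suc k + i))) (trans (cong (o +_) (≡ᵇ-sound j i e)) (o+ i))) (≡ᵇ-refl (suc (k + r) + (suc k + i))))))) (sumTo-δ r i i<)

      window : ∀ D → Unique D → (∀ c → c ∈ D → Place k r c (kind c)) → sumTo r (λ j → bit (memᵇ (o + j) D)) ≡ sumL (λ c → bit (isMi (kind c))) D
      window []      u        pl = sumTo-zero r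
      window (c ∷ D) (c∉ ∷ u) pl = trans (sumTo-cong r (λ j _ → split j)) (trans (sumTo-+ r (λ j → bit (o + j ≡ᵇ c)) _)
          (cong₂ _+_ (window-one c (pl c (here refl))) (window D u (λ c' p → pl c' (there p)))))
        where
        split : ∀ j → bit ((o + j ≡ᵇ c) ∨ memᵇ (o + j) D) ≡ bit (o + j ≡ᵇ c) + bit (memᵇ (o + j) D)
        split j with o + j ≡ᵇ c in e | memᵇ (o + j) D in e'
        ... | true  | true  = ⊥-elim (All.lookup c∉ (memᵇ-sound _ D e') (sym (≡ᵇ-sound _ c e)))
        ... | true  | false = refl
        ... | false | true  = refl
        ... | false | false = refl

      -- Each middle element of `C` meets the window of tail places exactly once and other elements
      -- never do; without repetitions in `C` the hits are distinct.
      ones-pattern : Unique C → ones (pattern-of k r) ≡ sumL (λ c → bit (isMi (kind c))) C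
      ones-pattern u = trans (ones-tab (constraint o) r) (trans (sumTo-cong r (λ j _ → value j)) (window C u place))
        where
        value : ∀ j → oneBit (constraint o j) ≡ bit (memᵇ (o + j) C)
        value j with memᵇ (o + j) C | memᵇ (o + j) C'
        ... | true  | _     = refl
        ... | false | true  = refl
        ... | false | false = refl

      twos-pattern : Unique C' → twos (pattern-of k r) ≡ sumL (λ c → bit (isMi (kind c))) C'
      twos-pattern u = trans (twos-tab (constraint o) r) (trans (sumTo-cong r (λ j _ → value j)) (window C' u place'))
        where
        value : ∀ j → twoBit (constraint o j) ≡ bit (memᵇ (o + j) C')
        value j with memᵇ (o + j) C in e | memᵇ (o + j) C' in e'
        ... | true  | true  = ⊥-elim (disjoint (o + j) (memᵇ-sound _ C e) (memᵇ-sound _ C' e'))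
        ... | true  | false = refl
        ... | false | true  = refl
        ... | false | false = refl

  prodL : {A : Set} → (A → ℕ) → List A → ℕ
  prodL f []       = 1
  prodL f (x ∷ xs) = f x * prodL f xs

  prodL-zero : {A : Set} (f : A → ℕ) {x : A} {xs : List A} → x ∈ xs → f x ≡ 0 → prodL f xs ≡ 0
  prodL-zero f {xs = y ∷ ys} (here refl) e rewrite e = refl
  prodL-zero f {xs = y ∷ ys} (there p)   e rewrite prodL-zero f p e = *-zeroʳ (f y)

  any-or-none : {A : Set} (b : A → Bool) (xs : List A) → (∀ x → x ∈ xs → b x ≡ false) ⊎ (∃ λ x → x ∈ xs × b x ≡ true)
  any-or-none b []       = inj₁ (λ _ ())
  any-or-none b (x ∷ xs) with b x in e | any-or-none b xs
  ... | true  | _                  = inj₂ (x , here refl , e)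
  ... | false | inj₂ (y , y∈ , e') = inj₂ (y , there y∈ , e')
  ... | false | inj₁ h             = inj₁ λ { y (here refl) → e ; y (there p) → h y p }

  module Target (p p' : ℕ) (kind : ℕ → Kind) where
    q = p + p'

    -- The values of f₁ and 1 − f₁, with 1/φ replaced by p/q, multiplied by q.
    vin vout : Kind → ℕ
    vin lo = 0
    vin mi = p
    vin hi = q
    vout lo = q
    vout mi = p'
    vout hi = 0

    mids : List ℕ → ℕ
    mids = sumL (λ c → bit (isMi (kind c)))

    tin tout : List ℕ → ℕ
    tin  = prodL (λ c → vin (kind c))
    tout = prodL (λ c → vout (kind c))

    mids≤ : ∀ C → mids C ≤ length C
    mids≤ C = ≤-trans (sumL-mono C (λ c _ → bit≤1 (isMi (kind c)))) (≤-reflexive (sym (length-sumL C)))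

    tin-noLo : ∀ C → (∀ c → c ∈ C → isLo (kind c) ≡ false) → tin C * q ^ mids C ≡ p ^ mids C * q ^ length C
    tin-noLo []      h = refl
    tin-noLo (c ∷ C) h with kind c | h c (here refl) | tin-noLo C (λ c' p → h c' (there p))
    ... | mi | _ | ih = trans (lem₁ p (tin C) q (q ^ mids C)) (trans (cong (p * q *_) ih) (lem₂ p q (p ^ mids C) (q ^ length C)))
      where
      lem₁ : ∀ p t q x → p * t * (q * x) ≡ p * q * (t * x)
      lem₁ = solve-∀
      lem₂ : ∀ p q x y → p * q * (x * y) ≡ p * x * (q * y)
      lem₂ = solve-∀
    ... | hi | _ | ih = trans (*-assoc q (tin C) _) (trans (cong (q *_) ih) (lem q (p ^ mids C) (q ^ length C)))
      where
      lem : ∀ q x y → q * (x * y) ≡ x * (q * y)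
      lem = solve-∀

    tout-noHi : ∀ C → (∀ c → c ∈ C → isHi (kind c) ≡ false) → tout C * q ^ mids C ≡ p' ^ mids C * q ^ length C
    tout-noHi []      h = refl
    tout-noHi (c ∷ C) h with kind c | h c (here refl) | tout-noHi C (λ c' p → h c' (there p))
    ... | mi | _ | ih = trans (lem₁ p' (tout C) q (q ^ mids C)) (trans (cong (p' * q *_) ih) (lem₂ p' q (p' ^ mids C) (q ^ length C)))
      where
      lem₁ : ∀ p t q x → p * t * (q * x) ≡ p * q * (t * x)
      lem₁ = solve-∀
      lem₂ : ∀ p q x y → p * q * (x * y) ≡ p * x * (q * y)
      lem₂ = solve-∀
    ... | lo | _ | ih = trans (*-assoc q (tout C) _) (trans (cong (q *_) ih) (lem q (p' ^ mids C) (q ^ length C)))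
      where
      lem : ∀ q x y → q * (x * y) ≡ x * (q * y)
      lem = solve-∀

    vin≤ : ∀ κ → vin κ ≤ q
    vin≤ lo = z≤n
    vin≤ mi = m≤m+n p p'
    vin≤ hi = ≤-refl

    vout≤ : ∀ κ → vout κ ≤ q
    vout≤ lo = ≤-refl
    vout≤ mi = m≤n+m p' p
    vout≤ hi = z≤n

    prodL≤ : ∀ (v : Kind → ℕ) → (∀ κ → v κ ≤ q) → ∀ C → prodL (λ c → v (kind c)) C ≤ q ^ length C
    prodL≤ v h []      = ≤-refl
    prodL≤ v h (c ∷ C) = *-mono-≤ (h (kind c)) (prodL≤ v h C)

    isLo-zero : ∀ κ → isLo κ ≡ true → vin κ ≡ 0
    isLo-zero lo _ = refl

    isHi-zero : ∀ κ → isHi κ ≡ true → vout κ ≡ 0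
    isHi-zero hi _ = refl

  ≈-zero : ∀ {x y e} → x ≡ 0 → y ≡ 0 → x ≈[ e ] y
  ≈-zero refl refl = z≤n , z≤n

  module GroupEstimate (p p' Y : ℕ) .⦃ _ : NonZero (p + p') ⦄ (C C' : List ℕ) (uC : Unique C) (uC' : Unique C')
    (disjoint : ∀ n → n ∈ C → n ∉ C') (kind : ℕ → Kind) where
    open Target p p' kind
    open Positions C C' disjoint kind
    private l = length C + length C'

    -- The effect of prescribing a letters 1 and b letters 2 in words of length r with e twos.
    Removable : ℕ → ℕ → Set
    Removable r e = ∀ a b → a + b ≤ l → ∃ λ d' → ∃ λ e' → r ≡ (a + d') + (b + e') × e ≡ b + e' ×
      Y * (q ^ (a + b) * ways d' e') ≈[ (a + b) * (q ^ (a + b) * ways (a + d') (b + e')) ] Y * (p ^ a * p' ^ b * ways (a + d') (b + e'))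

    -- A low element of `C` or a high element of `C'` makes the event impossible, and a factor of
    -- the target vanishes too. In the remaining case the event prescribes tail letters, and the
    -- powers of `q` supplied by the nonmiddle elements bring both sides to the common exponent `l`.
    group-estimate : ∀ {g} h r e → (∀ t → t ∈ arr r e → Good g (h , t)) →
      (∀ c → c ∈ C → Place (length h) r c (kind c)) → (∀ c → c ∈ C' → Place (length h) r c (kind c)) → Removable r e →
      Y * (q ^ l * sumL (λ t → bit (eventᵇ C C' (gapSet (h , t)))) (arr r e)) ≈[ l * (q ^ l * binom r e) ] Y * (tin C * tout C' * binom r e)
    group-estimate h r e good place place' rem with any-or-none (λ c → isLo (kind c)) C
    ... | inj₂ (c , c∈ , lw) = ≈-zero (trans (cong (λ z → Y * (q ^ l * z)) none) (trans (cong (Y *_) (*-zeroʳ (q ^ l))) (*-zeroʳ Y)))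
            (trans (cong (λ z → Y * (z * tout C' * binom r e)) (prodL-zero (λ c → vin (kind c)) c∈ (isLo-zero (kind c) lw))) (*-zeroʳ Y))
      where
      none : sumL (λ t → bit (eventᵇ C C' (gapSet (h , t)))) (arr r e) ≡ 0
      none = trans (sumL-cong (arr r e) (λ t t∈ → cong bit (event-low (length h) r place place' (good t t∈) refl (proj₁ (arr-sound r e t∈)) c c∈ lw)))
        (trans (sumL-const 0 (arr r e)) (*-zeroʳ (length (arr r e))))
    ... | inj₁ noLo with any-or-none (λ c → isHi (kind c)) C'
    ...   | inj₂ (c , c∈ , hg) = ≈-zero (trans (cong (λ z → Y * (q ^ l * z)) none) (trans (cong (Y *_) (*-zeroʳ (q ^ l))) (*-zeroʳ Y)))
            (trans (cong (λ z → Y * (tin C * z * binom r e)) (prodL-zero (λ c → vout (kind c)) c∈ (isHi-zero (kind c) hg)))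
              (trans (cong (λ z → Y * (z * binom r e)) (*-zeroʳ (tin C))) (*-zeroʳ Y)))
      where
      none : sumL (λ t → bit (eventᵇ C C' (gapSet (h , t)))) (arr r e) ≡ 0
      none = trans (sumL-cong (arr r e) (λ t t∈ → cong bit (event-high (length h) r place place' (good t t∈) refl (proj₁ (arr-sound r e t∈)) c c∈ hg)))
        (trans (sumL-const 0 (arr r e)) (*-zeroʳ (length (arr r e))))
    ...   | inj₁ noHi with rem (mids C) (mids C') (+-mono-≤ (mids≤ C) (mids≤ C'))
    ...     | d' , e' , r≡ , e≡ , near = ≈-cancel (q ^ (a + b)) ⦃ m^n≢0 q (a + b) ⦄
              (≈-subst left refl right (≈-weaken err (≈-* (q ^ l) near)))
      where
      a = mids C
      b = mids C'
      κ = pattern-of (length h) r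
      W = sumL (λ t → bit (eventᵇ C C' (gapSet (h , t)))) (arr r e)
      c = ways (a + d') (b + e')
      c≡ : c ≡ binom r e
      c≡ = cong₂ binom (sym r≡) (sym e≡)
      frees≡ : frees κ ≡ d' + e'
      frees≡ = +-cancelʳ-≡ (a + b) (frees κ) (d' + e') (trans (cong₂ (λ x y → frees κ + (x + y)) (sym (ones-pattern (length h) r place place' uC)) (sym (twos-pattern (length h) r place place' uC')))
        (trans (sym (frees+ones+twos κ)) (trans (length-tab _ r) (trans r≡ (lem a d' b e')))))
        where
        lem : ∀ a d b e → (a + d) + (b + e) ≡ d + e + (a + b)
        lem = solve-∀
      W≡ : W ≡ ways d' e'
      W≡ = begin-equality
        W                            ≡⟨ sumL-cong (arr r e) (λ t t∈ → cong bit (event-matches (length h) r place place' (good t t∈) refl (proj₁ (arr-sound r e t∈)) noLo noHi)) ⟩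
        sumL (λ t → bit (matches κ t)) (arr r e) ≡⟨ cong (λ z → sumL (λ t → bit (matches κ t)) (arr z e)) (length-tab _ r) ⟨
        sumL (λ t → bit (matches κ t)) (arr (length κ) e) ≡⟨ count-arr κ e ⟩
        count κ e                    ≡⟨ cong (count κ) (trans e≡ (cong (_+ e') (sym (twos-pattern (length h) r place place' uC')))) ⟩
        count κ (twos κ + e')        ≡⟨ count-binom κ e' ⟩
        binom (frees κ) e'           ≡⟨ cong (λ z → binom z e') frees≡ ⟩
        ways d' e' ∎
        where open ≤-Reasoning
      left : q ^ l * (Y * (q ^ (a + b) * ways d' e')) ≡ q ^ (a + b) * (Y * (q ^ l * W))
      left = trans (lem (q ^ l) Y (q ^ (a + b)) (ways d' e')) (cong (λ z → q ^ (a + b) * (Y * (q ^ l * z))) (sym W≡))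
        where
        lem : ∀ L Y x w → L * (Y * (x * w)) ≡ x * (Y * (L * w))
        lem = solve-∀
      right : q ^ l * (Y * (p ^ a * p' ^ b * c)) ≡ q ^ (a + b) * (Y * (tin C * tout C' * binom r e))
      right = begin-equality
        q ^ l * (Y * (p ^ a * p' ^ b * c))
          ≡⟨ cong₂ (λ x y → x * (Y * (p ^ a * p' ^ b * y))) (^-distribˡ-+-* q (length C) (length C')) c≡ ⟩
        (q ^ length C * q ^ length C') * (Y * (p ^ a * p' ^ b * binom r e))
          ≡⟨ lem₁ (q ^ length C) (q ^ length C') Y (p ^ a) (p' ^ b) (binom r e) ⟩
        Y * (((p ^ a * q ^ length C) * (p' ^ b * q ^ length C')) * binom r e)
          ≡⟨ cong₂ (λ x y → Y * ((x * y) * binom r e)) (sym (tin-noLo C noLo)) (sym (tout-noHi C' noHi)) ⟩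
        Y * (((tin C * q ^ a) * (tout C' * q ^ b)) * binom r e)
          ≡⟨ lem₂ Y (tin C) (q ^ a) (tout C') (q ^ b) (binom r e) ⟩
        (q ^ a * q ^ b) * (Y * (tin C * tout C' * binom r e))
          ≡⟨ cong (_* (Y * (tin C * tout C' * binom r e))) (^-distribˡ-+-* q a b) ⟨
        q ^ (a + b) * (Y * (tin C * tout C' * binom r e)) ∎
        where
        open ≤-Reasoning
        lem₁ : ∀ x y Y p p' w → (x * y) * (Y * (p * p' * w)) ≡ Y * (((p * x) * (p' * y)) * w)
        lem₁ = solve-∀
        lem₂ : ∀ Y t x t' y w → Y * (((t * x) * (t' * y)) * w) ≡ (x * y) * (Y * (t * t' * w))
        lem₂ = solve-∀
      err : q ^ l * ((a + b) * (q ^ (a + b) * c)) ≤ q ^ (a + b) * (l * (q ^ l * binom r e))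
      err = ≤-trans (≤-reflexive (trans (lem (q ^ l) (a + b) (q ^ (a + b)) c) (cong (λ z → q ^ (a + b) * ((a + b) * (q ^ l * z))) c≡)))
        (*-monoʳ-≤ (q ^ (a + b)) (*-monoˡ-≤ (q ^ l * binom r e) (+-mono-≤ (mids≤ C) (mids≤ C'))))
        where
        lem : ∀ L n x w → L * (n * (x * w)) ≡ x * (n * (L * w))
        lem = solve-∀

  -- Separation of the three zones

  ∸-≈ : ∀ x y → x ≈[ ∣ ℤ.+ x ℤ.- ℤ.+ y ∣ ] y
  ∸-≈ x y with ≤-total x y
  ... | inj₁ x≤y = ≤-trans x≤y (m≤m+n y _) , ≤-reflexive (trans (sym (m+[n∸m]≡n x≤y)) (cong (x +_) (sym (trans (cong ∣_∣ (ℤP.[+m]-[+n]≡m⊖n x y)) (ℤP.∣⊖∣-≤ x≤y)))))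
  ... | inj₂ y≤x = ≤-reflexive (trans (sym (m+[n∸m]≡n y≤x)) (cong (y +_) (sym (trans (cong ∣_∣ (ℤP.[+m]-[+n]≡m⊖n x y)) (trans (ℤP.∣m⊖n∣≡∣n⊖m∣ x y) (ℤP.∣⊖∣-≤ y≤x)))))) , ≤-trans y≤x (m≤m+n x _)

  dev-≈ : ∀ d e → d * d ≈[ ∣ dev (d + e) e ∣ ] (d + e) * e
  dev-≈ d e = subst (λ z → d * d ≈[ ∣ z ∣ ] (d + e) * e) eq (∸-≈ (d * d) ((d + e) * e))
    where
    lem : ∀ d e → d ℤ.* d ℤ.- (d ℤ.+ e) ℤ.* e ≡ (d ℤ.+ e ℤ.- e) ℤ.* (d ℤ.+ e ℤ.- e) ℤ.- (d ℤ.+ e) ℤ.* e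
    lem = ℤS.solve-∀
    eq : ℤ.+ (d * d) ℤ.- ℤ.+ ((d + e) * e) ≡ dev (d + e) e
    eq = trans (cong₂ ℤ._-_ (ℤP.pos-* d d) (ℤP.pos-* (d + e) e)) (lem (ℤ.+ d) (ℤ.+ e))

  square-< : ∀ x y → x * x < y * y → x < y
  square-< x y h = ≰⇒> (λ y≤x → <-irrefl refl (≤-trans h (*-mono-≤ y≤x y≤x)))

  typical-dev : ∀ Z N r → typical (Z * Z) N r ≡ true → Z * ∣ dev r (N ∸ r) ∣ < N * N
  typical-dev Z N r e = square-< (Z * δ) (N * N) (≤-trans (s≤s (≤-reflexive (lem Z δ))) (≤-trans (≰⇒> (λ le → case trans (sym (≤ᵇ-true le)) (not-true⁻ e) of λ ())) (≤-reflexive (lem' N))))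
    where
    δ = ∣ dev r (N ∸ r) ∣
    lem : ∀ z d → z * d * (z * d) ≡ z * z * (d * d)
    lem = solve-∀
    lem' : ∀ n → n * (n * (n * (n * 1))) ≡ n * n * (n * n)
    lem' = solve-∀

  module Removal (p p' Y Z l : ℕ) .⦃ _ : NonZero (p + p') ⦄ (unit : p * p + p * (p + p') ≈[ 1 ] (p + p') * (p + p'))
    (Y≤Z : 10 * Y ≤ Z) (40≤Z : 40 ≤ Z) (Y≤q : 10 * Y ≤ (p + p') * (p + p')) where
    private q = p + p'

    Removed : ℕ → ℕ → ℕ → ℕ → Set
    Removed r e a b = ∃ λ d' → ∃ λ e' → r ≡ (a + d') + (b + e') × e ≡ b + e' ×
      Y * (q ^ (a + b) * ways d' e') ≈[ (a + b) * (q ^ (a + b) * ways (a + d') (b + e')) ] Y * (p ^ a * p' ^ b * ways (a + d') (b + e'))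

    removed : ∀ a b d' e' δ → .⦃ _ : NonZero ((a + d') + (b + e')) ⦄ → a + b ≤ l →
      (a + d') * (a + d') ≈[ δ ] ((a + d') + (b + e')) * (b + e') → Z * δ ≤ 4 * (((a + d') + (b + e')) * ((a + d') + (b + e'))) →
      2 * (Y + 1) * l ≤ (a + d') + (b + e') → Removed ((a + d') + (b + e')) (b + e') a b
    removed a b d' e' δ ab dd small 2Yl = d' , e' , refl , refl , Estimate.estimate p p' Y a b d' e' near
      where
      near₀ : (10 * Y) * (q * (a + d')) ≈[ 5 * (q * ((a + d') + (b + e'))) ] (10 * Y) * (p * ((a + d') + (b + e')))
      near₀ = Ratio.ratio-≈ p p' unit (a + d') (b + e') δ (10 * Y) dd (≤-trans (*-monoˡ-≤ δ Y≤Z) small) Y≤q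
      near : ∀ i j → i ≤ a → j ≤ b → Estimate.Near p p' Y (i + d') (j + e')
      near i j i≤ j≤ with m≤n⇒∃[o]m+o≡n i≤ | m≤n⇒∃[o]m+o≡n j≤
      ... | u , eu | v , ev = Ratio.near-after-removal p p' unit Y l u v (i + d') (j + e')
        (≤-trans (+-mono-≤ (≤-trans (m≤n+m u i) (≤-reflexive eu)) (≤-trans (m≤n+m v j) (≤-reflexive ev))) ab)
        (≤-trans 2Yl (≤-reflexive (cong₂ _+_ a≡ b≡)))
        (≈-subst (cong (λ z → (10 * Y) * (q * z)) a≡) (cong₂ (λ x y → 5 * (q * (x + y))) a≡ b≡)
          (cong₂ (λ x y → (10 * Y) * (p * (x + y))) a≡ b≡) near₀)
        where
        eq : ∀ u i d → i + u + d ≡ u + (i + d)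
        eq = solve-∀
        a≡ : a + d' ≡ u + (i + d')
        a≡ = trans (cong (_+ d') (sym eu)) (eq u i d')
        b≡ : b + e' ≡ v + (j + e')
        b≡ = trans (cong (_+ e') (sym ev)) (eq v j e')

    ten-times : ∀ δ x → Z * δ ≤ 4 * x → 10 * δ ≤ x
    ten-times δ x h = *-cancelˡ-≤ {10 * δ} {x} 4 (begin
      4 * (10 * δ)   ≡⟨ lem δ ⟩
      40 * δ         ≤⟨ *-monoˡ-≤ δ 40≤Z ⟩
      Z * δ          ≤⟨ h ⟩
      4 * x ∎)
      where
      open ≤-Reasoning
      lem : ∀ δ → 4 * (10 * δ) ≡ 40 * δ
      lem = solve-∀

    removable : ∀ d e δ .⦃ _ : NonZero (d + e) ⦄ → d * d ≈[ δ ] (d + e) * e → Z * δ ≤ 4 * ((d + e) * (d + e)) →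
      4 * l ≤ d + e → 2 * (Y + 1) * l ≤ d + e → ∀ a b → a + b ≤ l → Removed (d + e) e a b
    removable d e δ dd small 4l 2Yl a b ab = go (m≤n⇒∃[o]m+o≡n a≤d) (m≤n⇒∃[o]m+o≡n b≤e)
      where
      a≤d : a ≤ d
      a≤d = ≤-trans (≤-trans (m≤m+n a b) ab) (many-ones d e δ l dd (ten-times δ ((d + e) * (d + e)) small) 4l)
      b≤e : b ≤ e
      b≤e = ≤-trans (≤-trans (m≤n+m b a) ab) (many-twos d e δ l dd (ten-times δ ((d + e) * (d + e)) small) 4l)
      go : (∃ λ d' → a + d' ≡ d) → (∃ λ e' → b + e' ≡ e) → Removed (d + e) e a b
      go (d' , refl) (e' , refl) = removed a b d' e' δ ab dd small 2Yl

  -- u < v (1 + 1/√5), where 1 + 1/√5 = 2γ.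
  Below : ℕ → ℕ → Set
  Below u v = ∀ a → 0 < a → v + a ≤ u → 5 * (a * a) < v * v

  -- The position of c relative to γ G and 2γ G, with a margin G/B.
  data Zone (B G c : ℕ) : Kind → Set where
    zone-lo : 1 ≤ c → Below (2 * B * c + 2 * G) (B * G) → Zone B G c lo
    zone-mi : ∀ z → 2 * B * c ≡ B * G + 2 * G + z → (B * G) * (B * G) < 5 * (z * z) → Below (B * c + G) (B * G) → Zone B G c mi
    zone-hi : ∀ z → B * c ≡ B * G + G + z → (B * G) * (B * G) < 5 * (z * z) → Zone B G c hi

  module Separation (B Kmax n d e : ℕ) (0<B : 0 < B) (0<N : 0 < (d + e) + e) (n≤ : n ≤ Kmax)
    (dev< : B * B * ∣ dev (d + e) e ∣ < ((d + e) + e) * ((d + e) + e))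
    (big₁ : 20 * (B * B * n) ≤ (d + e) + e) (big₂ : 10 * (B * (4 * Kmax + 2)) ≤ (d + e) + e) where
    open ≤-Reasoning
    private
      r = d + e
      N = r + e
      G = N + n
      δ = ∣ dev (d + e) e ∣
      instance
        nzB : NonZero B
        nzB = >-nonZero 0<B
      Bn≤ : 20 * (B * n) ≤ N
      Bn≤ = ≤-trans (*-monoʳ-≤ 20 (≤-trans (m≤n*m (B * n) B) (≤-reflexive (sym (*-assoc B B n))))) big₁

    -- Since N² = d² + 4 r e and r e ≈ d², typicality says that `N` is nearly d √5, so that
    -- `B * (N + d)` is close to the threshold 2γ B N. If `Below` held in spite of the margin `G`,
    -- the terms in B² would cancel and leave 5 c₀² < 4 N² up to lower order, although `c₀` is at
    -- least `N − B n`.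
    low-impossible : ∀ u → B * (N + d) + G ≤ u → ¬ Below u (B * G)
    low-impossible u le below with m≤n⇒∃[o]m+o≡n β≤N | m≤n⇒∃[o]m+o≡n (≤-trans β≤N (m≤m+n N n))
      where
      β≤N : B * n ≤ N
      β≤N = ≤-trans (m≤n*m (B * n) 20) Bn≤
    ... | c' , Nc | c₀ , Gc = <-irrefl refl (begin-strict
      5 * (c' * c')                                       ≤⟨ *-monoʳ-≤ 5 (*-mono-≤ c'≤c c'≤c) ⟩
      5 * (c₀ * c₀)                                       <⟨ key ⟩
      4 * (N * N) + (2 * (s * N) + β * β)                 ≡⟨ cong (λ x → 4 * (x * x) + (2 * (s * x) + β * β)) (sym Nc) ⟩
      4 * ((β + c') * (β + c')) + (2 * (s * (β + c')) + β * β)          ≡⟨ lem₁ β c' s ⟩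
      4 * (c' * c') + (8 * (β * c') + 5 * (β * β) + 2 * (s * β) + 2 * (s * c'))
        ≤⟨ +-monoʳ-≤ (4 * (c' * c')) (+-mono-≤ (+-mono-≤ (+-mono-≤ (*-monoʳ-≤ 8 (*-monoˡ-≤ c' β≤s)) (*-monoʳ-≤ 5 (*-mono-≤ β≤s (≤-trans β≤s s≤c')))) (*-monoʳ-≤ 2 (*-monoʳ-≤ s (≤-trans β≤s s≤c')))) ≤-refl) ⟩
      4 * (c' * c') + (8 * (s * c') + 5 * (s * c') + 2 * (s * c') + 2 * (s * c'))  ≡⟨ cong (4 * (c' * c') +_) (lem₂ s c') ⟩
      4 * (c' * c') + (17 * s) * c'                       ≤⟨ +-monoʳ-≤ (4 * (c' * c')) (*-monoˡ-≤ c' c'-big) ⟩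
      4 * (c' * c') + c' * c'                             ≡⟨ lem₃ (c' * c') ⟩
      5 * (c' * c') ∎)
      where
      β = B * n
      s = B * B * n
      β≤s : β ≤ s
      β≤s = ≤-trans (m≤n*m β B) (≤-reflexive (sym (*-assoc B B n)))
      c'-big : 17 * s ≤ c'
      c'-big = +-cancelˡ-≤ β _ _ (begin
        β + 17 * s      ≤⟨ +-monoˡ-≤ (17 * s) β≤s ⟩
        s + 17 * s      ≤⟨ *-monoˡ-≤ s {18} {20} (m≤m+n 18 2) ⟩
        20 * s          ≤⟨ big₁ ⟩
        N               ≡⟨ Nc ⟨
        β + c' ∎)
      s≤c' : s ≤ c'
      s≤c' = ≤-trans (m≤n*m s 17) c'-big
      c'≤c : c' ≤ c₀
      c'≤c = +-cancelˡ-≤ β _ _ (≤-trans (≤-reflexive Nc) (≤-trans (m≤m+n N n) (≤-reflexive (sym Gc))))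
      lem₁ : ∀ β c s → 4 * ((β + c) * (β + c)) + (2 * (s * (β + c)) + β * β) ≡ 4 * (c * c) + (8 * (β * c) + 5 * (β * β) + 2 * (s * β) + 2 * (s * c))
      lem₁ = solve-∀
      lem₂ : ∀ s c → 8 * (s * c) + 5 * (s * c) + 2 * (s * c) + 2 * (s * c) ≡ (17 * s) * c
      lem₂ = solve-∀
      lem₃ : ∀ x → 4 * x + x ≡ 5 * x
      lem₃ = solve-∀
      -- Chosen so that `B * G + a` equals `B * (N + d) + G`.
      a = B * d + c₀
      0<c : 0 < c₀
      0<c = n≢0⇒n>0 λ e → <-irrefl refl (≤-trans 0<N (N≤0 e))
        where
        N≤0 : c₀ ≡ 0 → N ≤ 0
        N≤0 e = ≤-trans (≤-reflexive (sym Nc)) (+-mono-≤ (≤-trans β≤s (≤-trans s≤c' (≤-trans c'≤c (≤-reflexive e)))) (≤-trans c'≤c (≤-reflexive e)))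
      va≤ : B * G + a ≤ u
      va≤ = ≤-trans (≤-reflexive (trans (lem B N n d c₀) (cong (B * (N + d) +_) Gc))) le
        where
        lem : ∀ B N n d c → B * (N + n) + (B * d + c) ≡ B * (N + d) + (B * n + c)
        lem = solve-∀
      small : 5 * (a * a) < (B * G) * (B * G)
      small = below a (≤-trans 0<c (m≤n+m c₀ (B * d))) va≤
      key : 5 * (c₀ * c₀) < 4 * (N * N) + (2 * (B * B * n * N) + (B * n) * (B * n))
      key = +-cancelˡ-< (5 * (B * B * (d * d)) + B * B * (N * N)) _ _ (begin-strict
        5 * (B * B * (d * d)) + B * B * (N * N) + 5 * (c₀ * c₀)
          ≤⟨ m≤m+n _ (10 * (B * d * c₀)) ⟩
        5 * (B * B * (d * d)) + B * B * (N * N) + 5 * (c₀ * c₀) + 10 * (B * d * c₀)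
          ≡⟨ lem₅ B d N c₀ ⟩
        5 * (a * a) + B * B * (N * N)
          <⟨ +-mono-<-≤ small form-bound ⟩
        (B * G) * (B * G) + (5 * (B * B * (d * d)) + 4 * (N * N))
          ≡⟨ lem₆ B N n d ⟩
        5 * (B * B * (d * d)) + B * B * (N * N) + (4 * (N * N) + (2 * (B * B * n * N) + (B * n) * (B * n))) ∎)
        where
        lem₅ : ∀ B d N c → 5 * (B * B * (d * d)) + B * B * (N * N) + 5 * (c * c) + 10 * (B * d * c) ≡ 5 * ((B * d + c) * (B * d + c)) + B * B * (N * N)
        lem₅ = solve-∀
        lem₆ : ∀ B N n d → (B * (N + n)) * (B * (N + n)) + (5 * (B * B * (d * d)) + 4 * (N * N)) ≡
          5 * (B * B * (d * d)) + B * B * (N * N) + (4 * (N * N) + (2 * (B * B * n * N) + (B * n) * (B * n)))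
        lem₆ = solve-∀
        form-bound : B * B * (N * N) ≤ 5 * (B * B * (d * d)) + 4 * (N * N)
        form-bound = begin
          B * B * (N * N)                                          ≡⟨ lem₇ B d e ⟩
          B * B * (d * d) + 4 * (B * B * (r * e))                  ≤⟨ +-monoʳ-≤ (B * B * (d * d)) (*-monoʳ-≤ 4 (*-monoʳ-≤ (B * B) (proj₂ (dev-≈ d e)))) ⟩
          B * B * (d * d) + 4 * (B * B * (d * d + δ))              ≡⟨ lem₈ (B * B) (d * d) δ ⟩
          5 * (B * B * (d * d)) + 4 * (B * B * δ)                  ≤⟨ +-monoʳ-≤ (5 * (B * B * (d * d))) (*-monoʳ-≤ 4 (<⇒≤ dev<)) ⟩
          5 * (B * B * (d * d)) + 4 * (N * N) ∎
          where
          lem₇ : ∀ B d e → B * B * ((d + e + e) * (d + e + e)) ≡ B * B * (d * d) + 4 * (B * B * ((d + e) * e))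
          lem₇ = solve-∀
          lem₈ : ∀ b d x → b * d + 4 * (b * (d + x)) ≡ 5 * (b * d) + 4 * (b * x)
          lem₈ = solve-∀

    -- The mirror image, with `T` equal to `N` minus the shift `b` caused by the head. From
    -- `z + T ≤ B * d` follows 5 T² < 4 N², whereas `T` is at least 9/10 of `N` and 5 · 81/100
    -- exceeds 4.
    high-impossible : ∀ z → (B * G) * (B * G) < 5 * (z * z) → z + N ≤ B * d + B * (4 * Kmax + 2) → ⊥
    high-impossible z vz le with m≤n⇒∃[o]m+o≡n (≤-trans (m≤n*m (B * (4 * Kmax + 2)) 10) big₂)
    ... | T , NT = <-irrefl refl (begin-strict
      5 * (T * T)                          <⟨ key ⟩
      4 * (N * N)                          ≡⟨ cong (λ x → 4 * (x * x)) (sym NT) ⟩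
      4 * ((b + T) * (b + T))              ≡⟨ lem₁ b T ⟩
      4 * (T * T) + (8 * (b * T) + 4 * (b * b))       ≤⟨ +-monoʳ-≤ (4 * (T * T)) (+-monoʳ-≤ (8 * (b * T)) (≤-trans (≤-reflexive (lem₂ b)) (*-monoʳ-≤ b (≤-trans (*-monoˡ-≤ b {4} {9} (m≤m+n 4 5)) T-big)))) ⟩
      4 * (T * T) + (8 * (b * T) + b * T)  ≡⟨ cong (4 * (T * T) +_) (lem₄' b T) ⟩
      4 * (T * T) + (9 * b) * T            ≤⟨ +-monoʳ-≤ (4 * (T * T)) (*-monoˡ-≤ T T-big) ⟩
      4 * (T * T) + T * T                  ≡⟨ lem₅' (T * T) ⟩
      5 * (T * T) ∎)
      where
      b = B * (4 * Kmax + 2)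
      lem₁ : ∀ b T → 4 * ((b + T) * (b + T)) ≡ 4 * (T * T) + (8 * (b * T) + 4 * (b * b))
      lem₁ = solve-∀
      lem₂ : ∀ b → 4 * (b * b) ≡ b * (4 * b)
      lem₂ = solve-∀
      lem₄' : ∀ b T → 8 * (b * T) + b * T ≡ (9 * b) * T
      lem₄' = solve-∀
      lem₅' : ∀ x → 4 * x + x ≡ 5 * x
      lem₅' = solve-∀
      T-big : 9 * b ≤ T
      T-big = +-cancelˡ-≤ b _ _ (≤-trans big₂ (≤-reflexive (sym NT)))
      zT : z + T ≤ B * d
      zT = +-cancelʳ-≤ b _ _ (≤-trans (≤-reflexive (trans (+-assoc z T b) (cong (z +_) (trans (+-comm T b) NT)))) le)
      key : 5 * (T * T) < 4 * (N * N)
      key = +-cancelˡ-< (5 * (z * z) + (B * N) * (B * N)) _ _ (begin-strict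
        5 * (z * z) + (B * N) * (B * N) + 5 * (T * T)        ≤⟨ m≤m+n _ (10 * (z * T)) ⟩
        5 * (z * z) + (B * N) * (B * N) + 5 * (T * T) + 10 * (z * T) ≡⟨ lem₃ z T (B * N) ⟩
        5 * ((z + T) * (z + T)) + (B * N) * (B * N)          ≤⟨ +-mono-≤ (*-monoʳ-≤ 5 (*-mono-≤ zT zT)) (*-mono-≤ (*-monoʳ-≤ B (m≤m+n N n)) (*-monoʳ-≤ B (m≤m+n N n))) ⟩
        5 * ((B * d) * (B * d)) + (B * G) * (B * G)          <⟨ +-mono-≤-< form-bound vz ⟩
        ((B * N) * (B * N) + 4 * (N * N)) + 5 * (z * z)      ≡⟨ lem₄ ((B * N) * (B * N)) (N * N) (z * z) ⟩
        5 * (z * z) + (B * N) * (B * N) + 4 * (N * N) ∎)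
        where
        lem₃ : ∀ z T x → 5 * (z * z) + x * x + 5 * (T * T) + 10 * (z * T) ≡ 5 * ((z + T) * (z + T)) + x * x
        lem₃ = solve-∀
        lem₄ : ∀ x y z → (x + 4 * y) + 5 * z ≡ 5 * z + x + 4 * y
        lem₄ = solve-∀
        form-bound : 5 * ((B * d) * (B * d)) ≤ (B * N) * (B * N) + 4 * (N * N)
        form-bound = begin
          5 * ((B * d) * (B * d))                                  ≡⟨ lem₅ B d ⟩
          B * B * (d * d) + 4 * (B * B * (d * d))                  ≤⟨ +-monoʳ-≤ (B * B * (d * d)) (*-monoʳ-≤ 4 (*-monoʳ-≤ (B * B) (proj₁ (dev-≈ d e)))) ⟩
          B * B * (d * d) + 4 * (B * B * (r * e + δ))              ≡⟨ lem₆ B d e δ ⟩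
          (B * N) * (B * N) + 4 * (B * B * δ)                      ≤⟨ +-monoʳ-≤ ((B * N) * (B * N)) (*-monoʳ-≤ 4 (<⇒≤ dev<)) ⟩
          (B * N) * (B * N) + 4 * (N * N) ∎
          where
          lem₅ : ∀ B d → 5 * ((B * d) * (B * d)) ≡ B * B * (d * d) + 4 * (B * B * (d * d))
          lem₅ = solve-∀
          lem₆ : ∀ B d e x → B * B * (d * d) + 4 * (B * B * ((d + e) * e + x)) ≡ (B * (d + e + e)) * (B * (d + e + e)) + 4 * (B * B * x)
          lem₆ = solve-∀

    private
      two-r : 2 * B * r ≡ B * (N + d)
      two-r = lem B d e
        where
        lem : ∀ B d e → 2 * B * (d + e) ≡ B * ((d + e + e) + d)
        lem = solve-∀

      G≤2G : G ≤ 2 * G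
      G≤2G = m≤m+n G (G + 0)
      N≤G : N ≤ G
      N≤G = m≤m+n N n

      far-enough : ∀ z x s → N ≤ s → B * G + s + z ≤ x → x ≤ B * N + (B * d + B * (4 * Kmax + 2)) → z + N ≤ B * d + B * (4 * Kmax + 2)
      far-enough z x s N≤s h₁ h₂ = +-cancelˡ-≤ (B * N) (z + N) (B * d + B * (4 * Kmax + 2)) (begin
        B * N + (z + N)    ≤⟨ +-mono-≤ (*-monoʳ-≤ B N≤G) (+-monoʳ-≤ z N≤s) ⟩
        B * G + (z + s)    ≡⟨ lem (B * G) z s ⟩
        B * G + s + z      ≤⟨ h₁ ⟩
        x                  ≤⟨ h₂ ⟩
        B * N + (B * d + B * (4 * Kmax + 2)) ∎)
        where
        lem : ∀ a z s → a + (z + s) ≡ a + s + z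
        lem = solve-∀

      lo-bound : ∀ c → r ≤ c → ¬ Below (2 * B * c + 2 * G) (B * G)
      lo-bound c r≤c = low-impossible (2 * B * c + 2 * G) (begin
        B * (N + d) + G       ≡⟨ cong (_+ G) two-r ⟨
        2 * B * r + G         ≤⟨ +-mono-≤ (*-monoʳ-≤ (2 * B) r≤c) G≤2G ⟩
        2 * B * c + 2 * G ∎)

      mi-upper : ∀ c → r + r ≤ c → ¬ Below (B * c + G) (B * G)
      mi-upper c r≤c = low-impossible (B * c + G) (begin
        B * (N + d) + G       ≡⟨ cong (_+ G) two-r ⟨
        2 * B * r + G         ≡⟨ cong (_+ G) (lem B r) ⟩
        B * (r + r) + G       ≤⟨ +-monoˡ-≤ G (*-monoʳ-≤ B r≤c) ⟩
        B * c + G ∎)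
        where
        lem : ∀ B r → 2 * B * r ≡ B * (r + r)
        lem = solve-∀

      mi-lower : ∀ k c z → k ≤ Kmax → c ≤ suc (k + r) + k → B * G + 2 * G + z ≤ 2 * B * c → (B * G) * (B * G) < 5 * (z * z) → ⊥
      mi-lower k c z k≤ c≤ h vz = high-impossible z vz (far-enough z (2 * B * c) (2 * G) (≤-trans N≤G G≤2G) h (begin
        2 * B * c                             ≤⟨ *-monoʳ-≤ (2 * B) (≤-trans c≤ (+-mono-≤ (s≤s (+-monoˡ-≤ r k≤)) k≤)) ⟩
        2 * B * (suc (Kmax + r) + Kmax)       ≡⟨ lem B Kmax d e ⟩
        B * N + (B * d + B * (4 * Kmax + 2)) ∎))
        where
        lem : ∀ B K d e → 2 * B * (suc (K + (d + e)) + K) ≡ B * (d + e + e) + (B * d + B * (4 * K + 2))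
        lem = solve-∀

      hi-lower : ∀ k c z → k ≤ Kmax → c ≤ suc (k + r) + suc (k + r) + k → B * G + G + z ≤ B * c → (B * G) * (B * G) < 5 * (z * z) → ⊥
      hi-lower k c z k≤ c≤ h vz = high-impossible z vz (far-enough z (B * c) G N≤G h (begin
        B * c                                 ≤⟨ *-monoʳ-≤ B (≤-trans c≤ (+-mono-≤ (+-mono-≤ (s≤s (+-monoˡ-≤ r k≤)) (s≤s (+-monoˡ-≤ r k≤))) k≤)) ⟩
        B * (suc (Kmax + r) + suc (Kmax + r) + Kmax)  ≤⟨ m≤m+n _ (B * Kmax) ⟩
        B * (suc (Kmax + r) + suc (Kmax + r) + Kmax) + B * Kmax ≡⟨ lem B Kmax d e ⟩
        B * N + (B * d + B * (4 * Kmax + 2)) ∎))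
        where
        lem : ∀ B K d e → B * (suc (K + (d + e)) + suc (K + (d + e)) + K) + B * K ≡ B * (d + e + e) + (B * d + B * (4 * K + 2))
        lem = solve-∀

      r≤m : ∀ k → r ≤ suc (k + r)
      r≤m k = ≤-trans (m≤n+m r k) (n≤1+n (k + r))

    -- As 2 r = N + d with `N` nearly d √5, the length `r` is about γ N. The multiplicity and its
    -- double therefore lie near γ G and 2γ G, and a head of length at most `Kmax` moves the borders
    -- of the zones, measured on the scale of 2 r, by at most `4 * Kmax + 2`.
    place : ∀ k c κ → k ≤ Kmax → Zone B G c κ → Place k r c κ
    place k c lo k≤ (zone-lo 1≤c below) = low 1≤c (≰⇒> λ m≤c → lo-bound c (≤-trans (r≤m k) m≤c) below)
    place k c hi k≤ (zone-hi z eq vz) = high (≰⇒> λ c≤ → hi-lower k c z k≤ c≤ (≤-reflexive (sym eq)) vz)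
    place k c mi k≤ (zone-mi z eq vz below) = go (m≤n⇒∃[o]m+o≡n lower)
      where
      lower : suc (k + r) + suc k ≤ c
      lower = ≤-trans (≤-reflexive (+-suc (suc (k + r)) k)) (≰⇒> λ c≤ → mi-lower k c z k≤ c≤ (≤-reflexive (sym eq)) vz)
      go : (∃ λ j → suc (k + r) + suc k + j ≡ c) → Place k r c mi
      go (j , j≡) = middle j (≰⇒> λ r≤j → mi-upper c (≤-trans (+-mono-≤ (≤-trans (r≤m k) (m≤m+n (suc (k + r)) (suc k))) r≤j) (≤-reflexive j≡)) below)
        (trans (sym j≡) (+-assoc (suc (k + r)) (suc k) j))

  -- Assembly of the estimate over all semigroups of one genus.

  length≤total : ∀ h → (∀ a → a ∈ h → 1 ≤ a) → length h ≤ total h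
  length≤total []      _ = z≤n
  length≤total (a ∷ h) l = +-mono-≤ (l a (here refl)) (length≤total h (λ x p → l x (there p)))

  -- Passing from good words to all semigroups changes the number of favourable cases and the number
  -- of all cases by at most `Bd` each. Both changes are at most s/(2 Y), so together they cost one
  -- more unit of error: `l` becomes `suc l`.
  combine : ∀ Y Q l T EV evL e s Bd → EV ≤ evL → evL ≤ EV + Bd → e ≤ s → s ≤ e + Bd → T ≤ Q → 2 * Y * Bd ≤ s →
    Y * (Q * EV) ≈[ l * (Q * e) ] Y * (T * e) → Y * (Q * evL) ≈[ suc l * (Q * s) ] Y * (T * s)
  combine Y Q l T EV evL e s Bd h₁ h₂ h₃ h₄ T≤ bd est = ≈-weaken err (≈-trans (≈-trans left est) right)
    where
    open ≤-Reasoning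
    left : Y * (Q * evL) ≈[ Y * (Q * Bd) ] Y * (Q * EV)
    left = ≈-* Y (≈-* Q (h₂ , ≤-trans h₁ (m≤m+n evL Bd)))
    right : Y * (T * e) ≈[ Y * (T * Bd) ] Y * (T * s)
    right = ≈-* Y (≈-* T (≤-trans h₃ (m≤m+n s Bd) , h₄))
    err : Y * (Q * Bd) + l * (Q * e) + Y * (T * Bd) ≤ suc l * (Q * s)
    err = begin
      Y * (Q * Bd) + l * (Q * e) + Y * (T * Bd)   ≤⟨ +-mono-≤ (+-monoʳ-≤ (Y * (Q * Bd)) (*-monoʳ-≤ l (*-monoʳ-≤ Q h₃))) (*-monoʳ-≤ Y (*-monoˡ-≤ Bd T≤)) ⟩
      Y * (Q * Bd) + l * (Q * s) + Y * (Q * Bd)   ≡⟨ lem Y Q Bd l s ⟩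
      Q * (2 * Y * Bd) + l * (Q * s)              ≤⟨ +-monoˡ-≤ (l * (Q * s)) (*-monoʳ-≤ Q bd) ⟩
      Q * s + l * (Q * s) ∎
      where
      lem : ∀ Y Q B l s → Y * (Q * B) + l * (Q * s) + Y * (Q * B) ≡ Q * (2 * Y * B) + l * (Q * s)
      lem = solve-∀

  module Core (l Y B p p' : ℕ) .⦃ nzq : NonZero (p + p') ⦄ (0<B : 0 < B)
    (unit : p * p + p * (p + p') ≈[ 1 ] (p + p') * (p + p')) (Y≤q : 10 * Y ≤ (p + p') * (p + p')) where

    -- Typicality gives `Z * |dev| < N * N`, and each summand of `Z` serves one purpose: 40 for
    -- having enough ones and twos, `10 * Y` for the proportion of ones, `B * B` for the separation
    -- of the zones. `X` is a square because `atypical` is stated with squares.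
    Z X K M : ℕ
    Z = 40 + 10 * Y + B * B
    X = Z * Z
    K = proj₁ (codes₂-small (6 * Y))
    private
      M₁ = proj₁ (codes₁-small (6 * Y))
      M₃ = proj₁ (codes₃-small (6 * Y) X K)
      -- What the sum `N = g − n` of the tail must exceed: positivity, the two size conditions of
      -- `Separation`, and twice the length needed for prescribing `l` letters, as the tail length
      -- is at least N/2.
      N₀ = 1 + 20 * (B * B * K) + 10 * (B * (4 * K + 2)) + 2 * (4 * l + 2 * (Y + 1) * l)
    M = K + (M₁ + M₃ + N₀)

    -- 6 Y is three times 2 Y: each exceptional class receives a third of the allowance.
    bad-small : ∀ g → M ≤ g → 2 * Y * badCount X K g ≤ fibo g
    bad-small g M≤ = *-cancelˡ-≤ 3 (begin
      3 * (2 * Y * (c₁ + (c₂ + c₃)))               ≡⟨ lem Y c₁ c₂ c₃ ⟩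
      6 * Y * c₁ + (6 * Y * c₂ + 6 * Y * c₃)       ≤⟨ +-mono-≤ (proj₂ (codes₁-small (6 * Y)) g (≤-trans M₁≤ M≤)) (+-mono-≤ (proj₂ (codes₂-small (6 * Y)) g) (proj₂ (codes₃-small (6 * Y) X K) g (≤-trans M₃≤ M≤))) ⟩
      fibo g + (fibo g + fibo g)                   ≡⟨ lem' (fibo g) ⟩
      3 * fibo g ∎)
      where
      open ≤-Reasoning
      c₁ = length (codes₁ g)
      c₂ = length (codes₂ K g)
      c₃ = length (codes₃ X K g)
      lem : ∀ Y a b c → 3 * (2 * Y * (a + (b + c))) ≡ 6 * Y * a + (6 * Y * b + 6 * Y * c)
      lem = solve-∀
      lem' : ∀ f → f + (f + f) ≡ 3 * f
      lem' = solve-∀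
      M₁≤ : M₁ ≤ M
      M₁≤ = ≤-trans (m≤m+n M₁ M₃) (≤-trans (m≤m+n (M₁ + M₃) N₀) (m≤n+m (M₁ + M₃ + N₀) K))
      M₃≤ : M₃ ≤ M
      M₃≤ = ≤-trans (m≤n+m M₃ M₁) (≤-trans (m≤m+n (M₁ + M₃) N₀) (m≤n+m (M₁ + M₃ + N₀) K))

    module _ (C C' : List ℕ) (uC : Unique C) (uC' : Unique C') (len : length C + length C' ≡ l)
      (disjoint : ∀ n → n ∈ C → n ∉ C') (kind : ℕ → Kind) where
      open Target p p' kind
      open GroupEstimate p p' Y C C' uC uC' disjoint kind

      target : ℕ
      target = tin C * tout C'

      target≤ : target ≤ q ^ l
      target≤ = ≤-trans (*-mono-≤ (prodL≤ vin vin≤ C) (prodL≤ vout vout≤ C'))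
        (≤-reflexive (trans (sym (^-distribˡ-+-* q (length C) (length C'))) (cong (q ^_) len)))

      ev : Word → ℕ
      ev x = bit (eventᵇ C C' (gapSet x))

      Est : List Word → Set
      Est xs = Y * (q ^ l * sumL ev xs) ≈[ l * (q ^ l * length xs) ] Y * (target * length xs)

      Est-[] : Est []
      Est-[] = ≈-zero (trans (cong (Y *_) (*-zeroʳ (q ^ l))) (*-zeroʳ Y)) (trans (cong (Y *_) (*-zeroʳ target)) (*-zeroʳ Y))

      -- Both sides and the error are linear in the list. This works because `kind` is fixed before
      -- the head and the number of twos are, so all groups share one target.
      Est-++ : ∀ xs ys → Est xs → Est ys → Est (xs ++ ys)
      Est-++ xs ys h₁ h₂ = ≈-subst
        (trans (lem Y (q ^ l) (sumL ev xs) (sumL ev ys)) (cong (λ z → Y * (q ^ l * z)) (sym (sumL-++ ev xs ys))))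
        (trans (lem l (q ^ l) (length xs) (length ys)) (cong (λ z → l * (q ^ l * z)) (sym (length-++ xs))))
        (trans (lem Y target (length xs) (length ys)) (cong (λ z → Y * (target * z)) (sym (length-++ xs)))) (≈-+ h₁ h₂)
        where
        lem : ∀ y q a b → y * (q * a) + y * (q * b) ≡ y * (q * (a + b))
        lem = solve-∀

      Est-concatMap : {A : Set} (f : A → List Word) (xs : List A) → (∀ x → x ∈ xs → Est (f x)) → Est (concatMap f xs)
      Est-concatMap f []       h = Est-[]
      Est-concatMap f (x ∷ xs) h = Est-++ (f x) (concatMap f xs) (h x (here refl)) (Est-concatMap f xs (λ y p → h y (there p)))

      module _ (g : ℕ) (M≤g : M ≤ g) (zone : ∀ c → c ∈ C → Zone B g c (kind c)) (zone' : ∀ c → c ∈ C' → Zone B g c (kind c)) where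

        private
          K≤g : K ≤ g
          K≤g = ≤-trans (m≤m+n K (M₁ + M₃ + N₀)) M≤g

          N₀≤ : ∀ n → n ≤ K → N₀ ≤ g ∸ n
          N₀≤ n n≤ = m+n≤o⇒m≤o∸n N₀ (≤-trans (≤-trans (≤-reflexive (+-comm N₀ n)) (+-mono-≤ n≤ (m≤n+m N₀ (M₁ + M₃)))) M≤g)

          core : ∀ n h d e → n ≤ K → h ∈ heads n → g ∸ n ≡ (d + e) + e → Z * ∣ dev (d + e) e ∣ < ((d + e) + e) * ((d + e) + e) →
            Y * (q ^ (length C + length C') * sumL (λ t → ev (h , t)) (arr (d + e) e)) ≈[ (length C + length C') * (q ^ (length C + length C') * binom (d + e) e) ] Y * (target * binom (d + e) e)
          core n h d e n≤ h∈ N≡ dev< = group-estimate h (d + e) e good (λ c c∈ → S.place (length h) c (kind c) k≤ (subst (λ z → Zone B z c (kind c)) G≡ (zone c c∈)))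
              (λ c c∈ → S.place (length h) c (kind c) k≤ (subst (λ z → Zone B z c (kind c)) G≡ (zone' c c∈))) rem
            where
            N = (d + e) + e
            r = d + e
            n≤g : n ≤ g
            n≤g = ≤-trans n≤ K≤g
            G≡ : g ≡ N + n
            G≡ = trans (sym (m∸n+n≡m n≤g)) (cong (_+ n) N≡)
            N₀≤N : N₀ ≤ N
            N₀≤N = ≤-trans (N₀≤ n n≤) (≤-reflexive N≡)
            a₁ = 20 * (B * B * K)
            a₂ = 10 * (B * (4 * K + 2))
            a₃ = 2 * (4 * l + 2 * (Y + 1) * l)
            big₁ : 20 * (B * B * n) ≤ N
            big₁ = ≤-trans (*-monoʳ-≤ 20 (*-monoʳ-≤ (B * B) n≤)) (≤-trans (≤-trans (m≤n+m a₁ 1) (≤-trans (m≤m+n (1 + a₁) a₂) (m≤m+n (1 + a₁ + a₂) a₃))) N₀≤N)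
            big₂ : a₂ ≤ N
            big₂ = ≤-trans (≤-trans (m≤n+m a₂ (1 + a₁)) (m≤m+n (1 + a₁ + a₂) a₃)) N₀≤N
            big₃ : a₃ ≤ N
            big₃ = ≤-trans (m≤n+m a₃ (1 + a₁ + a₂)) N₀≤N
            N≤2r : N ≤ 2 * r
            N≤2r = +-monoʳ-≤ r (≤-trans (m≤n+m e d) (m≤m+n r 0))
            0<N : 0 < N
            0<N = ≤-trans (s≤s z≤n) N₀≤N
            half-big : 4 * l + 2 * (Y + 1) * l ≤ r
            half-big = *-cancelˡ-≤ 2 (≤-trans big₃ N≤2r)
            BB≤Z : B * B ≤ Z
            BB≤Z = m≤n+m (B * B) (40 + 10 * Y)
            dev<' : B * B * ∣ dev (d + e) e ∣ < N * N
            dev<' = ≤-trans (s≤s (*-monoˡ-≤ ∣ dev (d + e) e ∣ BB≤Z)) dev<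
            module S = Separation B K n d e 0<B 0<N n≤ dev<' big₁ big₂
            letters-h = proj₂ (comps₃-sound n (proj₁ (filterᵇ-∈⁻ validᵇ (comps₃ n) h∈)))
            k≤ : length h ≤ K
            k≤ = ≤-trans (length≤total h (λ a a∈ → proj₁ (letters-h a a∈))) (≤-trans (≤-reflexive (proj₁ (comps₃-sound n (proj₁ (filterᵇ-∈⁻ validᵇ (comps₃ n) h∈))))) n≤)
            good : ∀ t → t ∈ arr r e → Good g (h , t)
            good t t∈ = valid-good n h t r n≤g h∈ (≤-trans (m≤m+n r e) (≤-reflexive (sym N≡))) (subst (λ z → t ∈ arr r z) (sym (trans (cong (_∸ r) N≡) (m+n∸m≡n r e))) t∈)
            rem : Removable r e
            rem a b ab = Removal.removable p p' Y Z l unit (≤-trans (m≤n+m (10 * Y) 40) (m≤m+n (40 + 10 * Y) (B * B))) (≤-trans (m≤m+n 40 (10 * Y)) (m≤m+n (40 + 10 * Y) (B * B))) Y≤q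
                d e (∣ dev (d + e) e ∣) ⦃ >-nonZero 0<r ⦄ (dev-≈ d e) small (≤-trans (m≤m+n (4 * l) _) half-big) (≤-trans (m≤n+m _ (4 * l)) half-big) a b (≤-trans ab (≤-reflexive len))
              where
              0<r : 0 < r
              0<r = *-cancelˡ-< 2 0 r (≤-trans 0<N N≤2r)
              small : Z * ∣ dev (d + e) e ∣ ≤ 4 * (r * r)
              small = ≤-trans (<⇒≤ dev<) (≤-trans (*-mono-≤ N≤2r N≤2r) (≤-reflexive (lem r)))
                where
                lem : ∀ r → 2 * r * (2 * r) ≡ 4 * (r * r)
                lem = solve-∀

          group : ∀ n h r → n ≤ K → h ∈ heads n → r ≤ g ∸ n → typical X (g ∸ n) r ≡ true → Est (goodGroup (g ∸ n) r h)
          group n h r n≤ h∈ r≤ typ = ≈-subst (cong (λ z → Y * (q ^ l * z)) (sym (sumL-map ev (h ,_) (arr r e)))) (cong (λ z → l * (q ^ l * z)) (sym len-group)) (cong (λ z → Y * (target * z)) (sym len-group)) est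
            where
            N = g ∸ n
            e = N ∸ r
            len-group : length (goodGroup N r h) ≡ binom r e
            len-group = trans (length-map (h ,_) (arr r e)) (length-arr r e)
            est : Y * (q ^ l * sumL (λ t → ev (h , t)) (arr r e)) ≈[ l * (q ^ l * binom r e) ] Y * (target * binom r e)
            est with e ≤? r
            ... | no e≰r = ≈-zero (trans (cong (λ z → Y * (q ^ l * z)) (empty (arr r e) (trans (length-arr r e) none))) (trans (cong (Y *_) (*-zeroʳ (q ^ l))) (*-zeroʳ Y)))
                             (trans (cong (λ z → Y * (target * z)) none) (trans (cong (Y *_) (*-zeroʳ target)) (*-zeroʳ Y)))
              where
              none : binom r e ≡ 0
              none = binom-zero r e (≰⇒> e≰r)
              empty : ∀ xs → length xs ≡ 0 → sumL (λ t → ev (h , t)) xs ≡ 0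
              empty [] _ = refl
            ... | yes e≤r = subst (λ z → Y * (q ^ z * sumL (λ t → ev (h , t)) (arr r e)) ≈[ z * (q ^ z * binom r e) ] Y * (target * binom r e)) len
                  (subst (λ z → Y * (q ^ (length C + length C') * sumL (λ t → ev (h , t)) (arr z e)) ≈[ (length C + length C') * (q ^ (length C + length C') * binom z e) ] Y * (target * binom z e)) r≡
                    (core n h (r ∸ e) e n≤ h∈ N≡ (subst₂ (λ x y → Z * ∣ dev x e ∣ < y * y) (sym r≡) N≡ (typical-dev Z N r typ))))
              where
              r≡ : (r ∸ e) + e ≡ r
              r≡ = m∸n+n≡m e≤r
              N≡ : N ≡ (r ∸ e) + e + e
              N≡ = trans (sym (m+[n∸m]≡n r≤)) (cong (_+ e) (sym r≡))

        good-estimate : Est (goodWords X K g)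
        good-estimate = Est-concatMap (goodFrom X g) (range K) λ n n∈ →
          Est-concatMap (goodAt X (g ∸ n)) (heads n) λ h h∈ →
            Est-concatMap (λ r → goodGroup (g ∸ n) r h) (filterᵇ (typical X (g ∸ n)) (range (g ∸ n))) λ r r∈ →
              let (r∈' , typ) = filterᵇ-∈⁻ (typical X (g ∸ n)) (range (g ∸ n)) r∈ in
              group n h r (≤-pred (∈-upTo⁻ n∈)) h∈ (≤-pred (∈-upTo⁻ r∈')) typ

        count-estimate : ∀ {L} → Enumerates g L → Y * (q ^ l * countᵇ (eventᵇ C C') L) ≈[ suc l * (q ^ l * length L) ] Y * (target * length L)
        count-estimate {L} en = combine Y (q ^ l) l target (sumL ev E) (countᵇ (eventᵇ C C') L) (length E) (length L) (badCount X K g)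
            (good-count en (eventᵇ C C') E (goodWords-unique X K g) (goodWords-good X K g K≤g))
            (count-≤ X K K≤g en (eventᵇ C C'))
            (≤-trans (≤-reflexive (length-sumL E)) (≤-trans (good-count en (λ _ → true) E (goodWords-unique X K g) (goodWords-good X K g K≤g)) (≤-reflexive (countᵇ-all L))))
            (≤-trans (≤-reflexive (sym (countᵇ-all L))) (≤-trans (count-≤ X K K≤g en (λ _ → true)) (≤-reflexive (cong (_+ badCount X K g) (sym (length-sumL E))))))
            target≤ (≤-trans (bad-small g M≤g) (fibo≤count en)) good-estimate
          where
          E = goodWords X K g

module Approximating where
  open import Defs
  open Counting using (∧-true; ∧-true⁻; ∨-true⁻; ∨-trueʳ; not-true; not-true⁻; ≢true⇒≡false; Kind; lo; mi; hi; Below; Zone; zone-lo; zone-mi; zone-hi; _≈[_]_; fibo≤count; fibo-pos; prodL; module Target; module Core)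
  open import Data.Bool using (Bool; true; false; _∧_; _∨_; not; if_then_else_; T)
  open import Data.Empty using (⊥-elim)
  open import Data.Integer as ℤ using (ℤ; +_; +[1+_]; -[1+_])
  import Data.Integer.Properties as ℤP
  open import Data.List using (List; []; _∷_; length)
  open import Data.List.Membership.Propositional using (_∈_; _∉_)
  open import Data.List.Relation.Unary.All as All using (All; []; _∷_)
  open import Data.List.Relation.Unary.Unique.Propositional using (Unique)
  open import Data.Nat as ℕ using (ℕ; zero; suc; s≤s; z≤n)
  import Data.Nat.Properties as ℕP
  open import Data.Nat.Tactic.RingSolver using (solve-∀)
  open import Data.Product using (∃; _×_; _,_; proj₁; proj₂)
  open import Data.Rational as Q using (ℚ; mkℚ; 0ℚ; 1ℚ; _≤_; _<_; _+_; _*_; -_; _-_; *≤*; *<*; toℚᵘ; positive; nonNegative)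
  open import Data.Rational.Properties
  open import Data.Rational.Solver using (module +-*-Solver)
  open import Data.Rational.Unnormalised as ℚᵘ using (ℚᵘ; mkℚᵘ)
  import Data.Rational.Unnormalised.Properties as ℚᵘP
  open import Data.Sum using (_⊎_; inj₁; inj₂)
  open import Data.Unit using (tt)
  open import Function using (case_of_)
  open import Relation.Binary using (tri<; tri≈; tri>)
  open import Relation.Binary.PropositionalEquality
  open import Relation.Nullary using (¬_; yes; no)
  open +-*-Solver using (solve; _:+_; _:*_; _:-_; :-_; _:=_; con)

  -- Signs in ℚ(√5)

  2ℚ : ℚ
  2ℚ = (+ 2) Q./ 1

  -- Kept abstract: unfolding the normalisation of open fractions is very expensive.
  abstract
    ν : ℕ → ℚ
    ν n = (+ n) Q./ 1

    ν-toℚᵘ : ∀ n → toℚᵘ (ν n) ℚᵘ.≃ mkℚᵘ (+ n) 0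
    ν-toℚᵘ n = toℚᵘ-fromℚᵘ (mkℚᵘ (+ n) 0)

    ν-+ : ∀ m n → ν (m ℕ.+ n) ≡ ν m + ν n
    ν-+ m n = toℚᵘ-injective (ℚᵘP.≃-trans (ν-toℚᵘ (m ℕ.+ n)) (ℚᵘP.≃-sym (ℚᵘP.≃-trans (toℚᵘ-homo-+ (ν m) (ν n))
      (ℚᵘP.≃-trans (ℚᵘP.+-cong (ν-toℚᵘ m) (ν-toℚᵘ n)) (ℚᵘ.*≡* (cong (ℤ._* + 1) (cong₂ ℤ._+_ (ℤP.*-identityʳ (+ m)) (ℤP.*-identityʳ (+ n)))))))))

    ν-* : ∀ m n → ν (m ℕ.* n) ≡ ν m * ν n
    ν-* m n = toℚᵘ-injective (ℚᵘP.≃-trans (ν-toℚᵘ (m ℕ.* n)) (ℚᵘP.≃-sym (ℚᵘP.≃-trans (toℚᵘ-homo-* (ν m) (ν n))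
      (ℚᵘP.≃-trans (ℚᵘP.*-cong (ν-toℚᵘ m) (ν-toℚᵘ n)) (ℚᵘ.*≡* (cong (ℤ._* + 1) (sym (ℤP.pos-* m n))))))))

    ν-mono-≤ : ∀ {m n} → m ℕ.≤ n → ν m ≤ ν n
    ν-mono-≤ {m} {n} h = toℚᵘ-cancel-≤ (ℚᵘP.≤-respˡ-≃ (ℚᵘP.≃-sym (ν-toℚᵘ m)) (ℚᵘP.≤-respʳ-≃ (ℚᵘP.≃-sym (ν-toℚᵘ n))
      (ℚᵘ.*≤* (subst₂ ℤ._≤_ (sym (ℤP.*-identityʳ (+ m))) (sym (ℤP.*-identityʳ (+ n))) (ℤ.+≤+ h)))))

    ν-mono-< : ∀ {m n} → m ℕ.< n → ν m < ν n
    ν-mono-< {m} {n} h = toℚᵘ-cancel-< (ℚᵘP.<-respˡ-≃ (ℚᵘP.≃-sym (ν-toℚᵘ m)) (ℚᵘP.<-respʳ-≃ (ℚᵘP.≃-sym (ν-toℚᵘ n))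
      (ℚᵘ.*<* (subst₂ ℤ._<_ (sym (ℤP.*-identityʳ (+ m))) (sym (ℤP.*-identityʳ (+ n))) (ℤ.+<+ h)))))

    ν-cancel-< : ∀ {m n} → ν m < ν n → m ℕ.< n
    ν-cancel-< {m} {n} h with m ℕP.<? n
    ... | yes p = p
    ... | no ¬p = ⊥-elim (<-irrefl refl (<-≤-trans h (ν-mono-≤ (ℕP.≮⇒≥ ¬p))))

    ν-nonNeg : ∀ n → 0ℚ ≤ ν n
    ν-nonNeg n = ν-mono-≤ {0} {n} z≤n

    0<ν : ∀ {n} → 0 ℕ.< n → 0ℚ < ν n
    0<ν = ν-mono-< {0}

    ν-def : ∀ n → (+ n) Q./ 1 ≡ ν n
    ν-def n = refl

    ν-1 : ν 1 ≡ 1ℚ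
    ν-1 = refl

    ν-2 : ν 2 ≡ 2ℚ
    ν-2 = refl

    ν-5 : ν 5 ≡ five
    ν-5 = refl

  0≤-* : ∀ {p q} → 0ℚ ≤ p → 0ℚ ≤ q → 0ℚ ≤ p * q
  0≤-* {p} {q} hp hq = subst (_≤ p * q) (*-zeroˡ q) (*-monoʳ-≤-nonNeg q ⦃ nonNegative hq ⦄ hp)

  0<-* : ∀ {p q} → 0ℚ < p → 0ℚ < q → 0ℚ < p * q
  0<-* {p} {q} hp hq = subst (_< p * q) (*-zeroˡ q) (*-monoˡ-<-pos q ⦃ positive hq ⦄ hp)

  *-mono : ∀ {a b c d} → 0ℚ ≤ a → 0ℚ ≤ d → a ≤ b → c ≤ d → a * c ≤ b * d
  *-mono {a} {b} {c} {d} 0≤a 0≤d ab cd = ≤-trans (*-monoˡ-≤-nonNeg a ⦃ nonNegative 0≤a ⦄ cd) (*-monoʳ-≤-nonNeg d ⦃ nonNegative 0≤d ⦄ ab)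

  cancel-< : ∀ {a b} c → 0ℚ < c → c * a < c * b → a < b
  cancel-< c hc h = *-cancelˡ-<-nonNeg c ⦃ nonNegative (<⇒≤ hc) ⦄ h

  cancel-≤ : ∀ {a b} c → 0ℚ < c → c * a ≤ c * b → a ≤ b
  cancel-≤ c hc h = *-cancelˡ-≤-pos c ⦃ positive hc ⦄ h

  scale-< : ∀ {a b} c → 0ℚ < c → a < b → c * a < c * b
  scale-< c hc h = *-monoʳ-<-pos c ⦃ positive hc ⦄ h

  scale-≤ : ∀ {a b} c → 0ℚ ≤ c → a ≤ b → c * a ≤ c * b
  scale-≤ c hc h = *-monoˡ-≤-nonNeg c ⦃ nonNegative hc ⦄ h

  negate-neg : ∀ {p} → p < 0ℚ → 0ℚ < - p
  negate-neg = neg-antimono-<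

  square-neg : ∀ p → (- p) * (- p) ≡ p * p
  square-neg = solve 1 (λ p → (:- p) :* (:- p) := p :* p) refl

  ≤ᵇ-yes : ∀ {p q} → p ≤ q → (p Q.≤ᵇ q) ≡ true
  ≤ᵇ-yes {p} {q} h with p Q.≤ᵇ q | ≤⇒≤ᵇ {p} {q} h
  ... | true | _ = refl

  ≤ᵇ-true⁻ : ∀ p q → (p Q.≤ᵇ q) ≡ true → p ≤ q
  ≤ᵇ-true⁻ p q e = ≤ᵇ⇒≤ (subst T (sym e) tt)

  <ᵇ-yes : ∀ {p q} → p < q → (p Defs.<ᵇ q) ≡ true
  <ᵇ-yes {p} {q} h = not-true (≢true⇒≡false (λ e → <-irrefl refl (<-≤-trans h (≤ᵇ-true⁻ q p e))))

  <ᵇ-true⁻ : ∀ p q → (p Defs.<ᵇ q) ≡ true → p < q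
  <ᵇ-true⁻ p q e = ≰⇒> (λ h → case trans (sym (≤ᵇ-yes h)) (not-true⁻ e) of λ ())

  record Pos (p q : ℚ) : Set where
    constructor pos
    field
      holds : posᵇ (p +√5· q) ≡ true
  open Pos public

  private
    branch₁ branch₂ branch₃ : ℚ → ℚ → Bool
    branch₁ p q = (0ℚ Q.≤ᵇ p) ∧ (0ℚ Q.≤ᵇ q) ∧ not ((p ==ᵇ 0ℚ) ∧ (q ==ᵇ 0ℚ))
    branch₂ p q = (0ℚ Defs.<ᵇ p) ∧ (q Defs.<ᵇ 0ℚ) ∧ ((five * (q * q)) Defs.<ᵇ (p * p))
    branch₃ p q = (p Defs.<ᵇ 0ℚ) ∧ (0ℚ Defs.<ᵇ q) ∧ ((p * p) Defs.<ᵇ (five * (q * q)))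

    pos-cases : ∀ p q → Pos p q → (0ℚ ≤ p × 0ℚ ≤ q) ⊎ (0ℚ < p × q < 0ℚ × five * (q * q) < p * p) ⊎ (p < 0ℚ × 0ℚ < q × p * p < five * (q * q))
    pos-cases p q (pos e) with ∨-true⁻ {branch₁ p q} e
    ... | inj₁ e₁ = let (a , e') = ∧-true⁻ {0ℚ Q.≤ᵇ p} e₁ ; (b , _) = ∧-true⁻ {0ℚ Q.≤ᵇ q} e' in inj₁ (≤ᵇ-true⁻ 0ℚ p a , ≤ᵇ-true⁻ 0ℚ q b)
    ... | inj₂ e₂ with ∨-true⁻ {branch₂ p q} e₂
    ...   | inj₁ e₃ = let (a , e') = ∧-true⁻ {0ℚ Defs.<ᵇ p} e₃ ; (b , c) = ∧-true⁻ {q Defs.<ᵇ 0ℚ} e' in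
              inj₂ (inj₁ (<ᵇ-true⁻ 0ℚ p a , <ᵇ-true⁻ q 0ℚ b , <ᵇ-true⁻ _ _ c))
    ...   | inj₂ e₃ = let (a , e') = ∧-true⁻ {p Defs.<ᵇ 0ℚ} e₃ ; (b , c) = ∧-true⁻ {0ℚ Defs.<ᵇ q} e' in
              inj₂ (inj₂ (<ᵇ-true⁻ p 0ℚ a , <ᵇ-true⁻ 0ℚ q b , <ᵇ-true⁻ _ _ c))

    ==ᵇ-no : ∀ {p} → ¬ (p ≤ 0ℚ × 0ℚ ≤ p) → (p ==ᵇ 0ℚ) ≡ false
    ==ᵇ-no {p} h = ≢true⇒≡false (λ e → let (a , b) = ∧-true⁻ {p Q.≤ᵇ 0ℚ} e in h (≤ᵇ-true⁻ p 0ℚ a , ≤ᵇ-true⁻ 0ℚ p b))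

    ∧-falseʳ : ∀ a {b} → b ≡ false → a ∧ b ≡ false
    ∧-falseʳ true  e = e
    ∧-falseʳ false _ = refl

    ∧-falseˡ : ∀ {a} b → a ≡ false → a ∧ b ≡ false
    ∧-falseˡ b refl = refl

    ∨-trueˡ : ∀ {a} b → a ≡ true → a ∨ b ≡ true
    ∨-trueˡ b refl = refl

  pos-nonneg-pos : ∀ {p q} → 0ℚ ≤ p → 0ℚ < q → Pos p q
  pos-nonneg-pos {p} {q} hp hq = pos (∨-trueˡ (branch₂ p q ∨ branch₃ p q) (∧-true (≤ᵇ-yes hp) (∧-true (≤ᵇ-yes (<⇒≤ hq))
    (not-true (∧-falseʳ (p ==ᵇ 0ℚ) (==ᵇ-no (λ (a , _) → <-irrefl refl (<-≤-trans hq a))))))))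

  pos-pos-nonneg : ∀ {p q} → 0ℚ < p → 0ℚ ≤ q → Pos p q
  pos-pos-nonneg {p} {q} hp hq = pos (∨-trueˡ (branch₂ p q ∨ branch₃ p q) (∧-true (≤ᵇ-yes (<⇒≤ hp)) (∧-true (≤ᵇ-yes hq)
    (not-true (∧-falseˡ (q ==ᵇ 0ℚ) (==ᵇ-no (λ (a , _) → <-irrefl refl (<-≤-trans hp a))))))))

  pos-pos-neg : ∀ {p q} → 0ℚ < p → q < 0ℚ → five * (q * q) < p * p → Pos p q
  pos-pos-neg {p} {q} hp hq h = pos (∨-trueʳ (branch₁ p q) (∨-trueˡ (branch₃ p q) (∧-true (<ᵇ-yes hp) (∧-true (<ᵇ-yes hq) (<ᵇ-yes h)))))

  pos-neg-pos : ∀ {p q} → p < 0ℚ → 0ℚ < q → p * p < five * (q * q) → Pos p q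
  pos-neg-pos {p} {q} hp hq h = pos (∨-trueʳ (branch₁ p q) (∨-trueʳ (branch₂ p q) (∧-true (<ᵇ-yes hp) (∧-true (<ᵇ-yes hq) (<ᵇ-yes h)))))

  pos-up⁻ : ∀ {p q} → Pos p q → p < 0ℚ → p * p < five * (q * q)
  pos-up⁻ {p} {q} e hp with pos-cases p q e
  ... | inj₁ (a , _)              = ⊥-elim (<-irrefl refl (<-≤-trans hp a))
  ... | inj₂ (inj₁ (a , _ , _))   = ⊥-elim (<-asym hp a)
  ... | inj₂ (inj₂ (_ , _ , c))   = c

  pos-down⁻ : ∀ {p q} → q < 0ℚ → Pos p q → 0ℚ < p × five * (q * q) < p * p
  pos-down⁻ {p} {q} hq e with pos-cases p q e
  ... | inj₁ (_ , b)              = ⊥-elim (<-irrefl refl (<-≤-trans hq b))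
  ... | inj₂ (inj₁ (a , _ , c))   = a , c
  ... | inj₂ (inj₂ (_ , b , _))   = ⊥-elim (<-asym hq b)

  square-mono-≤ : ∀ {x y} → 0ℚ ≤ x → x ≤ y → x * x ≤ y * y
  square-mono-≤ h xy = *-mono h (≤-trans h xy) xy xy

  square-mono-< : ∀ {x y} → 0ℚ ≤ x → x < y → x * x < y * y
  square-mono-< {x} {y} h xy = ≤-<-trans (scale-≤ x h (<⇒≤ xy)) (*-monoˡ-<-pos y ⦃ positive (≤-<-trans h xy) ⦄ xy)

  -- √5 lies between r₁ and r₂, so p + q√5 lies between p + q r₁ and p + q r₂.
  pos-between : ∀ p q r₁ r₂ → 0ℚ ≤ r₁ → 0ℚ ≤ r₂ → r₁ * r₁ ≤ five → five ≤ r₂ * r₂ → 0ℚ < p + q * r₁ → 0ℚ < p + q * r₂ → Pos p q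
  pos-between p q r₁ r₂ 0≤r₁ 0≤r₂ h₁ h₂ e₁ e₂ with <-cmp q 0ℚ
  ... | tri≈ _ refl _ = pos-pos-nonneg (subst (0ℚ <_) (lem p r₁) e₁) ≤-refl
    where
    lem : ∀ p r → p + 0ℚ * r ≡ p
    lem = solve 2 (λ p r → p :+ con 0ℚ :* r := p) refl
  ... | tri> _ _ 0<q with <-cmp p 0ℚ
  ...   | tri≈ _ refl _ = pos-nonneg-pos ≤-refl 0<q
  ...   | tri> _ _ 0<p  = pos-nonneg-pos (<⇒≤ 0<p) 0<q
  ...   | tri< p<0 _ _  = pos-neg-pos p<0 0<q (<-≤-trans
          (subst (_< (q * r₁) * (q * r₁)) (square-neg p) (square-mono-< (<⇒≤ (negate-neg p<0)) (subst₂ _<_ (+-identityˡ (- p)) (lem p (q * r₁)) (+-monoˡ-< (- p) e₁))))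
          (subst₂ _≤_ (lem' q r₁) (*-comm (q * q) five) (scale-≤ (q * q) (0≤-* (<⇒≤ 0<q) (<⇒≤ 0<q)) h₁)))
    where
    lem : ∀ p x → p + x + - p ≡ x
    lem = solve 2 (λ p x → p :+ x :+ :- p := x) refl
    lem' : ∀ q r → q * q * (r * r) ≡ q * r * (q * r)
    lem' = solve 2 (λ q r → q :* q :* (r :* r) := q :* r :* (q :* r)) refl
  pos-between p q r₁ r₂ 0≤r₁ 0≤r₂ h₁ h₂ e₁ e₂ | tri< q<0 _ _ = pos-pos-neg (≤-<-trans (0≤-* (<⇒≤ (negate-neg q<0)) 0≤r₂) big) q<0
      (≤-<-trans (subst₂ _≤_ (*-comm (q * q) five) (lem' q r₂) (scale-≤ (q * q) (subst (0ℚ ≤_) (square-neg q) (0≤-* (<⇒≤ (negate-neg q<0)) (<⇒≤ (negate-neg q<0)))) h₂))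
        (square-mono-< (0≤-* (<⇒≤ (negate-neg q<0)) 0≤r₂) big))
    where
    lem : ∀ p q x → p + q * x + (- q) * x ≡ p
    lem = solve 3 (λ p q x → p :+ q :* x :+ (:- q) :* x := p) refl
    lem' : ∀ q r → q * q * (r * r) ≡ (- q) * r * ((- q) * r)
    lem' = solve 2 (λ q r → q :* q :* (r :* r) := (:- q) :* r :* ((:- q) :* r)) refl
    big : (- q) * r₂ < p
    big = subst₂ _<_ (+-identityˡ ((- q) * r₂)) (lem p q r₂) (+-monoˡ-< ((- q) * r₂) e₂)

  ratio-ν : ∀ c g → ratio c (suc g) * ν (suc g) ≡ ν c
  ratio-ν c g = toℚᵘ-injective (ℚᵘP.≃-trans (toℚᵘ-homo-* (ratio c (suc g)) (ν (suc g)))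
    (ℚᵘP.≃-trans (ℚᵘP.*-cong (toℚᵘ-fromℚᵘ (mkℚᵘ (+ c) g)) (ν-toℚᵘ (suc g)))
      (ℚᵘP.≃-trans (ℚᵘ.*≡* (trans (ℤP.*-identityʳ (+ c ℤ.* + suc g)) (cong (λ z → + c ℤ.* + suc z) (sym (ℕP.*-identityʳ g))))) (ℚᵘP.≃-sym (ν-toℚᵘ c)))))

  -- ε is at least the reciprocal of its denominator.
  denominator : ∀ ε → 0ℚ < ε → ∃ λ B → 0 ℕ.< B × 1ℚ ≤ ε * ν B
  denominator ε@(mkℚ +[1+ k ] d _) _ = suc d , s≤s z≤n ,
    subst (1ℚ ≤_) (sym (trans (cong (_* ν (suc d)) (sym (fromℚᵘ-toℚᵘ ε))) (ratio-ν (suc k) d))) (subst (_≤ ν (suc k)) ν-1 (ν-mono-≤ {1} {suc k} (s≤s z≤n)))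
  denominator (mkℚ (+ 0) d c) h = ⊥-elim (ℤP.<-irrefl refl (subst₂ ℤ._<_ (ℤP.*-zeroˡ (+ suc d)) (ℤP.*-zeroˡ (+ 1)) (drop-*<* h)))
  denominator (mkℚ -[1+ k ] d c) (*<* ())

  0<five : 0ℚ < five
  0<five = *<* (ℤ.+<+ (s≤s z≤n))

  0≤five : 0ℚ ≤ five
  0≤five = <⇒≤ 0<five

  0<2ℚ : 0ℚ < 2ℚ
  0<2ℚ = *<* (ℤ.+<+ (s≤s z≤n))

  -- From the inequalities in ℚ(√5) to the integral zones.

  tenth fifth : ℚ
  tenth = (+ 1) Q./ 10
  fifth = (+ 1) Q./ 5

  positive-if-neg : ∀ {a} m {P} → 0ℚ < m → 0ℚ < a → a ≤ - (m * P) → P < 0ℚ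
  positive-if-neg {a} m {P} 0<m 0<a h = ≰⇒> λ 0≤P → <-irrefl refl (<-≤-trans (<-≤-trans 0<a h) (neg-antimono-≤ (0≤-* (<⇒≤ 0<m) 0≤P)))

  -- The scale `m` clears denominators: from P + Q √5 > 0 follows a ≤ - m P < m Q √5 = v/√5.
  below-lemma : ∀ m P Q a v → 0ℚ < m → 0ℚ < Q → 0 ℕ.< a → Pos P Q → ν a ≤ - (m * P) → five * (m * Q) ≡ ν v → 5 ℕ.* (a ℕ.* a) ℕ.< v ℕ.* v
  below-lemma m P Q a v 0<m 0<Q 0<a ps h e = ν-cancel-< (subst₂ _<_ (sym (trans (ν-* 5 (a ℕ.* a)) (cong₂ _*_ ν-5 (ν-* a a)))) (trans (cong₂ _*_ e e) (sym (ν-* v v)))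
    (≤-<-trans (scale-≤ five 0≤five (≤-trans (square-mono-≤ (ν-nonNeg a) h) (≤-reflexive (square-neg (m * P)))))
      (subst₂ _<_ (lem₁ m P) (lem₂ m Q) (scale-< (five * (m * m)) (0<-* 0<five (0<-* 0<m 0<m)) (pos-up⁻ ps P<0)))))
    where
    P<0 = positive-if-neg m 0<m (0<ν 0<a) h
    lem₁ : ∀ m P → five * (m * m) * (P * P) ≡ five * (m * P * (m * P))
    lem₁ = solve 2 (λ m P → con five :* (m :* m) :* (P :* P) := con five :* (m :* P :* (m :* P))) refl
    lem₂ : ∀ m Q → five * (m * m) * (five * (Q * Q)) ≡ five * (m * Q) * (five * (m * Q))
    lem₂ = solve 2 (λ m Q → con five :* (m :* m) :* (con five :* (Q :* Q)) := con five :* (m :* Q) :* (con five :* (m :* Q))) refl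

  -- The witness is x - y, and x - y ≥ m P > - m Q √5 = v/√5.
  above-lemma : ∀ m P Q x y v → 0ℚ < m → Q < 0ℚ → Pos P Q → m * P ≤ ν x - ν y → five * (m * Q) ≡ - ν v → ∃ λ z → x ≡ y ℕ.+ z × v ℕ.* v ℕ.< 5 ℕ.* (z ℕ.* z)
  above-lemma m P Q x y v 0<m Q<0 ps h e = z , sym y+z , ν-cancel-< (subst₂ _<_ left (sym right) (<-≤-trans scaled squared))
    where
    0<P : 0ℚ < P
    0<P = proj₁ (pos-down⁻ Q<0 ps)
    y<x : y ℕ.< x
    y<x = ν-cancel-< (subst₂ _<_ (+-identityˡ (ν y)) (lem₀ (ν x) (ν y)) (+-monoˡ-< (ν y) (<-≤-trans (0<-* 0<m 0<P) h)))
      where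
      lem₀ : ∀ x y → x - y + y ≡ x
      lem₀ = solve 2 (λ x y → x :- y :+ y := x) refl
    z : ℕ
    z = proj₁ (ℕP.m≤n⇒∃[o]m+o≡n (ℕP.<⇒≤ y<x))
    y+z : y ℕ.+ z ≡ x
    y+z = proj₂ (ℕP.m≤n⇒∃[o]m+o≡n (ℕP.<⇒≤ y<x))
    diff : ν x - ν y ≡ ν z
    diff = trans (cong (_- ν y) (trans (cong ν (sym y+z)) (ν-+ y z))) (lem₃ (ν y) (ν z))
      where
      lem₃ : ∀ y z → y + z - y ≡ z
      lem₃ = solve 2 (λ y z → y :+ z :- y := z) refl
    scaled : five * (m * m) * (five * (Q * Q)) < five * (m * m) * (P * P)
    scaled = scale-< (five * (m * m)) (0<-* 0<five (0<-* 0<m 0<m)) (proj₂ (pos-down⁻ Q<0 ps))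
    squared : five * (m * m) * (P * P) ≤ five * (ν z * ν z)
    squared = subst (_≤ five * (ν z * ν z)) (lem₂ m P) (scale-≤ five 0≤five (square-mono-≤ (0≤-* (<⇒≤ 0<m) (<⇒≤ 0<P)) (subst (m * P ≤_) diff h)))
      where
      lem₂ : ∀ m P → five * (m * P * (m * P)) ≡ five * (m * m) * (P * P)
      lem₂ = solve 2 (λ m P → con five :* (m :* P :* (m :* P)) := con five :* (m :* m) :* (P :* P)) refl
    left : five * (m * m) * (five * (Q * Q)) ≡ ν (v ℕ.* v)
    left = trans (lem₁ m Q) (trans (cong₂ _*_ e e) (trans (square-neg (ν v)) (sym (ν-* v v))))
      where
      lem₁ : ∀ m Q → five * (m * m) * (five * (Q * Q)) ≡ five * (m * Q) * (five * (m * Q))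
      lem₁ = solve 2 (λ m Q → con five :* (m :* m) :* (con five :* (Q :* Q)) := con five :* (m :* Q) :* (con five :* (m :* Q))) refl
    right : ν (5 ℕ.* (z ℕ.* z)) ≡ five * (ν z * ν z)
    right = trans (ν-* 5 (z ℕ.* z)) (cong₂ _*_ ν-5 (ν-* z z))

  -- Division by `G`: P + Q √5 is at most G (x + y √5), and the inequality between `P` and `G * x`
  -- discards the margin ε.
  pos-rescale : ∀ G x y P Q → 0ℚ < G → 0ℚ < y → P ≤ G * x → Q ≡ G * y → Pos P Q → Pos x y
  pos-rescale G x y P Q 0<G 0<y h refl ps with <-cmp x 0ℚ
  ... | tri≈ _ refl _ = pos-nonneg-pos ≤-refl 0<y
  ... | tri> _ _ 0<x  = pos-nonneg-pos (<⇒≤ 0<x) 0<y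
  ... | tri< x<0 _ _  = pos-neg-pos x<0 0<y (cancel-< (G * G) (0<-* 0<G 0<G) (≤-<-trans
        (subst₂ _≤_ (lem₁ G x) (square-neg P) (square-mono-≤ (<⇒≤ (negate-neg Gx<0)) (neg-antimono-≤ h)))
        (subst (P * P <_) (lem₂ G y) (pos-up⁻ ps (≤-<-trans h Gx<0)))))
    where
    Gx<0 : G * x < 0ℚ
    Gx<0 = subst (G * x <_) (*-zeroʳ G) (scale-< G 0<G x<0)
    lem₁ : ∀ G x → - (G * x) * - (G * x) ≡ G * G * (x * x)
    lem₁ = solve 2 (λ G x → :- (G :* x) :* :- (G :* x) := G :* G :* (x :* x)) refl
    lem₂ : ∀ G y → five * (G * y * (G * y)) ≡ G * G * (five * (y * y))
    lem₂ = solve 2 (λ G y → con five :* (G :* y :* (G :* y)) := G :* G :* (con five :* (y :* y))) refl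

  -- Here P + Q √5 is at most - G (x + y √5), so its positivity makes x + y √5 negative.
  not-pos-rescale : ∀ G x y P Q → 0ℚ < G → 0ℚ < y → P ≤ - (G * x) → Q ≡ - (G * y) → Pos P Q → posᵇ (x +√5· y) ≡ false
  not-pos-rescale G x y P Q 0<G 0<y h refl ps = ≢true⇒≡false λ e → <-irrefl refl (<-≤-trans (proj₂ down) (≤-trans (square-mono-≤ (<⇒≤ (proj₁ down)) h) (<⇒≤ (upper (pos e)))))
    where
    down : 0ℚ < P × five * (- (G * y) * - (G * y)) < P * P
    down = pos-down⁻ (neg-antimono-< (0<-* 0<G 0<y)) ps
    x<0 : x < 0ℚ
    x<0 = positive-if-neg G 0<G (proj₁ down) h
    lem₁ : ∀ G x → G * G * (x * x) ≡ - (G * x) * - (G * x)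
    lem₁ = solve 2 (λ G x → G :* G :* (x :* x) := :- (G :* x) :* :- (G :* x)) refl
    lem₂ : ∀ G y → G * G * (five * (y * y)) ≡ five * (- (G * y) * - (G * y))
    lem₂ = solve 2 (λ G y → G :* G :* (con five :* (y :* y)) := con five :* (:- (G :* y) :* :- (G :* y))) refl
    upper : Pos x y → - (G * x) * - (G * x) < five * (- (G * y) * - (G * y))
    upper ps' = subst₂ _<_ (lem₁ G x) (lem₂ G y) (scale-< (G * G) (0<-* 0<G 0<G) (pos-up⁻ ps' x<0))

  -- γ < 2γ
  γ-below-2γ : ∀ t → Pos (half - t) tenth → Pos (1ℚ - t) fifth
  γ-below-2γ t ps with <-cmp (1ℚ - t) 0ℚ
  ... | tri≈ _ e _   = subst (λ z → Pos z fifth) (sym e) (pos refl)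
  ... | tri> _ _ 0<x = pos-nonneg-pos (<⇒≤ 0<x) (0<fifth)
    where
    0<fifth : 0ℚ < fifth
    0<fifth = *<* (ℤ.+<+ (s≤s z≤n))
  ... | tri< x<0 _ _ = pos-neg-pos x<0 (*<* (ℤ.+<+ (s≤s z≤n))) (<-trans smaller (<-trans (pos-up⁻ ps y<0) (<ᵇ-true⁻ (five * (tenth * tenth)) (five * (fifth * fifth)) refl)))
    where
    y<x : half - t < 1ℚ - t
    y<x = +-monoˡ-< (- t) {half} {1ℚ} (<ᵇ-true⁻ half 1ℚ refl)
    y<0 : half - t < 0ℚ
    y<0 = <-trans y<x x<0
    smaller : (1ℚ - t) * (1ℚ - t) < (half - t) * (half - t)
    smaller = subst₂ _<_ (square-neg (1ℚ - t)) (square-neg (half - t)) (square-mono-< (<⇒≤ (negate-neg x<0)) (neg-antimono-< y<x))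

  <₅-pos : ∀ x y → x <₅ y → posᵇ (y ⊖ x) ≡ true
  <₅-pos x y h with posᵇ (y ⊖ x)
  ... | true = refl

  -- Read off from the same tests that define `f₁`, so the values of `f₁` need no further argument;
  -- what has to be proved is that the kind agrees with the part of the region.
  kind : ℕ → ℕ → Kind
  kind g c = if ι (ratio c g) <₅ᵇ γ then lo else (if ι (ratio c g) <₅ᵇ (two ⊗ γ) then mi else hi)

  kind-lo : ∀ g c → (ι (ratio c g) <₅ᵇ γ) ≡ true → kind g c ≡ lo
  kind-lo g c e rewrite e = refl

  kind-mi : ∀ g c → (ι (ratio c g) <₅ᵇ γ) ≡ false → (ι (ratio c g) <₅ᵇ (two ⊗ γ)) ≡ true → kind g c ≡ mi
  kind-mi g c e e' rewrite e | e' = refl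

  kind-hi : ∀ g c → (ι (ratio c g) <₅ᵇ γ) ≡ false → (ι (ratio c g) <₅ᵇ (two ⊗ γ)) ≡ false → kind g c ≡ hi
  kind-hi g c e e' rewrite e | e' = refl

  low-form′ : ∀ ε G C → ((γ ⊖ ι ε) ⊗ ι G) ⊖ ι C ≡ (((half - ε) * G - C) +√5· (tenth * G))
  low-form′ ε G C = cong₂ _+√5·_ (solve 3 (λ e G C → ((con half :+ :- e) :* G :+ (con five :* (con (tenth - 0ℚ) :* con 0ℚ))) :+ :- C := (con half :- e) :* G :- C) refl ε G C)
    (solve 2 (λ e G → ((con half :+ :- e) :* con 0ℚ :+ con (tenth - 0ℚ) :* G) :+ con (- 0ℚ) := con tenth :* G) refl ε G)

  mid-form₁′ : ∀ ε G C → ι C ⊖ ((γ ⊕ ι ε) ⊗ ι G) ≡ ((C - (half + ε) * G) +√5· (- (G * tenth)))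
  mid-form₁′ ε G C = cong₂ _+√5·_ (solve 3 (λ e G C → C :+ :- ((con half :+ e) :* G :+ (con five :* (con (tenth + 0ℚ) :* con 0ℚ))) := C :- (con half :+ e) :* G) refl ε G C)
    (solve 2 (λ e G → con 0ℚ :+ :- ((con half :+ e) :* con 0ℚ :+ con (tenth + 0ℚ) :* G) := :- (G :* con tenth)) refl ε G)

  mid-form₂′ : ∀ ε G C → (((two ⊗ γ) ⊖ ι ε) ⊗ ι G) ⊖ ι C ≡ (((1ℚ - ε) * G - C) +√5· (fifth * G))
  mid-form₂′ ε G C = cong₂ _+√5·_ (solve 3 (λ e G C → ((con 1ℚ :+ :- e) :* G :+ (con five :* (con (fifth - 0ℚ) :* con 0ℚ))) :+ :- C := (con 1ℚ :- e) :* G :- C) refl ε G C)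
    (solve 2 (λ e G → ((con 1ℚ :+ :- e) :* con 0ℚ :+ con (fifth - 0ℚ) :* G) :+ con (- 0ℚ) := con fifth :* G) refl ε G)

  high-form′ : ∀ ε G C → ι C ⊖ (((two ⊗ γ) ⊕ ι ε) ⊗ ι G) ≡ ((C - (1ℚ + ε) * G) +√5· (- (G * fifth)))
  high-form′ ε G C = cong₂ _+√5·_ (solve 3 (λ e G C → C :+ :- ((con 1ℚ :+ e) :* G :+ (con five :* (con (fifth + 0ℚ) :* con 0ℚ))) := C :- (con 1ℚ :+ e) :* G) refl ε G C)
    (solve 2 (λ e G → con 0ℚ :+ :- ((con 1ℚ :+ e) :* con 0ℚ :+ con (fifth + 0ℚ) :* G) := :- (G :* con fifth)) refl ε G)

  module Regions (ε : ℚ) (B : ℕ) (0<ε : 0ℚ < ε) (0<B : 0 ℕ.< B) (εB : 1ℚ ≤ ε * ν B) (g' c : ℕ) where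
    private
      g = suc g'
      G = ν g
      C = ν c
      b = ν B
      t = ratio c g
      0<G : 0ℚ < G
      0<G = 0<ν {g} (s≤s z≤n)
      0<b : 0ℚ < b
      0<b = 0<ν 0<B
      0<tenth : 0ℚ < tenth
      0<tenth = *<* (ℤ.+<+ (s≤s z≤n))
      0<fifth : 0ℚ < fifth
      0<fifth = *<* (ℤ.+<+ (s≤s z≤n))
      tG : G * t ≡ C
      tG = trans (*-comm G t) (ratio-ν c g')
      -- The margin ε G is at least G/B, the integral margin that `Zone` requires.
      gain : G ≤ G * (ε * b)
      gain = subst (_≤ G * (ε * b)) (*-identityʳ G) (scale-≤ G (<⇒≤ 0<G) εB)
      0≤εG : 0ℚ ≤ ε * G
      0≤εG = 0≤-* (<⇒≤ 0<ε) (<⇒≤ 0<G)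

      drop-ε : ∀ x → x - ε * G ≤ x
      drop-ε x = subst (x - ε * G ≤_) (+-identityʳ x) (+-monoʳ-≤ x (neg-antimono-≤ 0≤εG))

      γ-test : γ ⊖ ι t ≡ ((half - t) +√5· tenth)
      γ-test = cong ((half - t) +√5·_) refl

      2γ-test : (two ⊗ γ) ⊖ ι t ≡ ((1ℚ - t) +√5· fifth)
      2γ-test = cong ((1ℚ - t) +√5·_) refl

      low-form : ((γ ⊖ ι ε) ⊗ ℕ→Q5 g) ⊖ ℕ→Q5 c ≡ (((half - ε) * G - C) +√5· (tenth * G))
      low-form = trans (cong₂ (λ x y → ((γ ⊖ ι ε) ⊗ ι x) ⊖ ι y) (ν-def g) (ν-def c)) (low-form′ ε G C)

      mid-form₁ : ℕ→Q5 c ⊖ ((γ ⊕ ι ε) ⊗ ℕ→Q5 g) ≡ ((C - (half + ε) * G) +√5· (- (G * tenth)))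
      mid-form₁ = trans (cong₂ (λ x y → ι y ⊖ ((γ ⊕ ι ε) ⊗ ι x)) (ν-def g) (ν-def c)) (mid-form₁′ ε G C)

      mid-form₂ : (((two ⊗ γ) ⊖ ι ε) ⊗ ℕ→Q5 g) ⊖ ℕ→Q5 c ≡ (((1ℚ - ε) * G - C) +√5· (fifth * G))
      mid-form₂ = trans (cong₂ (λ x y → (((two ⊗ γ) ⊖ ι ε) ⊗ ι x) ⊖ ι y) (ν-def g) (ν-def c)) (mid-form₂′ ε G C)

      high-form : ℕ→Q5 c ⊖ (((two ⊗ γ) ⊕ ι ε) ⊗ ℕ→Q5 g) ≡ ((C - (1ℚ + ε) * G) +√5· (- (G * fifth)))
      high-form = trans (cong₂ (λ x y → ι y ⊖ (((two ⊗ γ) ⊕ ι ε) ⊗ ι x)) (ν-def g) (ν-def c)) (high-form′ ε G C)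

      below₁ : Pos ((half - ε) * G - C) (tenth * G) → Below (2 ℕ.* B ℕ.* c ℕ.+ 2 ℕ.* g) (B ℕ.* g)
      below₁ ps a 0<a le = below-lemma (2ℚ * b) ((half - ε) * G - C) (tenth * G) a (B ℕ.* g) (0<-* 0<2ℚ 0<b) (0<-* 0<tenth 0<G) 0<a ps
          (≤-trans bound (≤-reflexive (lem₁ ε G C b))) (trans (lem₂ b G) (sym (ν-* B g)))
        where
        lem₁ : ∀ e G C b → 2ℚ * b * C + 2ℚ * (G * (e * b)) - b * G ≡ - (2ℚ * b * ((half - e) * G - C))
        lem₁ = solve 4 (λ e G C b → con 2ℚ :* b :* C :+ con 2ℚ :* (G :* (e :* b)) :- b :* G := :- (con 2ℚ :* b :* ((con half :- e) :* G :- C))) refl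
        lem₂ : ∀ b G → five * (2ℚ * b * (tenth * G)) ≡ b * G
        lem₂ = solve 2 (λ b G → con five :* (con 2ℚ :* b :* (con tenth :* G)) := b :* G) refl
        lem₃ : ∀ x y → x + y - x ≡ y
        lem₃ = solve 2 (λ x y → x :+ y :- x := y) refl
        left : ν (B ℕ.* g ℕ.+ a) ≡ b * G + ν a
        left = trans (ν-+ (B ℕ.* g) a) (cong (_+ ν a) (ν-* B g))
        right : ν (2 ℕ.* B ℕ.* c ℕ.+ 2 ℕ.* g) ≡ 2ℚ * b * C + 2ℚ * G
        right = trans (ν-+ (2 ℕ.* B ℕ.* c) (2 ℕ.* g)) (cong₂ _+_ (trans (ν-* (2 ℕ.* B) c) (cong (_* C) (trans (ν-* 2 B) (cong (_* b) ν-2)))) (trans (ν-* 2 g) (cong (_* G) ν-2)))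
        bound : ν a ≤ 2ℚ * b * C + 2ℚ * (G * (ε * b)) - b * G
        bound = subst (_≤ 2ℚ * b * C + 2ℚ * (G * (ε * b)) - b * G) (lem₃ (b * G) (ν a)) (+-monoˡ-≤ (- (b * G))
          (≤-trans (subst₂ _≤_ left right (ν-mono-≤ le)) (+-monoʳ-≤ (2ℚ * b * C) (scale-≤ 2ℚ (<⇒≤ 0<2ℚ) gain))))

      below₂ : Pos ((1ℚ - ε) * G - C) (fifth * G) → Below (B ℕ.* c ℕ.+ g) (B ℕ.* g)
      below₂ ps a 0<a le = below-lemma b ((1ℚ - ε) * G - C) (fifth * G) a (B ℕ.* g) 0<b (0<-* 0<fifth 0<G) 0<a ps
          (≤-trans bound (≤-reflexive (lem₁ ε G C b))) (trans (lem₂ b G) (sym (ν-* B g)))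
        where
        lem₁ : ∀ e G C b → b * C + G * (e * b) - b * G ≡ - (b * ((1ℚ - e) * G - C))
        lem₁ = solve 4 (λ e G C b → b :* C :+ G :* (e :* b) :- b :* G := :- (b :* ((con 1ℚ :- e) :* G :- C))) refl
        lem₂ : ∀ b G → five * (b * (fifth * G)) ≡ b * G
        lem₂ = solve 2 (λ b G → con five :* (b :* (con fifth :* G)) := b :* G) refl
        lem₃ : ∀ x y → x + y - x ≡ y
        lem₃ = solve 2 (λ x y → x :+ y :- x := y) refl
        left : ν (B ℕ.* g ℕ.+ a) ≡ b * G + ν a
        left = trans (ν-+ (B ℕ.* g) a) (cong (_+ ν a) (ν-* B g))
        right : ν (B ℕ.* c ℕ.+ g) ≡ b * C + G
        right = trans (ν-+ (B ℕ.* c) g) (cong (_+ G) (ν-* B c))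
        bound : ν a ≤ b * C + G * (ε * b) - b * G
        bound = subst (_≤ b * C + G * (ε * b) - b * G) (lem₃ (b * G) (ν a)) (+-monoˡ-≤ (- (b * G))
          (≤-trans (subst₂ _≤_ left right (ν-mono-≤ le)) (+-monoʳ-≤ (b * C) gain)))

      above₁ : Pos (C - (half + ε) * G) (- (G * tenth)) → ∃ λ z → 2 ℕ.* B ℕ.* c ≡ B ℕ.* g ℕ.+ 2 ℕ.* g ℕ.+ z × (B ℕ.* g) ℕ.* (B ℕ.* g) ℕ.< 5 ℕ.* (z ℕ.* z)
      above₁ ps = above-lemma (2ℚ * b) (C - (half + ε) * G) (- (G * tenth)) (2 ℕ.* B ℕ.* c) (B ℕ.* g ℕ.+ 2 ℕ.* g) (B ℕ.* g)
          (0<-* 0<2ℚ 0<b) (neg-antimono-< (0<-* 0<G 0<tenth)) ps bound (trans (lem₂ b G) (cong -_ (sym (ν-* B g))))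
        where
        lem₁ : ∀ e G C b → 2ℚ * b * (C - (half + e) * G) ≡ 2ℚ * b * C - (b * G + 2ℚ * (G * (e * b)))
        lem₁ = solve 4 (λ e G C b → con 2ℚ :* b :* (C :- (con half :+ e) :* G) := con 2ℚ :* b :* C :- (b :* G :+ con 2ℚ :* (G :* (e :* b)))) refl
        lem₂ : ∀ b G → five * (2ℚ * b * (- (G * tenth))) ≡ - (b * G)
        lem₂ = solve 2 (λ b G → con five :* (con 2ℚ :* b :* (:- (G :* con tenth))) := :- (b :* G)) refl
        bound : 2ℚ * b * (C - (half + ε) * G) ≤ ν (2 ℕ.* B ℕ.* c) - ν (B ℕ.* g ℕ.+ 2 ℕ.* g)
        bound = ≤-trans (≤-reflexive (lem₁ ε G C b)) (subst₂ (λ x y → 2ℚ * b * C - (b * G + 2ℚ * (G * (ε * b))) ≤ x - y)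
          (sym (trans (ν-* (2 ℕ.* B) c) (cong (_* C) (trans (ν-* 2 B) (cong (_* b) ν-2))))) (sym (trans (ν-+ (B ℕ.* g) (2 ℕ.* g)) (cong₂ _+_ (ν-* B g) (trans (ν-* 2 g) (cong (_* G) ν-2)))))
          (+-monoʳ-≤ (2ℚ * b * C) (neg-antimono-≤ (+-monoʳ-≤ (b * G) (scale-≤ 2ℚ (<⇒≤ 0<2ℚ) gain)))))

      above₂ : Pos (C - (1ℚ + ε) * G) (- (G * fifth)) → ∃ λ z → B ℕ.* c ≡ B ℕ.* g ℕ.+ g ℕ.+ z × (B ℕ.* g) ℕ.* (B ℕ.* g) ℕ.< 5 ℕ.* (z ℕ.* z)
      above₂ ps = above-lemma b (C - (1ℚ + ε) * G) (- (G * fifth)) (B ℕ.* c) (B ℕ.* g ℕ.+ g) (B ℕ.* g)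
          0<b (neg-antimono-< (0<-* 0<G 0<fifth)) ps bound (trans (lem₂ b G) (cong -_ (sym (ν-* B g))))
        where
        lem₁ : ∀ e G C b → b * (C - (1ℚ + e) * G) ≡ b * C - (b * G + G * (e * b))
        lem₁ = solve 4 (λ e G C b → b :* (C :- (con 1ℚ :+ e) :* G) := b :* C :- (b :* G :+ G :* (e :* b))) refl
        lem₂ : ∀ b G → five * (b * (- (G * fifth))) ≡ - (b * G)
        lem₂ = solve 2 (λ b G → con five :* (b :* (:- (G :* con fifth))) := :- (b :* G)) refl
        bound : b * (C - (1ℚ + ε) * G) ≤ ν (B ℕ.* c) - ν (B ℕ.* g ℕ.+ g)
        bound = ≤-trans (≤-reflexive (lem₁ ε G C b)) (subst₂ (λ x y → b * C - (b * G + G * (ε * b)) ≤ x - y)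
          (sym (ν-* B c)) (sym (trans (ν-+ (B ℕ.* g) g) (cong (_+ G) (ν-* B g))))
          (+-monoʳ-≤ (b * C) (neg-antimono-≤ (+-monoʳ-≤ (b * G) gain))))

      up-bound : ∀ h → (h - ε) * G - C ≤ G * (h - t)
      up-bound h = subst₂ _≤_ (trans (cong (λ z → G * h - z - ε * G) tG) (lem₁ h ε G C)) (lem₂ h G t) (drop-ε (G * h - G * t))
        where
        lem₁ : ∀ h e G C → G * h - C - e * G ≡ (h - e) * G - C
        lem₁ = solve 4 (λ h e G C → G :* h :- C :- e :* G := (h :- e) :* G :- C) refl
        lem₂ : ∀ h G t → G * h - G * t ≡ G * (h - t)
        lem₂ = solve 3 (λ h G t → G :* h :- G :* t := G :* (h :- t)) refl

      down-bound : ∀ h → C - (h + ε) * G ≤ - (G * (h - t))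
      down-bound h = subst₂ _≤_ (trans (cong (λ z → z - G * h - ε * G) tG) (lem₁ h ε G C)) (lem₂ h G t) (drop-ε (G * t - G * h))
        where
        lem₁ : ∀ h e G C → C - G * h - e * G ≡ C - (h + e) * G
        lem₁ = solve 4 (λ h e G C → C :- G :* h :- e :* G := C :- (h :+ e) :* G) refl
        lem₂ : ∀ h G t → G * t - G * h ≡ - (G * (h - t))
        lem₂ = solve 3 (λ h G t → G :* t :- G :* h := :- (G :* (h :- t))) refl

    zone : InRegion ε g c → Zone B g c (kind g c)
    zone (1≤c , _ , inj₁ low) = subst (Zone B g c) (sym (kind-lo g c test)) (zone-lo 1≤c (below₁ ps))
      where
      ps : Pos ((half - ε) * G - C) (tenth * G)
      ps = pos (trans (cong posᵇ (sym low-form)) (<₅-pos (ℕ→Q5 c) ((γ ⊖ ι ε) ⊗ ℕ→Q5 g) low))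
      test : posᵇ (γ ⊖ ι t) ≡ true
      test = trans (cong posᵇ γ-test) (holds (pos-rescale G (half - t) tenth _ _ 0<G 0<tenth (up-bound half) (*-comm tenth G) ps))
    zone (1≤c , _ , inj₂ (inj₁ (low , high))) = subst (Zone B g c) (sym (kind-mi g c test₁ test₂)) (zone-mi (proj₁ z) (proj₁ (proj₂ z)) (proj₂ (proj₂ z)) (below₂ ps₂))
      where
      ps₁ : Pos (C - (half + ε) * G) (- (G * tenth))
      ps₁ = pos (trans (cong posᵇ (sym mid-form₁)) (<₅-pos ((γ ⊕ ι ε) ⊗ ℕ→Q5 g) (ℕ→Q5 c) low))
      ps₂ : Pos ((1ℚ - ε) * G - C) (fifth * G)
      ps₂ = pos (trans (cong posᵇ (sym mid-form₂)) (<₅-pos (ℕ→Q5 c) (((two ⊗ γ) ⊖ ι ε) ⊗ ℕ→Q5 g) high))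
      z = above₁ ps₁
      test₁ : posᵇ (γ ⊖ ι t) ≡ false
      test₁ = trans (cong posᵇ γ-test) (not-pos-rescale G (half - t) tenth _ _ 0<G 0<tenth (down-bound half) refl ps₁)
      test₂ : posᵇ ((two ⊗ γ) ⊖ ι t) ≡ true
      test₂ = trans (cong posᵇ 2γ-test) (holds (pos-rescale G (1ℚ - t) fifth _ _ 0<G 0<fifth (up-bound 1ℚ) (*-comm fifth G) ps₂))
    zone (1≤c , _ , inj₂ (inj₂ high)) = subst (Zone B g c) (sym (kind-hi g c test₁ test₂)) (zone-hi (proj₁ z) (proj₁ (proj₂ z)) (proj₂ (proj₂ z)))
      where
      ps : Pos (C - (1ℚ + ε) * G) (- (G * fifth))
      ps = pos (trans (cong posᵇ (sym high-form)) (<₅-pos (((two ⊗ γ) ⊕ ι ε) ⊗ ℕ→Q5 g) (ℕ→Q5 c) high))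
      z = above₂ ps
      test₂ : posᵇ ((two ⊗ γ) ⊖ ι t) ≡ false
      test₂ = trans (cong posᵇ 2γ-test) (not-pos-rescale G (1ℚ - t) fifth _ _ 0<G 0<fifth (down-bound 1ℚ) refl ps)
      test₁ : posᵇ (γ ⊖ ι t) ≡ false
      test₁ = ≢true⇒≡false λ e → case trans (sym (holds (γ-below-2γ t (pos (trans (cong posᵇ (sym γ-test)) e))))) (trans (cong posᵇ (sym 2γ-test)) test₂) of λ ()

  -- Rational approximation of √5

  f₁-value : Kind → Q5
  f₁-value lo = ι 0ℚ
  f₁-value mi = φ'
  f₁-value hi = ι 1ℚ

  f₁-kind : ∀ g c → f₁ (ratio c g) ≡ f₁-value (kind g c)
  f₁-kind g c with ι (ratio c g) <₅ᵇ γ | ι (ratio c g) <₅ᵇ (two ⊗ γ)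
  ... | true  | _     = refl
  ... | false | true  = refl
  ... | false | false = refl

  ratio-ν⁺ : ∀ c {n} → 0 ℕ.< n → ratio c n * ν n ≡ ν c
  ratio-ν⁺ c {suc n} _ = ratio-ν c n

  ∣_∣ : ℚ → ℚ
  ∣_∣ = Q.∣_∣

  abs-+ : ∀ {x y a b} → ∣ x ∣ ≤ a → ∣ y ∣ ≤ b → ∣ x + y ∣ ≤ a + b
  abs-+ {x} {y} h k = ≤-trans (∣p+q∣≤∣p∣+∣q∣ x y) (+-mono-≤ h k)

  abs-* : ∀ {x y a b} → 0ℚ ≤ b → ∣ x ∣ ≤ a → ∣ y ∣ ≤ b → ∣ x * y ∣ ≤ a * b
  abs-* {x} {y} 0≤b h k = ≤-trans (≤-reflexive (∣p*q∣≡∣p∣*∣q∣ x y)) (*-mono (0≤∣p∣ x) 0≤b h k)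

  abs-≤ : ∀ {x a} → 0ℚ ≤ x → x ≤ a → ∣ x ∣ ≤ a
  abs-≤ 0≤x h = ≤-trans (≤-reflexive (0≤p⇒∣p∣≡p 0≤x)) h

  ≤-abs : ∀ x → x ≤ ∣ x ∣
  ≤-abs x with ≤-total 0ℚ x
  ... | inj₁ h = ≤-reflexive (sym (0≤p⇒∣p∣≡p h))
  ... | inj₂ h = ≤-trans h (0≤∣p∣ x)

  -≤-abs : ∀ x → - x ≤ ∣ x ∣
  -≤-abs x = ≤-trans (≤-abs (- x)) (≤-reflexive (∣-p∣≡∣p∣ x))

  4ℚ : ℚ
  4ℚ = (+ 4) Q./ 1

  0≤4ℚ : 0ℚ ≤ 4ℚ
  0≤4ℚ = ≤ᵇ-true⁻ 0ℚ 4ℚ refl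

  4^ : ℕ → ℚ
  4^ zero    = 1ℚ
  4^ (suc n) = 4ℚ * 4^ n

  1≤4^ : ∀ n → 1ℚ ≤ 4^ n
  1≤4^ zero    = ≤-refl
  1≤4^ (suc n) = ≤-trans (≤ᵇ-true⁻ 1ℚ 4ℚ refl) (subst (_≤ 4ℚ * 4^ n) (*-identityʳ 4ℚ) (scale-≤ 4ℚ 0≤4ℚ (1≤4^ n)))

  0≤4^ : ∀ n → 0ℚ ≤ 4^ n
  0≤4^ n = ≤-trans (≤ᵇ-true⁻ 0ℚ 1ℚ refl) (1≤4^ n)

  4^-+ : ∀ m n → 4^ (m ℕ.+ n) ≡ 4^ m * 4^ n
  4^-+ zero    n = sym (*-identityˡ (4^ n))
  4^-+ (suc m) n = trans (cong (4ℚ *_) (4^-+ m n)) (sym (*-assoc 4ℚ (4^ m) (4^ n)))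

  4^-ν : ∀ n → 4^ n ≡ ν (4 ℕ.^ n)
  4^-ν zero    = sym ν-1
  4^-ν (suc n) = trans (cong₂ _*_ (ν-def 4) (4^-ν n)) (sym (ν-* 4 (4 ℕ.^ n)))

  3/2 : ℚ
  3/2 = (+ 3) Q./ 2

  prodQ : (ℕ → Q5) → List ℕ → Q5
  prodQ F []       = ι 1ℚ
  prodQ F (n ∷ ns) = F n ⊗ prodQ F ns

  prodR : (ℕ → ℚ) → List ℕ → ℚ
  prodR a []       = 1ℚ
  prodR a (n ∷ ns) = a n * prodR a ns

  prodIn≡ : ∀ g C → prodIn g C ≡ prodQ (λ c → f₁-value (kind g c)) C
  prodIn≡ g []      = refl
  prodIn≡ g (c ∷ C) = cong₂ _⊗_ (f₁-kind g c) (prodIn≡ g C)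

  prodOut≡ : ∀ g C → prodOut g C ≡ prodQ (λ c → ι 1ℚ ⊖ f₁-value (kind g c)) C
  prodOut≡ g []      = refl
  prodOut≡ g (c ∷ C) = cong₂ (λ x y → (ι 1ℚ ⊖ x) ⊗ y) (f₁-kind g c) (prodOut≡ g C)

  -- Evaluation of √5 at a rational r. It is multiplicative up to an error proportional to 5 − r².
  module Evaluation (r : ℚ) (∣r∣≤3 : ∣ r ∣ ≤ (+ 3) Q./ 1) where

    ev : Q5 → ℚ
    ev x = re x + im x * r

    D : ℚ
    D = ∣ five - r * r ∣

    0≤D : 0ℚ ≤ D
    0≤D = 0≤∣p∣ (five - r * r)

    -- The factors are 0, 1, 1/φ and 1 - 1/φ; the coefficients of the last, 3/2 and -1/2, are the
    -- largest in absolute value.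
    record Factor (x : Q5) (a : ℚ) : Set where
      field
        re≤ : ∣ re x ∣ ≤ 3/2
        im≤ : ∣ im x ∣ ≤ half
        val : ev x ≡ a
        a≤1 : ∣ a ∣ ≤ 1ℚ

    -- Multiplying by a `Factor` enlarges the coefficients by at most 3/2 + 5 · 1/2 = 4.
    record Bounds (n : ℕ) (x : Q5) (a : ℚ) : Set where
      field
        re≤ : ∣ re x ∣ ≤ 4^ n
        im≤ : ∣ im x ∣ ≤ 4^ n
        a≤1 : ∣ a ∣ ≤ 1ℚ
        err : ∣ ev x - a ∣ ≤ 4^ n * D

    -- Evaluation fails to be multiplicative by the product of the two coefficients of √5 times 5 -
    -- r². The new error is the old one times a value at most 1, plus at most 1/2 · 4^k · D; the sum
    -- 3/2 · 4^k · D stays below 4 · 4^k · D.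
    bounds : ∀ (F : ℕ → Q5) (a : ℕ → ℚ) → (∀ n → Factor (F n) (a n)) → ∀ xs → Bounds (length xs) (prodQ F xs) (prodR a xs)
    bounds F a fac [] = record { re≤ = ≤-refl ; im≤ = ≤ᵇ-true⁻ 0ℚ 1ℚ refl ; a≤1 = ≤-refl
      ; err = ≤-trans (≤-reflexive (cong ∣_∣ (lem r))) (subst (0ℚ ≤_) (sym (*-identityˡ D)) 0≤D) }
      where
      lem : ∀ r → 1ℚ + 0ℚ * r - 1ℚ ≡ 0ℚ
      lem = solve 1 (λ r → con 1ℚ :+ con 0ℚ :* r :- con 1ℚ := con 0ℚ) refl
    bounds F a fac (n ∷ ns) = record
      { re≤ = ≤-trans (abs-+ {p * u} {five * (q * v)} (abs-* (0≤4^ k) f.re≤ ih.re≤) (abs-* {five} (0≤-* 0≤half (0≤4^ k)) ≤-refl (abs-* (0≤4^ k) f.im≤ ih.im≤))) (≤-reflexive (lem₁ (4^ k)))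
      ; im≤ = ≤-trans (abs-+ {p * v} {q * u} (abs-* (0≤4^ k) f.re≤ ih.im≤) (abs-* (0≤4^ k) f.im≤ ih.re≤)) (≤-trans (≤-reflexive (lem₂ (4^ k))) (*-monoʳ-≤-nonNeg (4^ k) ⦃ nonNegative (0≤4^ k) ⦄ (≤ᵇ-true⁻ 2ℚ 4ℚ refl)))
      ; a≤1 = abs-* (≤ᵇ-true⁻ 0ℚ 1ℚ refl) f.a≤1 ih.a≤1
      ; err = ≤-trans (≤-reflexive (cong ∣_∣ (trans (cong (λ z → (p * u + five * (q * v)) + (p * v + q * u) * r - z * A) (sym f.val)) (trans (lem₃ p q u v r A) (cong (λ z → z * (u + v * r - A) + q * v * (five - r * r)) f.val)))))
          (≤-trans (abs-+ {a n * (u + v * r - A)} {q * v * (five - r * r)} (abs-* (0≤-* (0≤4^ k) 0≤D) f.a≤1 ih.err) (abs-* 0≤D (abs-* (0≤4^ k) f.im≤ ih.im≤) ≤-refl))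
            (≤-trans (≤-reflexive (lem₄ (4^ k) D)) (≤-trans (*-monoʳ-≤-nonNeg (4^ k * D) ⦃ nonNegative (0≤-* (0≤4^ k) 0≤D) ⦄ (≤ᵇ-true⁻ 3/2 4ℚ refl)) (≤-reflexive (sym (*-assoc 4ℚ (4^ k) D)))))) }
      where
      k = length ns
      p = re (F n)
      q = im (F n)
      u = re (prodQ F ns)
      v = im (prodQ F ns)
      A = prodR a ns
      module f = Factor (fac n)
      module ih = Bounds (bounds F a fac ns)
      0≤half : 0ℚ ≤ half
      0≤half = ≤ᵇ-true⁻ 0ℚ half refl
      lem₁ : ∀ x → 3/2 * x + five * (half * x) ≡ 4ℚ * x
      lem₁ = solve 1 (λ x → con 3/2 :* x :+ con five :* (con half :* x) := con 4ℚ :* x) refl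
      lem₂ : ∀ x → 3/2 * x + half * x ≡ 2ℚ * x
      lem₂ = solve 1 (λ x → con 3/2 :* x :+ con half :* x := con 2ℚ :* x) refl
      lem₃ : ∀ p q u v r A → (p * u + five * (q * v)) + (p * v + q * u) * r - (p + q * r) * A ≡ (p + q * r) * (u + v * r - A) + q * v * (five - r * r)
      lem₃ = solve 6 (λ p q u v r A → (p :* u :+ con five :* (q :* v)) :+ (p :* v :+ q :* u) :* r :- (p :+ q :* r) :* A := (p :+ q :* r) :* (u :+ v :* r :- A) :+ q :* v :* (con five :- r :* r)) refl
      lem₄ : ∀ x d → 1ℚ * (x * d) + half * x * d ≡ 3/2 * (x * d)
      lem₄ = solve 2 (λ x d → con 1ℚ :* (x :* d) :+ con half :* x :* d := con 3/2 :* (x :* d)) refl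

    6ℚ : ℚ
    6ℚ = (+ 6) Q./ 1

    -- 6 is 4 + 1 + 1: the error of `x` times the evaluation of `y`, where |r| ≤ 3 gives 1 + 3; the
    -- error of `y`; and the defect of multiplicativity.
    product-error : ∀ {m n x y a b} → Bounds m x a → Bounds n y b → ∣ ev (x ⊗ y) - a * b ∣ ≤ 6ℚ * (4^ (m ℕ.+ n) * D)
    product-error {m} {n} {x} {y} {a} {b} X Y = ≤-trans (≤-reflexive (cong ∣_∣ (lem (re x) (im x) (re y) (im y) r a b)))
        (≤-trans (abs-+ {(ev x - a) * ev y + a * (ev y - b)} {im x * im y * (five - r * r)}
            (abs-+ {(ev x - a) * ev y} {a * (ev y - b)} (abs-* {ev x - a} {ev y} (0≤-* (0≤4^ n) (≤ᵇ-true⁻ 0ℚ 4ℚ refl)) X.err evy) (abs-* {a} {ev y - b} (0≤-* (0≤4^ n) 0≤D) X.a≤1 Y.err))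
            (abs-* {im x * im y} {five - r * r} 0≤D (abs-* (0≤4^ n) X.im≤ Y.im≤) ≤-refl))
        (≤-trans (+-monoˡ-≤ (4^ m * 4^ n * D) (+-monoʳ-≤ (4^ m * D * (4^ n * 4ℚ)) (*-monoʳ-≤-nonNeg (4^ n * D) ⦃ nonNegative (0≤-* (0≤4^ n) 0≤D) ⦄ (1≤4^ m))))
          (≤-reflexive (trans (lem' (4^ m) (4^ n) D) (cong (λ z → 6ℚ * (z * D)) (sym (4^-+ m n)))))))
      where
      module X = Bounds X
      module Y = Bounds Y
      lem : ∀ p q u v r a b → (p * u + five * (q * v)) + (p * v + q * u) * r - a * b ≡ (p + q * r - a) * (u + v * r) + a * (u + v * r - b) + q * v * (five - r * r)
      lem = solve 7 (λ p q u v r a b → (p :* u :+ con five :* (q :* v)) :+ (p :* v :+ q :* u) :* r :- a :* b := (p :+ q :* r :- a) :* (u :+ v :* r) :+ a :* (u :+ v :* r :- b) :+ q :* v :* (con five :- r :* r)) refl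
      lem' : ∀ x y d → x * d * (y * 4ℚ) + x * (y * d) + x * y * d ≡ 6ℚ * (x * y * d)
      lem' = solve 3 (λ x y d → x :* d :* (y :* con 4ℚ) :+ x :* (y :* d) :+ x :* y :* d := con 6ℚ :* (x :* y :* d)) refl
      3ℚ = (+ 3) Q./ 1
      evy : ∣ ev y ∣ ≤ 4^ n * 4ℚ
      evy = ≤-trans (abs-+ {re y} {im y * r} Y.re≤ (abs-* {im y} {r} (≤ᵇ-true⁻ 0ℚ 3ℚ refl) Y.im≤ ∣r∣≤3)) (≤-reflexive (lem₅ (4^ n)))
        where
        lem₅ : ∀ x → x + x * 3ℚ ≡ x * 4ℚ
        lem₅ = solve 1 (λ x → x :+ x :* con 3ℚ := x :* con 4ℚ) refl

  -- Fibonacci quotients as approximations of 1/φ, and the error budget.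

  Unit⁻ Unit⁺ : ℕ → ℕ → Set
  Unit⁻ p p' = p ℕ.* p ℕ.+ p ℕ.* (p ℕ.+ p') ℕ.+ 1 ≡ (p ℕ.+ p') ℕ.* (p ℕ.+ p')
  Unit⁺ p p' = p ℕ.* p ℕ.+ p ℕ.* (p ℕ.+ p') ≡ (p ℕ.+ p') ℕ.* (p ℕ.+ p') ℕ.+ 1

  private
    -- With q = p + p', two Fibonacci steps take (p, q) to (p + q, p + 2 q) and preserve p² + p q -
    -- q² together with its sign. The quotients therefore stay on one side of 1/φ.
    double-step : ∀ p p' → (2 ℕ.* p ℕ.+ p') ℕ.* (2 ℕ.* p ℕ.+ p') ℕ.+ (2 ℕ.* p ℕ.+ p') ℕ.* ((2 ℕ.* p ℕ.+ p') ℕ.+ (p ℕ.+ p')) ℕ.+ (p ℕ.+ p') ℕ.* (p ℕ.+ p') ≡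
      ((2 ℕ.* p ℕ.+ p') ℕ.+ (p ℕ.+ p')) ℕ.* ((2 ℕ.* p ℕ.+ p') ℕ.+ (p ℕ.+ p')) ℕ.+ (p ℕ.* p ℕ.+ p ℕ.* (p ℕ.+ p'))
    double-step = solve-∀

    grow : ∀ K p p' → 0 ℕ.< p → K ℕ.≤ p ℕ.+ p' → suc K ℕ.≤ (2 ℕ.* p ℕ.+ p') ℕ.+ (p ℕ.+ p')
    grow K (suc p) p' _ h = ℕP.+-mono-≤ {1} (s≤s z≤n) h

  -- Quotients p/(p + p') of consecutive Fibonacci numbers, on either side of the golden ratio.
  fib⁻ : ∀ K → ∃ λ p → ∃ λ p' → 0 ℕ.< p × K ℕ.≤ p ℕ.+ p' × Unit⁻ p p'
  fib⁻ zero    = 1 , 1 , s≤s z≤n , z≤n , refl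
  fib⁻ (suc K) with fib⁻ K
  ... | p , p' , 0<p , K≤ , u = 2 ℕ.* p ℕ.+ p' , p ℕ.+ p' , ℕP.≤-trans 0<p (ℕP.≤-trans (ℕP.m≤m+n p _) (ℕP.m≤m+n (2 ℕ.* p) p')) , grow K p p' 0<p K≤ ,
      ℕP.+-cancelʳ-≡ a (A ℕ.+ 1) BQ (trans (lem A a) (trans (cong (A ℕ.+_) u) (double-step p p')))
    where
    a = p ℕ.* p ℕ.+ p ℕ.* (p ℕ.+ p')
    A = (2 ℕ.* p ℕ.+ p') ℕ.* (2 ℕ.* p ℕ.+ p') ℕ.+ (2 ℕ.* p ℕ.+ p') ℕ.* ((2 ℕ.* p ℕ.+ p') ℕ.+ (p ℕ.+ p'))
    BQ = ((2 ℕ.* p ℕ.+ p') ℕ.+ (p ℕ.+ p')) ℕ.* ((2 ℕ.* p ℕ.+ p') ℕ.+ (p ℕ.+ p'))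
    lem : ∀ A a → A ℕ.+ 1 ℕ.+ a ≡ A ℕ.+ (a ℕ.+ 1)
    lem = solve-∀

  fib⁺ : ∀ K → ∃ λ p → ∃ λ p' → 0 ℕ.< p × K ℕ.≤ p ℕ.+ p' × Unit⁺ p p'
  fib⁺ zero    = 2 , 1 , s≤s z≤n , z≤n , refl
  fib⁺ (suc K) with fib⁺ K
  ... | p , p' , 0<p , K≤ , u = 2 ℕ.* p ℕ.+ p' , p ℕ.+ p' , ℕP.≤-trans 0<p (ℕP.≤-trans (ℕP.m≤m+n p _) (ℕP.m≤m+n (2 ℕ.* p) p')) , grow K p p' 0<p K≤ ,
      ℕP.+-cancelʳ-≡ b A (BQ ℕ.+ 1) (trans (double-step p p') (trans (cong (BQ ℕ.+_) u) (lem BQ b)))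
    where
    b = (p ℕ.+ p') ℕ.* (p ℕ.+ p')
    A = (2 ℕ.* p ℕ.+ p') ℕ.* (2 ℕ.* p ℕ.+ p') ℕ.+ (2 ℕ.* p ℕ.+ p') ℕ.* ((2 ℕ.* p ℕ.+ p') ℕ.+ (p ℕ.+ p'))
    BQ = ((2 ℕ.* p ℕ.+ p') ℕ.+ (p ℕ.+ p')) ℕ.* ((2 ℕ.* p ℕ.+ p') ℕ.+ (p ℕ.+ p'))
    lem : ∀ B b → B ℕ.+ (b ℕ.+ 1) ≡ B ℕ.+ 1 ℕ.+ b
    lem = solve-∀

  3ℚ : ℚ
  3ℚ = (+ 3) Q./ 1

  0<3ℚ : 0ℚ < 3ℚ
  0<3ℚ = <ᵇ-true⁻ 0ℚ 3ℚ refl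

  1-≤ : ∀ {x} → 0ℚ ≤ x → x ≤ 1ℚ → ∣ 1ℚ - x ∣ ≤ 1ℚ
  1-≤ {x} h k = abs-≤ (subst (_≤ 1ℚ - x) (+-inverseʳ x) (+-monoˡ-≤ (- x) k)) (subst (1ℚ - x ≤_) (+-identityʳ 1ℚ) (+-monoʳ-≤ 1ℚ (neg-antimono-≤ h)))

  <₅-holds : ∀ x y → posᵇ (y ⊖ x) ≡ true → x <₅ y
  <₅-holds x y e with posᵇ (y ⊖ x)
  <₅-holds x y refl | true = tt

  -- The approximation α = p/q of 1/φ, and the corresponding approximation 2α + 1 of √5.
  module Approximation (p p' : ℕ) (0<p : 0 ℕ.< p) where
    q = p ℕ.+ p'

    0<q : 0 ℕ.< q
    0<q = ℕP.≤-trans 0<p (ℕP.m≤m+n p p')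

    private
      qℚ = ν q
      0<qℚ : 0ℚ < qℚ
      0<qℚ = 0<ν 0<q

    α r : ℚ
    α = ratio p q
    r = 2ℚ * α + 1ℚ

    αq : α * qℚ ≡ ν p
    αq = ratio-ν⁺ p 0<q

    0≤α : 0ℚ ≤ α
    0≤α = cancel-≤ qℚ 0<qℚ (subst₂ _≤_ (sym (*-zeroʳ qℚ)) (trans (sym αq) (*-comm α qℚ)) (ν-nonNeg p))

    α≤1 : α ≤ 1ℚ
    α≤1 = cancel-≤ qℚ 0<qℚ (subst₂ _≤_ (trans (sym αq) (*-comm α qℚ)) (sym (*-identityʳ qℚ)) (ν-mono-≤ (ℕP.m≤m+n p p')))

    1-αq : (1ℚ - α) * qℚ ≡ ν p'
    1-αq = trans (lem α qℚ) (trans (cong₂ _-_ (ν-+ p p') αq) (lem' (ν p) (ν p')))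
      where
      lem : ∀ a q → (1ℚ - a) * q ≡ q - a * q
      lem = solve 2 (λ a q → (con 1ℚ :- a) :* q := q :- a :* q) refl
      lem' : ∀ p p' → p + p' - p ≡ p'
      lem' = solve 2 (λ p p' → p :+ p' :- p := p') refl

    0≤r : 0ℚ ≤ r
    0≤r = +-mono-≤ {0ℚ} {2ℚ * α} {0ℚ} {1ℚ} (0≤-* (<⇒≤ 0<2ℚ) 0≤α) (≤ᵇ-true⁻ 0ℚ 1ℚ refl)

    ∣r∣≤3 : ∣ r ∣ ≤ 3ℚ
    ∣r∣≤3 = abs-≤ 0≤r (+-monoˡ-≤ 1ℚ (subst (2ℚ * α ≤_) (*-identityʳ 2ℚ) (scale-≤ 2ℚ (<⇒≤ 0<2ℚ) α≤1)))

    open Evaluation r ∣r∣≤3 public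

    in-value out-value : Kind → ℚ
    in-value lo = 0ℚ
    in-value mi = α
    in-value hi = 1ℚ
    out-value lo = 1ℚ
    out-value mi = 1ℚ - α
    out-value hi = 0ℚ

    in-factor : ∀ κ → Factor (f₁-value κ) (in-value κ)
    in-factor lo = record { re≤ = ≤ᵇ-true⁻ _ _ refl ; im≤ = ≤ᵇ-true⁻ _ _ refl ; val = lem r ; a≤1 = ≤ᵇ-true⁻ _ _ refl }
      where
      lem : ∀ r → 0ℚ + 0ℚ * r ≡ 0ℚ
      lem = solve 1 (λ r → con 0ℚ :+ con 0ℚ :* r := con 0ℚ) refl
    in-factor mi = record { re≤ = ≤ᵇ-true⁻ _ _ refl ; im≤ = ≤ᵇ-true⁻ _ _ refl ; val = lem α ; a≤1 = abs-≤ 0≤α α≤1 }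
      where
      lem : ∀ a → (- half) + half * (2ℚ * a + 1ℚ) ≡ a
      lem = solve 1 (λ a → con (- half) :+ con half :* (con 2ℚ :* a :+ con 1ℚ) := a) refl
    in-factor hi = record { re≤ = ≤ᵇ-true⁻ _ _ refl ; im≤ = ≤ᵇ-true⁻ _ _ refl ; val = lem r ; a≤1 = ≤ᵇ-true⁻ _ _ refl }
      where
      lem : ∀ r → 1ℚ + 0ℚ * r ≡ 1ℚ
      lem = solve 1 (λ r → con 1ℚ :+ con 0ℚ :* r := con 1ℚ) refl

    out-factor : ∀ κ → Factor (ι 1ℚ ⊖ f₁-value κ) (out-value κ)
    out-factor lo = record { re≤ = ≤ᵇ-true⁻ _ _ refl ; im≤ = ≤ᵇ-true⁻ _ _ refl ; val = lem r ; a≤1 = ≤ᵇ-true⁻ _ _ refl }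
      where
      lem : ∀ r → (1ℚ - 0ℚ) + (0ℚ - 0ℚ) * r ≡ 1ℚ
      lem = solve 1 (λ r → con (1ℚ - 0ℚ) :+ con (0ℚ - 0ℚ) :* r := con 1ℚ) refl
    out-factor mi = record { re≤ = ≤ᵇ-true⁻ _ _ refl ; im≤ = ≤ᵇ-true⁻ _ _ refl ; val = lem α ; a≤1 = 1-≤ 0≤α α≤1 }
      where
      lem : ∀ a → (1ℚ - (- half)) + (0ℚ - half) * (2ℚ * a + 1ℚ) ≡ 1ℚ - a
      lem = solve 1 (λ a → con (1ℚ - (- half)) :+ con (0ℚ - half) :* (con 2ℚ :* a :+ con 1ℚ) := con 1ℚ :- a) refl
    out-factor hi = record { re≤ = ≤ᵇ-true⁻ _ _ refl ; im≤ = ≤ᵇ-true⁻ _ _ refl ; val = lem r ; a≤1 = ≤ᵇ-true⁻ _ _ refl }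
      where
      lem : ∀ r → (1ℚ - 1ℚ) + (0ℚ - 0ℚ) * r ≡ 0ℚ
      lem = solve 1 (λ r → con (1ℚ - 1ℚ) :+ con (0ℚ - 0ℚ) :* r := con 0ℚ) refl

    -- With r = 2 α + 1 one has 5 - r² = 4 (1 - α - α²). On Fibonacci quotients the bracket is
    -- ±1/q², so the error of evaluation is of order 1/q².
    gap : (five - r * r) * (qℚ * qℚ) ≡ 4ℚ * (ν (q ℕ.* q) - ν (p ℕ.* p ℕ.+ p ℕ.* q))
    gap = trans (lem α qℚ) (cong (4ℚ *_) (cong₂ _-_ (sym (ν-* q q)) (trans (cong₂ (λ x y → x * x + y * qℚ) αq αq) (sym (trans (ν-+ (p ℕ.* p) (p ℕ.* q)) (cong₂ _+_ (ν-* p p) (ν-* p q)))))))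
      where
      lem : ∀ a q → (five - (2ℚ * a + 1ℚ) * (2ℚ * a + 1ℚ)) * (q * q) ≡ 4ℚ * (q * q - (a * q * (a * q) + a * q * q))
      lem = solve 2 (λ a q → (con five :- (con 2ℚ :* a :+ con 1ℚ) :* (con 2ℚ :* a :+ con 1ℚ)) :* (q :* q) := con 4ℚ :* (q :* q :- (a :* q :* (a :* q) :+ a :* q :* q))) refl

    module _ (kind : ℕ → Kind) where
      open Target p p' kind using (tin; tout; vin; vout)

      a-in a-out : ℕ → ℚ
      a-in c  = in-value (kind c)
      a-out c = out-value (kind c)

      in-scale : ∀ κ → in-value κ * qℚ ≡ ν (vin κ)
      in-scale lo = trans (*-zeroˡ qℚ) (ν-def 0)
      in-scale mi = αq
      in-scale hi = *-identityˡ qℚ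

      out-scale : ∀ κ → out-value κ * qℚ ≡ ν (vout κ)
      out-scale lo = *-identityˡ qℚ
      out-scale mi = 1-αq
      out-scale hi = trans (*-zeroˡ qℚ) (ν-def 0)

      prod-scale : (a : Kind → ℚ) (v : Kind → ℕ) → (∀ κ → a κ * qℚ ≡ ν (v κ)) → ∀ C →
        prodR (λ c → a (kind c)) C * ν (q ℕ.^ length C) ≡ ν (prodL (λ c → v (kind c)) C)
      prod-scale a v h []      = trans (*-identityˡ (ν 1)) refl
      prod-scale a v h (c ∷ C) = trans (cong (a (kind c) * prodR (λ c → a (kind c)) C *_) (ν-* q (q ℕ.^ length C)))
        (trans (lem (a (kind c)) (prodR (λ c → a (kind c)) C) qℚ (ν (q ℕ.^ length C)))
          (trans (cong₂ _*_ (h (kind c)) (prod-scale a v h C)) (sym (ν-* (v (kind c)) (prodL (λ c → v (kind c)) C)))))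
        where
        lem : ∀ a A q Q → a * A * (q * Q) ≡ a * q * (A * Q)
        lem = solve 4 (λ a A q Q → a :* A :* (q :* Q) := a :* q :* (A :* Q)) refl

      θ : List ℕ → List ℕ → ℚ
      θ C C' = prodR a-in C * prodR a-out C'

      θ-scale : ∀ C C' → θ C C' * ν (q ℕ.^ (length C ℕ.+ length C')) ≡ ν (tin C ℕ.* tout C')
      θ-scale C C' = trans (cong (θ C C' *_) (trans (cong ν (ℕP.^-distribˡ-+-* q (length C) (length C'))) (ν-* (q ℕ.^ length C) (q ℕ.^ length C'))))
        (trans (lem (prodR a-in C) (prodR a-out C') (ν (q ℕ.^ length C)) (ν (q ℕ.^ length C')))
          (trans (cong₂ _*_ (prod-scale in-value vin in-scale C) (prod-scale out-value vout out-scale C')) (sym (ν-* (tin C) (tout C')))))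
        where
        lem : ∀ a b x y → a * b * (x * y) ≡ a * x * (b * y)
        lem = solve 4 (λ a b x y → a :* b :* (x :* y) := a :* x :* (b :* y)) refl

    θ-error : ∀ g C C' → ∣ ev (prodIn g C ⊗ prodOut g C') - θ (kind g) C C' ∣ ≤ 6ℚ * (4^ (length C ℕ.+ length C') * D)
    θ-error g C C' = subst (λ z → ∣ ev z - θ (kind g) C C' ∣ ≤ 6ℚ * (4^ (length C ℕ.+ length C') * D)) (sym (cong₂ _⊗_ (prodIn≡ g C) (prodOut≡ g C')))
      (product-error (bounds (λ c → f₁-value (kind g c)) (a-in (kind g)) (λ c → in-factor (kind g c)) C)
        (bounds (λ c → ι 1ℚ ⊖ f₁-value (kind g c)) (a-out (kind g)) (λ c → out-factor (kind g c)) C'))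

    D-scale : Unit⁻ p p' ⊎ Unit⁺ p p' → D * (qℚ * qℚ) ≡ 4ℚ
    D-scale u = trans (cong (D *_) (sym (0≤p⇒∣p∣≡p (0≤-* (<⇒≤ 0<qℚ) (<⇒≤ 0<qℚ))))) (trans (sym (∣p*q∣≡∣p∣*∣q∣ (five - r * r) (qℚ * qℚ))) (trans (cong ∣_∣ gap) (go u)))
      where
      lem₁ : ∀ x → x + 1ℚ - x ≡ 1ℚ
      lem₁ = solve 1 (λ x → x :+ con 1ℚ :- x := con 1ℚ) refl
      lem₂ : ∀ x → x - (x + 1ℚ) ≡ - 1ℚ
      lem₂ = solve 1 (λ x → x :- (x :+ con 1ℚ) := :- con 1ℚ) refl
      A = p ℕ.* p ℕ.+ p ℕ.* q
      go : Unit⁻ p p' ⊎ Unit⁺ p p' → ∣ 4ℚ * (ν (q ℕ.* q) - ν A) ∣ ≡ 4ℚ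
      go (inj₁ u) = cong (λ z → ∣ 4ℚ * z ∣) (trans (cong (_- ν A) (trans (cong ν (sym u)) (trans (ν-+ A 1) (cong (_+_ (ν A)) ν-1)))) (lem₁ (ν A)))
      go (inj₂ u) = cong (λ z → ∣ 4ℚ * z ∣) (trans (cong (_-_ (ν (q ℕ.* q))) (trans (cong ν u) (trans (ν-+ (q ℕ.* q) 1) (cong (_+_ (ν (q ℕ.* q))) ν-1)))) (lem₂ (ν (q ℕ.* q))))

    private
      0<q² : 0ℚ < qℚ * qℚ
      0<q² = 0<-* 0<qℚ 0<qℚ

    r²≤5 : Unit⁻ p p' → r * r ≤ five
    r²≤5 u = subst₂ _≤_ (+-identityˡ (r * r)) (lem five (r * r)) (+-monoˡ-≤ (r * r) {0ℚ} {five - r * r} (cancel-≤ {0ℚ} {five - r * r} (qℚ * qℚ) 0<q² (subst₂ _≤_ (sym (*-zeroʳ (qℚ * qℚ))) (trans (sym gap) (*-comm (five - r * r) (qℚ * qℚ)))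
        (0≤-* 0≤4ℚ (subst (_≤ ν (q ℕ.* q) - ν A) (+-inverseʳ (ν A)) (+-monoˡ-≤ (- ν A) (ν-mono-≤ (ℕP.≤-trans (ℕP.m≤m+n A 1) (ℕP.≤-reflexive u)))))))))
      where
      A = p ℕ.* p ℕ.+ p ℕ.* q
      lem : ∀ x y → x - y + y ≡ x
      lem = solve 2 (λ x y → x :- y :+ y := x) refl

    5≤r² : Unit⁺ p p' → five ≤ r * r
    5≤r² u = subst₂ _≤_ (lem five (r * r)) (+-identityˡ (r * r)) (+-monoˡ-≤ (r * r) {five - r * r} {0ℚ} (cancel-≤ {five - r * r} {0ℚ} (qℚ * qℚ) 0<q² (subst₂ _≤_ (trans (sym gap) (*-comm (five - r * r) (qℚ * qℚ))) (sym (*-zeroʳ (qℚ * qℚ)))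
        (subst (4ℚ * (ν (q ℕ.* q) - ν A) ≤_) (*-zeroʳ 4ℚ) (scale-≤ 4ℚ 0≤4ℚ (subst (ν (q ℕ.* q) - ν A ≤_) (+-inverseʳ (ν A)) (+-monoˡ-≤ (- ν A) (ν-mono-≤ (ℕP.≤-trans (ℕP.m≤m+n (q ℕ.* q) 1) (ℕP.≤-reflexive (sym u)))))))))))
      where
      A = p ℕ.* p ℕ.+ p ℕ.* q
      lem : ∀ x y → x - y + y ≡ x
      lem = solve 2 (λ x y → x :- y :+ y := x) refl

    -- 72 is 3 · 6 · 4: a third of ε₂ is available, `product-error` contributes 6, and `D` times q²
    -- is 4.
    evaluation-error : ∀ ε₂ B l → 1ℚ ≤ ε₂ * ν B → Unit⁻ p p' ⊎ Unit⁺ p p' → 72 ℕ.* (4 ℕ.^ l) ℕ.* B ℕ.≤ q →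
      3ℚ * (6ℚ * (4^ l * D)) ≤ ε₂
    evaluation-error ε₂ B l εB u big = cancel-≤ (qℚ * qℚ) 0<q² (≤-trans (≤-reflexive (trans (lem₁ (qℚ * qℚ) (4^ l) D) (cong (λ z → 18ℚ * (4^ l * z)) (D-scale u))))
        (≤-trans (≤-reflexive (lem₂ (4^ l))) (≤-trans (subst (_≤ ε₂ * ν B * (72ℚ * 4^ l)) (*-identityˡ (72ℚ * 4^ l)) (*-monoʳ-≤-nonNeg (72ℚ * 4^ l) ⦃ nonNegative 0≤x ⦄ εB))
          (≤-trans (≤-reflexive (lem₃ ε₂ (ν B) (4^ l))) (≤-trans (scale-≤ ε₂ 0≤ε big') (≤-reflexive (*-comm ε₂ (qℚ * qℚ))))))))
      where
      18ℚ = (+ 18) Q./ 1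
      72ℚ = (+ 72) Q./ 1
      0≤x : 0ℚ ≤ 72ℚ * 4^ l
      0≤x = 0≤-* (≤ᵇ-true⁻ 0ℚ 72ℚ refl) (0≤4^ l)
      0≤ε : 0ℚ ≤ ε₂
      0≤ε = ≮⇒≥ λ neg → <-irrefl refl (<-≤-trans (≤-<-trans εB (≤-<-trans (≤-reflexive refl) (neg* neg))) (≤ᵇ-true⁻ 0ℚ 1ℚ refl))
        where
        0<B : 0 ℕ.< B
        0<B = ℕP.n≢0⇒n>0 λ { refl → <-irrefl refl (<-≤-trans (<ᵇ-true⁻ 0ℚ 1ℚ refl) (≤-trans εB (≤-reflexive (trans (cong (ε₂ *_) (sym (ν-def 0))) (*-zeroʳ ε₂))))) }
        neg* : ε₂ < 0ℚ → ε₂ * ν B < 0ℚ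
        neg* h = subst (ε₂ * ν B <_) (*-zeroˡ (ν B)) (*-monoˡ-<-pos (ν B) ⦃ positive (0<ν 0<B) ⦄ h)
      lem₁ : ∀ Q x D → Q * (3ℚ * (6ℚ * (x * D))) ≡ 18ℚ * (x * (D * Q))
      lem₁ = solve 3 (λ Q x D → Q :* (con 3ℚ :* (con 6ℚ :* (x :* D))) := con 18ℚ :* (x :* (D :* Q))) refl
      lem₂ : ∀ x → 18ℚ * (x * 4ℚ) ≡ 72ℚ * x
      lem₂ = solve 1 (λ x → con 18ℚ :* (x :* con 4ℚ) := con 72ℚ :* x) refl
      lem₃ : ∀ e b x → e * b * (72ℚ * x) ≡ e * (72ℚ * x * b)
      lem₃ = solve 3 (λ e b x → e :* b :* (con 72ℚ :* x) := e :* (con 72ℚ :* x :* b)) refl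
      big' : 72ℚ * 4^ l * ν B ≤ qℚ * qℚ
      big' = subst₂ _≤_ (trans (ν-* (72 ℕ.* 4 ℕ.^ l) B) (cong (_* ν B) (trans (ν-* 72 (4 ℕ.^ l)) (cong₂ _*_ (sym (ν-def 72)) (sym (4^-ν l)))))) (ν-* q q)
        (ν-mono-≤ (ℕP.≤-trans big (ℕP.m≤m*n q q ⦃ ℕ.>-nonZero 0<q ⦄)))

    -- With `Y = 3 * suc l * B` the counting error `suc l` / Y is 1/(3 B), at most a third of ε₂.
    counting-error : ∀ ε₂ B l P θ' e s T → 0 ℕ.< s → 0 ℕ.< B → 1ℚ ≤ ε₂ * ν B → P * ν s ≡ ν e → θ' * ν (q ℕ.^ l) ≡ ν T →
      (3 ℕ.* suc l ℕ.* B) ℕ.* (q ℕ.^ l ℕ.* e) ≈[ suc l ℕ.* (q ℕ.^ l ℕ.* s) ] (3 ℕ.* suc l ℕ.* B) ℕ.* (T ℕ.* s) →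
      3ℚ * ∣ P - θ' ∣ ≤ ε₂
    counting-error ε₂ B l P θ' e s T 0<s 0<B εB Ps θQ (h₁ , h₂) = go (≤-total 0ℚ (P - θ'))
      where
      Y = 3 ℕ.* suc l ℕ.* B
      Q' = q ℕ.^ l
      c = ν Y * ν Q' * ν s
      0<c : 0ℚ < c
      0<c = 0<-* (0<-* (0<ν (ℕP.*-mono-< {0} {3 ℕ.* suc l} {0} {B} (s≤s z≤n) 0<B)) (0<ν (ℕP.m^n>0 q ⦃ ℕ.>-nonZero 0<q ⦄ l))) (0<ν 0<s)
      E : ℚ
      E = ν (suc l) * (ν Q' * ν s)
      νE : ν (suc l ℕ.* (Q' ℕ.* s)) ≡ E
      νE = trans (ν-* (suc l) (Q' ℕ.* s)) (cong (ν (suc l) *_) (ν-* Q' s))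
      left : ν (Y ℕ.* (Q' ℕ.* e)) ≡ c * P
      left = trans (ν-* Y (Q' ℕ.* e)) (trans (cong (ν Y *_) (trans (ν-* Q' e) (cong (ν Q' *_) (sym Ps)))) (lem (ν Y) (ν Q') P (ν s)))
        where
        lem : ∀ Y Q P s → Y * (Q * (P * s)) ≡ Y * Q * s * P
        lem = solve 4 (λ Y Q P s → Y :* (Q :* (P :* s)) := Y :* Q :* s :* P) refl
      right : ν (Y ℕ.* (T ℕ.* s)) ≡ c * θ'
      right = trans (ν-* Y (T ℕ.* s)) (trans (cong (ν Y *_) (trans (ν-* T s) (cong (_* ν s) (sym θQ)))) (lem (ν Y) (ν Q') θ' (ν s)))
        where
        lem : ∀ Y Q t s → Y * (t * Q * s) ≡ Y * Q * s * t
        lem = solve 4 (λ Y Q t s → Y :* (t :* Q :* s) := Y :* Q :* s :* t) refl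
      cε : 3ℚ * E ≤ c * ε₂
      cε = ≤-trans (subst (_≤ ε₂ * ν B * (3ℚ * E)) (*-identityˡ (3ℚ * E)) (*-monoʳ-≤-nonNeg (3ℚ * E) ⦃ nonNegative 0≤3E ⦄ εB))
        (≤-reflexive (trans (lem ε₂ (ν B) (ν (suc l)) (ν Q') (ν s)) (cong (λ z → z * ν Q' * ν s * ε₂) (sym νY))))
        where
        0≤3E : 0ℚ ≤ 3ℚ * E
        0≤3E = 0≤-* (<⇒≤ 0<3ℚ) (0≤-* (ν-nonNeg (suc l)) (0≤-* (ν-nonNeg Q') (ν-nonNeg s)))
        νY : ν Y ≡ 3ℚ * ν (suc l) * ν B
        νY = trans (ν-* (3 ℕ.* suc l) B) (cong (_* ν B) (trans (ν-* 3 (suc l)) (cong (_* ν (suc l)) (sym (ν-def 3)))))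
        lem : ∀ e b l Q s → e * b * (3ℚ * (l * (Q * s))) ≡ 3ℚ * l * b * Q * s * e
        lem = solve 5 (λ e b l Q s → e :* b :* (con 3ℚ :* (l :* (Q :* s))) := con 3ℚ :* l :* b :* Q :* s :* e) refl
      bound : ∀ x y → c * x ≤ c * y + E → 3ℚ * (x - y) ≤ ε₂
      bound x y h = cancel-≤ c 0<c (≤-trans (≤-reflexive (lem c x y)) (≤-trans (scale-≤ 3ℚ (<⇒≤ 0<3ℚ) (subst (c * x - c * y ≤_) (lem' (c * y) E) (+-monoˡ-≤ (- (c * y)) h))) cε))
        where
        lem : ∀ c x y → c * (3ℚ * (x - y)) ≡ 3ℚ * (c * x - c * y)
        lem = solve 3 (λ c x y → c :* (con 3ℚ :* (x :- y)) := con 3ℚ :* (c :* x :- c :* y)) refl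
        lem' : ∀ a b → a + b - a ≡ b
        lem' = solve 2 (λ a b → a :+ b :- a := b) refl
      up : c * P ≤ c * θ' + E
      up = subst₂ _≤_ left (trans (ν-+ (Y ℕ.* (T ℕ.* s)) (suc l ℕ.* (Q' ℕ.* s))) (cong₂ _+_ right νE)) (ν-mono-≤ h₁)
      down : c * θ' ≤ c * P + E
      down = subst₂ _≤_ right (trans (ν-+ (Y ℕ.* (Q' ℕ.* e)) (suc l ℕ.* (Q' ℕ.* s))) (cong₂ _+_ left νE)) (ν-mono-≤ h₂)
      go : (0ℚ ≤ P - θ') ⊎ (P - θ' ≤ 0ℚ) → 3ℚ * ∣ P - θ' ∣ ≤ ε₂
      go (inj₁ x≥0) = ≤-trans (≤-reflexive (cong (3ℚ *_) (0≤p⇒∣p∣≡p x≥0))) (bound P θ' up)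
      go (inj₂ x≤0) = ≤-trans (≤-reflexive (cong (3ℚ *_) (trans (sym (∣-p∣≡∣p∣ (P - θ'))) (trans (0≤p⇒∣p∣≡p (neg-antimono-≤ x≤0)) (lem P θ'))))) (bound θ' P down)
        where
        lem : ∀ x y → - (x - y) ≡ y - x
        lem = solve 2 (λ x y → :- (x :- y) := y :- x) refl

  -- Both approximations combined, and the threshold for the genus.

  Unit : ℕ → ℕ → Set
  Unit p p' = Unit⁻ p p' ⊎ Unit⁺ p p'

  unit-≈ : ∀ {p p'} → Unit p p' → p ℕ.* p ℕ.+ p ℕ.* (p ℕ.+ p') ≈[ 1 ] (p ℕ.+ p') ℕ.* (p ℕ.+ p')
  unit-≈ {p} {p'} (inj₁ u) = ℕP.≤-trans (ℕP.m≤m+n A 1) (ℕP.≤-trans (ℕP.≤-reflexive u) (ℕP.m≤m+n _ 1)) , ℕP.≤-reflexive (sym u)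
    where A = p ℕ.* p ℕ.+ p ℕ.* (p ℕ.+ p')
  unit-≈ {p} {p'} (inj₂ u) = ℕP.≤-reflexive u , ℕP.≤-trans (ℕP.m≤m+n ((p ℕ.+ p') ℕ.* (p ℕ.+ p')) 1) (ℕP.≤-trans (ℕP.≤-reflexive (sym u)) (ℕP.m≤m+n _ 1))

  -- Each of the two errors uses at most a third of ε; the last third makes the inequality strict.
  difference-< : ∀ a b ε → 0ℚ < ε → 3ℚ * ∣ a ∣ ≤ ε → 3ℚ * ∣ b ∣ ≤ ε → 0ℚ < ε + (a - b)
  difference-< a b ε 0<ε ha hb = cancel-< {0ℚ} {ε + (a - b)} 3ℚ 0<3ℚ (subst₂ _<_ (sym (*-zeroʳ 3ℚ)) (lem a b ε) (+-mono-<-≤ {0ℚ} {ε} {0ℚ + 0ℚ} 0<ε (+-mono-≤ {0ℚ} {ε - 3ℚ * (- a)} {0ℚ} {ε - 3ℚ * b} (room (≤-trans (scale-≤ 3ℚ (<⇒≤ 0<3ℚ) (-≤-abs a)) ha)) (room (≤-trans (scale-≤ 3ℚ (<⇒≤ 0<3ℚ) (≤-abs b)) hb)))))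
    where
    room : ∀ {x} → x ≤ ε → 0ℚ ≤ ε - x
    room {x} h = subst (_≤ ε - x) (+-inverseʳ x) (+-monoˡ-≤ (- x) h)
    lem : ∀ a b ε → ε + ((ε - 3ℚ * (- a)) + (ε - 3ℚ * b)) ≡ 3ℚ * (ε + (a - b))
    lem = solve 3 (λ a b ε → ε :+ ((ε :- con 3ℚ :* (:- a)) :+ (ε :- con 3ℚ :* b)) := con 3ℚ :* (ε :+ (a :- b))) refl

  -- AbsLt (ι P ⊖ X) (ι ε), with √5 replaced by the rational r.
  Close : ℚ → ℚ → Q5 → ℚ → Set
  Close ε P X r = 0ℚ < re lower + im lower * r × 0ℚ < re upper + im upper * r
    where
    lower = (ι P ⊖ X) ⊖ (⊝ (ι ε))
    upper = ι ε ⊖ (ι P ⊖ X)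

  close : ∀ ε P X r θ → 0ℚ < ε → 3ℚ * ∣ P - θ ∣ ≤ ε → 3ℚ * ∣ re X + im X * r - θ ∣ ≤ ε → Close ε P X r
  close ε P (u +√5· v) r θ 0<ε h k =
    subst (0ℚ <_) (lem₁ ε P u v r θ) (difference-< (P - θ) (u + v * r - θ) ε 0<ε h k) ,
    subst (0ℚ <_) (lem₂ ε P u v r θ) (difference-< (u + v * r - θ) (P - θ) ε 0<ε k h)
    where
    lem₁ : ∀ ε P u v r θ → ε + ((P - θ) - (u + v * r - θ)) ≡ (P + - u) + - (- ε) + (0ℚ + - v + 0ℚ) * r
    lem₁ = solve 6 (λ ε P u v r θ → ε :+ ((P :- θ) :- (u :+ v :* r :- θ)) := (P :+ :- u) :+ :- (:- ε) :+ (con 0ℚ :+ :- v :+ con 0ℚ) :* r) refl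
    lem₂ : ∀ ε P u v r θ → ε + ((u + v * r - θ) - (P - θ)) ≡ ε + - (P + - u) + (0ℚ + - (0ℚ + - v)) * r
    lem₂ = solve 6 (λ ε P u v r θ → ε :+ ((u :+ v :* r :- θ) :- (P :- θ)) := ε :+ :- (P :+ :- u) :+ (con 0ℚ :+ :- (con 0ℚ :+ :- v)) :* r) refl

  <₅-between : ∀ x y r₁ r₂ → 0ℚ ≤ r₁ → 0ℚ ≤ r₂ → r₁ * r₁ ≤ five → five ≤ r₂ * r₂ →
    0ℚ < re (y ⊖ x) + im (y ⊖ x) * r₁ → 0ℚ < re (y ⊖ x) + im (y ⊖ x) * r₂ → x <₅ y
  <₅-between x y r₁ r₂ 0≤r₁ 0≤r₂ h₁ h₂ e₁ e₂ = <₅-holds x y (Pos.holds (pos-between (re (y ⊖ x)) (im (y ⊖ x)) r₁ r₂ 0≤r₁ 0≤r₂ h₁ h₂ e₁ e₂))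

  -- Both inequalities are affine in √5 with rational coefficients, so they follow from their values
  -- at a rational point on each side of √5. Hence the whole estimate is carried out twice, once for
  -- each approximation.
  absLt : ∀ ε P X r₁ r₂ → 0ℚ ≤ r₁ → 0ℚ ≤ r₂ → r₁ * r₁ ≤ five → five ≤ r₂ * r₂ → Close ε P X r₁ → Close ε P X r₂ → AbsLt (ι P ⊖ X) (ι ε)
  absLt ε P X r₁ r₂ 0≤r₁ 0≤r₂ h₁ h₂ (a₁ , b₁) (a₂ , b₂) =
    <₅-between (⊝ (ι ε)) (ι P ⊖ X) r₁ r₂ 0≤r₁ 0≤r₂ h₁ h₂ a₁ a₂ , <₅-between (ι P ⊖ X) (ι ε) r₁ r₂ 0≤r₁ 0≤r₂ h₁ h₂ b₁ b₂

  module _ (l₁ l₂ : ℕ) (ε₁ ε₂ : ℚ) (0<ε₁ : 0ℚ < ε₁) (0<ε₂ : 0ℚ < ε₂) where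

    Closeness : ℚ → ℕ → Set
    Closeness r M = ∀ g → M ℕ.< g → ∀ L → Enumerates g L → ∀ C C' → Unique C → Unique C' →
      length C ≡ l₁ → length C' ≡ l₂ → (∀ n → n ∈ C → n ∉ C') → All (InRegion ε₁ g) C → All (InRegion ε₁ g) C' →
      Close ε₂ (prob L C C') (prodIn g C ⊗ prodOut g C') r

    Bound : ℕ → Set
    Bound M = ∀ g → M ℕ.< g → ∀ L → Enumerates g L → ∀ C C' → Unique C → Unique C' →
      length C ≡ l₁ → length C' ≡ l₂ → (∀ n → n ∈ C → n ∉ C') → All (InRegion ε₁ g) C → All (InRegion ε₁ g) C' →
      AbsLt (ι (prob L C C') ⊖ (prodIn g C ⊗ prodOut g C')) (ι ε₂)

    two-sided : ∀ r₁ r₂ → 0ℚ ≤ r₁ → 0ℚ ≤ r₂ → r₁ * r₁ ≤ five → five ≤ r₂ * r₂ → ∃ (Closeness r₁) → ∃ (Closeness r₂) → ∃ Bound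
    two-sided r₁ r₂ 0≤r₁ 0≤r₂ h₁ h₂ (M₁ , c₁) (M₂ , c₂) = M₁ ℕ.+ M₂ , λ g M<g L en C C' uC uC' e₁ e₂ dis rC rC' →
      absLt ε₂ (prob L C C') (prodIn g C ⊗ prodOut g C') r₁ r₂ 0≤r₁ 0≤r₂ h₁ h₂
        (c₁ g (ℕP.≤-<-trans (ℕP.m≤m+n M₁ M₂) M<g) L en C C' uC uC' e₁ e₂ dis rC rC')
        (c₂ g (ℕP.≤-<-trans (ℕP.m≤n+m M₂ M₁) M<g) L en C C' uC uC' e₁ e₂ dis rC rC')

    module _ (B₁ : ℕ) (0<B₁ : 0 ℕ.< B₁) (εB₁ : 1ℚ ≤ ε₁ * ν B₁) (B₂ : ℕ) (0<B₂ : 0 ℕ.< B₂) (εB₂ : 1ℚ ≤ ε₂ * ν B₂) where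

      l Y : ℕ
      l = l₁ ℕ.+ l₂
      Y = 3 ℕ.* suc l ℕ.* B₂

      -- The first summand provides the bound on q² that the counting argument asks for, the second
      -- the one for `evaluation-error`.
      fineness : ℕ
      fineness = 10 ℕ.* Y ℕ.+ 72 ℕ.* (4 ℕ.^ l) ℕ.* B₂

      closeness : ∀ p p' (0<p : 0 ℕ.< p) → fineness ℕ.≤ p ℕ.+ p' → Unit p p' → ∃ (Closeness (Approximation.r p p' 0<p))
      closeness p p' 0<p fine u = E.M , result
        where
        open Approximation p p' 0<p
        instance
          q≢0 : ℕ.NonZero (p ℕ.+ p')
          q≢0 = ℕ.>-nonZero 0<q
        module E = Core l Y B₁ p p' 0<B₁ (unit-≈ {p} {p'} u) (ℕP.≤-trans (ℕP.m≤m+n (10 ℕ.* Y) (72 ℕ.* (4 ℕ.^ l) ℕ.* B₂)) (ℕP.≤-trans fine (ℕP.m≤m*n q q)))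
        result : Closeness r E.M
        result (suc g) M<g L en C C' uC uC' refl refl disjoint rC rC' = close ε₂ P X r θ' 0<ε₂
            (counting-error ε₂ B₂ l P θ' e s target 0<s 0<B₂ εB₂ (ratio-ν⁺ e 0<s) (θ-scale (kind (suc g)) C C')
              (E.count-estimate C C' uC uC' refl disjoint (kind (suc g)) (suc g) (ℕP.<⇒≤ M<g) (λ c c∈ → zone' c (All.lookup rC c∈)) (λ c c∈ → zone' c (All.lookup rC' c∈)) en))
            (≤-trans (scale-≤ 3ℚ (<⇒≤ 0<3ℚ) (θ-error (suc g) C C')) (evaluation-error ε₂ B₂ l εB₂ u (ℕP.≤-trans (ℕP.m≤n+m (72 ℕ.* (4 ℕ.^ l) ℕ.* B₂) (10 ℕ.* Y)) fine)))
          where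
          zone' : ∀ c → InRegion ε₁ (suc g) c → _
          zone' c = Regions.zone ε₁ B₁ 0<ε₁ 0<B₁ εB₁ g c
          s e : ℕ
          s = length L
          e = countᵇ (eventᵇ C C') L
          0<s : 0 ℕ.< s
          0<s = ℕP.≤-trans (fibo-pos (suc g)) (fibo≤count en)
          P θ' : ℚ
          P = prob L C C'
          θ' = θ (kind (suc g)) C C'
          X = prodIn (suc g) C ⊗ prodOut (suc g) C'
          target = E.target C C' uC uC' refl disjoint (kind (suc g))

      threshold : ∃ Bound
      threshold = go (fib⁻ fineness) (fib⁺ fineness)
        where
        go : (∃ λ p → ∃ λ p' → 0 ℕ.< p × fineness ℕ.≤ p ℕ.+ p' × Unit⁻ p p') → (∃ λ p → ∃ λ p' → 0 ℕ.< p × fineness ℕ.≤ p ℕ.+ p' × Unit⁺ p p') → ∃ Bound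
        go (p₁ , p₁' , 0<p₁ , K₁ , u₁) (p₂ , p₂' , 0<p₂ , K₂ , u₂) = two-sided A₁.r A₂.r A₁.0≤r A₂.0≤r (A₁.r²≤5 u₁) (A₂.5≤r² u₂)
            (closeness p₁ p₁' 0<p₁ K₁ (inj₁ u₁)) (closeness p₂ p₂' 0<p₂ K₂ (inj₂ u₂))
          where
          module A₁ = Approximation p₁ p₁' 0<p₁
          module A₂ = Approximation p₂ p₂' 0<p₂

  exists-threshold : ∀ l₁ l₂ ε₁ ε₂ (0<ε₁ : 0ℚ < ε₁) (0<ε₂ : 0ℚ < ε₂) → ∃ (Bound l₁ l₂ ε₁ ε₂ 0<ε₁ 0<ε₂)
  exists-threshold l₁ l₂ ε₁ ε₂ 0<ε₁ 0<ε₂ = go (denominator ε₁ 0<ε₁) (denominator ε₂ 0<ε₂)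
    where
    go : (∃ λ B → 0 ℕ.< B × 1ℚ ≤ ε₁ * ν B) → (∃ λ B → 0 ℕ.< B × 1ℚ ≤ ε₂ * ν B) → ∃ (Bound l₁ l₂ ε₁ ε₂ 0<ε₁ 0<ε₂)
    go (B₁ , 0<B₁ , εB₁) (B₂ , 0<B₂ , εB₂) = threshold l₁ l₂ ε₁ ε₂ 0<ε₁ 0<ε₂ B₁ 0<B₁ εB₁ B₂ 0<B₂ εB₂

open import Defs
open import Data.Nat using (ℕ; _<_)
open import Data.Rational using (ℚ; 0ℚ)
open import Data.List using (List; length)
open import Data.List.Relation.Unary.All using (All)
open import Data.List.Relation.Unary.Unique.Propositional using (Unique)
open import Data.List.Membership.Propositional using (_∈_; _∉_)
open import Data.Product using (∃-syntax)
open import Relation.Binary.PropositionalEquality using (_≡_)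
open Approximating using (exists-threshold)

theorem6p1 : (l₁ l₂ : ℕ) (ε₁ ε₂ : ℚ) → Data.Rational._<_ 0ℚ ε₁ → Data.Rational._<_ 0ℚ ε₂ →
    ∃[ M ] (∀ (g : ℕ) → M < g →
    ∀ (L : List (List ℕ)) → Enumerates g L →
    ∀ (C C' : List ℕ) → Unique C → Unique C' →
    length C ≡ l₁ → length C' ≡ l₂ →
    (∀ n → n ∈ C → n ∉ C') →
    All (InRegion ε₁ g) C → All (InRegion ε₁ g) C' →
    AbsLt (ι (prob L C C') ⊖ (prodIn g C ⊗ prodOut g C')) (ι ε₂))
theorem6p1 = exists-threshold
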